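{- Let $\lambda:\mathbb N\to\mathbb N$ be any function with $\lambda(n)\to\infty$. For every constant $\epsilon>0$ there is $\gamma>0$ such that if $\mathcal D$ is a $\lambda$-well-behaved (feasible) degree sequence of length $n$ with $R_{\mathcal D}\ge\epsilon M_{\mathcal D}$, then the probability that $H(\mathcal D)$ has a component of size at least $\gamma M_{\mathcal D}$ is $1-o(1)$ (as $n\to\infty$, uniformly in such $\mathcal D$).
   Context: A degree sequence $\mathcal D=(d_1,\dots,d_n)$ consists of positive integers (no zero entries) and is feasible if realizable by a simple graph; $G(\mathcal D)$ is a uniformly random simple graph on $\{1,\dots,n\}$ with vertex $i$ of degree $d_i$. With $\pi$ a permutation such that $d_{\pi_1}\le\dots\le d_{\pi_n}$, let $j_{\mathcal D}=\min\big(\{j\in[n]:\sum_{i=1}^j d_{\pi_i}(d_{\pi_i}-2)>0\}\cup\{n\}\big)$, $R_{\mathcal D}=\sum_{i=j_{\mathcal D}}^n d_{\pi_i}$, $M_{\mathcal D}=\sum_{i:d_i\ne2}d_i$; $\mathcal D$ is $\lambda$-well-behaved if $M_{\mathcal D}\ge\lambda(n)$. $H(\mathcal D)$ is the multigraph obtained from $G(\mathcal D)$ by deleting all components that are cycles and then suppressing every vertex of degree 2 (deleting it and joining its two neighbours by an edge, possibly creating loops and multiple edges). The size of a component is its number of edges. -}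

module Defs where

open import Data.Bool using (Bool; true; false; _∧_; _∨_; not; if_then_else_; T)
open import Data.Nat as ℕ using (ℕ; zero; suc; _≤_; _<_; _≡ᵇ_)
open import Data.Nat.Properties using (≤-decTotalOrder)
open import Data.Integer as ℤ using (ℤ; +_)
open import Data.Rational as ℚ using (ℚ; _/_)
open import Data.Fin using (toℕ)
open import Data.Fin using (Fin; _≟_)
open import Data.Product using (_×_; _,_; proj₁; proj₂; ∃)
open import Data.List as List using (List; []; _∷_; filterᵇ; length; allFin; concatMap; foldl; map)
open import Data.Nat.ListAction using (sum)
open import Data.Bool.ListAction using (all; any)
open import Data.Vec as Vec using (Vec; lookup; replicate; updateAt; toList)
open import Relation.Nullary.Decidable using (⌊_⌋)
open import Relation.Binary.PropositionalEquality using (_≡_)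
open import Data.List.Sort ≤-decTotalOrder using (sort)

Positive : ∀ {n} → Vec ℕ n → Set
Positive {n} D = (i : Fin n) → 1 ≤ lookup D i

Mat : ℕ → Set
Mat n = Vec (Vec Bool n) n

adj : ∀ {n} → Mat n → Fin n → Fin n → Bool
adj A i j = lookup (lookup A i) j

eqᵇ : ∀ {n} → Fin n → Fin n → Bool
eqᵇ i j = ⌊ i ≟ j ⌋

countTrue : List Bool → ℕ
countTrue bs = length (filterᵇ (λ b → b) bs)

degreeIn : ∀ {n} → Mat n → Fin n → ℕ
degreeIn A i = countTrue (toList (lookup A i))

boolEq : Bool → Bool → Bool
boolEq true b = b
boolEq false b = not b

isRealization : ∀ {n} → Vec ℕ n → Mat n → Bool
isRealization {n} D A =
  all (λ i → not (adj A i i) ∧ (degreeIn A i ≡ᵇ lookup D i)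
             ∧ all (λ j → boolEq (adj A i j) (adj A j i)) (allFin n))
      (allFin n)

allVecs : ∀ k → List (Vec Bool k)
allVecs zero = Vec.[] ∷ []
allVecs (suc k) = concatMap (λ v → (true Vec.∷ v) ∷ (false Vec.∷ v) ∷ []) (allVecs k)

allMats : ∀ m k → List (Vec (Vec Bool k) m)
allMats zero k = Vec.[] ∷ []
allMats (suc m) k = concatMap (λ M → map (λ r → r Vec.∷ M) (allVecs k)) (allMats m k)

realizations : ∀ {n} → Vec ℕ n → List (Mat n)
realizations {n} D = filterᵇ (isRealization D) (allMats n n)

Feasible : ∀ {n} → Vec ℕ n → Set
Feasible {n} D = ∃ λ (A : Mat n) → T (isRealization D A)

M : ∀ {n} → Vec ℕ n → ℕ
M D = sum (filterᵇ (λ d → not (d ≡ᵇ 2)) (toList D))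

w : ℕ → ℤ
w d = + d ℤ.* (+ d ℤ.- + 2)

-- Given the running prefix sum s of d(d-2) and the remaining sorted
-- degrees, returns Σ_{i ≥ j_D} d_{π_i}.
Rgo : ℤ → List ℕ → ℕ
Rgo s [] = 0
Rgo s (d ∷ []) = d
Rgo s (d ∷ ds@(_ ∷ _)) =
  if ℤ.+ 1 ℤ.≤ᵇ (s ℤ.+ w d) then d ℕ.+ sum ds else Rgo (s ℤ.+ w d) ds

R : ∀ {n} → Vec ℕ n → ℕ
R D = Rgo (+ 0) (sort (toList D))

-- Multigraphs on Fin n as edge lists (loops and multi-edges allowed).

MG : ℕ → Set
MG n = List (Fin n × Fin n)

edgesOf : ∀ {n} → Mat n → MG n
edgesOf {n} A = concatMap (λ i → map (λ j → (i , j))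
                  (filterᵇ (λ j → adj A i j ∧ (toℕ i ℕ.<ᵇ toℕ j)) (allFin n)))
                (allFin n)

touches : ∀ {n} → Fin n → Fin n × Fin n → Bool
touches v (a , b) = eqᵇ v a ∨ eqᵇ v b

step : ∀ {n} → MG n → Vec Bool n → Vec Bool n
step {n} E S = Vec.tabulate (λ u → lookup S u ∨
   any (λ e → touches u e ∧ (lookup S (proj₁ e) ∨ lookup S (proj₂ e))) E)

iter : ∀ {A : Set} → ℕ → (A → A) → A → A
iter zero f x = x
iter (suc k) f x = iter k f (f x)

reach : ∀ {n} → MG n → Fin n → Vec Bool n
reach {n} E v = iter n (step E) (Vec.tabulate (eqᵇ v))

-- a component all of whose vertices have degree 2 (a connected 2-regular
-- simple graph, i.e. a cycle component)
inCycleComponent : ∀ {n} → Vec ℕ n → MG n → Fin n → Bool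
inCycleComponent {n} D E v =
  all (λ u → not (lookup (reach E v) u) ∨ (lookup D u ≡ᵇ 2)) (allFin n)

deleteCycles : ∀ {n} → Vec ℕ n → MG n → MG n
deleteCycles D E = filterᵇ (λ e → not (inCycleComponent D E (proj₁ e))) E

other : ∀ {n} → Fin n → Fin n × Fin n → Fin n
other v (a , b) = if eqᵇ v a then b else a

-- suppress vertex v if it has degree 2 (two incident non-loop edges)
suppress : ∀ {n} → Vec ℕ n → MG n → Fin n → MG n
suppress D E v with lookup D v ≡ᵇ 2 | filterᵇ (touches v) E
... | true | e₁ ∷ e₂ ∷ [] = (other v e₁ , other v e₂) ∷ filterᵇ (λ e → not (touches v e)) E
... | _ | _ = E

-- H(D) from a realization A; suppressed/deleted vertices remain as isolated
-- vertices, which carry no edges and so do not affect component sizes.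
H : ∀ {n} → Vec ℕ n → Mat n → MG n
H {n} D A = foldl (suppress D) (deleteCycles D (edgesOf A)) (allFin n)

componentSize : ∀ {n} → MG n → Fin n × Fin n → ℕ
componentSize E e = length (filterᵇ (λ e' → lookup (reach E (proj₁ e)) (proj₁ e')) E)

toℚ : ℕ → ℚ
toℚ k = + k / 1

-- the multigraph has a component with at least x edges (x ∈ ℚ).
-- Every component of H contains an edge (H has no genuine isolated
-- vertices), so it suffices to range over components of edges.
hasComponentOfSize≥ : ∀ {n} → MG n → ℚ → Bool
hasComponentOfSize≥ E x = any (λ e → x ℚ.≤ᵇ toℚ (componentSize E e)) E

-- number of realizations, and number in which H(D) has a component of
-- size ≥ γ·M_D; Pr = good / total under the uniform distribution G(D).
total : ∀ {n} → Vec ℕ n → ℕ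
total D = length (realizations D)

good : ∀ {n} → Vec ℕ n → ℚ → ℕ
good D γ = length (filterᵇ (λ A → hasComponentOfSize≥ (H D A) (γ ℚ.* toℚ (M D))) (realizations D))

{-# OPTIONS --safe #-}

-- Call a realization bad if every component has volume (sum of the degrees ≠ 2 in it) at most
-- L = M/(48Q); a component of larger volume survives in H with at least half its volume in
-- edges, so it suffices that bad realizations are rare.  Everything is a double count of
-- switches: half-edges up and xq with u, x in different components, deg u ≠ 2 ≠ deg x, become uq and xp;
-- such a switch always yields a realization, and on adjacency matrices it is an involution.
--
-- R ≥ M/e makes the degrees supercritical: a half-edge at a random vertex leads on average to
-- more than one further half-edge, even with the offspring capped at B.  In small tree
-- components the corresponding sum of branch volumes would have to grow under a random switch
-- although it is stationary, so it is rare that the components of volume > t carry less than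
-- the fraction 1/Q of the volume.  Otherwise:
--   * If those components have many leaves, grafting three large components at one vertex
--     creates a branching of edges each of which cuts off volume t on either side; by Euler's
--     formula any graph has few of those, so this case is rare.
--   * If they have few leaves, Euler's formula yields many edges that close a cycle, most of them
--     in few two-edge cuts.  Merging two components through such non-bridges leaves the new
--     half-edges in few two-edge cuts too, so each outcome arises in few ways.
module Submission where

-- A switch acts between different components, so it never creates a loop or a double edge. The
-- price is that pairs inside one component are lost; these are few because the counts concern
-- components of volume at most t or at most L. The two scales differ: t is a constant, L a fixed
-- fraction of M, and degrees may be as large as L, hence the caps on offspring and on branch
-- volumes. Being mostly small is not stable under a switch, so the stationarity argument weights
-- realizations by `ω`, which a switch lowers by a bounded amount only. Three grafts are made at a
-- vertex because two separating edges may just lie on a path; Euler's formula controls the excess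
-- over two. The degree bound behind supercriticality is read off from a single bad realization,
-- where a vertex is no heavier than its component; if there is no bad realization, nothing remains
-- to be shown. Each of the three cases takes at most a fraction 1/(3 dl) of the realizations, with
-- 1/dl at most δ. Only t and the lower bound on M depend on dl, so γ does not.

module Proof where

  open import Data.Nat using (ℕ; zero; suc; _+_; _*_; _∸_; _≤_; _<_; z≤n; s≤s; _⊓_; _≤?_; _<?_; _≡ᵇ_; >-nonZero; _<ᵇ_)
  open import Data.Fin using (Fin; zero; suc; toℕ)
  open import Data.Fin.Properties using (any?; all?; toℕ-injective; ¬∀⟶∃¬) renaming (_≟_ to _≟ᶠ_; suc-injective to suc-injectiveᶠ)
  open import Data.List using (List; []; _∷_; _++_; map; length; filter; cartesianProduct; concatMap; filterᵇ; allFin; tabulate; foldl)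
  open import Data.Product using (∃; _×_; _,_; proj₁; proj₂)
  open import Data.Sum using (_⊎_; inj₁; inj₂; [_,_]′)
  open import Data.Empty using (⊥; ⊥-elim)
  open import Data.Unit using (⊤; tt)
  open import Function using (_∘_; id)
  open import Relation.Nullary using (Dec; yes; no; ¬_; contradiction; ¬?; _×-dec_; _⊎-dec_)
  open import Relation.Binary.PropositionalEquality using (_≡_; _≢_; refl; sym; trans; cong; cong₂; subst; subst₂; module ≡-Reasoning)
  open import Data.Nat.Tactic.RingSolver using (solve-∀)
  open import Data.List.Membership.Propositional using (_∈_)
  open import Data.List.Membership.Propositional.Properties using (∈-filter⁺; ∈-filter⁻; ∈-cartesianProduct⁺; ∈-map⁺; ∈-++⁺ʳ; ∈-++⁻; ∈-++⁺ˡ)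
  open import Data.List.Relation.Unary.Any using (here; there)
  open import Relation.Nullary.Decidable using (map′; isYes; toWitness; fromWitness)
  open import Relation.Binary.Construct.Closure.ReflexiveTransitive using (Star; ε; _◅_; _◅◅_; kleisliStar; reverse; return)
  open import Defs using (Mat; adj; isRealization; degreeIn; countTrue; boolEq; allVecs; allMats; Positive; total; realizations; M; R; Rgo; MG; edgesOf; touches; eqᵇ; iter; reach; inCycleComponent; deleteCycles; other; suppress; H; componentSize; good; toℚ; hasComponentOfSize≥)
  open import Data.Bool using (Bool; true; false; _∧_; not; _xor_; T; T?; _∨_)
  open import Data.Bool.Properties using (T-∧; T-≡; T-∨) renaming (_≟_ to _≟ᵇ_)
  open import Data.List.Properties using (map-tabulate; length-map)
  open import Data.Vec as Vec using (Vec; lookup; toList)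
  open import Data.Vec.Properties using (lookup-zipWith; lookup∘tabulate)
  open import Function.Bundles using (Equivalence)
  open import Data.List.Relation.Unary.Unique.Propositional using (Unique)
  open import Data.List.Relation.Unary.Unique.Propositional.Properties using (map⁺; cartesianProduct⁺; filter⁺)
  open import Data.List.Relation.Unary.AllPairs using ([]; _∷_; AllPairs)
  open import Data.List.Relation.Unary.All using (All; []; _∷_)
  open import Relation.Binary.Definitions using (Tri; tri<; tri≈; tri>)
  open import Data.Product.Properties using (≡-dec)
  open import Data.Nat.ListAction using (sum)
  open import Data.Integer as ℤ using (ℤ) renaming (+_ to pos)
  open import Data.Integer.Tactic.RingSolver using () renaming (solve-∀ to solveℤ-∀)
  open import Data.List.Relation.Unary.Linked.Properties using (Linked⇒AllPairs)
  open import Data.List.Relation.Binary.Permutation.Propositional using (_↭_; prep) renaming (refl to ↭-refl; swap to ↭-swap; trans to ↭-trans)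
  open import Data.Nat.DivMod using (_/_; m*n/n≡m; m/n*n≤m; /-monoˡ-≤)
  open import Data.Rational as ℚ using (ℚ; mkℚ; 0ℚ; 1ℚ; toℚᵘ; fromℚᵘ)
  open import Data.Rational.Unnormalised as ℚᵘ using (ℚᵘ; mkℚᵘ; *≤*)
  open import Data.Nat.Properties
  import Data.Bool.ListAction as BL
  import Data.List.Relation.Unary.All as All
  import Data.List.Relation.Unary.All.Properties as AllP
  import Data.Integer.Properties as ℤP
  import Data.List.Relation.Binary.Permutation.Propositional.Properties as Perm
  import Data.Rational.Properties as ℚP
  import Data.Rational.Unnormalised.Properties as ℚᵘP
  open import Data.List.Sort ≤-decTotalOrder using (sort; sort-↭; sort-↗)

  -- Sums and indicators

  𝟙 : {P : Set} → Dec P → ℕ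
  𝟙 (yes _) = 1
  𝟙 (no _) = 0

  𝟙-yes : {P : Set} (d : Dec P) → P → 𝟙 d ≡ 1
  𝟙-yes (yes _) _ = refl
  𝟙-yes (no ¬p) p = contradiction p ¬p

  𝟙-no : {P : Set} (d : Dec P) → ¬ P → 𝟙 d ≡ 0
  𝟙-no (yes p) ¬p = contradiction p ¬p
  𝟙-no (no _) _ = refl

  𝟙≤1 : {P : Set} (d : Dec P) → 𝟙 d ≤ 1
  𝟙≤1 (yes _) = ≤-refl
  𝟙≤1 (no _) = z≤n

  𝟙-mono : {P Q : Set} (d : Dec P) (d′ : Dec Q) → (P → Q) → 𝟙 d ≤ 𝟙 d′
  𝟙-mono (yes p) d′ f = ≤-reflexive (sym (𝟙-yes d′ (f p)))
  𝟙-mono (no _) d′ f = z≤n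

  𝟙-cong : {P Q : Set} (d : Dec P) (d′ : Dec Q) → (P → Q) → (Q → P) → 𝟙 d ≡ 𝟙 d′
  𝟙-cong d d′ f g = ≤-antisym (𝟙-mono d d′ f) (𝟙-mono d′ d g)

  𝟙*-mono : {P Q : Set} (d : Dec P) (d′ : Dec Q) {a b : ℕ} → (P → Q × a ≤ b) → 𝟙 d * a ≤ 𝟙 d′ * b
  𝟙*-mono (no _) d′ f = z≤n
  𝟙*-mono (yes p) d′ {a} {b} f = subst (λ k → 1 * a ≤ k * b) (sym (𝟙-yes d′ (proj₁ (f p)))) (*-monoʳ-≤ 1 (proj₂ (f p)))

  𝟙*-≤ : {P : Set} (d : Dec P) {a b : ℕ} → (P → a ≤ b) → 𝟙 d * a ≤ b
  𝟙*-≤ (no _) f = z≤n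
  𝟙*-≤ (yes p) {a} f = ≤-trans (≤-reflexive (*-identityˡ a)) (f p)

  𝟙*-le : {P : Set} (d : Dec P) (a : ℕ) → 𝟙 d * a ≤ a
  𝟙*-le d a = 𝟙*-≤ d (λ _ → ≤-refl)

  𝟙-× : {P Q : Set} (d : Dec P) (d′ : Dec Q) → 𝟙 (d ×-dec d′) ≡ 𝟙 d * 𝟙 d′
  𝟙-× (yes _) (yes _) = refl
  𝟙-× (yes _) (no _) = refl
  𝟙-× (no _) _ = refl

  𝟙-¬ : {P : Set} (d : Dec P) → 𝟙 d + 𝟙 (¬? d) ≡ 1
  𝟙-¬ (yes _) = refl
  𝟙-¬ (no _) = refl

  𝟙-pos : {P : Set} (d : Dec P) → 0 < 𝟙 d → P
  𝟙-pos (yes p) _ = p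

  -- With L ≤ R, an identity A + R + s ≡ B + L yields A ≤ B.
  lin : ∀ {L R} → L ≤ R → ∀ {A B} s → A + R + s ≡ B + L → A ≤ B
  lin {L} {R} h {A} {B} s eq = +-cancelʳ-≤ R A B
    (≤-trans (m≤m+n (A + R) s) (≤-trans (≤-reflexive eq) (+-monoʳ-≤ B h)))

  +-subˡ : ∀ {a b c} → a ≡ b → a + c ≡ b + c
  +-subˡ {c = c} = cong (_+ c)

  ∑ : {A : Set} → List A → (A → ℕ) → ℕ
  ∑ [] f = 0
  ∑ (x ∷ xs) f = f x + ∑ xs f

  module _ {A : Set} where

    ∑-cong : (xs : List A) {f g : A → ℕ} → (∀ x → f x ≡ g x) → ∑ xs f ≡ ∑ xs g
    ∑-cong [] e = refl
    ∑-cong (x ∷ xs) e = cong₂ _+_ (e x) (∑-cong xs e)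

    ∑-mono : (xs : List A) {f g : A → ℕ} → (∀ x → f x ≤ g x) → ∑ xs f ≤ ∑ xs g
    ∑-mono [] e = z≤n
    ∑-mono (x ∷ xs) e = +-mono-≤ (e x) (∑-mono xs e)

    ∑-0 : (xs : List A) → ∑ xs (λ _ → 0) ≡ 0
    ∑-0 [] = refl
    ∑-0 (x ∷ xs) = ∑-0 xs

    ∑-zero : (xs : List A) {f : A → ℕ} → (∀ x → f x ≡ 0) → ∑ xs f ≡ 0
    ∑-zero xs e = trans (∑-cong xs e) (∑-0 xs)

    ∑-+ : (xs : List A) (f g : A → ℕ) → ∑ xs (λ x → f x + g x) ≡ ∑ xs f + ∑ xs g
    ∑-+ [] f g = refl
    ∑-+ (x ∷ xs) f g = trans (cong (f x + g x +_) (∑-+ xs f g)) (eq (f x) (g x) (∑ xs f) (∑ xs g))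
      where
      eq : ∀ a b c d → a + b + (c + d) ≡ a + c + (b + d)
      eq = solve-∀

    ∑-*ˡ : (xs : List A) (c : ℕ) (f : A → ℕ) → ∑ xs (λ x → c * f x) ≡ c * ∑ xs f
    ∑-*ˡ [] c f = sym (*-zeroʳ c)
    ∑-*ˡ (x ∷ xs) c f = trans (cong (c * f x +_) (∑-*ˡ xs c f)) (sym (*-distribˡ-+ c (f x) _))

    ∑-*ʳ : (xs : List A) (c : ℕ) (f : A → ℕ) → ∑ xs (λ x → f x * c) ≡ ∑ xs f * c
    ∑-*ʳ xs c f = trans (∑-cong xs (λ x → *-comm (f x) c)) (trans (∑-*ˡ xs c f) (*-comm c _))

    ∑-const : (xs : List A) (c : ℕ) → ∑ xs (λ _ → c) ≡ length xs * c
    ∑-const [] c = refl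
    ∑-const (x ∷ xs) c = cong (c +_) (∑-const xs c)

    ∑-++ : (xs ys : List A) (f : A → ℕ) → ∑ (xs ++ ys) f ≡ ∑ xs f + ∑ ys f
    ∑-++ [] ys f = refl
    ∑-++ (x ∷ xs) ys f = trans (cong (f x +_) (∑-++ xs ys f)) (sym (+-assoc (f x) _ _))

  ∑-swap : {A B : Set} (xs : List A) (ys : List B) (f : A → B → ℕ) →
           ∑ xs (λ x → ∑ ys (f x)) ≡ ∑ ys (λ y → ∑ xs (λ x → f x y))
  ∑-swap [] ys f = sym (∑-0 ys)
  ∑-swap (x ∷ xs) ys f = trans (cong (∑ ys (f x) +_) (∑-swap xs ys f)) (sym (∑-+ ys (f x) _))

  ∑-map : {A B : Set} (h : A → B) (xs : List A) (f : B → ℕ) → ∑ (map h xs) f ≡ ∑ xs (f ∘ h)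
  ∑-map h [] f = refl
  ∑-map h (x ∷ xs) f = cong (f (h x) +_) (∑-map h xs f)

  ∑-product : {A B : Set} (xs : List A) (ys : List B) (f : A → ℕ) (g : B → ℕ) →
              ∑ xs (λ x → ∑ ys (λ y → f x * g y)) ≡ ∑ xs f * ∑ ys g
  ∑-product xs ys f g = trans (∑-cong xs (λ x → ∑-*ˡ ys (f x) g)) (∑-*ʳ xs (∑ ys g) f)

  fins : ∀ n → List (Fin n)
  fins zero = []
  fins (suc n) = zero ∷ map suc (fins n)

  module _ {n : ℕ} where

    ∑ᵛ : (Fin n → ℕ) → ℕ
    ∑ᵛ = ∑ (fins n)

  ∑-point : ∀ {n} (a : Fin n) (f : Fin n → ℕ) → ∑ᵛ (λ i → 𝟙 (i ≟ᶠ a) * f i) ≡ f a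
  ∑-point {suc n} zero f = trans (cong (f zero + 0 +_)
      (trans (∑-map suc (fins n) _) (∑-zero (fins n) (λ i → cong (_* f (suc i)) (𝟙-no (suc i ≟ᶠ zero) (λ ()))))))
    (trans (+-identityʳ _) (+-identityʳ _))
  ∑-point {suc n} (suc a) f = trans (∑-map suc (fins n) _) (trans (∑-cong (fins n) step) (∑-point a (f ∘ suc)))
    where
    step : ∀ i → 𝟙 (suc i ≟ᶠ suc a) * f (suc i) ≡ 𝟙 (i ≟ᶠ a) * f (suc i)
    step i = cong (_* f (suc i)) (𝟙-cong (suc i ≟ᶠ suc a) (i ≟ᶠ a) suc-injectiveᶠ (cong suc))

  ∑-point₁ : ∀ {n} (a : Fin n) → ∑ᵛ (λ i → 𝟙 (i ≟ᶠ a)) ≡ 1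
  ∑-point₁ {n} a = trans (∑-cong (fins n) (λ i → sym (*-identityʳ _))) (∑-point a (λ _ → 1))

  ∑-term : ∀ {n} (a : Fin n) (f : Fin n → ℕ) → f a ≤ ∑ᵛ f
  ∑-term {n} a f = subst (_≤ ∑ᵛ f) (∑-point a f) (∑-mono (fins n) (λ i → 𝟙*-le (i ≟ᶠ a) (f i)))

  ∑-two-terms : ∀ {n} (a b : Fin n) (f : Fin n → ℕ) → a ≢ b → f a + f b ≤ ∑ᵛ f
  ∑-two-terms {n} a b f a≢b = subst (_≤ ∑ᵛ f)
    (trans (∑-+ (fins n) (λ i → 𝟙 (i ≟ᶠ a) * f i) (λ i → 𝟙 (i ≟ᶠ b) * f i)) (cong₂ _+_ (∑-point a f) (∑-point b f)))
    (∑-mono (fins n) le)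
    where
    le : ∀ i → 𝟙 (i ≟ᶠ a) * f i + 𝟙 (i ≟ᶠ b) * f i ≤ f i
    le i with i ≟ᶠ a | i ≟ᶠ b
    ... | yes p | yes q = contradiction (trans (sym p) q) a≢b
    ... | yes p | no _ = ≤-reflexive (trans (+-identityʳ _) (+-identityʳ _))
    ... | no _ | yes q = ≤-reflexive (+-identityʳ _)
    ... | no _ | no _ = z≤n

  ∑-unique : ∀ {n} {P : Fin n → Set} (P? : ∀ i → Dec (P i)) →
             (∀ i j → P i → P j → i ≡ j) → ∑ᵛ (λ i → 𝟙 (P? i)) ≤ 1
  ∑-unique {n} P? uniq with any? P?
  ... | yes (a , pa) = ≤-trans (∑-mono (fins n) (λ i → 𝟙-mono (P? i) (i ≟ᶠ a) (λ p → uniq i a p pa)))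
                               (≤-reflexive (∑-point₁ a))
  ... | no none = ≤-trans (≤-reflexive (∑-zero (fins n) (λ i → 𝟙-no (P? i) (λ p → none (i , p))))) z≤n

  ∑-none⊎some : {A : Set} (xs : List A) (f : A → ℕ) → ∑ xs f ≡ 0 ⊎ ∃ λ x → 0 < f x
  ∑-none⊎some [] f = inj₁ refl
  ∑-none⊎some (x ∷ xs) f with f x in eq
  ... | suc k = inj₂ (x , subst (0 <_) (sym eq) (s≤s z≤n))
  ... | zero with ∑-none⊎some xs f
  ... | inj₁ e = inj₁ e
  ... | inj₂ s = inj₂ s

  ∑-pos : {A : Set} (xs : List A) (f : A → ℕ) → 0 < ∑ xs f → ∃ λ x → 0 < f x
  ∑-pos xs f h with ∑-none⊎some xs f
  ... | inj₁ e = contradiction (subst (0 <_) e h) (λ ())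
  ... | inj₂ s = s

  *-posˡ : ∀ a b → 0 < a * b → 0 < a
  *-posˡ (suc a) b _ = s≤s z≤n

  *-posʳ : ∀ a b → 0 < a * b → 0 < b
  *-posʳ a (suc b) _ = s≤s z≤n
  *-posʳ a zero h = contradiction (subst (0 <_) (*-zeroʳ a) h) (λ ())

  -- Graphs, connectivity and spanning forests

  Same : ∀ {n} → Fin n → Fin n → Fin n → Fin n → Set
  Same i j a b = (i ≡ a × j ≡ b) ⊎ (i ≡ b × j ≡ a)

  same? : ∀ {n} (i j a b : Fin n) → Dec (Same i j a b)
  same? i j a b = ((i ≟ᶠ a) ×-dec (j ≟ᶠ b)) ⊎-dec ((i ≟ᶠ b) ×-dec (j ≟ᶠ a))

  same-sym : ∀ {n} {i j a b : Fin n} → Same i j a b → Same j i a b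
  same-sym (inj₁ (p , q)) = inj₂ (q , p)
  same-sym (inj₂ (p , q)) = inj₁ (q , p)

  same-refl : ∀ {n} {a b : Fin n} → Same a b a b
  same-refl = inj₁ (refl , refl)

  module _ {n : ℕ} where

    -- Walks are carried from one graph to another region by region: inside Q every edge of the
    -- first is an edge of the second. With a trivial `R′` only the confinement to Q is used.
    star-closed : {R R′ : Fin n → Fin n → Set} (Q : Fin n → Set) →
      (∀ {a b} → Q a → R a b → Q b × R′ a b) →
      ∀ {a b} → Q a → Star R a b → Q b × Star R′ a b
    star-closed Q step qa ε = qa , ε
    star-closed Q step qa (r ◅ rs) =
      let qb , r′ = step qa r
          qc , rs′ = star-closed Q step qb rs
      in qc , r′ ◅ rs′

    -- The excursion between two crossings of cd can be cut out, so at most one crossing is left, in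
    -- one of the two directions.
    star-add : {R R′ : Fin n → Fin n → Set} (c d : Fin n) →
      (∀ {i j} → R i j → R′ i j ⊎ Same i j c d) →
      ∀ {a b} → Star R a b →
      Star R′ a b ⊎ (Star R′ a c × Star R′ d b) ⊎ (Star R′ a d × Star R′ c b)
    star-add c d f ε = inj₁ ε
    star-add c d f (r ◅ rs) with f r | star-add c d f rs
    ... | inj₁ r′ | inj₁ s = inj₁ (r′ ◅ s)
    ... | inj₁ r′ | inj₂ (inj₁ (s , t)) = inj₂ (inj₁ (r′ ◅ s , t))
    ... | inj₁ r′ | inj₂ (inj₂ (s , t)) = inj₂ (inj₂ (r′ ◅ s , t))
    ... | inj₂ (inj₁ (refl , refl)) | inj₁ s = inj₂ (inj₁ (ε , s))
    ... | inj₂ (inj₁ (refl , refl)) | inj₂ (inj₁ (s , t)) = inj₂ (inj₁ (ε , t))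
    ... | inj₂ (inj₁ (refl , refl)) | inj₂ (inj₂ (s , t)) = inj₁ t
    ... | inj₂ (inj₂ (refl , refl)) | inj₁ s = inj₂ (inj₂ (ε , s))
    ... | inj₂ (inj₂ (refl , refl)) | inj₂ (inj₁ (s , t)) = inj₁ t
    ... | inj₂ (inj₂ (refl , refl)) | inj₂ (inj₂ (s , t)) = inj₂ (inj₂ (ε , t))

    Adj : List (Fin n × Fin n) → Fin n → Fin n → Set
    Adj es i j = (i , j) ∈ es ⊎ (j , i) ∈ es

    adj-sym : ∀ es {i j} → Adj es i j → Adj es j i
    adj-sym es (inj₁ p) = inj₂ p
    adj-sym es (inj₂ p) = inj₁ p

    adj-there : ∀ {e es i j} → Adj es i j → Adj (e ∷ es) i j
    adj-there (inj₁ p) = inj₁ (there p)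
    adj-there (inj₂ p) = inj₂ (there p)

    star-there : ∀ {e es a b} → Star (Adj es) a b → Star (Adj (e ∷ es)) a b
    star-there = kleisliStar id (λ r → return (adj-there r))

    choose : {P : Set} → Dec P → Fin n → Fin n → Fin n
    choose (yes _) x y = x
    choose (no _) x y = y

    -- Union–find: every vertex points at the representative of its component.
    lab : List (Fin n × Fin n) → Fin n → Fin n
    lab [] v = v
    lab ((a , b) ∷ es) v = choose (lab es v ≟ᶠ lab es b) (lab es a) (lab es v)

    lab-star : ∀ es v → Star (Adj es) v (lab es v)
    lab-star [] v = ε
    lab-star ((a , b) ∷ es) v with lab es v ≟ᶠ lab es b
    ... | no _ = star-there (lab-star es v)
    ... | yes p = star-there (lab-star es v) ◅◅ subst (λ w → Star _ w (lab es a)) (sym p)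
       (reverse (adj-sym _) (star-there (lab-star es b)) ◅◅ (inj₂ (here refl) ◅ star-there (lab-star es a)))

    lab-cong : ∀ e es {v w} → lab es v ≡ lab es w → lab (e ∷ es) v ≡ lab (e ∷ es) w
    lab-cong (a , b) es eq = cong (λ l → choose (l ≟ᶠ lab es b) (lab es a) l) eq

    lab-edge : ∀ es {i j} → (i , j) ∈ es → lab es i ≡ lab es j
    lab-edge ((a , b) ∷ es) (there p) = lab-cong (a , b) es (lab-edge es p)
    lab-edge ((a , b) ∷ es) (here refl) with lab es b ≟ᶠ lab es b
    ... | no ¬p = contradiction refl ¬p
    ... | yes _ with lab es a ≟ᶠ lab es b
    ... | yes _ = refl
    ... | no _ = refl

    lab-complete : ∀ es {i j} → Star (Adj es) i j → lab es i ≡ lab es j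
    lab-complete es ε = refl
    lab-complete es (inj₁ p ◅ rs) = trans (lab-edge es p) (lab-complete es rs)
    lab-complete es (inj₂ p ◅ rs) = trans (sym (lab-edge es p)) (lab-complete es rs)

    lab-sound : ∀ es {i j} → lab es i ≡ lab es j → Star (Adj es) i j
    lab-sound es {i} {j} eq = lab-star es i ◅◅ subst (λ w → Star _ w j) (sym eq) (reverse (adj-sym es) (lab-star es j))

    lab-idem : ∀ es v → lab es (lab es v) ≡ lab es v
    lab-idem es v = sym (lab-complete es (lab-star es v))

    Root : List (Fin n × Fin n) → Fin n → Set
    Root es v = lab es v ≡ v

    root? : ∀ es v → Dec (Root es v)
    root? es v = lab es v ≟ᶠ v

    Joins : List (Fin n × Fin n) → Fin n × Fin n → Set
    Joins es (a , b) = ¬ (lab es a ≡ lab es b)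

    joins? : ∀ es e → Dec (Joins es e)
    joins? es (a , b) = ¬? (lab es a ≟ᶠ lab es b)

    module _ {W : Fin n → Set} (W? : ∀ v → Dec (W v)) where

      -- Building the list up from its end, the edges that join two components form a spanning
      -- forest. Each is counted at its first end; for a closed W either end would give the same
      -- count.
      forest : List (Fin n × Fin n) → ℕ
      forest [] = 0
      forest (e ∷ es) = 𝟙 (W? (proj₁ e)) * 𝟙 (joins? es e) + forest es

      Closed : List (Fin n × Fin n) → Set
      Closed es = ∀ {a b} → Adj es a b → W a → W b

      closed-star : ∀ es → Closed es → ∀ {a b} → Star (Adj es) a b → W a → W b
      closed-star es cl ε w = w
      closed-star es cl (r ◅ rs) w = closed-star es cl rs (cl r w)

      roots : List (Fin n × Fin n) → ℕ
      roots es = ∑ᵛ (λ v → 𝟙 (W? v) * 𝟙 (root? es v))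

      -- Euler's formula for forests. Adding ab merges the class of b into that of a: if they
      -- differ, exactly the root `lab es b` disappears, otherwise no label changes. Closedness
      -- makes W hold at a exactly when it holds at that root.
      forest+roots : ∀ es → Closed es → forest es + roots es ≡ ∑ᵛ (λ v → 𝟙 (W? v))
      forest+roots [] cl = ∑-cong (fins n) (λ v → trans (cong (𝟙 (W? v) *_) (𝟙-yes (root? [] v) refl)) (*-identityʳ _))
      forest+roots ((a , b) ∷ es) cl = trans step (forest+roots es cl′)
        where
        cl′ : Closed es
        cl′ = cl ∘ adj-there
        α = lab es a
        β = lab es b
        old new : Fin n → ℕ
        old v = 𝟙 (W? v) * 𝟙 (root? es v)
        new v = 𝟙 (W? v) * 𝟙 (root? ((a , b) ∷ es) v)
        inner : Dec (α ≡ β) → 𝟙 (W? a) * 𝟙 (joins? es (a , b)) + ∑ᵛ new ≡ ∑ᵛ old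
        inner (yes p) = trans (cong (λ k → 𝟙 (W? a) * k + ∑ᵛ new) (𝟙-no (joins? es (a , b)) (λ ¬p → ¬p p)))
          (trans (cong (_+ ∑ᵛ new) (*-zeroʳ (𝟙 (W? a)))) (∑-cong (fins n) λ v → cong (𝟙 (W? v) *_)
            (𝟙-cong (root? ((a , b) ∷ es) v) (root? es v) (λ r → trans (sym (same v)) r) (λ r → trans (same v) r))))
          where
          same : ∀ v → lab ((a , b) ∷ es) v ≡ lab es v
          same v with lab es v ≟ᶠ lab es b
          ... | yes q = trans p (sym q)
          ... | no _ = refl
        inner (no ¬p) = trans (cong (_+ ∑ᵛ new) lhs) (trans (sym (∑-+ (fins n) (λ v → 𝟙 (v ≟ᶠ β) * 𝟙 (W? v)) new)) (∑-cong (fins n) pw))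
          where
          a⇒β : W a → W β
          a⇒β wa = closed-star es cl′ (lab-star es b) (cl (inj₁ (here refl)) wa)
          β⇒a : W β → W a
          β⇒a wβ = cl (inj₂ (here refl)) (closed-star es cl′ (reverse (adj-sym es) (lab-star es b)) wβ)
          lhs : 𝟙 (W? a) * 𝟙 (joins? es (a , b)) ≡ ∑ᵛ (λ v → 𝟙 (v ≟ᶠ β) * 𝟙 (W? v))
          lhs = trans (cong (𝟙 (W? a) *_) (𝟙-yes (joins? es (a , b)) ¬p)) (trans (*-identityʳ _)
                (trans (𝟙-cong (W? a) (W? β) a⇒β β⇒a) (sym (∑-point β (λ v → 𝟙 (W? v))))))
          fix⇒ : ∀ v → lab ((a , b) ∷ es) v ≡ v → lab es v ≡ v × v ≢ β
          fix⇒ v r with lab es v ≟ᶠ lab es b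
          ... | yes q = contradiction (trans (sym (lab-idem es a)) (trans (cong (lab es) r) q)) ¬p
          ... | no ¬q = r , λ v≡β → ¬q (trans (cong (lab es) v≡β) (lab-idem es b))
          fix⇐ : ∀ v → lab es v ≡ v → v ≢ β → lab ((a , b) ∷ es) v ≡ v
          fix⇐ v r v≢β with lab es v ≟ᶠ lab es b
          ... | yes q = contradiction (trans (sym r) q) v≢β
          ... | no _ = r
          pw : ∀ v → 𝟙 (v ≟ᶠ β) * 𝟙 (W? v) + new v ≡ old v
          pw v with v ≟ᶠ β
          ... | yes v≡β = trans (cong₂ _+_ (+-identityʳ (𝟙 (W? v)))
                  (trans (cong (𝟙 (W? v) *_) (𝟙-no (root? ((a , b) ∷ es) v) (λ r → proj₂ (fix⇒ v r) v≡β))) (*-zeroʳ (𝟙 (W? v)))))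
                  (trans (+-identityʳ _) (sym (trans (cong (𝟙 (W? v) *_) (𝟙-yes (root? es v) (trans (cong (lab es) v≡β) (trans (lab-idem es b) (sym v≡β))))) (*-identityʳ _))))
          ... | no v≢β = cong (𝟙 (W? v) *_) (𝟙-cong (root? ((a , b) ∷ es) v) (root? es v) (proj₁ ∘ fix⇒ v) (λ r → fix⇐ v r v≢β))
        step : forest ((a , b) ∷ es) + roots ((a , b) ∷ es) ≡ forest es + roots es
        step = trans (eq (𝟙 (W? a) * 𝟙 (joins? es (a , b))) (forest es) (∑ᵛ new)) (cong (forest es +_) (inner (α ≟ᶠ β)))
          where
          eq : ∀ x y z → x + y + z ≡ y + (x + z)
          eq = solve-∀

  ∈fins : ∀ {n} (v : Fin n) → v ∈ fins n
  ∈fins zero = here refl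
  ∈fins (suc v) = there (∈-map⁺ suc (∈fins v))

  record Graph (n : ℕ) : Set₁ where
    field
      E : Fin n → Fin n → Set
      E? : ∀ i j → Dec (E i j)
      E-sym : ∀ {i j} → E i j → E j i
  open Graph public

  pairs : ∀ n → List (Fin n × Fin n)
  pairs n = cartesianProduct (fins n) (fins n)

  edgeList : ∀ {n} → Graph n → List (Fin n × Fin n)
  edgeList {n} g = filter (λ e → E? g (proj₁ e) (proj₂ e)) (pairs n)

  Conn : ∀ {n} → Graph n → Fin n → Fin n → Set
  Conn g = Star (E g)

  conn-sym : ∀ {n} (g : Graph n) {a b} → Conn g a b → Conn g b a
  conn-sym g = reverse (E-sym g)

  module _ {n : ℕ} where

    conv : {R R′ : Fin n → Fin n → Set} → (∀ {i j} → R i j → Star R′ i j) → ∀ {i j} → Star R i j → Star R′ i j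
    conv = kleisliStar id

    abstract
      conn? : (g : Graph n) → ∀ a b → Dec (Conn g a b)
      conn? g a b = map′ (λ eq → conv back (lab-sound es eq)) (λ s → lab-complete es (conv forth s))
                         (lab es a ≟ᶠ lab es b)
        where
        es : List (Fin n × Fin n)
        es = edgeList g
        back : ∀ {i j} → Adj es i j → Conn g i j
        back (inj₁ p) = return (proj₂ (∈-filter⁻ (λ e → E? g (proj₁ e) (proj₂ e)) {xs = pairs n} p))
        back (inj₂ p) = return (E-sym g (proj₂ (∈-filter⁻ (λ e → E? g (proj₁ e) (proj₂ e)) {xs = pairs n} p)))
        forth : ∀ {i j} → E g i j → Star (Adj es) i j
        forth {i} {j} e = return (inj₁ (∈-filter⁺ (λ e → E? g (proj₁ e) (proj₂ e)) (∈-cartesianProduct⁺ (∈fins i) (∈fins j)) e))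

    conn-map : (g g′ : Graph n) (Φ : Fin n → Fin n) → (∀ {a b} → E g a b → Conn g′ (Φ a) (Φ b)) →
               ∀ {a b} → Conn g a b → Conn g′ (Φ a) (Φ b)
    conn-map g g′ Φ = kleisliStar Φ

    conn-sub : (g g′ : Graph n) → (∀ {a b} → E g a b → E g′ a b) → ∀ {a b} → Conn g a b → Conn g′ a b
    conn-sub g g′ f = kleisliStar id (λ e → return (f e))

    del : Graph n → Fin n → Fin n → Graph n
    del g a b = record
      { E = λ i j → E g i j × ¬ Same i j a b
      ; E? = λ i j → E? g i j ×-dec ¬? (same? i j a b)
      ; E-sym = λ { (e , ¬s) → E-sym g e , λ s → ¬s (same-sym s) } }

    -- The vertex is isolated rather than removed, so all graphs share one vertex set and a walk
    -- that starts at v cannot leave it.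
    _∖_ : Graph n → Fin n → Graph n
    g ∖ v = record
      { E = λ i j → E g i j × i ≢ v × j ≢ v
      ; E? = λ i j → E? g i j ×-dec (¬? (i ≟ᶠ v) ×-dec ¬? (j ≟ᶠ v))
      ; E-sym = λ { (e , p , q) → E-sym g e , q , p } }

    ∖⊆ : ∀ g v {a b} → Conn (g ∖ v) a b → Conn g a b
    ∖⊆ g v = conn-sub (g ∖ v) g proj₁

    ∖-avoid : ∀ g v {a b} → Conn (g ∖ v) a b → a ≢ v → b ≢ v
    ∖-avoid g v ε p = p
    ∖-avoid g v ((_ , _ , q) ◅ rs) p = ∖-avoid g v rs q

    -- The part of a walk after its last visit to v.
    last-exit : ∀ (g : Graph n) v {a b} → Conn g a b → b ≢ v →
                Conn (g ∖ v) a b ⊎ ∃ λ z → E g v z × z ≢ v × Conn (g ∖ v) z b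
    last-exit g v ε b≢v = inj₁ ε
    last-exit g v {a} (_◅_ {j = c} e rs) b≢v with last-exit g v rs b≢v
    ... | inj₂ r = inj₂ r
    ... | inj₁ s with a ≟ᶠ v | c ≟ᶠ v
    ... | yes refl | yes refl = inj₁ s
    ... | yes refl | no c≢v = inj₂ (c , e , c≢v , s)
    ... | no a≢v | no c≢v = inj₁ ((e , a≢v , c≢v) ◅ s)
    ... | no a≢v | yes refl = contradiction s (stuck b≢v)
      where
      stuck : ∀ {b} → b ≢ v → ¬ Conn (g ∖ v) v b
      stuck b≢v ε = b≢v refl
      stuck b≢v ((_ , p , _) ◅ _) = p refl

    module _ (δ : Fin n → ℕ) where

      vol : Graph n → Fin n → ℕ
      vol g v = ∑ᵛ (λ w → 𝟙 (conn? g v w) * δ w)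

      vol-mono : ∀ g g′ v v′ → (∀ {w} → Conn g v w → Conn g′ v′ w) → vol g v ≤ vol g′ v′
      vol-mono g g′ v v′ f = ∑-mono (fins n) (λ w → *-monoˡ-≤ (δ w) (𝟙-mono (conn? g v w) (conn? g′ v′ w) f))

      vol-cong : ∀ g g′ v v′ → (∀ {w} → Conn g v w → Conn g′ v′ w) → (∀ {w} → Conn g′ v′ w → Conn g v w) → vol g v ≡ vol g′ v′
      vol-cong g g′ v v′ f h = ≤-antisym (vol-mono g g′ v v′ f) (vol-mono g′ g v′ v h)

      vol-conn : ∀ g {v w} → Conn g v w → vol g v ≡ vol g w
      vol-conn g c = vol-cong g g _ _ (λ s → conn-sym g c ◅◅ s) (λ s → c ◅◅ s)

      δ≤vol : ∀ g v → δ v ≤ vol g v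
      δ≤vol g v = ≤-trans (≤-reflexive (sym (trans (cong (_* δ v) (𝟙-yes (conn? g v v) ε)) (*-identityˡ (δ v)))))
                          (∑-term v (λ w → 𝟙 (conn? g v w) * δ w))

  -- Adjacency matrices and switches

  allFin≡fins : ∀ n → allFin n ≡ fins n
  allFin≡fins zero = refl
  allFin≡fins (suc n) = cong (zero ∷_) (trans (sym (map-tabulate id suc)) (cong (map suc) (allFin≡fins n)))

  ∑-concatMap : {A B : Set} (h : A → List B) (xs : List A) (f : B → ℕ) → ∑ (concatMap h xs) f ≡ ∑ xs (λ x → ∑ (h x) f)
  ∑-concatMap h [] f = refl
  ∑-concatMap h (x ∷ xs) f = trans (∑-++ (h x) (concatMap h xs) f) (cong (∑ (h x) f +_) (∑-concatMap h xs f))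

  xorV : ∀ {k} → Vec Bool k → Vec Bool k → Vec Bool k
  xorV = Vec.zipWith _xor_

  xorM : ∀ {m k} → Vec (Vec Bool k) m → Vec (Vec Bool k) m → Vec (Vec Bool k) m
  xorM = Vec.zipWith xorV

  -- XOR with a fixed mask permutes all vectors: a set bit exchanges the two one-bit extensions.
  -- Invariance of sums over all matrices replaces a bijection between sets of realizations.
  ∑-xorV : ∀ {k} (m : Vec Bool k) (f : Vec Bool k → ℕ) → ∑ (allVecs k) f ≡ ∑ (allVecs k) (f ∘ xorV m)
  ∑-xorV Vec.[] f = refl
  ∑-xorV {suc k} (b Vec.∷ m) f = trans (∑-concatMap ext (allVecs k) f)
     (trans (∑-xorV m (λ v → ∑ (ext v) f)) (trans (∑-cong (allVecs k) (pw b)) (sym (∑-concatMap ext (allVecs k) (f ∘ xorV (b Vec.∷ m))))))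
    where
    ext : Vec Bool k → List (Vec Bool (suc k))
    ext v = (true Vec.∷ v) ∷ (false Vec.∷ v) ∷ []
    pw : ∀ b v → ∑ (ext (xorV m v)) f ≡ ∑ (ext v) (f ∘ xorV (b Vec.∷ m))
    pw false v = refl
    pw true v = eq (f (true Vec.∷ xorV m v)) (f (false Vec.∷ xorV m v))
      where
      eq : ∀ x y → x + (y + 0) ≡ y + (x + 0)
      eq = solve-∀

  ∑-xorM : ∀ {m k} (X : Vec (Vec Bool k) m) (f : Vec (Vec Bool k) m → ℕ) → ∑ (allMats m k) f ≡ ∑ (allMats m k) (f ∘ xorM X)
  ∑-xorM Vec.[] f = refl
  ∑-xorM {suc m} {k} (r Vec.∷ X) f = trans (∑-concatMap ext (allMats m k) f)
     (trans (∑-xorM X (λ A → ∑ (ext A) f)) (trans (∑-cong (allMats m k) pw) (sym (∑-concatMap ext (allMats m k) (f ∘ xorM (r Vec.∷ X))))))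
    where
    ext : Vec (Vec Bool k) m → List (Vec (Vec Bool k) (suc m))
    ext A = map (Vec._∷ A) (allVecs k)
    pw : ∀ A → ∑ (ext (xorM X A)) f ≡ ∑ (ext A) (f ∘ xorM (r Vec.∷ X))
    pw A = trans (∑-map (Vec._∷ xorM X A) (allVecs k) f)
           (trans (∑-xorV r (λ v → f (v Vec.∷ xorM X A))) (sym (∑-map (Vec._∷ A) (allVecs k) _)))

  adj-xorM : ∀ {n} (X A : Mat n) i j → adj (xorM X A) i j ≡ adj X i j xor adj A i j
  adj-xorM X A i j = trans (cong (λ r → lookup r j) (lookup-zipWith xorV i X A)) (lookup-zipWith _xor_ j (lookup X i) (lookup A i))

  -- Asymmetric entries are ignored; on realizations this is adj itself.
  gr : ∀ {n} → Mat n → Graph n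
  gr A = record
    { E = λ i j → adj A i j ≡ true × adj A j i ≡ true
    ; E? = λ i j → (adj A i j ≟ᵇ true) ×-dec (adj A j i ≟ᵇ true)
    ; E-sym = λ { (p , q) → q , p } }

  record Realizes {n} (d : Fin n → ℕ) (g : Graph n) : Set where
    field
      irr : ∀ i → ¬ E g i i
      deg : ∀ i → ∑ᵛ (λ j → 𝟙 (E? g i j)) ≡ d i
  open Realizes public

  all-∀ : ∀ {n} (p : Fin n → Bool) → T (BL.all p (allFin n)) → ∀ i → T (p i)
  all-∀ {n} p h i = go (allFin n) h (subst (i ∈_) (sym (allFin≡fins n)) (∈fins i))
    where
    go : ∀ xs → T (BL.all p xs) → i ∈ xs → T (p i)
    go (x ∷ xs) h (here refl) = proj₁ (Equivalence.to (T-∧ {p x}) h)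
    go (x ∷ xs) h (there m) = go xs (proj₂ (Equivalence.to (T-∧ {p x}) h)) m

  ∀-all : ∀ {n} (p : Fin n → Bool) → (∀ i → T (p i)) → T (BL.all p (allFin n))
  ∀-all {n} p h = go (allFin n)
    where
    go : ∀ xs → T (BL.all p xs)
    go [] = tt
    go (x ∷ xs) = Equivalence.from (T-∧ {p x}) (h x , go xs)

  count-row : ∀ {k} (v : Vec Bool k) → countTrue (toList v) ≡ ∑ᵛ (λ j → 𝟙 (lookup v j ≟ᵇ true))
  count-row Vec.[] = refl
  count-row {suc k} (true Vec.∷ v) = cong suc (trans (count-row v) (sym (∑-map suc (fins k) _)))
  count-row {suc k} (false Vec.∷ v) = trans (count-row v) (sym (∑-map suc (fins k) _))

  boolEq-sound : ∀ a b → T (boolEq a b) → a ≡ b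
  boolEq-sound true true _ = refl
  boolEq-sound false false _ = refl

  boolEq-refl : ∀ a → T (boolEq a a)
  boolEq-refl true = tt
  boolEq-refl false = tt

  T-not : ∀ b → T (not b) → b ≡ false
  T-not false _ = refl

  module _ {n} (D : Vec ℕ n) where

    IsReal : Mat n → Set
    IsReal A = T (isRealization D A)

    isReal? : ∀ A → Dec (IsReal A)
    isReal? A = T? (isRealization D A)

    private
      cond : Mat n → Fin n → Bool
      cond A i = not (adj A i i) ∧ ((degreeIn A i ≡ᵇ lookup D i) ∧ BL.all (λ j → boolEq (adj A i j) (adj A j i)) (allFin n))

    real-symm : ∀ A → IsReal A → ∀ i j → adj A i j ≡ adj A j i
    real-symm A h i j = boolEq-sound _ _ (all-∀ (λ j → boolEq (adj A i j) (adj A j i))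
      (proj₂ (Equivalence.to (T-∧ {degreeIn A i ≡ᵇ lookup D i}) (proj₂ (Equivalence.to (T-∧ {not (adj A i i)}) (all-∀ (cond A) h i))))) j)

    real⇒ : ∀ A → IsReal A → Realizes (lookup D) (gr A)
    real⇒ A h = record { irr = irr′ ; deg = deg′ }
      where
      irr′ : ∀ i → ¬ E (gr A) i i
      irr′ i (p , _) with trans (sym p) (T-not _ (proj₁ (Equivalence.to (T-∧ {not (adj A i i)}) (all-∀ (cond A) h i))))
      ... | ()
      deg′ : ∀ i → ∑ᵛ (λ j → 𝟙 (E? (gr A) i j)) ≡ lookup D i
      deg′ i = trans (trans (∑-cong (fins n) (λ j → 𝟙-cong (E? (gr A) i j) (lookup (lookup A i) j ≟ᵇ true) proj₁
                       (λ p → p , trans (sym (real-symm A h i j)) p))) (sym (count-row (lookup A i))))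
               (≡ᵇ⇒≡ _ _ (proj₁ (Equivalence.to (T-∧ {degreeIn A i ≡ᵇ lookup D i}) (proj₂ (Equivalence.to (T-∧ {not (adj A i i)}) (all-∀ (cond A) h i))))))

    ⇒real : ∀ A → Realizes (lookup D) (gr A) → (∀ i j → adj A i j ≡ adj A j i) → IsReal A
    ⇒real A r s = ∀-all (cond A) λ i → Equivalence.from (T-∧ {not (adj A i i)})
        (irr″ i , Equivalence.from (T-∧ {degreeIn A i ≡ᵇ lookup D i})
          (≡⇒≡ᵇ _ _ (deg″ i) , ∀-all (λ j → boolEq (adj A i j) (adj A j i)) (λ j → subst (λ b → T (boolEq (adj A i j) b)) (s i j) (boolEq-refl (adj A i j)))))
      where
      irr″ : ∀ i → T (not (adj A i i))
      irr″ i with adj A i i in eq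
      ... | true = ⊥-elim (irr r i (eq , eq))
      ... | false = tt
      deg″ : ∀ i → degreeIn A i ≡ lookup D i
      deg″ i = trans (count-row (lookup A i)) (trans (∑-cong (fins n) (λ j → 𝟙-cong (lookup (lookup A i) j ≟ᵇ true) (E? (gr A) i j)
                       (λ p → p , trans (sym (s i j)) p) proj₁)) (deg r i))

    ∑ᵐ : (Mat n → ℕ) → ℕ
    ∑ᵐ = ∑ (allMats n n)

    length-filterᵇ : {A : Set} (p : A → Bool) (xs : List A) → length (filterᵇ p xs) ≡ ∑ xs (λ x → 𝟙 (T? (p x)))
    length-filterᵇ p [] = refl
    length-filterᵇ p (x ∷ xs) with p x
    ... | true = cong suc (length-filterᵇ p xs)
    ... | false = length-filterᵇ p xs

    total≡ : total D ≡ ∑ᵐ (λ A → 𝟙 (isReal? A))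
    total≡ = length-filterᵇ (isRealization D) (allMats n n)

  -- With u and x in different components, neither uq nor xp can be a loop or an edge already
  -- present, so the switch is never rejected. The new graph is described through its edges alone,
  -- without reference to matrices.
  record Switch {n} (g g′ : Graph n) (u p x q : Fin n) : Set where
    field
      up : E g u p
      xq : E g x q
      apart : ¬ Conn g u x
      uq′ : E g′ u q
      xp′ : E g′ x p
      old : ∀ {i j} → E g′ i j → (E g i j × ¬ Same i j u p × ¬ Same i j x q) ⊎ Same i j u q ⊎ Same i j x p
      keep : ∀ {i j} → E g i j → ¬ Same i j u p → ¬ Same i j x q → E g′ i j

    u≢x : u ≢ x
    u≢x refl = apart ε
    u≢q : u ≢ q
    u≢q refl = apart (return (E-sym g xq))
    p≢x : p ≢ x
    p≢x refl = apart (return up)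
    p≢q : p ≢ q
    p≢q refl = apart (up ◅ E-sym g xq ◅ ε)
    ¬uq : ¬ E g u q
    ¬uq e = apart (e ◅ E-sym g xq ◅ ε)

  open Switch public

  module _ {n} {g g′ : Graph n} {u p x q : Fin n} where

    switch-swap : Switch g g′ u p x q → Switch g g′ x q u p
    switch-swap s = record
      { up = xq s ; xq = up s ; apart = apart s ∘ conn-sym g ; uq′ = xp′ s ; xp′ = uq′ s
      ; old = λ e → [ (λ { (e , a , b) → inj₁ (e , b , a) }) , [ (λ a → inj₂ (inj₂ a)) , (λ a → inj₂ (inj₁ a)) ]′ ]′ (old s e)
      ; keep = λ e a b → keep s e b a }

    private
      rv : ∀ {i j a b : Fin n} → Same i j a b → Same i j b a
      rv (inj₁ r) = inj₂ r
      rv (inj₂ r) = inj₁ r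

    -- The same exchange seen from q and p. Together with `switch-swap` it lets each of the four
    -- vertices take the place of u, so that the degree has to be computed at one of them only.
    switch-turn : Switch g g′ u p x q → Switch g g′ q x p u
    switch-turn s = record
      { up = E-sym g (xq s) ; xq = E-sym g (up s)
      ; apart = λ c → apart s (up s ◅ (conn-sym g c ◅◅ return (E-sym g (xq s))))
      ; uq′ = E-sym g′ (uq′ s) ; xp′ = E-sym g′ (xp′ s)
      ; old = λ e → [ (λ { (e , a , b) → inj₁ (e , b ∘ rv , a ∘ rv) }) , [ (λ a → inj₂ (inj₁ (rv a))) , (λ a → inj₂ (inj₂ (rv a))) ]′ ]′ (old s e)
      ; keep = λ e a b → keep s e (b ∘ rv) (a ∘ rv) }

  module _ {n} {g g′ : Graph n} where

    switch-deg : ∀ {u p x q} → ¬ E g p p → Switch g g′ u p x q → ∑ᵛ (λ j → 𝟙 (E? g′ u j)) ≡ ∑ᵛ (λ j → 𝟙 (E? g u j))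
    switch-deg {u} {p} {x} {q} irrp s = +-cancelʳ-≡ 1 _ _ (trans (cong (_ +_) (sym (∑-point₁ p)))
        (trans (sym (∑-+ (fins n) _ _)) (trans (∑-cong (fins n) pw) (trans (∑-+ (fins n) _ _) (cong (_ +_) (∑-point₁ q))))))
      where
      u≢p : u ≢ p
      u≢p refl = irrp (up s)
      pw : ∀ j → 𝟙 (E? g′ u j) + 𝟙 (j ≟ᶠ p) ≡ 𝟙 (E? g u j) + 𝟙 (j ≟ᶠ q)
      pw j with j ≟ᶠ p | j ≟ᶠ q
      ... | yes refl | yes refl = contradiction refl (p≢q s)
      ... | yes refl | no _ = cong₂ _+_ (𝟙-no (E? g′ u p) ne) (refl {x = 1}) ▹ sym (trans (+-identityʳ _) (𝟙-yes (E? g u p) (up s)))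
        where
        _▹_ : ∀ {a b c : ℕ} → a ≡ b → b ≡ c → a ≡ c
        _▹_ = trans
        ne : ¬ E g′ u p
        ne e with old s e
        ... | inj₁ (_ , ns , _) = ns same-refl
        ... | inj₂ (inj₁ (inj₁ (_ , r))) = p≢q s r
        ... | inj₂ (inj₁ (inj₂ (r , _))) = u≢q s r
        ... | inj₂ (inj₂ (inj₁ (r , _))) = u≢x s r
        ... | inj₂ (inj₂ (inj₂ (r , _))) = u≢p r
      ... | no _ | yes refl = trans (+-identityʳ _) (trans (𝟙-yes (E? g′ u q) (uq′ s)) (sym (cong (_+ 1) (𝟙-no (E? g u q) (¬uq s)))))
      ... | no j≢p | no j≢q = cong (_+ 0) (𝟙-cong (E? g′ u j) (E? g u j) fw bw)
        where
        fw : E g′ u j → E g u j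
        fw e with old s e
        ... | inj₁ (e′ , _) = e′
        ... | inj₂ (inj₁ (inj₁ (_ , r))) = contradiction r j≢q
        ... | inj₂ (inj₁ (inj₂ (r , _))) = contradiction r (u≢q s)
        ... | inj₂ (inj₂ (inj₁ (r , _))) = contradiction r (u≢x s)
        ... | inj₂ (inj₂ (inj₂ (r , _))) = contradiction r u≢p
        bw : E g u j → E g′ u j
        bw e = keep s e [ (λ { (_ , r) → j≢p r }) , (λ { (r , _) → u≢p r }) ]′ [ (λ { (r , _) → u≢x s r }) , (λ { (r , _) → u≢q s r }) ]′

    switch-realizes : ∀ {d u p x q} → Switch g g′ u p x q → Realizes d g → Realizes d g′
    switch-realizes {d} {u} {p} {x} {q} s r = record { irr = irr′ ; deg = λ i → trans (deg′ i) (deg r i) }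
      where
      irr′ : ∀ i → ¬ E g′ i i
      irr′ i e with old s e
      ... | inj₁ (e′ , _) = irr r i e′
      ... | inj₂ (inj₁ (inj₁ (a , b))) = u≢q s (trans (sym a) b)
      ... | inj₂ (inj₁ (inj₂ (a , b))) = u≢q s (trans (sym b) a)
      ... | inj₂ (inj₂ (inj₁ (a , b))) = p≢x s (trans (sym b) a)
      ... | inj₂ (inj₂ (inj₂ (a , b))) = p≢x s (trans (sym a) b)
      deg′ : ∀ i → ∑ᵛ (λ j → 𝟙 (E? g′ i j)) ≡ ∑ᵛ (λ j → 𝟙 (E? g i j))
      deg′ i with i ≟ᶠ u | i ≟ᶠ p | i ≟ᶠ x | i ≟ᶠ q
      ... | yes refl | _ | _ | _ = switch-deg (irr r p) s
      ... | no _ | yes refl | _ | _ = switch-deg (irr r u) (switch-turn (switch-swap s))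
      ... | no _ | no _ | yes refl | _ = switch-deg (irr r q) (switch-swap s)
      ... | no _ | no _ | no _ | yes refl = switch-deg (irr r x) (switch-turn s)
      ... | no a | no b | no c | no d = ∑-cong (fins n) (λ j → 𝟙-cong (E? g′ i j) (E? g i j) fw bw)
        where
        fw : ∀ {j} → E g′ i j → E g i j
        fw e with old s e
        ... | inj₁ (e′ , _) = e′
        ... | inj₂ (inj₁ (inj₁ (t , _))) = contradiction t a
        ... | inj₂ (inj₁ (inj₂ (t , _))) = contradiction t d
        ... | inj₂ (inj₂ (inj₁ (t , _))) = contradiction t c
        ... | inj₂ (inj₂ (inj₂ (t , _))) = contradiction t b
        bw : ∀ {j} → E g i j → E g′ i j
        bw e = keep s e [ (λ { (t , _) → a t }) , (λ { (t , _) → b t }) ]′ [ (λ { (t , _) → c t }) , (λ { (t , _) → d t }) ]′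

  module _ {n} (u p x q : Fin n) where

    Touched : Fin n → Fin n → Set
    Touched i j = (Same i j u p ⊎ Same i j x q) ⊎ (Same i j u q ⊎ Same i j x p)

    touched? : ∀ i j → Dec (Touched i j)
    touched? i j = (same? i j u p ⊎-dec same? i j x q) ⊎-dec (same? i j u q ⊎-dec same? i j x p)

    mask : Mat n
    mask = Vec.tabulate (λ i → Vec.tabulate (λ j → isYes (touched? i j)))

    sw : Mat n → Mat n
    sw = xorM mask

    adj-sw : ∀ A i j → adj (sw A) i j ≡ isYes (touched? i j) xor adj A i j
    adj-sw A i j = trans (adj-xorM mask A i j) (cong (_xor adj A i j)
      (trans (cong (λ r → lookup r j) (lookup∘tabulate _ i)) (lookup∘tabulate _ j)))

    sw-touched : ∀ A {i j} → Touched i j → adj (sw A) i j ≡ not (adj A i j)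
    sw-touched A {i} {j} t with touched? i j | adj-sw A i j
    ... | yes _ | eq = eq
    ... | no ¬t | eq = contradiction t ¬t

    sw-untouched : ∀ A {i j} → ¬ Touched i j → adj (sw A) i j ≡ adj A i j
    sw-untouched A {i} {j} ¬t with touched? i j | adj-sw A i j
    ... | yes t | eq = contradiction t ¬t
    ... | no _ | eq = eq

    touched-sym : ∀ {i j} → Touched i j → Touched j i
    touched-sym (inj₁ (inj₁ t)) = inj₁ (inj₁ (same-sym t))
    touched-sym (inj₁ (inj₂ t)) = inj₁ (inj₂ (same-sym t))
    touched-sym (inj₂ (inj₁ t)) = inj₂ (inj₁ (same-sym t))
    touched-sym (inj₂ (inj₂ t)) = inj₂ (inj₂ (same-sym t))

    module _ (A : Mat n) (A-sym : ∀ i j → adj A i j ≡ adj A j i) where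

      sw-sym : ∀ i j → adj (sw A) i j ≡ adj (sw A) j i
      sw-sym i j with touched? i j
      ... | yes t = trans (sw-touched A t) (trans (cong not (A-sym i j)) (sym (sw-touched A (touched-sym t))))
      ... | no ¬t = trans (sw-untouched A ¬t) (trans (A-sym i j) (sym (sw-untouched A (¬t ∘ touched-sym))))

      sw-switch : E (gr A) u p → E (gr A) x q → ¬ Conn (gr A) u x → Switch (gr A) (gr (sw A)) u p x q
      sw-switch eup exq nc = record { up = eup ; xq = exq ; apart = nc ; uq′ = new (inj₁ same-refl) ; xp′ = new (inj₂ same-refl)
                                    ; old = old′ ; keep = keep′ }
        where
        new¬ : ∀ {i j} → Same i j u q ⊎ Same i j x p → ¬ E (gr A) i j
        new¬ (inj₁ (inj₁ (refl , refl))) e = nc (e ◅ E-sym (gr A) exq ◅ ε)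
        new¬ (inj₁ (inj₂ (refl , refl))) e = nc (E-sym (gr A) e ◅ E-sym (gr A) exq ◅ ε)
        new¬ (inj₂ (inj₁ (refl , refl))) e = nc (eup ◅ E-sym (gr A) e ◅ ε)
        new¬ (inj₂ (inj₂ (refl , refl))) e = nc (eup ◅ e ◅ ε)
        gone : ∀ {i j} → Same i j u p ⊎ Same i j x q → E (gr A) i j
        gone (inj₁ (inj₁ (refl , refl))) = eup
        gone (inj₁ (inj₂ (refl , refl))) = E-sym (gr A) eup
        gone (inj₂ (inj₁ (refl , refl))) = exq
        gone (inj₂ (inj₂ (refl , refl))) = E-sym (gr A) exq
        edge : ∀ (B : Mat n) → (∀ i j → adj B i j ≡ adj B j i) → ∀ {i j} → adj B i j ≡ true → E (gr B) i j
        edge B s e = e , trans (sym (s _ _)) e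
        new : ∀ {i j} → Same i j u q ⊎ Same i j x p → E (gr (sw A)) i j
        new {i} {j} t = edge (sw A) sw-sym (trans (sw-touched A (inj₂ t)) (flipped (adj A i j) refl))
          where
          flipped : ∀ b → adj A i j ≡ b → not b ≡ true
          flipped true eq = contradiction (edge A A-sym eq) (new¬ t)
          flipped false eq = refl
        old′ : ∀ {i j} → E (gr (sw A)) i j → (E (gr A) i j × ¬ Same i j u p × ¬ Same i j x q) ⊎ Same i j u q ⊎ Same i j x p
        old′ {i} {j} (e , _) with touched? i j
        ... | no ¬t = inj₁ (edge A A-sym (trans (sym (sw-untouched A ¬t)) e) , ¬t ∘ inj₁ ∘ inj₁ , ¬t ∘ inj₁ ∘ inj₂)
        ... | yes (inj₂ t) = inj₂ t
        ... | yes (inj₁ t) with trans (sym e) (trans (sw-touched A (inj₁ t)) (cong not (proj₁ (gone t))))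
        ... | ()
        keep′ : ∀ {i j} → E (gr A) i j → ¬ Same i j u p → ¬ Same i j x q → E (gr (sw A)) i j
        keep′ {i} {j} e a b with touched? i j
        ... | no ¬t = edge (sw A) sw-sym (trans (sw-untouched A ¬t) (proj₁ e))
        ... | yes (inj₁ (inj₁ t)) = contradiction t a
        ... | yes (inj₁ (inj₂ t)) = contradiction t b
        ... | yes (inj₂ t) = contradiction e (new¬ t)

    ∑-sw : (D : Vec ℕ n) (f : Mat n → ℕ) → ∑ᵐ D f ≡ ∑ᵐ D (f ∘ sw)
    ∑-sw D f = ∑-xorM mask f

  sw-real : ∀ {n} (D : Vec ℕ n) (A : Mat n) {u p x q} → IsReal D A → E (gr A) u p → E (gr A) x q → ¬ Conn (gr A) u x →
            IsReal D (sw u p x q A) × Switch (gr A) (gr (sw u p x q A)) u p x q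
  sw-real D A {u} {p} {x} {q} r eup exq nc = ⇒real D (sw u p x q A) (switch-realizes s (real⇒ D A r)) (sw-sym u p x q A (real-symm D A r)) , s
    where
    s = sw-switch u p x q A (real-symm D A r) eup exq nc

  -- Volumes, branches and trees

  ∑-exactly-one : ∀ {n} {P : Fin n → Set} (P? : ∀ i → Dec (P i)) →
                  (∀ i j → P i → P j → i ≡ j) → ∃ P → ∑ᵛ (λ i → 𝟙 (P? i)) ≡ 1
  ∑-exactly-one P? uniq (a , pa) = ≤-antisym (∑-unique P? uniq)
    (≤-trans (≤-reflexive (sym (𝟙-yes (P? a) pa))) (∑-term a (λ i → 𝟙 (P? i))))

  ∑-split : ∀ {n} (a : Fin n) (f : Fin n → ℕ) → ∑ᵛ f ≡ f a + ∑ᵛ (λ i → 𝟙 (¬? (i ≟ᶠ a)) * f i)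
  ∑-split {n} a f = trans (∑-cong (fins n) pw) (trans (∑-+ (fins n) _ _) (+-subˡ (∑-point a f)))
    where
    pw : ∀ i → f i ≡ 𝟙 (i ≟ᶠ a) * f i + 𝟙 (¬? (i ≟ᶠ a)) * f i
    pw i = trans (sym (*-identityˡ (f i))) (trans (cong (_* f i) (sym (𝟙-¬ (i ≟ᶠ a)))) (*-distribʳ-+ (f i) (𝟙 (i ≟ᶠ a)) _))

  two-elements : ∀ {n} {P : Fin n → Set} (P? : ∀ i → Dec (P i)) → ∑ᵛ (λ i → 𝟙 (P? i)) ≡ 2 →
    ∃ λ a → ∃ λ b → a ≢ b × P a × P b × (∀ i → P i → i ≡ a ⊎ i ≡ b)
  two-elements {n} {P} P? eq = a , b , (λ a≡b → b≢a (sym a≡b)) , pa , pb , only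
    where
    first : ∃ λ a → 0 < 𝟙 (P? a)
    first = ∑-pos (fins n) _ (subst (0 <_) (sym eq) (s≤s z≤n))
    a = proj₁ first
    pa = 𝟙-pos (P? a) (proj₂ first)
    f : Fin n → ℕ
    f i = 𝟙 (¬? (i ≟ᶠ a)) * 𝟙 (P? i)
    rest : ∑ᵛ f ≡ 1
    rest = suc-injective (trans (cong (_+ ∑ᵛ f) (sym (𝟙-yes (P? a) pa))) (trans (sym (∑-split a (λ i → 𝟙 (P? i)))) eq))
    second : ∃ λ b → 0 < f b
    second = ∑-pos (fins n) f (subst (0 <_) (sym rest) (s≤s z≤n))
    b = proj₁ second
    b≢a : b ≢ a
    b≢a = 𝟙-pos (¬? (b ≟ᶠ a)) (*-posˡ _ _ (proj₂ second))
    pb = 𝟙-pos (P? b) (*-posʳ (𝟙 (¬? (b ≟ᶠ a))) _ (proj₂ second))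
    only : ∀ i → P i → i ≡ a ⊎ i ≡ b
    only i pi with i ≟ᶠ a | i ≟ᶠ b
    ... | yes p | _ = inj₁ p
    ... | no _ | yes p = inj₂ p
    ... | no i≢a | no i≢b = contradiction (subst₂ _≤_ (cong₂ _+_ (one i i≢a pi) (one b b≢a pb)) rest (∑-two-terms i b f i≢b)) (λ { (s≤s ()) })
      where
      one : ∀ j → j ≢ a → P j → f j ≡ 1
      one j ne pj = cong₂ _*_ (𝟙-yes (¬? (j ≟ᶠ a)) ne) (𝟙-yes (P? j) pj)

  ∑-two-elements : ∀ {n} {P : Fin n → Set} (P? : ∀ i → Dec (P i)) {a b} → a ≢ b → P a → P b →
    (∀ i → P i → i ≡ a ⊎ i ≡ b) → (f : Fin n → ℕ) → ∑ᵛ (λ i → 𝟙 (P? i) * f i) ≡ f a + f b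
  ∑-two-elements {n} {P} P? {a} {b} a≢b pa pb only f = trans (∑-cong (fins n) pw) (trans (∑-+ (fins n) _ _) (cong₂ _+_ (∑-point a f) (∑-point b f)))
    where
    pw : ∀ i → 𝟙 (P? i) * f i ≡ 𝟙 (i ≟ᶠ a) * f i + 𝟙 (i ≟ᶠ b) * f i
    pw i with i ≟ᶠ a | i ≟ᶠ b
    ... | yes refl | yes refl = contradiction refl a≢b
    ... | yes refl | no _ = trans (cong (_* f i) (𝟙-yes (P? i) pa)) (sym (+-identityʳ _))
    ... | no _ | yes refl = cong (_* f i) (𝟙-yes (P? i) pb)
    ... | no p | no q = cong (_* f i) (𝟙-no (P? i) λ pi → [ p , q ]′ (only i pi))

  -- If the i-th cost α i dominates the total value β of the other elements, then
  -- min(2y, β), restricted to costs at most y, is dominated (with multiplicity c) by min(2y, α).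
  -- Two elements of cost ≤ y bound the total value by 2y; a single one is charged to all others.
  module _ {n} {P : Fin n → Set} (P? : ∀ i → Dec (P i)) (α β : Fin n → ℕ) (y c : ℕ)
           (dom : ∀ i → P i → ∑ᵛ (λ j → 𝟙 (P? j) * β j) ≤ α i + β i)
           (size : suc c ≤ ∑ᵛ (λ j → 𝟙 (P? j))) where

    private
      S = y + y
      cheap? : ∀ i → Dec (P i × α i ≤ y)
      cheap? i = P? i ×-dec (α i ≤? y)
      τ = ∑ᵛ (λ j → 𝟙 (P? j) * β j)
      lhs rhs : Fin n → ℕ
      lhs i = 𝟙 (cheap? i) * (S ⊓ β i) * c
      rhs i = 𝟙 (P? i) * (S ⊓ α i)
      pβ : ∀ i → P i → β i ≤ 𝟙 (P? i) * β i
      pβ i p = ≤-reflexive (sym (trans (cong (_* β i) (𝟙-yes (P? i) p)) (*-identityˡ _)))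
      two : ∀ i j → P i → P j → i ≢ j → β i + β j ≤ τ
      two i j pi pj ne = ≤-trans (+-mono-≤ (pβ i pi) (pβ j pj)) (∑-two-terms i j (λ k → 𝟙 (P? k) * β k) ne)
      cross : ∀ i j → P i → P j → i ≢ j → β j ≤ α i
      cross i j pi pj ne = +-cancelˡ-≤ (β i) _ _ (≤-trans (two i j pi pj ne) (≤-trans (dom i pi) (≤-reflexive (+-comm (α i) (β i)))))

    charging : ∑ᵛ (λ i → 𝟙 (cheap? i) * (S ⊓ β i) * c) ≤ ∑ᵛ (λ i → 𝟙 (P? i) * (S ⊓ α i))
    charging with any? cheap?
    ... | no none = ≤-trans (≤-reflexive (∑-zero (fins n) (λ i → cong (λ k → k * (S ⊓ β i) * c) (𝟙-no (cheap? i) (λ h → none (i , h)))))) z≤n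
    ... | yes (a , pa , αa≤y) with any? (λ i → cheap? i ×-dec ¬? (i ≟ᶠ a))
    ... | no noother = begin
        ∑ᵛ lhs                                       ≤⟨ ∑-mono (fins n) only-a ⟩
        ∑ᵛ (λ i → 𝟙 (i ≟ᶠ a) * ((S ⊓ β i) * c))      ≡⟨ ∑-point a _ ⟩
        (S ⊓ β a) * c                                ≡⟨ *-comm (S ⊓ β a) c ⟩
        c * (S ⊓ β a)                                ≤⟨ *-monoˡ-≤ (S ⊓ β a) others ⟩
        ∑ᵛ (λ i → 𝟙 (¬? (i ≟ᶠ a)) * 𝟙 (P? i)) * (S ⊓ β a) ≡⟨ sym (∑-*ʳ (fins n) (S ⊓ β a) _) ⟩
        ∑ᵛ (λ i → 𝟙 (¬? (i ≟ᶠ a)) * 𝟙 (P? i) * (S ⊓ β a)) ≤⟨ ∑-mono (fins n) charge ⟩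
        ∑ᵛ rhs ∎
      where
      open ≤-Reasoning
      only-a : ∀ i → lhs i ≤ 𝟙 (i ≟ᶠ a) * ((S ⊓ β i) * c)
      only-a i = ≤-trans (≤-reflexive (*-assoc (𝟙 (cheap? i)) _ c)) (𝟙*-mono (cheap? i) (i ≟ᶠ a) (λ h → dec-eq h , ≤-refl))
        where
        dec-eq : P i × α i ≤ y → i ≡ a
        dec-eq h with i ≟ᶠ a
        ... | yes e = e
        ... | no ne = contradiction (i , h , ne) noother
      others : c ≤ ∑ᵛ (λ i → 𝟙 (¬? (i ≟ᶠ a)) * 𝟙 (P? i))
      others = ≤-pred (≤-trans size (≤-reflexive (trans (∑-split a (λ i → 𝟙 (P? i))) (+-subˡ (𝟙-yes (P? a) pa)))))
      charge : ∀ i → 𝟙 (¬? (i ≟ᶠ a)) * 𝟙 (P? i) * (S ⊓ β a) ≤ rhs i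
      charge i = ≤-trans (≤-reflexive (cong (_* (S ⊓ β a)) (sym (𝟙-× (¬? (i ≟ᶠ a)) (P? i)))))
        (𝟙*-mono (¬? (i ≟ᶠ a) ×-dec P? i) (P? i) (λ { (ne , pi) → pi , ⊓-monoʳ-≤ S (cross i a pi pa ne) }))
    -- With two cheap elements, β a is at most α b, so τ is at most α a + β a ≤ 2y and fits under
    -- the cap S. Adding τ to both sides leaves `suc c` copies of τ, each paid by `S ⊓ α j + β j`
    -- for a different j.
    ... | yes (b , (pb , αb≤y) , b≢a) = +-cancelʳ-≤ τ _ _ (begin
        ∑ᵛ lhs + τ                   ≤⟨ +-monoˡ-≤ τ (∑-mono (fins n) lhs≤) ⟩
        ∑ᵛ (λ i → c * (𝟙 (P? i) * β i)) + τ ≡⟨ cong (_+ τ) (∑-*ˡ (fins n) c _) ⟩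
        c * τ + τ                    ≡⟨ +-comm (c * τ) τ ⟩
        suc c * τ                    ≤⟨ *-monoˡ-≤ τ size ⟩
        ∑ᵛ (λ j → 𝟙 (P? j)) * τ      ≡⟨ sym (∑-*ʳ (fins n) τ _) ⟩
        ∑ᵛ (λ j → 𝟙 (P? j) * τ)      ≤⟨ ∑-mono (fins n) pw ⟩
        ∑ᵛ (λ j → rhs j + 𝟙 (P? j) * β j) ≡⟨ ∑-+ (fins n) rhs _ ⟩
        ∑ᵛ rhs + τ ∎)
      where
      open ≤-Reasoning
      τ≤S : τ ≤ S
      τ≤S = ≤-trans (dom a pa) (+-mono-≤ αa≤y (≤-trans (cross b a pb pa b≢a) αb≤y))
      lhs≤ : ∀ i → lhs i ≤ c * (𝟙 (P? i) * β i)
      lhs≤ i = ≤-trans (≤-reflexive (*-comm _ c)) (*-monoʳ-≤ c (𝟙*-mono (cheap? i) (P? i) (λ h → proj₁ h , m⊓n≤n S (β i))))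
      pw : ∀ j → 𝟙 (P? j) * τ ≤ rhs j + 𝟙 (P? j) * β j
      pw j = ≤-trans (𝟙*-mono (P? j) (P? j) {τ} {S ⊓ α j + β j} (λ p → p , lem p)) (≤-reflexive (*-distribˡ-+ (𝟙 (P? j)) (S ⊓ α j) (β j)))
        where
        lem : P j → τ ≤ S ⊓ α j + β j
        lem p with ≤-total S (α j)
        ... | inj₁ le = subst (λ k → τ ≤ k + β j) (sym (m≤n⇒m⊓n≡m le)) (≤-trans τ≤S (m≤m+n S (β j)))
        ... | inj₂ le = subst (λ k → τ ≤ k + β j) (sym (m≥n⇒m⊓n≡n le)) (dom j p)

  module Degrees {n : ℕ} (d : Fin n → ℕ) where

    Branching : Fin n → Set
    Branching v = d v ≢ 2

    branching? : ∀ v → Dec (Branching v)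
    branching? v = ¬? (d v ≟ 2)

    δ : Fin n → ℕ
    δ v = 𝟙 (branching? v) * d v

    Mδ : ℕ
    Mδ = ∑ᵛ δ

    volume : Graph n → Fin n → ℕ
    volume = vol δ

    -- A sum over the half-edges at branching vertices, the only vertices that suppression leaves;
    -- every realization has `Mδ` such half-edges.
    ∑ʰ : Graph n → (Fin n → Fin n → ℕ) → ℕ
    ∑ʰ g f = ∑ᵛ (λ v → ∑ᵛ (λ z → 𝟙 (branching? v) * 𝟙 (E? g v z) * f v z))

    branch : Graph n → Fin n → Fin n → ℕ
    branch g v z = volume (g ∖ v) z

    -- v lies on a cycle, expressed by two neighbours that stay connected without v, so that no
    -- simple closed walks have to be handled.
    Cyc : Graph n → Fin n → Set
    Cyc g v = ∃ λ z → ∃ λ z′ → E g v z × E g v z′ × z ≢ z′ × Conn (g ∖ v) z z′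

    cyc? : ∀ g v → Dec (Cyc g v)
    cyc? g v = any? λ z → any? λ z′ → E? g v z ×-dec (E? g v z′ ×-dec (¬? (z ≟ᶠ z′) ×-dec conn? (g ∖ v) z z′))

    OnCyclic : Graph n → Fin n → Set
    OnCyclic g v = ∃ λ w → Conn g v w × Cyc g w

    onCyclic? : ∀ g v → Dec (OnCyclic g v)
    onCyclic? g v = any? λ w → conn? g v w ×-dec cyc? g w

    Tree : Graph n → Fin n → Set
    Tree g v = ¬ OnCyclic g v

    tree? : ∀ g v → Dec (Tree g v)
    tree? g v = ¬? (onCyclic? g v)

    tree-conn : ∀ g {v w} → Conn g v w → Tree g v → Tree g w
    tree-conn g c t (u , c′ , cy) = t (u , c ◅◅ c′ , cy)

    tree-acyclic : ∀ g {v} → Tree g v → ¬ Cyc g v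
    tree-acyclic g t cy = t (_ , ε , cy)

    stuck : ∀ (g : Graph n) v {b} → Conn (g ∖ v) v b → b ≡ v
    stuck g v ε = refl
    stuck g v ((_ , p , _) ◅ _) = contradiction refl p

    -- The cycle is turned by one vertex: the walk from a to b leaves a for the last time towards
    -- some w, and then v and w are neighbours of a that stay connected through b without a.
    cyc-step : ∀ (g : Graph n) → (∀ {a b} → E g a b → a ≢ b) → ∀ {v a b} →
               E g v a → E g v b → a ≢ b → Conn (g ∖ v) a b → Cyc g a
    cyc-step g edge-≢ {v} {a} {b} ea eb a≢b c with last-exit (g ∖ v) a c (a≢b ∘ sym)
    ... | inj₁ c′ = contradiction (sym (stuck (g ∖ v) a c′)) a≢b
    ... | inj₂ (w , (e , _ , w≢v) , _ , c′) = v , w , E-sym g ea , e , w≢v ∘ sym ,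
          (eb , edge-≢ ea , a≢b ∘ sym) ◅ conn-sym (g ∖ a) (conn-sub ((g ∖ v) ∖ a) (g ∖ a) (λ { ((e , _) , p) → e , p }) c′)

    -- Twice `suc x`, the bound `y + y` of the charging inequality when the costs are branch volumes
    -- increased by one.
    cap : ℕ → ℕ
    cap x = suc x + suc x

    -- The added one keeps the weight positive on branches without volume, so the total weight is at
    -- least the volume in tree components. The cap bounds the total by a constant multiple of `Mδ`.
    treeWeight : ℕ → Graph n → Fin n → Fin n → ℕ
    treeWeight x g v z = 𝟙 (tree? g v) * (cap x ⊓ suc (branch g v z))

    module _ (g : Graph n) (real : Realizes d g) where

      ∑ʰ-1 : ∑ʰ g (λ _ _ → 1) ≡ Mδ
      ∑ʰ-1 = ∑-cong (fins n) λ v → trans (∑-cong (fins n) (λ z → *-identityʳ _)) (trans (∑-*ˡ (fins n) (𝟙 (branching? v)) _) (cong (𝟙 (branching? v) *_) (deg real v)))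

      ∑ʰ-vertex : (f : Fin n → ℕ) → ∑ʰ g (λ v _ → f v) ≡ ∑ᵛ (λ v → δ v * f v)
      ∑ʰ-vertex f = ∑-cong (fins n) λ v → trans (∑-*ʳ (fins n) (f v) _) (cong (_* f v)
         (trans (∑-*ˡ (fins n) (𝟙 (branching? v)) _) (cong (𝟙 (branching? v) *_) (deg real v))))

      edge-≢ : ∀ {a b} → E g a b → a ≢ b
      edge-≢ e refl = irr real _ e

      -- Deleting z from a tree component leaves v together with its other branches.
      branch-recursion : ∀ {v z} → ¬ Cyc g v → E g v z →
        branch g z v ≡ δ v + ∑ᵛ (λ z′ → 𝟙 (E? g v z′ ×-dec ¬? (z′ ≟ᶠ z)) * branch g v z′)
      branch-recursion {v} {z} acyc evz = begin
        ∑ᵛ (λ w → 𝟙 (conn? (g ∖ z) v w) * δ w)                ≡⟨ ∑-cong (fins n) (λ w → cong (_* δ w) (pw w)) ⟩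
        ∑ᵛ (λ w → (𝟙 (w ≟ᶠ v) + ∑ᵛ (λ z′ → 𝟙 (sel z′) * 𝟙 (conn? (g ∖ v) z′ w))) * δ w)
          ≡⟨ ∑-cong (fins n) (λ w → *-distribʳ-+ (δ w) (𝟙 (w ≟ᶠ v)) _) ⟩
        ∑ᵛ (λ w → 𝟙 (w ≟ᶠ v) * δ w + ∑ᵛ (λ z′ → 𝟙 (sel z′) * 𝟙 (conn? (g ∖ v) z′ w)) * δ w)
          ≡⟨ ∑-+ (fins n) _ _ ⟩
        ∑ᵛ (λ w → 𝟙 (w ≟ᶠ v) * δ w) + ∑ᵛ (λ w → ∑ᵛ (λ z′ → 𝟙 (sel z′) * 𝟙 (conn? (g ∖ v) z′ w)) * δ w)
          ≡⟨ cong₂ _+_ (∑-point v δ) (∑-cong (fins n) (λ w → sym (∑-*ʳ (fins n) (δ w) _))) ⟩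
        δ v + ∑ᵛ (λ w → ∑ᵛ (λ z′ → 𝟙 (sel z′) * 𝟙 (conn? (g ∖ v) z′ w) * δ w))
          ≡⟨ cong (δ v +_) (∑-swap (fins n) (fins n) _) ⟩
        δ v + ∑ᵛ (λ z′ → ∑ᵛ (λ w → 𝟙 (sel z′) * 𝟙 (conn? (g ∖ v) z′ w) * δ w))
          ≡⟨ cong (δ v +_) (∑-cong (fins n) (λ z′ → trans (∑-cong (fins n) (λ w → *-assoc (𝟙 (sel z′)) _ (δ w))) (∑-*ˡ (fins n) (𝟙 (sel z′)) _))) ⟩
        δ v + ∑ᵛ (λ z′ → 𝟙 (sel z′) * branch g v z′) ∎
        where
        open ≡-Reasoning
        sel : ∀ z′ → Dec (E g v z′ × z′ ≢ z)
        sel z′ = E? g v z′ ×-dec ¬? (z′ ≟ᶠ z)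
        Via : Fin n → Fin n → Set
        Via w z′ = (E g v z′ × z′ ≢ z) × Conn (g ∖ v) z′ w
        Via? : ∀ w z′ → Dec (Via w z′)
        Via? w z′ = sel z′ ×-dec conn? (g ∖ v) z′ w
        forward : ∀ {w} → w ≢ v → Conn (g ∖ z) v w → ∃ (Via w)
        forward w≢v c with last-exit (g ∖ z) v c w≢v
        ... | inj₁ c′ = contradiction (stuck (g ∖ z) v c′) w≢v
        ... | inj₂ (z′ , (e , _ , z′≢z) , _ , c′) = z′ , (e , z′≢z) ,
              conn-sub ((g ∖ z) ∖ v) (g ∖ v) (λ { ((e , _) , p) → e , p }) c′
        backward : ∀ {w z′} → Via w z′ → Conn (g ∖ z) v w
        backward {w} {z′} ((e , z′≢z) , c) = (e , edge-≢ evz , z′≢z) ◅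
          proj₂ (star-closed (λ a → Conn (g ∖ v) z′ a) (λ {a} {b} ca r → (ca ◅◅ return r) , proj₁ r , away ca , away (ca ◅◅ return r)) ε c)
          where
          away : ∀ {a} → Conn (g ∖ v) z′ a → a ≢ z
          away ca refl = acyc (z′ , z , e , evz , z′≢z , ca)
        unique : ∀ {w} i j → Via w i → Via w j → i ≡ j
        unique {w} i j ((ei , _) , ci) ((ej , _) , cj) with i ≟ᶠ j
        ... | yes eq = eq
        ... | no ne = contradiction (i , j , ei , ej , ne , ci ◅◅ conn-sym (g ∖ v) cj) acyc
        pw : ∀ w → 𝟙 (conn? (g ∖ z) v w) ≡ 𝟙 (w ≟ᶠ v) + ∑ᵛ (λ z′ → 𝟙 (sel z′) * 𝟙 (conn? (g ∖ v) z′ w))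
        pw w = trans (pw′ w (w ≟ᶠ v) (conn? (g ∖ z) v w)) (cong (𝟙 (w ≟ᶠ v) +_) (∑-cong (fins n) (λ z′ → 𝟙-× (sel z′) (conn? (g ∖ v) z′ w))))
          where
          pw′ : ∀ w (q : Dec (w ≡ v)) (q′ : Dec (Conn (g ∖ z) v w)) → 𝟙 q′ ≡ 𝟙 q + ∑ᵛ (λ z′ → 𝟙 (Via? w z′))
          pw′ w (yes refl) q′ = trans (𝟙-yes q′ ε) (cong suc (sym (∑-zero (fins n) (λ z′ → 𝟙-no (Via? v z′)
               (λ { ((e , _) , c) → ∖-avoid g v c (edge-≢ e ∘ sym) refl })))))
          pw′ w (no w≢v) (yes c) = sym (∑-exactly-one (Via? w) unique (forward w≢v c))
          pw′ w (no w≢v) (no ¬c) = sym (∑-zero (fins n) (λ z′ → 𝟙-no (Via? w z′) (λ r → ¬c (backward r))))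

      cyc-neighbour : ∀ {v z} → d v ≡ 2 → Cyc g v → E g v z → Cyc g z
      cyc-neighbour {v} dv≡2 (a , b , ea , eb , a≢b , c) ez with two-elements (E? g v) (trans (deg real v) dv≡2)
      ... | p , q , _ , _ , _ , only = [ (λ { refl → go ea eb a≢b c }) , (λ { refl → go eb ea (a≢b ∘ sym) (conn-sym (g ∖ v) c) }) ]′ (ab (only a ea) (only b eb) (only _ ez))
        where
        ab : ∀ {z} → a ≡ p ⊎ a ≡ q → b ≡ p ⊎ b ≡ q → z ≡ p ⊎ z ≡ q → z ≡ a ⊎ z ≡ b
        ab (inj₁ refl) (inj₁ refl) _ = contradiction refl a≢b
        ab (inj₂ refl) (inj₂ refl) _ = contradiction refl a≢b
        ab (inj₁ refl) (inj₂ refl) h = h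
        ab (inj₂ refl) (inj₁ refl) (inj₁ h) = inj₂ h
        ab (inj₂ refl) (inj₁ refl) (inj₂ h) = inj₁ h
        go : ∀ {a b} → E g v a → E g v b → a ≢ b → Conn (g ∖ v) a b → Cyc g a
        go = cyc-step g edge-≢

      -- A cycle can be left only at a branching vertex: the walk from w to m stays on the cycle as
      -- long as the degrees are 2.
      cyc-branching : ∀ {w m} → Cyc g w → Conn g w m → Branching m → ∃ λ u → Branching u × Conn g w u × Cyc g u
      cyc-branching {w} cy c bm with branching? w
      ... | yes bw = w , bw , ε , cy
      cyc-branching cy ε bm | no ¬bw = contradiction bm ¬bw
      cyc-branching {w} cy (e ◅ c) bm | no ¬bw with d w ≟ 2
      ... | no ne = contradiction ne ¬bw
      ... | yes dw≡2 with cyc-branching (cyc-neighbour dw≡2 cy e) c bm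
      ... | u , bu , c′ , cu = u , bu , e ◅ c′ , cu

      cyc-nonbridge : ∀ {v} → Cyc g v → ∃ λ z → E g v z × Conn (del g v z) v z
      cyc-nonbridge {v} (z , z′ , ez , ez′ , ne , c) = z , ez ,
        (ez′ , (λ { (inj₁ (_ , r)) → ne (sym r) ; (inj₂ (r , _)) → edge-≢ ez r })) ◅
        conn-sub (g ∖ v) (del g v z) (λ { (e , p , q) → e , (λ { (inj₁ (r , _)) → p r ; (inj₂ (_ , r)) → q r }) }) (conn-sym (g ∖ v) c)

      module _ (x : ℕ) where

        private
          S : ℕ
          S = cap x

          weight τ : Fin n → Fin n → ℕ
          weight v z = S ⊓ suc (branch g v z)
          τ = treeWeight x g

          out inn : Fin n → ℕ
          out v = ∑ᵛ (λ z → 𝟙 (E? g v z) * τ v z)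
          inn v = ∑ᵛ (λ z → 𝟙 (E? g v z) * τ z v)

          ∑out≡∑inn : ∑ᵛ out ≡ ∑ᵛ inn
          ∑out≡∑inn = trans (∑-swap (fins n) (fins n) _) (∑-cong (fins n) λ z → ∑-cong (fins n) λ v →
            cong (_* τ v z) (𝟙-cong (E? g v z) (E? g z v) (E-sym g) (E-sym g)))

          τ-in : ∀ {v z} → E g v z → τ z v ≡ 𝟙 (tree? g v) * weight z v
          τ-in {v} {z} e = cong (_* weight z v) (𝟙-cong (tree? g z) (tree? g v) (tree-conn g (return (E-sym g e))) (tree-conn g (return e)))

          -- A vertex of degree 2 carries no volume, so the branch that its one neighbour sees
          -- through v is the branch behind the other neighbour.
          out≡inn : ∀ v → d v ≡ 2 → out v ≡ inn v
          out≡inn v dv≡2 with two-elements (E? g v) (trans (deg real v) dv≡2)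
          ... | a , b , a≢b , ea , eb , only = trans (∑-two-elements (E? g v) a≢b ea eb only (τ v))
               (trans (lem (tree? g v)) (trans (sym (cong₂ _+_ (τ-in ea) (τ-in eb))) (sym (∑-two-elements (E? g v) a≢b ea eb only (λ z → τ z v)))))
            where
            δ0 : δ v ≡ 0
            δ0 = cong (_* d v) (𝟙-no (branching? v) (λ ne → ne dv≡2))
            flip : ¬ Cyc g v → ∀ {a b} → a ≢ b → E g v a → E g v b → (∀ i → E g v i → i ≡ a ⊎ i ≡ b) → weight a v ≡ weight v b
            flip ac {a} {b} a≢b ea eb only = cong (λ k → S ⊓ suc k) (trans (branch-recursion ac ea) (trans (+-subˡ δ0)
              (trans (∑-cong (fins n) (λ z′ → cong (_* branch g v z′) (𝟙-cong (E? g v z′ ×-dec ¬? (z′ ≟ᶠ a)) (z′ ≟ᶠ b)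
                (λ { (e , ne) → [ (λ r → contradiction r ne) , id ]′ (only z′ e) }) (λ { refl → eb , a≢b ∘ sym })))) (∑-point b (branch g v)))))
            lem : (t : Dec (Tree g v)) → 𝟙 t * weight v a + 𝟙 t * weight v b ≡ 𝟙 t * weight a v + 𝟙 t * weight b v
            lem (no _) = refl
            lem (yes t) = trans (+-comm (1 * weight v a) _) (cong₂ _+_ (cong (1 *_) (sym (flip (tree-acyclic g t) a≢b ea eb only)))
                         (cong (1 *_) (sym (flip (tree-acyclic g t) (a≢b ∘ sym) eb ea (λ i e → [ inj₂ , inj₁ ]′ (only i e))))))

          ∑ʰ-out : ∑ʰ g τ ≡ ∑ᵛ (λ v → 𝟙 (branching? v) * out v)
          ∑ʰ-out = ∑-cong (fins n) λ v → trans (∑-cong (fins n) λ z → *-assoc (𝟙 (branching? v)) _ _) (∑-*ˡ (fins n) (𝟙 (branching? v)) _)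

          -- Over all vertices, outgoing and incoming weights are one sum in two orders. The
          -- vertices of degree 2 balance individually, so the branching ones balance together. This
          -- is the stationarity of the branch weights.
          branching-balance : ∑ᵛ (λ v → 𝟙 (branching? v) * out v) ≡ ∑ᵛ (λ v → 𝟙 (branching? v) * inn v)
          branching-balance = +-cancelˡ-≡ (∑ᵛ (λ v → 𝟙 (¬? (branching? v)) * out v)) _ _
            (trans (sym (∑-+ (fins n) _ _)) (trans (trans (∑-cong (fins n) (λ v → sym (parts (out v) v))) (trans ∑out≡∑inn (∑-cong (fins n) (λ v → parts (inn v) v))))
              (trans (∑-+ (fins n) _ _) (+-subˡ (sym (∑-cong (fins n) non))))))
            where
            parts : ∀ k v → k ≡ 𝟙 (¬? (branching? v)) * k + 𝟙 (branching? v) * k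
            parts k v = trans (sym (*-identityˡ k)) (trans (cong (_* k) (trans (sym (𝟙-¬ (branching? v))) (+-comm (𝟙 (branching? v)) _))) (*-distribʳ-+ k (𝟙 (¬? (branching? v))) _))
            non : ∀ v → 𝟙 (¬? (branching? v)) * out v ≡ 𝟙 (¬? (branching? v)) * inn v
            non v with d v ≟ 2
            ... | yes e = cong (1 *_) (out≡inn v e)
            ... | no _ = refl

        -- The expected number of branches reached from a half-edge cannot exceed one in tree components.
        cheap-branches : (c : Fin n → ℕ) → (∀ v → c v ≤ d v ∸ 1) →
          ∑ʰ g (λ v z → 𝟙 (branch g z v ≤? x) * c v * treeWeight x g v z) ≤ ∑ʰ g (treeWeight x g)
        cheap-branches c c≤ = ≤-trans (∑-mono (fins n) vertex) (≤-reflexive (sym (trans ∑ʰ-out branching-balance)))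
          where
          vertex : ∀ v → ∑ᵛ (λ z → 𝟙 (branching? v) * 𝟙 (E? g v z) * (𝟙 (branch g z v ≤? x) * c v * τ v z)) ≤ 𝟙 (branching? v) * inn v
          vertex v = ≤-trans (≤-reflexive (trans (∑-cong (fins n) (λ z → *-assoc (𝟙 (branching? v)) _ _)) (∑-*ˡ (fins n) (𝟙 (branching? v)) _)))
                     (𝟙*-mono (branching? v) (branching? v) (λ bv → bv , local bv (tree? g v) refl))
            where
            local : Branching v → (t : Dec (Tree g v)) → tree? g v ≡ t → ∑ᵛ (λ z → 𝟙 (E? g v z) * (𝟙 (branch g z v ≤? x) * c v * τ v z)) ≤ inn v
            local bv (no ¬t) eq = ≤-trans (≤-reflexive (∑-zero (fins n) λ z → trans (cong (λ k → 𝟙 (E? g v z) * (𝟙 (branch g z v ≤? x) * c v * (k * weight v z))) (𝟙-no (tree? g v) ¬t))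
                 (trans (cong (𝟙 (E? g v z) *_) (*-zeroʳ (𝟙 (branch g z v ≤? x) * c v))) (*-zeroʳ (𝟙 (E? g v z)))))) z≤n
            local bv (yes t) eq = bycase bv t (d v) refl
              where
              bycase : Branching v → Tree g v → ∀ k → d v ≡ k → ∑ᵛ (λ z → 𝟙 (E? g v z) * (𝟙 (branch g z v ≤? x) * c v * τ v z)) ≤ inn v
              bycase bv t zero dv = ≤-trans (≤-reflexive (∑-zero (fins n) λ z → trans (cong (λ k → 𝟙 (E? g v z) * (𝟙 (branch g z v ≤? x) * k * τ v z)) c0)
                    (trans (cong (λ k → 𝟙 (E? g v z) * (k * τ v z)) (*-zeroʳ (𝟙 (branch g z v ≤? x)))) (*-zeroʳ (𝟙 (E? g v z)))))) z≤n
                    where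
                    c0 : c v ≡ 0
                    c0 = n≤0⇒n≡0 (subst (λ k → c v ≤ k ∸ 1) dv (c≤ v))
              bycase bv t (suc d′) dv = ≤-trans (≤-reflexive (∑-cong (fins n) lhs)) (≤-trans main (≤-reflexive (∑-cong (fins n) rhs)))
                where
                tw : ∀ w z → 𝟙 (tree? g v) * weight w z ≡ weight w z
                tw w z = trans (cong (_* weight w z) (𝟙-yes (tree? g v) t)) (*-identityˡ _)
                cheap′ : ∀ z → Dec (E g v z × suc (branch g z v) ≤ suc x)
                cheap′ z = E? g v z ×-dec (suc (branch g z v) ≤? suc x)
                lhs : ∀ z → 𝟙 (E? g v z) * (𝟙 (branch g z v ≤? x) * c v * τ v z) ≡ 𝟙 (cheap′ z) * weight v z * c v
                lhs z = trans (cong (λ k → 𝟙 (E? g v z) * (𝟙 (branch g z v ≤? x) * c v * k)) (tw v z))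
                  (trans (re (𝟙 (E? g v z)) (𝟙 (branch g z v ≤? x)) (c v) (weight v z)) (cong (λ k → k * weight v z * c v)
                    (trans (cong (𝟙 (E? g v z) *_) (𝟙-cong (branch g z v ≤? x) (suc (branch g z v) ≤? suc x) s≤s ≤-pred)) (sym (𝟙-× (E? g v z) (suc (branch g z v) ≤? suc x))))))
                  where
                  re : ∀ a b c d → a * (b * c * d) ≡ a * b * d * c
                  re = solve-∀
                rhs : ∀ z → 𝟙 (E? g v z) * (S ⊓ suc (branch g z v)) ≡ 𝟙 (E? g v z) * τ z v
                rhs z with E? g v z
                ... | no _ = refl
                ... | yes e = cong (1 *_) (sym (trans (τ-in e) (tw z v)))
                -- Every neighbour z splits the component into `branch g z v` and `branch g v z`.
                -- The ones added to the d v branches at v supply exactly the δ v of the vertex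
                -- itself.
                dom : ∀ z → E g v z → ∑ᵛ (λ j → 𝟙 (E? g v j) * suc (branch g v j)) ≤ suc (branch g z v) + suc (branch g v z)
                dom z e = ≤-reflexive (begin
                  ∑ᵛ (λ j → 𝟙 (E? g v j) * suc (branch g v j)) ≡⟨ ∑-cong (fins n) (λ j → *-suc (𝟙 (E? g v j)) _) ⟩
                  ∑ᵛ (λ j → 𝟙 (E? g v j) + 𝟙 (E? g v j) * branch g v j) ≡⟨ ∑-+ (fins n) _ _ ⟩
                  ∑ᵛ (λ j → 𝟙 (E? g v j)) + ∑ᵛ (λ j → 𝟙 (E? g v j) * branch g v j)
                    ≡⟨ cong₂ _+_ (trans (deg real v) (trans dv (sym δv))) (∑-split z _) ⟩
                  δ v + (𝟙 (E? g v z) * branch g v z + ∑ᵛ (λ j → 𝟙 (¬? (j ≟ᶠ z)) * (𝟙 (E? g v j) * branch g v j)))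
                    ≡⟨ cong₂ (λ p q → δ v + (p * branch g v z + q)) (𝟙-yes (E? g v z) e) (∑-cong (fins n) (λ j → trans (re (𝟙 (¬? (j ≟ᶠ z))) (𝟙 (E? g v j)) _) (cong (_* branch g v j) (sym (𝟙-× (E? g v j) (¬? (j ≟ᶠ z))))))) ⟩
                  δ v + (1 * branch g v z + ∑ᵛ (λ j → 𝟙 (E? g v j ×-dec ¬? (j ≟ᶠ z)) * branch g v j))
                    ≡⟨ re2 (δ v) (branch g v z) _ ⟩
                  δ v + ∑ᵛ (λ j → 𝟙 (E? g v j ×-dec ¬? (j ≟ᶠ z)) * branch g v j) + branch g v z
                    ≡⟨ cong (_+ branch g v z) (sym (branch-recursion (tree-acyclic g t) e)) ⟩
                  branch g z v + branch g v z ∎) ▸ ≤-trans (+-monoʳ-≤ (branch g z v) (n≤1+n _)) (n≤1+n _)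
                  where
                  open ≡-Reasoning
                  _▸_ : ∀ {a b c : ℕ} → a ≤ b → b ≤ c → a ≤ c
                  _▸_ = ≤-trans
                  re : ∀ a b c → a * (b * c) ≡ b * a * c
                  re = solve-∀
                  re2 : ∀ a b c → a + (1 * b + c) ≡ a + c + b
                  re2 = solve-∀
                  δv : δ v ≡ suc d′
                  δv = trans (cong (_* d v) (𝟙-yes (branching? v) bv)) (trans (*-identityˡ _) dv)
                main : ∑ᵛ (λ z → 𝟙 (cheap′ z) * weight v z * c v) ≤ ∑ᵛ (λ z → 𝟙 (E? g v z) * (S ⊓ suc (branch g z v)))
                main = charging (E? g v) (λ z → suc (branch g z v)) (λ z → suc (branch g v z)) (suc x) (c v) dom
                       (≤-trans (s≤s (subst (λ k → c v ≤ k ∸ 1) dv (c≤ v))) (≤-reflexive (sym (trans (deg real v) dv))))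

  -- The effect of a switch

  module Transfer {n : ℕ} (d : Fin n → ℕ) where

    open Degrees d

    -- Volume of the components of volume more than x.
    heavy : ℕ → Graph n → ℕ
    heavy x g = ∑ᵛ (λ v → 𝟙 (suc x ≤? volume g v) * δ v)

    module _ {g g′ : Graph n} (real : Realizes d g) where

      private
        within : ∀ {u a b} → Conn g u a → E g a b → Conn g u b
        within c e = c ◅◅ return e

      module _ {u p x q : Fin n} (s : Switch g g′ u p x q) where

        far-closed : ∀ {a b} → ¬ Conn g u a × ¬ Conn g x a → E g′ a b → (¬ Conn g u b × ¬ Conn g x b) × E g a b
        far-closed (nu , nx) e with old s e
        ... | inj₁ (e′ , _) = ((λ c → nu (within c (E-sym g e′))) , (λ c → nx (within c (E-sym g e′)))) , e′
        ... | inj₂ (inj₁ (inj₁ (refl , _))) = contradiction ε nu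
        ... | inj₂ (inj₁ (inj₂ (refl , _))) = contradiction (return (xq s)) nx
        ... | inj₂ (inj₂ (inj₁ (refl , _))) = contradiction ε nx
        ... | inj₂ (inj₂ (inj₂ (refl , _))) = contradiction (return (up s)) nu

        far-conn : ∀ {v w} → ¬ Conn g u v → ¬ Conn g x v → Conn g′ v w → Conn g v w
        far-conn nu nx c = proj₂ (star-closed (λ a → ¬ Conn g u a × ¬ Conn g x a) far-closed (nu , nx) c)

        near-closed : ∀ {a b} → Conn g u a ⊎ Conn g x a → E g′ a b → (Conn g u b ⊎ Conn g x b) × ⊤
        near-closed c e with old s e
        ... | inj₁ (e′ , _) = [ (λ c → inj₁ (within c e′)) , (λ c → inj₂ (within c e′)) ]′ c , tt
        ... | inj₂ (inj₁ (inj₁ (refl , refl))) = inj₂ (return (xq s)) , tt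
        ... | inj₂ (inj₁ (inj₂ (refl , refl))) = inj₁ ε , tt
        ... | inj₂ (inj₂ (inj₁ (refl , refl))) = inj₁ (return (up s)) , tt
        ... | inj₂ (inj₂ (inj₂ (refl , refl))) = inj₂ ε , tt

        near-conn : ∀ {w} → Conn g′ u w → Conn g u w ⊎ Conn g x w
        near-conn c = proj₁ (star-closed {R′ = λ _ _ → ⊤} (λ a → Conn g u a ⊎ Conn g x a) near-closed (inj₁ ε) c)

        volume-merge : volume g′ u ≤ volume g u + volume g x
        volume-merge = ≤-trans (∑-mono (fins n) pw) (≤-reflexive (∑-+ (fins n) _ _))
          where
          pw : ∀ w → 𝟙 (conn? g′ u w) * δ w ≤ 𝟙 (conn? g u w) * δ w + 𝟙 (conn? g x w) * δ w
          pw w = 𝟙*-≤ (conn? g′ u w) λ c → [ (λ c′ → ≤-trans (≤-reflexive (sym (trans (cong (_* δ w) (𝟙-yes (conn? g u w) c′)) (*-identityˡ _)))) (m≤m+n _ _))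
                                           , (λ c′ → ≤-trans (≤-reflexive (sym (trans (cong (_* δ w) (𝟙-yes (conn? g x w) c′)) (*-identityˡ _)))) (m≤n+m _ _)) ]′ (near-conn c)

        -- The component of u stays connected without up, and the new edge xp ties it to x.
        nonbridge-merge : Conn (del g u p) u p → Conn g′ u x
        nonbridge-merge c = proj₂ (star-closed (Conn g u) step ε c) ◅◅ return (E-sym g′ (xp′ s))
          where
          step : ∀ {a b} → Conn g u a → E (del g u p) a b → Conn g u b × E g′ a b
          step ca (e , ns) = within ca e , keep s e ns (λ { (inj₁ (refl , _)) → apart s ca ; (inj₂ (_ , refl)) → apart s (within ca e) })

        -- Only vertices of the two switched components can become heavy. That of u has volume at
        -- most y, and that of x adds something only if its volume was at most y too.
        heavy-growth : ∀ y → volume g u ≤ y → heavy y g′ ≤ heavy y g + (y + y)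
        heavy-growth y small = ≤-trans (∑-mono (fins n) pw) (≤-trans (≤-reflexive (trans (∑-+ (fins n) _ _) (cong (heavy y g +_) (∑-+ (fins n) _ _))))
               (+-monoʳ-≤ (heavy y g) (+-mono-≤ small part)))
          where
          small? = volume g x ≤? y
          part : ∑ᵛ (λ v → 𝟙 small? * (𝟙 (conn? g x v) * δ v)) ≤ y
          part = ≤-trans (≤-reflexive (∑-*ˡ (fins n) (𝟙 small?) _)) (𝟙*-≤ small? id)
          pw : ∀ v → 𝟙 (suc y ≤? volume g′ v) * δ v ≤
                     𝟙 (suc y ≤? volume g v) * δ v + (𝟙 (conn? g u v) * δ v + 𝟙 small? * (𝟙 (conn? g x v) * δ v))
          pw v = cases (conn? g u v) (conn? g x v) small?
            where
            one : {P : Set} (p? : Dec P) → P → ∀ k → k ≤ 𝟙 p? * k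
            one p? p k = ≤-reflexive (sym (trans (cong (_* k) (𝟙-yes p? p)) (*-identityˡ k)))
            a = 𝟙 (suc y ≤? volume g v) * δ v
            b = 𝟙 (conn? g u v) * δ v
            c = 𝟙 small? * (𝟙 (conn? g x v) * δ v)
            cases : Dec (Conn g u v) → Dec (Conn g x v) → Dec (volume g x ≤ y) → 𝟙 (suc y ≤? volume g′ v) * δ v ≤ a + (b + c)
            cases (yes p) _ _ = ≤-trans (𝟙*-le (suc y ≤? volume g′ v) (δ v)) (m≤n⇒m≤o+n a (m≤n⇒m≤n+o c (one (conn? g u v) p (δ v))))
            cases (no _) (yes p) (yes sm) = ≤-trans (𝟙*-le (suc y ≤? volume g′ v) (δ v)) (m≤n⇒m≤o+n a (m≤n⇒m≤o+n b (≤-trans (one (conn? g x v) p (δ v)) (one small? sm _))))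
            cases (no _) (yes p) (no big) = ≤-trans (𝟙*-le (suc y ≤? volume g′ v) (δ v))
              (m≤n⇒m≤n+o (b + c) (one (suc y ≤? volume g v) (subst (suc y ≤_) (vol-conn δ g p) (≰⇒> big)) (δ v)))
            cases (no nu) (no nx) _ = m≤n⇒m≤n+o (b + c) (𝟙*-mono (suc y ≤? volume g′ v) (suc y ≤? volume g v)
                (λ le → ≤-trans le (vol-mono δ g′ g v v (far-conn nu nx)) , ≤-refl))

        -- The side of u after cutting up.
        Side : Fin n → Set
        Side = Conn (g ∖ p) u

        side⊆ : ∀ {a} → Side a → Conn g u a
        side⊆ = ∖⊆ g p

        side-≢p : ∀ {a} → Side a → a ≢ p
        side-≢p c = ∖-avoid g p c λ { refl → irr real _ (up s) }

        -- Without a cycle through p, the edge up is the only way from the side of u to p, so after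
        -- the switch this side is left through uq alone.
        side-step : ¬ Cyc g p → ∀ {a b} → Side a → E g′ a b → (Side b × E g a b × ¬ Same a b u p) ⊎ (a ≡ u × b ≡ q)
        side-step ac {a} {b} ca e with old s e
        ... | inj₂ (inj₁ (inj₁ (r , r′))) = inj₂ (r , r′)
        ... | inj₂ (inj₁ (inj₂ (refl , _))) = contradiction (side⊆ ca ◅◅ return (E-sym g (xq s))) (apart s)
        ... | inj₂ (inj₂ (inj₁ (refl , _))) = contradiction (side⊆ ca) (apart s)
        ... | inj₂ (inj₂ (inj₂ (refl , _))) = contradiction refl (side-≢p ca)
        ... | inj₁ (e′ , ns , _) with b ≟ᶠ p
        ... | no b≢p = inj₁ (ca ◅◅ return (e′ , side-≢p ca , b≢p) , e′ , ns)
        ... | yes refl with a ≟ᶠ u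
        ... | yes refl = contradiction same-refl ns
        ... | no a≢u = contradiction (u , a , E-sym g (up s) , E-sym g e′ , a≢u ∘ sym , ca) ac

        -- The new graph is projected to the old one by sending everything outside the old component
        -- of u to p: uq becomes up, while xp and all foreign edges collapse. The two neighbours on
        -- the cycle stay distinct because p is not on the side of u.
        side-cyc : ∀ {w} → Side w → ¬ Cyc g p → Cyc g′ w → Cyc g w
        side-cyc {w} cw acp (z , z′ , ez , ez′ , z≢z′ , c) =
          Φ z , Φ z′ , proj₁ (nb ez) , proj₁ (nb ez′) , distinct (side-step acp cw ez) (side-step acp cw ez′) , conn-map (g′ ∖ w) (g ∖ w) Φ hom c
          where
          Φ′ : ∀ a → Dec (Conn g u a) → Fin n
          Φ′ a (yes _) = a
          Φ′ a (no _) = p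
          Φ : Fin n → Fin n
          Φ a = Φ′ a (conn? g u a)
          Φ-in : ∀ {a} → Conn g u a → Φ a ≡ a
          Φ-in {a} ca with conn? g u a
          ... | yes _ = refl
          ... | no nc = contradiction ca nc
          Φ-out : ∀ {a} → ¬ Conn g u a → Φ a ≡ p
          Φ-out {a} na with conn? g u a
          ... | yes ca = contradiction ca na
          ... | no _ = refl
          Φx : Φ x ≡ p
          Φx = Φ-out (apart s)
          Φq : Φ q ≡ p
          Φq = Φ-out (λ c → apart s (c ◅◅ return (E-sym g (xq s))))
          Φu : Φ u ≡ u
          Φu = Φ-in ε
          Φp : Φ p ≡ p
          Φp = Φ-in (return (up s))
          eqε : ∀ {a b c} → a ≡ c → b ≡ c → Conn (g ∖ w) a b
          eqε refl refl = ε
          edge : ∀ {a b a′ b′} → a ≡ a′ → b ≡ b′ → E (g ∖ w) a′ b′ → Conn (g ∖ w) a b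
          edge refl refl e = return e
          hom : ∀ {a b} → E (g′ ∖ w) a b → Conn (g ∖ w) (Φ a) (Φ b)
          hom {a} {b} (e , a≢w , b≢w) with old s e
          ... | inj₂ (inj₁ (inj₁ (refl , refl))) = edge Φu Φq (up s , a≢w , (side-≢p cw ∘ sym))
          ... | inj₂ (inj₁ (inj₂ (refl , refl))) = edge Φq Φu (E-sym g (up s) , (side-≢p cw ∘ sym) , b≢w)
          ... | inj₂ (inj₂ (inj₁ (refl , refl))) = eqε Φx Φp
          ... | inj₂ (inj₂ (inj₂ (refl , refl))) = eqε Φp Φx
          ... | inj₁ (e′ , _) with conn? g u a
          ... | yes ca = edge refl (Φ-in (within ca e′)) (e′ , a≢w , b≢w)
          ... | no na = eqε refl (Φ-out (λ cb → na (within cb (E-sym g e′))))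
          nb : ∀ {z} → E g′ w z → E g w (Φ z) × ⊤
          nb {z} e with side-step acp cw e
          ... | inj₁ (cz , e′ , _) = subst (E g w) (sym (Φ-in (side⊆ cz))) e′ , tt
          ... | inj₂ (refl , refl) = subst (E g u) (sym Φq) (up s) , tt
          distinct : (Side z × E g w z × ¬ Same w z u p) ⊎ (w ≡ u × z ≡ q) → (Side z′ × E g w z′ × ¬ Same w z′ u p) ⊎ (w ≡ u × z′ ≡ q) → Φ z ≢ Φ z′
          distinct (inj₁ (cz , _)) (inj₁ (cz′ , _)) eq = z≢z′ (trans (sym (Φ-in (side⊆ cz))) (trans eq (Φ-in (side⊆ cz′))))
          distinct (inj₁ (cz , _)) (inj₂ (_ , refl)) eq = side-≢p cz (trans (sym (Φ-in (side⊆ cz))) (trans eq Φq))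
          distinct (inj₂ (_ , refl)) (inj₁ (cz′ , _)) eq = side-≢p cz′ (trans (sym (Φ-in (side⊆ cz′))) (trans (sym eq) Φq))
          distinct (inj₂ (_ , r)) (inj₂ (_ , r′)) eq = z≢z′ (trans r (sym r′))

        branch-back : ¬ Cyc g p → branch g′ q u ≤ volume g u
        branch-back acp = vol-mono δ (g′ ∖ q) g u u (λ c → side⊆ (proj₁ (star-closed {R′ = λ _ _ → ⊤} Side step ε c)))
          where
          step : ∀ {a b} → Side a → E (g′ ∖ q) a b → Side b × ⊤
          step ca (e , _ , b≢q) = [ (λ h → proj₁ h , tt) , (λ h → contradiction (proj₂ h) b≢q) ]′ (side-step acp ca e)

        -- A walk from q that avoids x uses neither removed edge and never meets u, so the branch
        -- behind q is carried over from x to u.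
        branch-front : branch g x q ≤ branch g′ u q
        branch-front = vol-mono δ (g ∖ x) (g′ ∖ u) q q (λ c → proj₂ (star-closed (Conn g x) step (return (xq s)) c))
          where
          step : ∀ {a b} → Conn g x a → E (g ∖ x) a b → Conn g x b × E (g′ ∖ u) a b
          step ca (e , a≢x , b≢x) = within ca e ,
            keep s e (λ { (inj₁ (refl , _)) → apart s (conn-sym g ca) ; (inj₂ (_ , refl)) → apart s (conn-sym g (within ca e)) })
                     (λ { (inj₁ (r , _)) → a≢x r ; (inj₂ (_ , r)) → b≢x r }) ,
            (λ { refl → apart s (conn-sym g ca) }) , (λ { refl → apart s (conn-sym g (within ca e)) })

      module _ {u p x q : Fin n} (s : Switch g g′ u p x q) where

        private
          t : Switch g g′ q x p u
          t = switch-turn s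

        -- The new component of u consists of the old sides of u and q, joined by uq alone; a cycle
        -- through a vertex of either side would have existed before.
        tree-switch : Tree g u → Tree g x → Tree g′ u
        tree-switch tu tx (w , c , cy) = [ (λ sd → tu (w , side⊆ s sd , side-cyc s sd acp cy))
                                         , (λ sd → tx (w , return (xq s) ◅◅ side⊆ t sd , side-cyc t sd acx cy)) ]′
                                         (proj₁ (star-closed {R′ = λ _ _ → ⊤} Q step (inj₁ ε) c))
          where
          acp : ¬ Cyc g p
          acp = tree-acyclic g (tree-conn g (return (up s)) tu)
          acx : ¬ Cyc g x
          acx = tree-acyclic g tx
          Q : Fin n → Set
          Q a = Side s a ⊎ Side t a
          step : ∀ {a b} → Q a → E g′ a b → Q b × ⊤
          step (inj₁ ca) e = [ (λ h → inj₁ (proj₁ h) , tt) , (λ { (_ , refl) → inj₂ ε , tt }) ]′ (side-step s acp ca e)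
          step (inj₂ ca) e = [ (λ h → inj₂ (proj₁ h) , tt) , (λ { (_ , refl) → inj₁ ε , tt }) ]′ (side-step t acx ca e)

  -- Counting realizations

  module Counting {n : ℕ} (D : Vec ℕ n) where

    d : Fin n → ℕ
    d = lookup D

    open Degrees d public
    open Transfer d public

    mats : List (Mat n)
    mats = allMats n n

    -- Realizations are selected by an indicator inside a sum over all matrices, because the XOR
    -- with a switch mask permutes all matrices, whether or not the switch makes sense on them.
    ∑ᴿ : (Mat n → ℕ) → ℕ
    ∑ᴿ f = ∑ᵐ D (λ A → 𝟙 (isReal? D A) * f A)

    Tot : ℕ
    Tot = ∑ᴿ (λ _ → 1)

    total≡Tot : total D ≡ Tot
    total≡Tot = trans (total≡ D) (∑-cong mats (λ A → sym (*-identityʳ _)))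

    ∑ᴿ-mono : {f h : Mat n → ℕ} → (∀ A → IsReal D A → f A ≤ h A) → ∑ᴿ f ≤ ∑ᴿ h
    ∑ᴿ-mono le = ∑-mono mats (λ A → 𝟙*-mono (isReal? D A) (isReal? D A) (λ r → r , le A r))

    ∑ᴿ-+ : (f h : Mat n → ℕ) → ∑ᴿ (λ A → f A + h A) ≡ ∑ᴿ f + ∑ᴿ h
    ∑ᴿ-+ f h = trans (∑-cong mats (λ A → *-distribˡ-+ (𝟙 (isReal? D A)) (f A) (h A))) (∑-+ mats _ _)

    ∑ᴿ-*ˡ : (c : ℕ) (f : Mat n → ℕ) → ∑ᴿ (λ A → c * f A) ≡ c * ∑ᴿ f
    ∑ᴿ-*ˡ c f = trans (∑-cong mats (λ A → eq (𝟙 (isReal? D A)) c (f A))) (∑-*ˡ mats c _)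
      where
      eq : ∀ a b c → a * (b * c) ≡ b * (a * c)
      eq = solve-∀

    ∑ᴿ-const : (c : ℕ) → ∑ᴿ (λ _ → c) ≡ c * Tot
    ∑ᴿ-const c = trans (∑-cong mats (λ A → cong (𝟙 (isReal? D A) *_) (sym (*-identityʳ c)))) (∑ᴿ-*ˡ c (λ _ → 1))

    ∑ʰ-mono : ∀ g {f h : Fin n → Fin n → ℕ} → (∀ v z → Branching v → E g v z → f v z ≤ h v z) → ∑ʰ g f ≤ ∑ʰ g h
    ∑ʰ-mono g {f} {h} le = ∑-mono (fins n) λ v → ∑-mono (fins n) λ z → pw v z (branching? v) (E? g v z)
      where
      pw : ∀ v z (b : Dec (Branching v)) (e : Dec (E g v z)) → 𝟙 b * 𝟙 e * f v z ≤ 𝟙 b * 𝟙 e * h v z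
      pw v z (no _) _ = z≤n
      pw v z (yes _) (no _) = z≤n
      pw v z (yes b) (yes e) = +-monoˡ-≤ 0 (le v z b e)

    ∑ʰ-cong : ∀ g {f h : Fin n → Fin n → ℕ} → (∀ v z → f v z ≡ h v z) → ∑ʰ g f ≡ ∑ʰ g h
    ∑ʰ-cong g eq = ∑-cong (fins n) λ v → ∑-cong (fins n) λ z → cong (𝟙 (branching? v) * 𝟙 (E? g v z) *_) (eq v z)

    ∑ʰ-+ : ∀ g (f h : Fin n → Fin n → ℕ) → ∑ʰ g (λ v z → f v z + h v z) ≡ ∑ʰ g f + ∑ʰ g h
    ∑ʰ-+ g f h = trans (∑-cong (fins n) (λ v → trans (∑-cong (fins n) (λ z → *-distribˡ-+ (𝟙 (branching? v) * 𝟙 (E? g v z)) (f v z) (h v z))) (∑-+ (fins n) _ _))) (∑-+ (fins n) _ _)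

    ∑ʰ-*ˡ : ∀ g c (f : Fin n → Fin n → ℕ) → ∑ʰ g (λ v z → c * f v z) ≡ c * ∑ʰ g f
    ∑ʰ-*ˡ g c f = trans (∑-cong (fins n) (λ v → trans (∑-cong (fins n) (λ z → eq (𝟙 (branching? v) * 𝟙 (E? g v z)) c (f v z))) (∑-*ˡ (fins n) c _))) (∑-*ˡ (fins n) c _)
      where
      eq : ∀ a b c → a * (b * c) ≡ b * (a * c)
      eq = solve-∀

    ∑ʰ-*ʳ : ∀ g c (f : Fin n → Fin n → ℕ) → ∑ʰ g (λ v z → f v z * c) ≡ ∑ʰ g f * c
    ∑ʰ-*ʳ g c f = trans (∑ʰ-cong g (λ v z → *-comm (f v z) c)) (trans (∑ʰ-*ˡ g c f) (*-comm c _))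

    ∑ʰ-term : ∀ g (f : Fin n → Fin n → ℕ) {v z} → Branching v → E g v z → f v z ≤ ∑ʰ g f
    ∑ʰ-term g f {v} {z} b e = ≤-trans (≤-reflexive (sym (trans (cong₂ (λ i j → i * j * f v z) (𝟙-yes (branching? v) b) (𝟙-yes (E? g v z) e)) (*-identityˡ _))))
      (≤-trans (∑-term z (λ z → 𝟙 (branching? v) * 𝟙 (E? g v z) * f v z)) (∑-term v (λ v → ∑ᵛ (λ z → 𝟙 (branching? v) * 𝟙 (E? g v z) * f v z))))

    ∑ʰ-const : ∀ g → Realizes d g → ∀ c → ∑ʰ g (λ _ _ → c) ≡ c * Mδ
    ∑ʰ-const g r c = trans (∑ʰ-cong g (λ _ _ → sym (*-identityʳ c))) (trans (∑ʰ-*ˡ g c (λ _ _ → 1)) (cong (c *_) (∑ʰ-1 g r)))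

    ∑ʰ-conn : ∀ g → Realizes d g → ∀ u → ∑ʰ g (λ x _ → 𝟙 (conn? g u x)) ≡ volume g u
    ∑ʰ-conn g r u = trans (∑ʰ-vertex g r (λ x → 𝟙 (conn? g u x))) (∑-cong (fins n) (λ x → *-comm (δ x) _))

    ∑⁴ : (Fin n → Fin n → Fin n → Fin n → ℕ) → ℕ
    ∑⁴ f = ∑ᵛ λ u → ∑ᵛ λ p → ∑ᵛ λ x → ∑ᵛ λ q → f u p x q

    ∑⁴-mono : ∀ {f h} → (∀ u p x q → f u p x q ≤ h u p x q) → ∑⁴ f ≤ ∑⁴ h
    ∑⁴-mono le = ∑-mono (fins n) λ u → ∑-mono (fins n) λ p → ∑-mono (fins n) λ x → ∑-mono (fins n) λ q → le u p x q

    ∑⁴-exchange : ∀ f → ∑⁴ f ≡ ∑⁴ (λ u p x q → f u q x p)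
    ∑⁴-exchange f = ∑-cong (fins n) λ u → begin
        ∑ᵛ (λ p → ∑ᵛ λ x → ∑ᵛ λ q → f u p x q) ≡⟨ ∑-swap (fins n) (fins n) _ ⟩
        ∑ᵛ (λ x → ∑ᵛ λ p → ∑ᵛ λ q → f u p x q) ≡⟨ ∑-cong (fins n) (λ x → ∑-swap (fins n) (fins n) _) ⟩
        ∑ᵛ (λ x → ∑ᵛ λ q → ∑ᵛ λ p → f u p x q) ≡⟨ ∑-swap (fins n) (fins n) _ ⟩
        ∑ᵛ (λ q → ∑ᵛ λ x → ∑ᵛ λ p → f u p x q) ∎
      where open ≡-Reasoning

    ∑ᵐ-∑⁴ : (f : Mat n → Fin n → Fin n → Fin n → Fin n → ℕ) → ∑ᵐ D (λ A → ∑⁴ (f A)) ≡ ∑⁴ (λ u p x q → ∑ᵐ D (λ A → f A u p x q))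
    ∑ᵐ-∑⁴ f = trans (∑-swap mats (fins n) _) (∑-cong (fins n) λ u → trans (∑-swap mats (fins n) _) (∑-cong (fins n) λ p →
              trans (∑-swap mats (fins n) _) (∑-cong (fins n) λ x → ∑-swap mats (fins n) _)))

    quad : Mat n → (Fin n → Fin n → Fin n → Fin n → ℕ) → Fin n → Fin n → Fin n → Fin n → ℕ
    quad A f u p x q = 𝟙 (isReal? D A) * (𝟙 (branching? u) * 𝟙 (E? (gr A) u p) * (𝟙 (branching? x) * 𝟙 (E? (gr A) x q) * f u p x q))

    ∑ʰ∑ʰ : ∀ A f → 𝟙 (isReal? D A) * ∑ʰ (gr A) (λ u p → ∑ʰ (gr A) (λ x q → f u p x q)) ≡ ∑⁴ (quad A f)
    ∑ʰ∑ʰ A f = trans (sym (∑-*ˡ (fins n) r _)) (∑-cong (fins n) λ u → trans (sym (∑-*ˡ (fins n) r _)) (∑-cong (fins n) λ p →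
       trans (cong (r *_) (sym (∑-*ˡ (fins n) (hf u p) _))) (trans (sym (∑-*ˡ (fins n) r _)) (∑-cong (fins n) λ x →
         trans (cong (r *_) (sym (∑-*ˡ (fins n) (hf u p) _))) (sym (∑-*ˡ (fins n) r _))))))
      where
      r = 𝟙 (isReal? D A)
      hf : Fin n → Fin n → ℕ
      hf v z = 𝟙 (branching? v) * 𝟙 (E? (gr A) v z)

    -- Both sides sum over a realization and two half-edges, before the switch on the left and after
    -- it on the right. Afterwards uq and xp take the places of up and xq, so p and q are exchanged
    -- in the summation. Terms on the right that come from no switch only enlarge that side.
    switch-count : (F F′ : Mat n → Fin n → Fin n → Fin n → Fin n → ℕ) →
      (∀ A u p x q → IsReal D A → Switch (gr A) (gr (sw u p x q A)) u p x q → F A u p x q ≤ F′ (sw u p x q A) u q x p) →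
      ∑ᴿ (λ A → ∑ʰ (gr A) λ u p → ∑ʰ (gr A) λ x q → 𝟙 (¬? (conn? (gr A) u x)) * F A u p x q) ≤
      ∑ᴿ (λ A → ∑ʰ (gr A) λ u q → ∑ʰ (gr A) λ x p → F′ A u q x p)
    switch-count F F′ le = begin
        ∑ᴿ (λ A → ∑ʰ (gr A) λ u p → ∑ʰ (gr A) λ x q → F₀ A u p x q) ≡⟨ ∑-cong mats (λ A → ∑ʰ∑ʰ A (F₀ A)) ⟩
        ∑ᵐ D (λ A → ∑⁴ (quad A (F₀ A)))                                 ≡⟨ ∑ᵐ-∑⁴ (λ A → quad A (F₀ A)) ⟩
        ∑⁴ (λ u p x q → ∑ᵐ D (λ A → quad A (F₀ A) u p x q))             ≤⟨ ∑⁴-mono step ⟩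
        ∑⁴ (λ u p x q → ∑ᵐ D (λ A → quad A (F′ A) u q x p))             ≡⟨ ∑⁴-exchange (λ u p x q → ∑ᵐ D (λ A → quad A (F′ A) u q x p)) ⟩
        ∑⁴ (λ u p x q → ∑ᵐ D (λ A → quad A (F′ A) u p x q))             ≡⟨ sym (∑ᵐ-∑⁴ (λ A → quad A (F′ A))) ⟩
        ∑ᵐ D (λ A → ∑⁴ (quad A (F′ A)))                                 ≡⟨ sym (∑-cong mats (λ A → ∑ʰ∑ʰ A (F′ A))) ⟩
        ∑ᴿ (λ A → ∑ʰ (gr A) λ u q → ∑ʰ (gr A) λ x p → F′ A u q x p) ∎
      where
      open ≤-Reasoning
      F₀ : Mat n → Fin n → Fin n → Fin n → Fin n → ℕ
      F₀ A u p x q = 𝟙 (¬? (conn? (gr A) u x)) * F A u p x q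
      step : ∀ u p x q → ∑ᵐ D (λ A → quad A (F₀ A) u p x q) ≤ ∑ᵐ D (λ A → quad A (F′ A) u q x p)
      step u p x q = ≤-trans (∑-mono mats (λ A → pw A (isReal? D A) (branching? u) (E? (gr A) u p) (branching? x) (E? (gr A) x q) (¬? (conn? (gr A) u x))))
                             (≤-reflexive (sym (∑-sw u p x q D (λ A → quad A (F′ A) u q x p))))
        where
        pw : ∀ A (r : Dec (IsReal D A)) (bu : Dec (Branching u)) (eu : Dec (E (gr A) u p)) (bx : Dec (Branching x)) (ex : Dec (E (gr A) x q)) (c : Dec (¬ Conn (gr A) u x)) →
             𝟙 r * (𝟙 bu * 𝟙 eu * (𝟙 bx * 𝟙 ex * (𝟙 c * F A u p x q))) ≤ quad (sw u p x q A) (F′ (sw u p x q A)) u q x p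
        pw A (no _) _ _ _ _ _ = z≤n
        pw A (yes _) (no _) _ _ _ _ = z≤n
        pw A (yes _) (yes _) (no _) _ _ _ = z≤n
        pw A (yes _) (yes _) (yes _) (no _) _ _ = z≤n
        pw A (yes _) (yes _) (yes _) (yes _) (no _) _ = z≤n
        pw A (yes _) (yes _) (yes _) (yes _) (yes _) (no _) = z≤n
        pw A (yes r) (yes bu) (yes eu) (yes bx) (yes ex) (yes nc) = ≤-trans (≤-reflexive (ones (F A u p x q)))
           (≤-trans (le A u p x q r (proj₂ rs)) (≤-reflexive (sym (trans
             (cong₂ (λ i j → i * (j * 𝟙 (E? g′ u q) * (𝟙 (branching? x) * 𝟙 (E? g′ x p) * fv))) (𝟙-yes (isReal? D A′) (proj₁ rs)) (𝟙-yes (branching? u) bu))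
             (trans (cong₂ (λ i j → 1 * (1 * i * (j * 𝟙 (E? g′ x p) * fv))) (𝟙-yes (E? g′ u q) (uq′ (proj₂ rs))) (𝟙-yes (branching? x) bx))
               (trans (cong (λ i → 1 * (1 * 1 * (1 * i * fv))) (𝟙-yes (E? g′ x p) (xp′ (proj₂ rs)))) (ones′ fv)))))))
          where
          A′ = sw u p x q A
          g′ = gr A′
          fv = F′ A′ u q x p
          rs = sw-real D A r eu ex nc
          ones : ∀ k → 1 * (1 * 1 * (1 * 1 * (1 * k))) ≡ k
          ones = solve-∀
          ones′ : ∀ k → 1 * (1 * 1 * (1 * 1 * k)) ≡ k
          ones′ = solve-∀

  -- Realizations with mostly small components are rare

  -- The bound reached in `weights`, with its abbreviations unfolded. It depends on e, B and y only,
  -- hence is a constant compared with M.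
  smallBound : ℕ → ℕ → ℕ → ℕ
  smallBound e B y = 8 * e * (16 * (e * B) * (y + y)) * (suc y + suc y) + 16 * e * B * (suc y + suc y) * y + 48 * e * B * (suc y + suc y) * (y * y) + 7 * (y * y)

  module SmallComponents {n : ℕ} (D : Vec ℕ n) (e B y : ℕ) (c : Fin n → ℕ) where

    open Counting D

    module _ (c≤B : ∀ v → c v ≤ B) (c≤d : ∀ v → c v ≤ d v ∸ 1)
             (supercritical : (2 * e + 1) * Mδ ≤ 2 * e * ∑ᵛ (λ v → δ v * c v))
             (1≤e : 1 ≤ e) (1≤B : 1 ≤ B) (y-small : 8 * y ≤ Mδ) (M>0 : 0 < Mδ) where

      private
        Q κ S : ℕ
        Q = 16 * (e * B)
        κ = Q * (y + y)
        S = cap y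

        16≤Q : 16 ≤ Q
        16≤Q = ≤-trans (≤-reflexive (sym (*-identityʳ 16))) (*-monoʳ-≤ 16 (*-mono-≤ 1≤e 1≤B))

        G : Mat n → Graph n
        G = gr

        big : Mat n → ℕ
        big A = heavy y (G A)

        -- A gradual substitute for the event that heavy components carry little volume: it is at
        -- least M if `Q * big A` is at most M, it vanishes unless A is light, and by `heavy-growth`
        -- a switch starting in a small component lowers it by at most κ. An indicator would not be
        -- stable in this way.
        ω : Mat n → ℕ
        ω A = 2 * Mδ ∸ Q * big A

        small? : ∀ A v → Dec (volume (G A) v ≤ y)
        small? A v = volume (G A) v ≤? y

        tw : Mat n → Fin n → Fin n → ℕ
        tw A = treeWeight y (G A)

        Y : Mat n → ℕ
        Y A = ∑ʰ (G A) (tw A)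

        light? : ∀ A → Dec (Q * big A < 2 * Mδ)
        light? A = Q * big A <? 2 * Mδ

        nontree : Mat n → ℕ
        nontree A = ∑ᵛ (λ v → 𝟙 (small? A v) * 𝟙 (onCyclic? (G A) v) * δ v)

        nb? : ∀ A u p → Dec (Conn (del (G A) u p) u p)
        nb? A u p = conn? (del (G A) u p) u p

        Z : Mat n → ℕ
        Z A = ∑ʰ (G A) (λ u p → 𝟙 (small? A u) * 𝟙 (nb? A u p))

        real : ∀ A → IsReal D A → Realizes d (G A)
        real A r = real⇒ D A r

        δ-pos : ∀ v → 0 < δ v → Branching v
        δ-pos v h = 𝟙-pos (branching? v) (*-posˡ _ (d v) h)

        -- A small component that has volume and a cycle has a branching vertex on that cycle, and
        -- there a half-edge that is no bridge. This half-edge pays for the whole component, whose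
        -- volume is at most y.
        nontree≤ : ∀ A → IsReal D A → nontree A ≤ y * Z A
        nontree≤ A r = begin
            nontree A ≤⟨ ∑-mono (fins n) pw ⟩
            ∑ᵛ (λ v → ∑ʰ g (λ u p → 𝟙 (small? A u) * 𝟙 (nb? A u p) * (𝟙 (conn? g u v) * δ v)))
              ≡⟨ ∑-swap (fins n) (fins n) _ ⟩
            ∑ᵛ (λ u → ∑ᵛ (λ v → ∑ᵛ (λ p → h u p * (𝟙 (small? A u) * 𝟙 (nb? A u p) * (𝟙 (conn? g u v) * δ v)))))
              ≡⟨ ∑-cong (fins n) (λ u → ∑-swap (fins n) (fins n) _) ⟩
            ∑ᵛ (λ u → ∑ᵛ (λ p → ∑ᵛ (λ v → h u p * (𝟙 (small? A u) * 𝟙 (nb? A u p) * (𝟙 (conn? g u v) * δ v)))))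
              ≡⟨ ∑-cong (fins n) (λ u → ∑-cong (fins n) (λ p → trans (∑-*ˡ (fins n) (h u p) _) (cong (h u p *_) (∑-*ˡ (fins n) (𝟙 (small? A u) * 𝟙 (nb? A u p)) _)))) ⟩
            ∑ʰ g (λ u p → 𝟙 (small? A u) * 𝟙 (nb? A u p) * volume g u)
              ≤⟨ ∑ʰ-mono g (λ u p _ _ → vol-small u p (small? A u)) ⟩
            ∑ʰ g (λ u p → y * (𝟙 (small? A u) * 𝟙 (nb? A u p))) ≡⟨ ∑ʰ-*ˡ g y _ ⟩
            y * Z A ∎
          where
          open ≤-Reasoning
          g = G A
          h : Fin n → Fin n → ℕ
          h v z = 𝟙 (branching? v) * 𝟙 (E? g v z)
          vol-small : ∀ u p (s : Dec (volume g u ≤ y)) → 𝟙 s * 𝟙 (nb? A u p) * volume g u ≤ y * (𝟙 s * 𝟙 (nb? A u p))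
          vol-small u p (no _) = z≤n
          vol-small u p (yes s) = ≤-trans (*-monoʳ-≤ (1 * 𝟙 (nb? A u p)) s) (≤-reflexive (*-comm _ y))
          pw : ∀ v → 𝟙 (small? A v) * 𝟙 (onCyclic? g v) * δ v ≤ ∑ʰ g (λ u p → 𝟙 (small? A u) * 𝟙 (nb? A u p) * (𝟙 (conn? g u v) * δ v))
          pw v = go (0 <? δ v) (small? A v) (onCyclic? g v)
            where
            f : Fin n → Fin n → ℕ
            f u p = 𝟙 (small? A u) * 𝟙 (nb? A u p) * (𝟙 (conn? g u v) * δ v)
            go : Dec (0 < δ v) → (s : Dec (volume g v ≤ y)) (o : Dec (OnCyclic g v)) → 𝟙 s * 𝟙 o * δ v ≤ ∑ʰ g f
            go _ (no _) _ = z≤n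
            go _ (yes _) (no _) = z≤n
            go (no δ≯0) (yes _) (yes _) = ≤-trans (≤-reflexive (cong (1 *_) (n≤0⇒n≡0 (≮⇒≥ δ≯0)))) z≤n
            go (yes δ>0) (yes s) (yes (w , c , cy)) with cyc-branching g (real A r) cy (conn-sym g c) (δ-pos v δ>0)
            ... | u , bu , c′ , cu with cyc-nonbridge g (real A r) cu
            ... | p , eup , nb = ≤-trans (≤-reflexive (sym val)) (∑ʰ-term g f bu eup)
              where
              ones : ∀ k → 1 * 1 * (1 * k) ≡ 1 * 1 * k
              ones = solve-∀
              val : f u p ≡ 1 * 1 * δ v
              val = trans (cong₂ (λ i j → i * j * (𝟙 (conn? g u v) * δ v))
                    (𝟙-yes (small? A u) (subst (_≤ y) (vol-conn δ g (c ◅◅ c′)) s)) (𝟙-yes (nb? A u p) nb))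
                    (trans (cong (λ i → 1 * 1 * (i * δ v)) (𝟙-yes (conn? g u v) (conn-sym g (c ◅◅ c′)))) (ones (δ v)))

        κ≤ : ∀ A u p x q → IsReal D A → Switch (G A) (G (sw u p x q A)) u p x q → volume (G A) u ≤ y →
             ω A ≤ ω (sw u p x q A) + κ
        κ≤ A u p x q r s sm = m≤n+o⇒m∸n≤o (2 * Mδ) (Q * big A) (begin
            2 * Mδ                          ≤⟨ m≤n+m∸n (2 * Mδ) (Q * b′) ⟩
            Q * b′ + ω′                     ≤⟨ +-monoˡ-≤ ω′ (*-monoʳ-≤ Q (heavy-growth (real A r) s y sm)) ⟩
            Q * (big A + (y + y)) + ω′      ≡⟨ eq Q (big A) (y + y) ω′ ⟩
            Q * big A + (ω′ + κ) ∎)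
          where
          open ≤-Reasoning
          b′ = big (sw u p x q A)
          ω′ = ω (sw u p x q A)
          eq : ∀ q b z w → q * (b + z) + w ≡ q * b + (w + q * z)
          eq = solve-∀

        light : Mat n → ℕ
        light A = 𝟙 (light? A)

        big-small : ∀ A → Q * big A < 2 * Mδ → 8 * big A ≤ Mδ
        big-small A h = *-cancelˡ-≤ 2 (≤-trans (≤-reflexive (eq (big A))) (≤-trans (*-monoˡ-≤ (big A) 16≤Q) (<⇒≤ h)))
          where
          eq : ∀ b → 2 * (8 * b) ≡ 16 * b
          eq = solve-∀

        -- Merging a component through a non-bridge with another small one is hard to undo:
        -- both new half-edges lie in a component of volume at most 2y.
        nonbridges : 3 * ∑ᴿ (λ A → light A * Z A) ≤ 8 * y * Tot
        nonbridges = *-cancelˡ-≤ Mδ {{>-nonZero M>0}} (begin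
            Mδ * (3 * ∑ᴿ (λ A → light A * Z A)) ≡⟨ eq₁ Mδ (∑ᴿ (λ A → light A * Z A)) ⟩
            3 * Mδ * ∑ᴿ (λ A → light A * Z A) ≡⟨ sym (∑ᴿ-*ˡ (3 * Mδ) _) ⟩
            ∑ᴿ (λ A → 3 * Mδ * (light A * Z A)) ≤⟨ ∑ᴿ-mono (λ A r → perA A r (light? A)) ⟩
            ∑ᴿ (λ A → 4 * ∑ʰ (G A) (λ u p → ∑ʰ (G A) (λ x q → 𝟙 (¬? (conn? (G A) u x)) * F A u p x q))) ≡⟨ ∑ᴿ-*ˡ 4 _ ⟩
            4 * ∑ᴿ (λ A → ∑ʰ (G A) (λ u p → ∑ʰ (G A) (λ x q → 𝟙 (¬? (conn? (G A) u x)) * F A u p x q)))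
              ≤⟨ *-monoʳ-≤ 4 (switch-count F F′ F≤F′) ⟩
            4 * ∑ᴿ (λ A → ∑ʰ (G A) (λ u q → ∑ʰ (G A) (λ x p → F′ A u q x p))) ≤⟨ *-monoʳ-≤ 4 (∑ᴿ-mono reverse≤) ⟩
            4 * ∑ᴿ (λ _ → (y + y) * Mδ) ≡⟨ cong (4 *_) (∑ᴿ-const _) ⟩
            4 * ((y + y) * Mδ * Tot) ≡⟨ eq₂ y Mδ Tot ⟩
            Mδ * (8 * y * Tot) ∎)
          where
          open ≤-Reasoning
          eq₁ : ∀ m z → m * (3 * z) ≡ 3 * m * z
          eq₁ = solve-∀
          eq₂ : ∀ y m t → 4 * ((y + y) * m * t) ≡ m * (8 * y * t)
          eq₂ = solve-∀
          F F′ : Mat n → Fin n → Fin n → Fin n → Fin n → ℕ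
          F A u p x q = light A * (𝟙 (small? A u) * 𝟙 (nb? A u p)) * 𝟙 (small? A x)
          F′ A u q x p = 𝟙 (conn? (G A) u x) * 𝟙 (volume (G A) u ≤? y + y)
          F≤F′ : ∀ A u p x q → IsReal D A → Switch (G A) (G (sw u p x q A)) u p x q → F A u p x q ≤ F′ (sw u p x q A) u q x p
          F≤F′ A u p x q r s = go (light? A) (small? A u) (nb? A u p) (small? A x)
            where
            go : (l : Dec (Q * big A < 2 * Mδ)) (su : Dec (volume (G A) u ≤ y)) (nb : Dec (Conn (del (G A) u p) u p)) (sx : Dec (volume (G A) x ≤ y)) →
                 𝟙 l * (𝟙 su * 𝟙 nb) * 𝟙 sx ≤ F′ (sw u p x q A) u q x p
            go (no _) _ _ _ = z≤n
            go (yes _) (no _) _ _ = z≤n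
            go (yes _) (yes _) (no _) _ = z≤n
            go (yes _) (yes _) (yes _) (no _) = z≤n
            go (yes _) (yes su) (yes nb) (yes sx) = ≤-reflexive (sym (cong₂ _*_
              (𝟙-yes (conn? (G (sw u p x q A)) u x) (nonbridge-merge (real A r) s nb))
              (𝟙-yes (volume (G (sw u p x q A)) u ≤? y + y) (≤-trans (volume-merge (real A r) s) (+-mono-≤ su sx)))))
          reverse≤ : ∀ A → IsReal D A → ∑ʰ (G A) (λ u q → ∑ʰ (G A) (λ x p → F′ A u q x p)) ≤ (y + y) * Mδ
          reverse≤ A r = ≤-trans (∑ʰ-mono (G A) (λ u q _ _ → ≤-trans (≤-reflexive (∑ʰ-*ʳ (G A) (𝟙 (volume (G A) u ≤? y + y)) _))
                (≤-trans (≤-reflexive (trans (cong (_* 𝟙 (volume (G A) u ≤? y + y)) (∑ʰ-conn (G A) (real A r) u)) (*-comm (volume (G A) u) _))) (𝟙*-≤ (volume (G A) u ≤? y + y) id))))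
                (≤-reflexive (∑ʰ-const (G A) (real A r) (y + y)))
          perA : ∀ A → IsReal D A → (l : Dec (Q * big A < 2 * Mδ)) → 3 * Mδ * (𝟙 l * Z A) ≤ 4 * ∑ʰ (G A) (λ u p → ∑ʰ (G A) (λ x q → 𝟙 (¬? (conn? (G A) u x)) * F A u p x q))
          perA A r (no _) = ≤-trans (≤-reflexive (*-zeroʳ (3 * Mδ))) z≤n
          perA A r (yes l) = begin
              3 * Mδ * (1 * Z A) ≡⟨ eq₃ Mδ (Z A) ⟩
              3 * Mδ * Z A ≡⟨ sym (∑ʰ-*ˡ g (3 * Mδ) _) ⟩
              ∑ʰ g (λ u p → 3 * Mδ * (𝟙 (small? A u) * 𝟙 (nb? A u p))) ≤⟨ ∑ʰ-mono g (λ u p _ _ → each u p (small? A u)) ⟩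
              ∑ʰ g (λ u p → 4 * ((𝟙 (small? A u) * 𝟙 (nb? A u p)) * J u)) ≡⟨ ∑ʰ-*ˡ g 4 _ ⟩
              4 * ∑ʰ g (λ u p → (𝟙 (small? A u) * 𝟙 (nb? A u p)) * J u)
                ≡⟨ cong (4 *_) (∑ʰ-cong g (λ u p → trans (sym (∑ʰ-*ˡ g (𝟙 (small? A u) * 𝟙 (nb? A u p)) (λ x q → 𝟙 (¬? (conn? g u x)) * 𝟙 (small? A x)))) (∑ʰ-cong g (λ x q → trans (eq₄ (𝟙 (small? A u) * 𝟙 (nb? A u p)) (𝟙 (¬? (conn? g u x))) (𝟙 (small? A x)))
                      (cong (λ k → 𝟙 (¬? (conn? g u x)) * (k * (𝟙 (small? A u) * 𝟙 (nb? A u p)) * 𝟙 (small? A x))) (sym (𝟙-yes (light? A) l))))))) ⟩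
              4 * ∑ʰ g (λ u p → ∑ʰ g (λ x q → 𝟙 (¬? (conn? g u x)) * F A u p x q)) ∎
            where
            g = G A
            eq₃ : ∀ m z → 3 * m * (1 * z) ≡ 3 * m * z
            eq₃ = solve-∀
            eq₄ : ∀ a b c → a * (b * c) ≡ b * (1 * a * c)
            eq₄ = solve-∀
            J : Fin n → ℕ
            J u = ∑ʰ g (λ x q → 𝟙 (¬? (conn? g u x)) * 𝟙 (small? A x))
            M≤ : ∀ u → Mδ ≤ J u + (volume g u + big A)
            M≤ u = ≤-trans (≤-reflexive (sym (∑ʰ-1 g (real A r)))) (≤-trans (∑ʰ-mono g (λ x q _ _ → cover x (conn? g u x) (small? A x)))
                   (≤-reflexive (trans (∑ʰ-+ g _ _) (cong (J u +_) (trans (∑ʰ-+ g _ _) (cong₂ _+_ (∑ʰ-conn g (real A r) u)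
                     (trans (∑ʰ-vertex g (real A r) (λ x → 𝟙 (suc y ≤? volume g x))) (∑-cong (fins n) (λ x → *-comm (δ x) _)))))))))
              where
              cover : ∀ x (c : Dec (Conn g u x)) (s : Dec (volume g x ≤ y)) → 1 ≤ 𝟙 (¬? c) * 𝟙 s + (𝟙 c + 𝟙 (suc y ≤? volume g x))
              cover x (yes _) _ = s≤s z≤n
              cover x (no _) (yes _) = s≤s z≤n
              cover x (no _) (no big) = ≤-reflexive (sym (𝟙-yes (suc y ≤? volume g x) (≰⇒> big)))
            each : ∀ u p (s : Dec (volume g u ≤ y)) → 3 * Mδ * (𝟙 s * 𝟙 (nb? A u p)) ≤ 4 * ((𝟙 s * 𝟙 (nb? A u p)) * J u)
            each u p (no _) = ≤-trans (≤-reflexive (*-zeroʳ (3 * Mδ))) z≤n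
            each u p (yes s) = ≤-trans (*-monoˡ-≤ (1 * 𝟙 (nb? A u p)) 3M≤4J) (≤-reflexive (eq₅ (J u) (1 * 𝟙 (nb? A u p))))
              where
              eq₅ : ∀ j b → 4 * j * b ≡ 4 * (b * j)
              eq₅ = solve-∀
              -- Excluded are the component of u and all heavy components; each of these two losses
              -- is at most M/8, the second because A is light.
              3M≤4J : 3 * Mδ ≤ 4 * J u
              3M≤4J = *-cancelˡ-≤ 2 (lin (+-mono-≤ (*-monoʳ-≤ 8 (M≤ u)) (+-mono-≤ (*-monoʳ-≤ 8 s) (+-mono-≤ y-small (big-small A l)))) 0
                       (eq₆ Mδ (J u) (volume g u) (big A) y))
                where
                eq₆ : ∀ m j v b y → 2 * (3 * m) + (8 * (j + (v + b)) + (8 * y + (m + m))) + 0 ≡ 2 * (4 * j) + (8 * m + (8 * v + (8 * y + 8 * b)))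
                eq₆ = solve-∀

        N : ℕ
        N = ∑ᴿ (λ A → light A * nontree A)

        N≤ : N ≤ 3 * (y * y) * Tot
        N≤ = *-cancelˡ-≤ 3 (begin
            3 * N ≤⟨ *-monoʳ-≤ 3 (∑ᴿ-mono (λ A r → *-monoʳ-≤ (light A) (nontree≤ A r))) ⟩
            3 * ∑ᴿ (λ A → light A * (y * Z A)) ≡⟨ cong (3 *_) (trans (∑-cong mats (λ A → cong (𝟙 (isReal? D A) *_) (eq₁ (light A) y (Z A)))) (∑ᴿ-*ˡ y _)) ⟩
            3 * (y * ∑ᴿ (λ A → light A * Z A)) ≡⟨ eq₁ 3 y _ ⟩
            y * (3 * ∑ᴿ (λ A → light A * Z A)) ≤⟨ *-monoʳ-≤ y nonbridges ⟩
            y * (8 * y * Tot) ≤⟨ m≤m+n _ (y * y * Tot) ⟩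
            y * (8 * y * Tot) + y * y * Tot ≡⟨ eq₂ y Tot ⟩
            3 * (3 * (y * y) * Tot) ∎)
          where
          open ≤-Reasoning
          eq₁ : ∀ a b c → a * (b * c) ≡ b * (a * c)
          eq₁ = solve-∀
          eq₂ : ∀ y t → y * (8 * y * t) + y * y * t ≡ 3 * (3 * (y * y) * t)
          eq₂ = solve-∀

        sel : Mat n → Fin n → ℕ
        sel A u = 𝟙 (small? A u) * 𝟙 (tree? (G A) u) * c u

        selected : Mat n → ℕ
        selected A = ∑ʰ (G A) (λ u _ → sel A u)

        -- The pairs that drive the drift: u, in a small tree component, counts with its capped
        -- offspring, and xq with the tree weight of the branch that the switch will attach to u.
        I : Mat n → ℕ
        I A = ∑ʰ (G A) (λ u p → ∑ʰ (G A) (λ x q → 𝟙 (¬? (conn? (G A) u x)) * (sel A u * tw A x q)))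

        tw≤S : ∀ A v z → tw A v z ≤ S
        tw≤S A v z = ≤-trans (𝟙*-le (tree? (G A) v) _) (m⊓n≤m S _)

        Y≤ : ∀ A → IsReal D A → Y A ≤ S * Mδ
        Y≤ A r = ≤-trans (∑ʰ-mono (G A) (λ v z _ _ → tw≤S A v z)) (≤-reflexive (∑ʰ-const (G A) (real A r) S))

        sel≤B : ∀ A u → sel A u ≤ B
        sel≤B A u = ≤-trans (*-mono-≤ (*-mono-≤ (𝟙≤1 (small? A u)) (𝟙≤1 (tree? (G A) u))) (c≤B u)) (≤-reflexive (*-identityˡ B))

        selected≤ : ∀ A → IsReal D A → selected A ≤ B * Mδ
        selected≤ A r = ≤-trans (∑ʰ-mono (G A) (λ u _ _ _ → sel≤B A u)) (≤-reflexive (∑ʰ-const (G A) (real A r) B))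

        -- Only the (few) half-edges of the same component are lost.
        pairs≤ : ∀ A → IsReal D A → selected A * Y A ≤ I A + selected A * (S * y)
        pairs≤ A r = begin
            selected A * Y A ≡⟨ sym (∑ʰ-*ʳ g (Y A) _) ⟩
            ∑ʰ g (λ u p → sel A u * Y A) ≤⟨ ∑ʰ-mono g (λ u p _ _ → each u (small? A u)) ⟩
            ∑ʰ g (λ u p → sel A u * J u + sel A u * (S * y)) ≡⟨ ∑ʰ-+ g _ _ ⟩
            ∑ʰ g (λ u p → sel A u * J u) + ∑ʰ g (λ u p → sel A u * (S * y))
              ≡⟨ cong₂ _+_ (∑ʰ-cong g (λ u p → trans (sym (∑ʰ-*ˡ g (sel A u) _)) (∑ʰ-cong g (λ x q → eq (sel A u) (𝟙 (¬? (conn? g u x))) (tw A x q))))) (∑ʰ-*ʳ g (S * y) _) ⟩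
            I A + selected A * (S * y) ∎
          where
          open ≤-Reasoning
          g = G A
          eq : ∀ a b c → a * (b * c) ≡ b * (a * c)
          eq = solve-∀
          J : Fin n → ℕ
          J u = ∑ʰ g (λ x q → 𝟙 (¬? (conn? g u x)) * tw A x q)
          Y≤J : ∀ u → Y A ≤ J u + volume g u * S
          Y≤J u = ≤-trans (∑ʰ-mono g (λ x q _ _ → cover x q (conn? g u x))) (≤-reflexive (trans (∑ʰ-+ g _ _)
                  (cong (J u +_) (trans (∑ʰ-*ʳ g S _) (cong (_* S) (∑ʰ-conn g (real A r) u))))))
            where
            cover : ∀ x q (c : Dec (Conn g u x)) → tw A x q ≤ 𝟙 (¬? c) * tw A x q + 𝟙 c * S
            cover x q (yes _) = ≤-trans (tw≤S A x q) (≤-reflexive (sym (+-identityʳ S)))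
            cover x q (no _) = ≤-reflexive (sym (trans (+-identityʳ _) (+-identityʳ _)))
          each : ∀ u (s : Dec (volume g u ≤ y)) → 𝟙 s * 𝟙 (tree? g u) * c u * Y A ≤ 𝟙 s * 𝟙 (tree? g u) * c u * J u + 𝟙 s * 𝟙 (tree? g u) * c u * (S * y)
          each u (no _) = z≤n
          each u (yes s) = ≤-trans (*-monoʳ-≤ k (≤-trans (Y≤J u) (+-monoʳ-≤ (J u) (≤-trans (*-monoˡ-≤ S s) (≤-reflexive (*-comm y S))))))
                           (≤-reflexive (*-distribˡ-+ k (J u) (S * y)))
            where k = 1 * 𝟙 (tree? g u) * c u

        classify : ∀ A v (k : ℕ) (s : Dec (volume (G A) v ≤ y)) (o : Dec (OnCyclic (G A) v)) →
                   k ≤ 𝟙 s * 𝟙 (¬? o) * k + (𝟙 (suc y ≤? volume (G A) v) * k + 𝟙 s * 𝟙 o * k)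
        classify A v k (yes _) (yes _) = m≤n⇒m≤o+n (𝟙 (suc y ≤? volume (G A) v) * k) (≤-reflexive (sym (*-identityˡ k)))
        classify A v k (yes _) (no _) = m≤n⇒m≤n+o _ (≤-reflexive (sym (*-identityˡ k)))
        classify A v k (no big) _ = m≤n⇒m≤n+o 0 (≤-reflexive (sym (trans (cong (_* k) (𝟙-yes (suc y ≤? volume (G A) v) (≰⇒> big))) (*-identityˡ k))))

        C≤ : ∀ A → IsReal D A → ∑ᵛ (λ v → δ v * c v) ≤ selected A + B * (big A + nontree A)
        C≤ A r = begin
            ∑ᵛ (λ v → δ v * c v) ≤⟨ ∑-mono (fins n) pw ⟩
            ∑ᵛ (λ v → δ v * sel A v + B * (h v + t v)) ≡⟨ ∑-+ (fins n) _ _ ⟩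
            ∑ᵛ (λ v → δ v * sel A v) + ∑ᵛ (λ v → B * (h v + t v))
              ≡⟨ cong₂ _+_ (sym (∑ʰ-vertex (G A) (real A r) (sel A))) (trans (∑-*ˡ (fins n) B _) (cong (B *_) (∑-+ (fins n) h t))) ⟩
            selected A + B * (big A + nontree A) ∎
          where
          open ≤-Reasoning
          h t : Fin n → ℕ
          h v = 𝟙 (suc y ≤? volume (G A) v) * δ v
          t v = 𝟙 (small? A v) * 𝟙 (onCyclic? (G A) v) * δ v
          pw : ∀ v → δ v * c v ≤ δ v * sel A v + B * (h v + t v)
          pw v = begin
            δ v * c v ≤⟨ *-monoˡ-≤ (c v) (classify A v (δ v) (small? A v) (onCyclic? (G A) v)) ⟩
            (𝟙 (small? A v) * 𝟙 (tree? (G A) v) * δ v + (h v + t v)) * c v ≡⟨ eq (𝟙 (small? A v) * 𝟙 (tree? (G A) v)) (δ v) (h v + t v) (c v) ⟩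
            δ v * sel A v + c v * (h v + t v) ≤⟨ +-monoʳ-≤ (δ v * sel A v) (*-monoˡ-≤ (h v + t v) (c≤B v)) ⟩
            δ v * sel A v + B * (h v + t v) ∎
            where
            eq : ∀ a b c d → (a * b + c) * d ≡ b * (a * d) + d * c
            eq = solve-∀

        M≤ : ∀ A → IsReal D A → Mδ ≤ Y A + (big A + nontree A)
        M≤ A r = begin
            Mδ ≤⟨ ∑-mono (fins n) pw ⟩
            ∑ᵛ (λ v → δ v * 𝟙 (tree? (G A) v) + (h v + t v)) ≡⟨ trans (∑-+ (fins n) _ _) (cong₂ _+_ (sym (∑ʰ-vertex (G A) (real A r) (λ v → 𝟙 (tree? (G A) v)))) (∑-+ (fins n) h t)) ⟩
            ∑ʰ (G A) (λ v _ → 𝟙 (tree? (G A) v)) + (big A + nontree A)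
              ≤⟨ +-monoˡ-≤ (big A + nontree A) (∑ʰ-mono (G A) (λ v z _ _ → ≤-trans (≤-reflexive (sym (*-identityʳ _))) (*-monoʳ-≤ (𝟙 (tree? (G A) v)) (s≤s z≤n)))) ⟩
            Y A + (big A + nontree A) ∎
          where
          open ≤-Reasoning
          h t : Fin n → ℕ
          h v = 𝟙 (suc y ≤? volume (G A) v) * δ v
          t v = 𝟙 (small? A v) * 𝟙 (onCyclic? (G A) v) * δ v
          pw : ∀ v → δ v ≤ δ v * 𝟙 (tree? (G A) v) + (h v + t v)
          pw v = ≤-trans (classify A v (δ v) (small? A v) (onCyclic? (G A) v)) (+-monoˡ-≤ (h v + t v)
                 (≤-trans (*-monoˡ-≤ (δ v) (≤-trans (*-monoˡ-≤ (𝟙 (tree? (G A) v)) (𝟙≤1 (small? A v))) (≤-reflexive (*-identityˡ _)))) (≤-reflexive (*-comm _ (δ v)))))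

        ω≤ : ∀ A → ω A ≤ 2 * Mδ
        ω≤ A = m∸n≤m (2 * Mδ) (Q * big A)

        -- Supercriticality as growth: a random half-edge selects on average more than one further
        -- branch, each of average weight `Y A` over `Mδ`. The error consists of the pairs inside
        -- one component and of the small components with cycles.
        drift : ∀ A → IsReal D A → Q * big A < 2 * Mδ →
                (8 * e + 3) * Mδ * Y A ≤ 8 * e * I A + 8 * e * B * S * Mδ * (y + nontree A)
        drift A r l = begin
            (8 * e + 3) * Mδ * Y A ≤⟨ *-monoˡ-≤ (Y A) linear ⟩
            (8 * e * selected A + 8 * e * B * nontree A) * Y A ≡⟨ eq₁ e (selected A) (B * nontree A) (Y A) B (nontree A) ⟩
            8 * e * (selected A * Y A) + 8 * e * B * nontree A * Y A
              ≤⟨ +-mono-≤ (*-monoʳ-≤ (8 * e) (≤-trans (pairs≤ A r) (+-monoʳ-≤ (I A) (*-monoˡ-≤ (S * y) (selected≤ A r))))) (*-monoʳ-≤ (8 * e * B * nontree A) (Y≤ A r)) ⟩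
            8 * e * (I A + B * Mδ * (S * y)) + 8 * e * B * nontree A * (S * Mδ) ≡⟨ eq₂ e (I A) B Mδ S y (nontree A) ⟩
            8 * e * I A + 8 * e * B * S * Mδ * (y + nontree A) ∎
          where
          open ≤-Reasoning
          eq₁ : ∀ e a z y b n → (8 * e * a + 8 * e * b * n) * y ≡ 8 * e * (a * y) + 8 * e * b * n * y
          eq₁ e a z y b n = eq₁′ e a y b n
            where
            eq₁′ : ∀ e a y b n → (8 * e * a + 8 * e * b * n) * y ≡ 8 * e * (a * y) + 8 * e * b * n * y
            eq₁′ = solve-∀
          eq₂ : ∀ e i b m s y n → 8 * e * (i + b * m * (s * y)) + 8 * e * b * n * (s * m) ≡ 8 * e * i + 8 * e * b * s * m * (y + n)
          eq₂ = solve-∀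
          -- The surplus 1/(2e) survives the heavy components: they cost at most B times their
          -- volume, which is below M/(8e) for light A because Q is 16 e B. What remains is 3/(8e).
          linear : (8 * e + 3) * Mδ ≤ 8 * e * selected A + 8 * e * B * nontree A
          linear = *-cancelˡ-≤ 2 (lin (+-mono-≤ (*-monoʳ-≤ 8 supercritical) (+-mono-≤ (*-monoʳ-≤ (16 * e) (C≤ A r)) (<⇒≤ l))) 0
              (eq₃ e B Mδ (∑ᵛ (λ v → δ v * c v)) (selected A) (big A) (nontree A)))
            where
            eq₃ : ∀ e b m c s h n → 2 * ((8 * e + 3) * m) + (8 * (2 * e * c) + (16 * e * (s + b * (h + n)) + 2 * m)) + 0
                  ≡ 2 * (8 * e * s + 8 * e * b * n) + (8 * ((2 * e + 1) * m) + (16 * e * c + 16 * (e * b) * h))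
            eq₃ = solve-∀

        -- After the switch, uq leads from a branch of volume at most y into the old branch behind
        -- q, so `cheap-branches` bounds the weighted choices of uq by `Y`. The half-edge xp is then
        -- free and gives the factor M; the change of `ω` costs κ.
        flow : ∑ᴿ (λ A → ω A * I A) ≤ Mδ * ∑ᴿ (λ A → ω A * Y A) + κ * (S * Mδ * Mδ) * Tot
        flow = begin
            ∑ᴿ (λ A → ω A * I A) ≡⟨ ∑-cong mats (λ A → cong (𝟙 (isReal? D A) *_) (inside A)) ⟩
            ∑ᴿ (λ A → ∑ʰ (G A) (λ u p → ∑ʰ (G A) (λ x q → 𝟙 (¬? (conn? (G A) u x)) * F A u p x q))) ≤⟨ switch-count F F′ F≤F′ ⟩
            ∑ᴿ (λ A → ∑ʰ (G A) (λ u q → ∑ʰ (G A) (λ x p → F′ A u q x p))) ≤⟨ ∑ᴿ-mono out ⟩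
            ∑ᴿ (λ A → Mδ * (ω A * Y A) + κ * (S * Mδ * Mδ)) ≡⟨ ∑ᴿ-+ _ _ ⟩
            ∑ᴿ (λ A → Mδ * (ω A * Y A)) + ∑ᴿ (λ _ → κ * (S * Mδ * Mδ)) ≡⟨ cong₂ _+_ (∑ᴿ-*ˡ Mδ _) (∑ᴿ-const _) ⟩
            Mδ * ∑ᴿ (λ A → ω A * Y A) + κ * (S * Mδ * Mδ) * Tot ∎
          where
          open ≤-Reasoning
          α : Mat n → Fin n → Fin n → ℕ
          α A u q = 𝟙 (branch (G A) q u ≤? y) * c u * tw A u q
          F F′ : Mat n → Fin n → Fin n → Fin n → Fin n → ℕ
          F A u p x q = ω A * (sel A u * tw A x q)
          F′ A u q x p = (ω A + κ) * α A u q
          eq : ∀ a b c → a * (b * c) ≡ b * (a * c)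
          eq = solve-∀
          inside : ∀ A → ω A * I A ≡ ∑ʰ (G A) (λ u p → ∑ʰ (G A) (λ x q → 𝟙 (¬? (conn? (G A) u x)) * F A u p x q))
          inside A = trans (sym (∑ʰ-*ˡ (G A) (ω A) _)) (∑ʰ-cong (G A) (λ u p → trans (sym (∑ʰ-*ˡ (G A) (ω A) _))
                     (∑ʰ-cong (G A) (λ x q → eq (ω A) (𝟙 (¬? (conn? (G A) u x))) (sel A u * tw A x q)))))
          out : ∀ A → IsReal D A → ∑ʰ (G A) (λ u q → ∑ʰ (G A) (λ x p → F′ A u q x p)) ≤ Mδ * (ω A * Y A) + κ * (S * Mδ * Mδ)
          out A r = begin
              ∑ʰ (G A) (λ u q → ∑ʰ (G A) (λ x p → F′ A u q x p)) ≡⟨ ∑ʰ-cong (G A) (λ u q → ∑ʰ-const (G A) (real A r) (F′ A u q u q)) ⟩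
              ∑ʰ (G A) (λ u q → (ω A + κ) * α A u q * Mδ) ≡⟨ trans (∑ʰ-*ʳ (G A) Mδ _) (cong (_* Mδ) (∑ʰ-*ˡ (G A) (ω A + κ) _)) ⟩
              (ω A + κ) * ∑ʰ (G A) (α A) * Mδ ≤⟨ *-monoˡ-≤ Mδ (*-monoʳ-≤ (ω A + κ) (cheap-branches (G A) (real A r) y c c≤d)) ⟩
              (ω A + κ) * Y A * Mδ ≡⟨ eq₂ (ω A) κ (Y A) Mδ ⟩
              Mδ * (ω A * Y A) + κ * (Y A * Mδ) ≤⟨ +-monoʳ-≤ (Mδ * (ω A * Y A)) (*-monoʳ-≤ κ (*-monoˡ-≤ Mδ (Y≤ A r))) ⟩
              Mδ * (ω A * Y A) + κ * (S * Mδ * Mδ) ∎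
            where
            eq₂ : ∀ w k y m → (w + k) * y * m ≡ m * (w * y) + k * (y * m)
            eq₂ = solve-∀
          F≤F′ : ∀ A u p x q → IsReal D A → Switch (G A) (G (sw u p x q A)) u p x q → F A u p x q ≤ F′ (sw u p x q A) u q x p
          F≤F′ A u p x q r s = go (small? A u) (tree? (G A) u) (tree? (G A) x)
            where
            A′ = sw u p x q A
            go : (su : Dec (volume (G A) u ≤ y)) (tu : Dec (Tree (G A) u)) (tx : Dec (Tree (G A) x)) →
                 ω A * (𝟙 su * 𝟙 tu * c u * (𝟙 tx * (S ⊓ suc (branch (G A) x q)))) ≤ F′ A′ u q x p
            go (no _) _ _ = ≤-trans (≤-reflexive (*-zeroʳ (ω A))) z≤n
            go (yes _) (no _) _ = ≤-trans (≤-reflexive (*-zeroʳ (ω A))) z≤n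
            go (yes _) (yes _) (no _) = ≤-trans (≤-reflexive (trans (cong (ω A *_) (*-zeroʳ (1 * 1 * c u))) (*-zeroʳ (ω A)))) z≤n
            go (yes su) (yes tu) (yes tx) = *-mono-≤ (κ≤ A u p x q r s su) (*-mono-≤
              (≤-reflexive (trans (cong (_* c u) (*-identityˡ 1)) (cong (_* c u) (sym (𝟙-yes (branch (G A′) q u ≤? y)
                (≤-trans (branch-back (real A r) s (tree-acyclic (G A) (tree-conn (G A) (return (up s)) tu))) su))))))
              (*-mono-≤ (≤-reflexive (sym (𝟙-yes (tree? (G A′) u) (tree-switch (real A r) s tu tx)))) (⊓-monoʳ-≤ S (s≤s (branch-front (real A r) s)))))

        K₁ : ℕ
        K₁ = 8 * e * κ * S + 16 * e * B * S * y + 48 * e * B * S * (y * y)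

        -- The drift of the weighted functional Y contradicts its stationarity unless ω is small on average.
        weighted-Y : 3 * ∑ᴿ (λ A → ω A * Y A) ≤ Mδ * (Tot * K₁)
        weighted-Y = *-cancelˡ-≤ Mδ {{>-nonZero M>0}} (lin (+-mono-≤ sumDrift (+-mono-≤ (*-monoʳ-≤ (8 * e) flow) (*-monoʳ-≤ (16 * e * B * S * Mδ * Mδ) N≤))) 0
            (eq e B S Mδ y κ Tot (∑ᴿ (λ A → ω A * Y A)) (∑ᴿ (λ A → ω A * I A)) N))
          where
          open ≤-Reasoning
          eq : ∀ e b s m y k t wy wi nn →
            m * (3 * wy) + (8 * e * wi + (16 * e * b * s * m * m * y) * t + (16 * e * b * s * m * m) * nn + (8 * e * (m * wy + k * (s * m * m) * t) + 16 * e * b * s * m * m * (3 * (y * y) * t))) + 0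
            ≡ m * (m * (t * (8 * e * k * s + 16 * e * b * s * y + 48 * e * b * s * (y * y)))) + ((8 * e + 3) * m * wy + (8 * e * wi + 16 * e * b * s * m * m * nn))
          eq = solve-∀
          perA : ∀ A → IsReal D A → Dec (Q * big A < 2 * Mδ) → (8 * e + 3) * Mδ * (ω A * Y A) ≤ 8 * e * (ω A * I A) + 16 * e * B * S * Mδ * Mδ * y + 16 * e * B * S * Mδ * Mδ * (light A * nontree A)
          perA A r (no nl) = ≤-trans (≤-reflexive (trans (cong (λ w → (8 * e + 3) * Mδ * (w * Y A)) (m≤n⇒m∸n≡0 (≮⇒≥ nl))) (*-zeroʳ ((8 * e + 3) * Mδ)))) z≤n
          perA A r (yes l) = begin
            (8 * e + 3) * Mδ * (ω A * Y A) ≡⟨ eq₁ ((8 * e + 3) * Mδ) (ω A) (Y A) ⟩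
            ω A * ((8 * e + 3) * Mδ * Y A) ≤⟨ *-monoʳ-≤ (ω A) (drift A r l) ⟩
            ω A * (8 * e * I A + 8 * e * B * S * Mδ * (y + nontree A)) ≡⟨ *-distribˡ-+ (ω A) _ _ ⟩
            ω A * (8 * e * I A) + ω A * (8 * e * B * S * Mδ * (y + nontree A)) ≤⟨ +-mono-≤ (≤-reflexive (eq₁ (ω A) (8 * e) (I A))) (*-monoˡ-≤ _ (ω≤ A)) ⟩
            8 * e * (ω A * I A) + 2 * Mδ * (8 * e * B * S * Mδ * (y + nontree A)) ≡⟨ eq₂ e (ω A * I A) B S Mδ y (nontree A) ⟩
            8 * e * (ω A * I A) + 16 * e * B * S * Mδ * Mδ * y + 16 * e * B * S * Mδ * Mδ * (1 * nontree A)
              ≡⟨ cong (λ k → 8 * e * (ω A * I A) + 16 * e * B * S * Mδ * Mδ * y + 16 * e * B * S * Mδ * Mδ * (k * nontree A)) (sym (𝟙-yes (light? A) l)) ⟩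
            8 * e * (ω A * I A) + 16 * e * B * S * Mδ * Mδ * y + 16 * e * B * S * Mδ * Mδ * (light A * nontree A) ∎
            where
            eq₁ : ∀ a b c → a * (b * c) ≡ b * (a * c)
            eq₁ = solve-∀
            eq₂ : ∀ e w b s m y t → 8 * e * w + 2 * m * (8 * e * b * s * m * (y + t)) ≡ 8 * e * w + 16 * e * b * s * m * m * y + 16 * e * b * s * m * m * (1 * t)
            eq₂ = solve-∀
          sumDrift : (8 * e + 3) * Mδ * ∑ᴿ (λ A → ω A * Y A) ≤ 8 * e * ∑ᴿ (λ A → ω A * I A) + 16 * e * B * S * Mδ * Mδ * y * Tot + 16 * e * B * S * Mδ * Mδ * N
          sumDrift = begin
            (8 * e + 3) * Mδ * ∑ᴿ (λ A → ω A * Y A) ≡⟨ sym (∑ᴿ-*ˡ ((8 * e + 3) * Mδ) (λ A → ω A * Y A)) ⟩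
            ∑ᴿ (λ A → (8 * e + 3) * Mδ * (ω A * Y A)) ≤⟨ ∑ᴿ-mono (λ A r → perA A r (light? A)) ⟩
            ∑ᴿ (λ A → 8 * e * (ω A * I A) + 16 * e * B * S * Mδ * Mδ * y + 16 * e * B * S * Mδ * Mδ * (light A * nontree A))
              ≡⟨ trans (∑ᴿ-+ _ _) (cong₂ _+_ (trans (∑ᴿ-+ _ _) (cong₂ _+_ (∑ᴿ-*ˡ (8 * e) _) (∑ᴿ-const _))) (∑ᴿ-*ˡ (16 * e * B * S * Mδ * Mδ) _)) ⟩
            8 * e * ∑ᴿ (λ A → ω A * I A) + 16 * e * B * S * Mδ * Mδ * y * Tot + 16 * e * B * S * Mδ * Mδ * N ∎

        -- On light A the heavy components take at most M/8, so `Y A` is at least 7M/8 up to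
        -- `nontree A`. Thus M times the sum of `ω` is controlled by `weighted-Y`, whose right side
        -- is linear in M.
        weights : ∑ᴿ ω ≤ Tot * (K₁ + 7 * (y * y))
        weights = *-cancelˡ-≤ 21 (*-cancelˡ-≤ Mδ {{>-nonZero M>0}} (lin (+-mono-≤ (*-monoʳ-≤ 3 sumM) (+-mono-≤ (*-monoʳ-≤ 8 weighted-Y) (*-monoʳ-≤ (48 * Mδ) N≤)))
            (Mδ * (13 * Tot * K₁) + Mδ * (3 * Tot * (y * y))) (eq Mδ (∑ᴿ ω) (∑ᴿ (λ A → ω A * Y A)) N Tot K₁ (y * y))))
          where
          open ≤-Reasoning
          eq : ∀ m w wy nn t k yy → m * (21 * w) + (3 * (8 * wy + 16 * m * nn) + (8 * (m * (t * k)) + 48 * m * (3 * yy * t))) + (m * (13 * t * k) + m * (3 * t * yy))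
               ≡ m * (21 * (t * (k + 7 * yy))) + (3 * (7 * m * w) + (8 * (3 * wy) + 48 * m * nn))
          eq = solve-∀
          perA : ∀ A → IsReal D A → Dec (Q * big A < 2 * Mδ) → 7 * Mδ * ω A ≤ 8 * (ω A * Y A) + 16 * Mδ * (light A * nontree A)
          perA A r (no nl) = ≤-trans (≤-reflexive (trans (cong (7 * Mδ *_) (m≤n⇒m∸n≡0 (≮⇒≥ nl))) (*-zeroʳ (7 * Mδ)))) z≤n
          perA A r (yes l) = lin (+-mono-≤ (*-monoʳ-≤ (ω A) (*-monoʳ-≤ 8 (M≤ A r))) (+-mono-≤ (*-monoʳ-≤ (ω A) (big-small A l)) (*-monoˡ-≤ (8 * nontree A) (ω≤ A)))) 0
              (trans (eq₂ Mδ (ω A) (Y A) (big A) (nontree A)) (cong (λ k → 8 * (ω A * Y A) + 16 * Mδ * (k * nontree A) + (ω A * (8 * Mδ) + (ω A * (8 * big A) + ω A * (8 * nontree A)))) (sym (𝟙-yes (light? A) l))))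
            where
            eq₂ : ∀ m w y b t → 7 * m * w + (w * (8 * (y + (b + t))) + (w * m + 2 * m * (8 * t))) + 0 ≡ 8 * (w * y) + 16 * m * (1 * t) + (w * (8 * m) + (w * (8 * b) + w * (8 * t)))
            eq₂ = solve-∀
          sumM : 7 * Mδ * ∑ᴿ ω ≤ 8 * ∑ᴿ (λ A → ω A * Y A) + 16 * Mδ * N
          sumM = begin
            7 * Mδ * ∑ᴿ ω ≡⟨ sym (∑ᴿ-*ˡ (7 * Mδ) ω) ⟩
            ∑ᴿ (λ A → 7 * Mδ * ω A) ≤⟨ ∑ᴿ-mono (λ A r → perA A r (light? A)) ⟩
            ∑ᴿ (λ A → 8 * (ω A * Y A) + 16 * Mδ * (light A * nontree A)) ≡⟨ trans (∑ᴿ-+ _ _) (cong₂ _+_ (∑ᴿ-*ˡ 8 _) (∑ᴿ-*ˡ (16 * Mδ) _)) ⟩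
            8 * ∑ᴿ (λ A → ω A * Y A) + 16 * Mδ * N ∎

      -- Markov's inequality: `ω` is at least M on the realizations counted here, which is why its
      -- definition starts from 2M.
      mostly-small : Mδ * ∑ᴿ (λ A → 𝟙 (16 * (e * B) * heavy y (gr A) ≤? Mδ)) ≤ Tot * smallBound e B y
      mostly-small = ≤-trans (≤-reflexive (sym (∑ᴿ-*ˡ Mδ _))) (≤-trans (∑ᴿ-mono (λ A r → ≤-trans (≤-reflexive (*-comm Mδ _))
          (𝟙*-≤ (16 * (e * B) * heavy y (gr A) ≤? Mδ) (λ h → ≤-trans (≤-reflexive (sym (trans (cong (_∸ Mδ) (cong (Mδ +_) (+-identityʳ Mδ))) (m+n∸n≡m Mδ Mδ)))) (∸-monoʳ-≤ (2 * Mδ) h))))) weights)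

  -- Separating edges

  fins-unique : ∀ n → Unique (fins n)
  fins-unique zero = []
  fins-unique (suc n) = AllP.map⁺ (All.tabulate (λ _ ())) ∷ map⁺ suc-injectiveᶠ (fins-unique n)

  pairs-unique : ∀ n → Unique (pairs n)
  pairs-unique n = cartesianProduct⁺ (fins-unique n) (fins-unique n)

  ∸2-+ : ∀ a b → (a ∸ 2) + (b ∸ 2) ≤ (a + b) ∸ 2
  ∸2-+ a b with ≤-total 2 a
  ... | inj₂ a≤2 = subst (λ k → k + (b ∸ 2) ≤ (a + b) ∸ 2) (sym (m≤n⇒m∸n≡0 a≤2)) (∸-monoˡ-≤ 2 (m≤n+m b a))
  ... | inj₁ 2≤a = ≤-trans (+-monoʳ-≤ (a ∸ 2) (m∸n≤m b 2)) (≤-reflexive (sym (+-∸-comm b 2≤a)))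

  ∑-∸2 : {A : Set} (xs : List A) (f : A → ℕ) → ∑ xs (λ x → f x ∸ 2) ≤ ∑ xs f ∸ 2
  ∑-∸2 [] f = z≤n
  ∑-∸2 (x ∷ xs) f = ≤-trans (+-monoʳ-≤ (f x ∸ 2) (∑-∸2 xs f)) (∸2-+ (f x) (∑ xs f))

  -- A set of edges whose removal cuts off at least t from both ends.
  module Separators {n : ℕ} (d : Fin n → ℕ) (t : ℕ) where

    open Degrees d

    Separates : Graph n → Fin n → Fin n → Set
    Separates g a b = E g a b × ¬ Conn (del g a b) a b × t ≤ volume (del g a b) a × t ≤ volume (del g a b) b

    separates? : ∀ g a b → Dec (Separates g a b)
    separates? g a b = E? g a b ×-dec (¬? (conn? (del g a b) a b) ×-dec ((t ≤? volume (del g a b) a) ×-dec (t ≤? volume (del g a b) b)))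

    sepDeg : Graph n → Fin n → ℕ
    sepDeg g v = ∑ᵛ (λ z → 𝟙 (separates? g v z))

    module _ (g : Graph n) (real : Realizes d g) where

      private
        swap-del : ∀ {a b i j} → Conn (del g a b) i j → Conn (del g b a) i j
        swap-del {a} {b} = conn-sub (del g a b) (del g b a) (λ { (e , ns) → e , (λ { (inj₁ r) → ns (inj₂ r) ; (inj₂ r) → ns (inj₁ r) }) })

        sep-sym : ∀ {a b} → Separates g a b → Separates g b a
        sep-sym {a} {b} (e , nc , va , vb) = E-sym g e , (λ c → nc (conn-sym (del g a b) (swap-del c))) ,
          ≤-trans vb (vol-mono δ (del g a b) (del g b a) b b swap-del) , ≤-trans va (vol-mono δ (del g a b) (del g b a) a a swap-del)

        -- Its components are the pieces. Contracted to points, they form a forest whose edges are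
        -- the separating edges of g.
        g₀ : Graph n
        g₀ = record
          { E = λ i j → E g i j × ¬ Separates g i j
          ; E? = λ i j → E? g i j ×-dec ¬? (separates? g i j)
          ; E-sym = λ { (e , ns) → E-sym g e , λ s → ns (sep-sym s) } }

        s : Fin n → ℕ
        s = sepDeg g

        Up : Fin n × Fin n → Set
        Up (a , b) = (toℕ a < toℕ b) × Separates g a b

        up? : ∀ e → Dec (Up e)
        up? (a , b) = (toℕ a <? toℕ b) ×-dec separates? g a b

        es₀ es : List (Fin n × Fin n)
        es₀ = edgeList g₀
        es = filter up? (pairs n)

        es₀⊆ : ∀ {i j} → (i , j) ∈ es₀ → E g₀ i j
        es₀⊆ p = proj₂ (∈-filter⁻ (λ e → E? g₀ (proj₁ e) (proj₂ e)) {xs = pairs n} p)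

        ⊆es₀ : ∀ {i j} → E g₀ i j → (i , j) ∈ es₀
        ⊆es₀ {i} {j} e = ∈-filter⁺ (λ e → E? g₀ (proj₁ e) (proj₂ e)) (∈-cartesianProduct⁺ (∈fins i) (∈fins j)) e

        piece : Fin n → Fin n
        piece = lab es₀

        conn-piece : ∀ {v w} → Conn g₀ v w → piece v ≡ piece w
        conn-piece c = lab-complete es₀ (conv (λ e → return (inj₁ (⊆es₀ e))) c)

        -- Only pieces that meet a separating edge count as vertices of the contracted forest; a
        -- piece of degree zero would violate the estimate by leaves in `active-root`.
        Active : Fin n → Set
        Active v = ∃ λ w → Conn g₀ v w × ∃ λ z → Separates g w z

        active? : ∀ v → Dec (Active v)
        active? v = any? λ w → conn? g₀ v w ×-dec any? (separates? g w)

        active-closed : ∀ xs → (∀ {e} → e ∈ xs → Up e) → ∀ {a b} → Adj (xs ++ es₀) a b → Active a → Active b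
        active-closed xs all (inj₁ p) (w , c , h) with ∈-++⁻ xs p
        ... | inj₂ q = w , E-sym g₀ (es₀⊆ q) ◅ c , h
        ... | inj₁ q = _ , ε , _ , sep-sym (proj₂ (all q))
        active-closed xs all (inj₂ p) (w , c , h) with ∈-++⁻ xs p
        ... | inj₂ q = w , es₀⊆ q ◅ c , h
        ... | inj₁ q = _ , ε , _ , proj₂ (all q)

        -- Separating edges are bridges, so adding them one at a time always joins two pieces.
        forest-grows : ∀ xs → (∀ {e} → e ∈ xs → Up e) → Unique xs → length xs + forest active? es₀ ≤ forest active? (xs ++ es₀)
        forest-grows [] all u = ≤-refl
        forest-grows ((a , b) ∷ xs) all (fresh ∷ u) = +-mono-≤ (≤-reflexive (sym (cong₂ _*_ (𝟙-yes (active? a) (a , ε , b , proj₂ (all (here refl))))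
            (𝟙-yes (joins? (xs ++ es₀) (a , b)) joins)))) (forest-grows xs (all ∘ there) u)
          where
          joins : ¬ (lab (xs ++ es₀) a ≡ lab (xs ++ es₀) b)
          joins eq = proj₁ (proj₂ (proj₂ (all (here refl)))) (conv (λ { (inj₁ p) → return (step p) ; (inj₂ p) → return (E-sym (del g a b) (step p)) }) (lab-sound (xs ++ es₀) eq))
            where
            step : ∀ {i j} → (i , j) ∈ xs ++ es₀ → E (del g a b) i j
            step {i} {j} p with ∈-++⁻ xs p
            ... | inj₂ q = proj₁ (es₀⊆ q) , (λ { (inj₁ (refl , refl)) → proj₂ (es₀⊆ q) (proj₂ (all (here refl)))
                                                ; (inj₂ (refl , refl)) → proj₂ (es₀⊆ q) (sep-sym (proj₂ (all (here refl)))) })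
            ... | inj₁ q = proj₁ (proj₂ (all (there q))) , (λ { (inj₁ (refl , refl)) → All.lookup fresh q refl
                                                               ; (inj₂ (refl , refl)) → <-asym (proj₁ (all (here refl))) (proj₁ (all (there q))) })

        es-up : ∀ {e} → e ∈ es → Up e
        es-up p = proj₂ (∈-filter⁻ up? {xs = pairs n} p)

        activeRoots : ℕ
        activeRoots = roots active? es₀

        edges≤roots : length es ≤ activeRoots
        edges≤roots = +-cancelˡ-≤ (forest active? es₀) _ _ (begin
            forest active? es₀ + length es ≡⟨ +-comm (forest active? es₀) _ ⟩
            length es + forest active? es₀ ≤⟨ forest-grows es es-up (filter⁺ up? (pairs-unique n)) ⟩
            forest active? (es ++ es₀) ≤⟨ m≤m+n _ (roots active? (es ++ es₀)) ⟩
            forest active? (es ++ es₀) + roots active? (es ++ es₀) ≡⟨ forest+roots active? (es ++ es₀) (active-closed es es-up) ⟩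
            ∑ᵛ (λ v → 𝟙 (active? v)) ≡⟨ sym (forest+roots active? es₀ (active-closed [] (λ ()))) ⟩
            forest active? es₀ + activeRoots ∎)
          where open ≤-Reasoning

        length-filter : {A : Set} {P : A → Set} (P? : ∀ x → Dec (P x)) (xs : List A) → length (filter P? xs) ≡ ∑ xs (λ x → 𝟙 (P? x))
        length-filter P? [] = refl
        length-filter P? (x ∷ xs) with P? x
        ... | yes _ = cong suc (length-filter P? xs)
        ... | no _ = length-filter P? xs

        ∑-pairs : (f : Fin n × Fin n → ℕ) (xs ys : List (Fin n)) → ∑ (cartesianProduct xs ys) f ≡ ∑ xs (λ a → ∑ ys (λ b → f (a , b)))
        ∑-pairs f [] ys = refl
        ∑-pairs f (x ∷ xs) ys = trans (∑-++ (map (x ,_) ys) (cartesianProduct xs ys) f) (cong₂ _+_ (∑-map (x ,_) ys f) (∑-pairs f xs ys))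

        handshake : ∑ᵛ s ≡ 2 * length es
        handshake = trans (∑-cong (fins n) (λ a → trans (∑-cong (fins n) (λ b → parts a b)) (∑-+ (fins n) _ _))) (trans (∑-+ (fins n) _ _)
            (trans (cong₂ _+_ refl (∑-swap (fins n) (fins n) _)) (trans (cong₂ _+_ (sym half) (sym half)) (cong (length es +_) (sym (+-identityʳ _))))))
          where
          half : length es ≡ ∑ᵛ (λ a → ∑ᵛ (λ b → 𝟙 (up? (a , b))))
          half = trans (length-filter up? (pairs n)) (∑-pairs (λ e → 𝟙 (up? e)) (fins n) (fins n))
          parts : ∀ a b → 𝟙 (separates? g a b) ≡ 𝟙 (up? (a , b)) + 𝟙 (up? (b , a))
          parts a b = go (separates? g a b) (<-cmp (toℕ a) (toℕ b))
            where
            open import Relation.Binary.Definitions using (Tri; tri<; tri≈; tri>)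
            go : Dec (Separates g a b) → Tri (toℕ a < toℕ b) (toℕ a ≡ toℕ b) (toℕ b < toℕ a) → 𝟙 (separates? g a b) ≡ 𝟙 (up? (a , b)) + 𝟙 (up? (b , a))
            go (no ns) _ = trans (𝟙-no (separates? g a b) ns) (sym (cong₂ _+_ (𝟙-no (up? (a , b)) (ns ∘ proj₂)) (𝟙-no (up? (b , a)) (ns ∘ sep-sym ∘ proj₂))))
            go (yes sp) (tri< lt _ ngt) = trans (𝟙-yes (separates? g a b) sp) (sym (cong₂ _+_ (𝟙-yes (up? (a , b)) (lt , sp)) (𝟙-no (up? (b , a)) (ngt ∘ proj₁))))
            go (yes sp) (tri> nlt _ gt) = trans (𝟙-yes (separates? g a b) sp) (sym (cong₂ _+_ (𝟙-no (up? (a , b)) (nlt ∘ proj₁)) (𝟙-yes (up? (b , a)) (gt , sep-sym sp))))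
            go (yes sp) (tri≈ _ eq _) = contradiction (subst (E g a) (sym (toℕ-injective eq)) (proj₁ sp)) (irr real a)

        pdeg : Fin n → ℕ
        pdeg r = ∑ᵛ (λ v → 𝟙 (piece v ≟ᶠ r) * s v)

        over-pieces : (f : Fin n → ℕ) → ∑ᵛ (λ r → ∑ᵛ (λ v → 𝟙 (piece v ≟ᶠ r) * f v)) ≡ ∑ᵛ f
        over-pieces f = trans (∑-swap (fins n) (fins n) _) (∑-cong (fins n) (λ v → trans (∑-*ʳ (fins n) (f v) _)
          (trans (cong (_* f v) (trans (∑-cong (fins n) (λ r → 𝟙-cong (piece v ≟ᶠ r) (r ≟ᶠ piece v) sym sym)) (∑-point₁ (piece v)))) (*-identityˡ (f v)))))

        one? : ∀ r → Dec (pdeg r ≡ 1)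
        one? r = pdeg r ≟ 1

        s≤pdeg : ∀ {v r} → piece v ≡ r → s v ≤ pdeg r
        s≤pdeg {v} {r} eq = ≤-trans (≤-reflexive (sym (trans (cong (_* s v) (𝟙-yes (piece v ≟ᶠ r) eq)) (*-identityˡ _)))) (∑-term v (λ v → 𝟙 (piece v ≟ᶠ r) * s v))

        s-pos : ∀ {v z} → Separates g v z → 1 ≤ s v
        s-pos {v} {z} sp = ≤-trans (≤-reflexive (sym (𝟙-yes (separates? g v z) sp))) (∑-term z (λ z → 𝟙 (separates? g v z)))

        active-root : ∀ r → pdeg r ∸ 2 + 2 * (𝟙 (active? r) * 𝟙 (root? es₀ r)) ≤ pdeg r + 𝟙 (one? r)
        active-root r = go (active? r) (root? es₀ r)
          where
          easy : ∀ k → pdeg r ∸ 2 + 0 ≤ pdeg r + k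
          easy k = ≤-trans (≤-reflexive (+-identityʳ _)) (m≤n⇒m≤n+o k (m∸n≤m (pdeg r) 2))
          go : (a : Dec (Active r)) (o : Dec (Root es₀ r)) → pdeg r ∸ 2 + 2 * (𝟙 a * 𝟙 o) ≤ pdeg r + 𝟙 (one? r)
          go (no _) _ = easy _
          go (yes _) (no _) = easy _
          go (yes (w , c , z , sp)) (yes ro) = lem (pdeg r) (one? r) (≤-trans (s-pos sp) (s≤pdeg (trans (sym (conn-piece c)) ro)))
            where
            lem : ∀ k (o : Dec (k ≡ 1)) → 1 ≤ k → k ∸ 2 + 2 * 1 ≤ k + 𝟙 o
            lem (suc zero) (yes _) _ = s≤s (s≤s z≤n)
            lem (suc zero) (no ne) _ = contradiction refl ne
            lem (suc (suc k)) o _ = m≤n⇒m≤n+o (𝟙 o) (≤-reflexive (+-comm k 2))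

        leaves : ℕ
        leaves = ∑ᵛ (λ r → 𝟙 (one? r))

        -- A forest has no more edges than vertices, so deg - 2 sums to at most zero, and the
        -- excesses over two are paid for by the leaves. Passing from vertices to pieces adds
        -- degrees up, which does not lower the excess.
        branching≤leaves : ∑ᵛ (λ v → s v ∸ 2) ≤ leaves
        branching≤leaves = ≤-trans (≤-reflexive (sym (over-pieces (λ v → s v ∸ 2)))) (≤-trans (∑-mono (fins n) merge) fin)
          where
          merge : ∀ r → ∑ᵛ (λ v → 𝟙 (piece v ≟ᶠ r) * (s v ∸ 2)) ≤ pdeg r ∸ 2
          merge r = ≤-trans (∑-mono (fins n) (λ v → inside v (piece v ≟ᶠ r))) (∑-∸2 (fins n) _)
            where
            inside : ∀ v (p : Dec (piece v ≡ r)) → 𝟙 p * (s v ∸ 2) ≤ 𝟙 p * s v ∸ 2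
            inside v (no _) = z≤n
            inside v (yes _) = ≤-reflexive (trans (*-identityˡ (s v ∸ 2)) (cong (_∸ 2) (sym (*-identityˡ (s v)))))
          fin : ∑ᵛ (λ r → pdeg r ∸ 2) ≤ leaves
          fin = lin (+-mono-≤ whole (*-monoʳ-≤ 2 edges≤roots)) 0 (trans (eq (∑ᵛ (λ r → pdeg r ∸ 2)) (∑ᵛ pdeg) leaves activeRoots) (cong (λ k → leaves + (∑ᵛ (λ r → pdeg r ∸ 2) + 2 * activeRoots + k)) (trans (over-pieces s) handshake)))
            where
            eq : ∀ a p l r → a + (p + l + 2 * r) + 0 ≡ l + (a + 2 * r + p)
            eq = solve-∀
            whole : ∑ᵛ (λ r → pdeg r ∸ 2) + 2 * activeRoots ≤ ∑ᵛ pdeg + leaves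
            whole = ≤-trans (≤-reflexive (trans (cong (∑ᵛ (λ r → pdeg r ∸ 2) +_) (sym (∑-*ˡ (fins n) 2 _))) (sym (∑-+ (fins n) _ _))))
                    (≤-trans (∑-mono (fins n) active-root) (≤-reflexive (∑-+ (fins n) _ _)))

        share : Fin n → Fin n → ℕ
        share r v = 𝟙 (piece v ≟ᶠ r) * s v

        -- A leaf piece meets a single separating edge vz, so the whole side of v that remains after
        -- deleting vz lies in this piece, and that side has volume at least t.
        module Leaf (r : Fin n) (p1 : pdeg r ≡ 1) (v : Fin n) (pv : piece v ≡ r) (z : Fin n) (sp : Separates g v z) where

          share≥ : ∀ {w} → piece w ≡ r → 1 ≤ s w → 1 ≤ share r w
          share≥ {w} eq le = ≤-trans le (≤-reflexive (sym (trans (cong (_* s w) (𝟙-yes (piece w ≟ᶠ r) eq)) (*-identityˡ _))))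

          not-two : ¬ (2 ≤ pdeg r)
          not-two le = 1+n≰n (subst (2 ≤_) p1 le)

          same-v : ∀ {a b} → piece a ≡ r → Separates g a b → a ≡ v
          same-v {a} pa sab with a ≟ᶠ v
          ... | yes eq = eq
          ... | no ne = contradiction (≤-trans (+-mono-≤ (share≥ pa (s-pos sab)) (share≥ pv (s-pos sp))) (∑-two-terms a v (share r) ne)) not-two

          same-z : ∀ {b} → Separates g v b → b ≡ z
          same-z {b} sab with b ≟ᶠ z
          ... | yes eq = eq
          ... | no ne = contradiction (≤-trans (≤-trans (+-mono-≤ (≤-reflexive (sym (𝟙-yes (separates? g v b) sab))) (≤-reflexive (sym (𝟙-yes (separates? g v z) sp))))
                 (∑-two-terms b z (λ z → 𝟙 (separates? g v z)) ne)) (s≤pdeg pv)) not-two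

          step : ∀ {a b} → piece a ≡ r → E (del g v z) a b → (piece b ≡ r) × ⊤
          step {a} {b} pa (e , ns) = go (separates? g a b)
            where
            go : Dec (Separates g a b) → (piece b ≡ r) × ⊤
            go (no nsab) = trans (conn-piece (return (E-sym g₀ (e , nsab)))) pa , tt
            go (yes sab) = contradiction (inj₁ (same-v pa sab , same-z (subst (λ k → Separates g k b) (same-v pa sab) sab))) ns

          inside : ∀ {w} → Conn (del g v z) v w → piece w ≡ r
          inside c = proj₁ (star-closed {R′ = λ _ _ → ⊤} (λ a → piece a ≡ r) step pv c)

          volume≤ : t ≤ ∑ᵛ (λ w → 𝟙 (piece w ≟ᶠ r) * δ w)
          volume≤ = ≤-trans (proj₁ (proj₂ (proj₂ sp))) (∑-mono (fins n) (λ w → *-monoˡ-≤ (δ w) (𝟙-mono (conn? (del g v z) v w) (piece w ≟ᶠ r) inside)))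

        leaf-witness : ∀ r → pdeg r ≡ 1 → ∃ λ v → piece v ≡ r × ∃ λ z → Separates g v z
        leaf-witness r p1 with ∑-pos (fins n) (share r) (subst (0 <_) (sym p1) (s≤s z≤n))
        ... | v , h with ∑-pos (fins n) (λ z → 𝟙 (separates? g v z)) (*-posʳ (𝟙 (piece v ≟ᶠ r)) (s v) h)
        ... | z , h′ = v , 𝟙-pos (piece v ≟ᶠ r) (*-posˡ (𝟙 (piece v ≟ᶠ r)) (s v) h) , z , 𝟙-pos (separates? g v z) h′

        leaf-volume : ∀ r → t * 𝟙 (one? r) ≤ ∑ᵛ (λ w → 𝟙 (piece w ≟ᶠ r) * δ w)
        leaf-volume r = ≤-trans (≤-reflexive (*-comm t _)) (𝟙*-≤ (one? r) (λ p1 → let v , pv , z , sp = leaf-witness r p1 in Leaf.volume≤ r p1 v pv z sp))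

      -- Branching vertices of the tree of pieces are at most as many as its leaves, and each leaf has volume t.
      separator-branching : t * ∑ᵛ (λ v → sepDeg g v ∸ 2) ≤ Mδ
      separator-branching = ≤-trans (*-monoʳ-≤ t branching≤leaves) (≤-trans (≤-reflexive (sym (∑-*ˡ (fins n) t _)))
          (≤-trans (∑-mono (fins n) leaf-volume) (≤-reflexive (over-pieces δ))))

  -- Grafting leaves

  module Grafting {n : ℕ} (d : Fin n → ℕ) (t : ℕ) where

    open Degrees d
    open Transfer d
    open Separators d t

    Hanging : Graph n → Fin n → Fin n → Set
    Hanging g v y = E g v y × (∀ z → E g v z → z ≢ y → ¬ Conn (g ∖ v) y z) × t ≤ branch g v y

    -- `suc t` rather than t: the component is grafted without the leaf x, whose own volume is 1,
    -- and t must remain.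
    Leaf : Graph n → Fin n → Fin n → Set
    Leaf g x y = E g x y × d x ≡ 1 × suc t ≤ volume g x

    leaf-only : ∀ g → Realizes d g → ∀ {x y w} → d x ≡ 1 → E g x y → E g x w → w ≡ y
    leaf-only g real {x} {y} {w} dx ey ew with w ≟ᶠ y
    ... | yes eq = eq
    ... | no ne = contradiction (subst (2 ≤_) (trans (deg real x) dx) (≤-trans (≤-reflexive (sym (cong₂ _+_ (𝟙-yes (E? g x w) ew) (𝟙-yes (E? g x y) ey))))
                   (∑-two-terms w y (λ j → 𝟙 (E? g x j)) ne))) (λ { (s≤s ()) })

    -- Beyond va lies the branch at a, and on the side of v the branch at b, both of volume at least
    -- t. A hanging branch thus needs a second one before its edge separates.
    hanging-separates : ∀ g → Realizes d g → ∀ {v a b} → a ≢ b → Hanging g v a → Hanging g v b → Separates g v a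
    hanging-separates g real {v} {a} {b} a≢b (ea , single , va) (eb , _ , vb) = ea , bridge ,
        ≤-trans vb (vol-mono δ (g ∖ v) (del g v a) b v (λ c → (eb , (λ { (inj₁ (_ , r)) → a≢b (sym r) ; (inj₂ (r , _)) → edge-≢ g real ea r })) ◅ sub c)) ,
        ≤-trans va (vol-mono δ (g ∖ v) (del g v a) a a sub)
      where
      sub : ∀ {i j} → Conn (g ∖ v) i j → Conn (del g v a) i j
      sub = conn-sub (g ∖ v) (del g v a) (λ { (e , p , q) → e , (λ { (inj₁ (r , _)) → p r ; (inj₂ (_ , r)) → q r }) })
      bridge : ¬ Conn (del g v a) v a
      bridge c with last-exit (del g v a) v c (edge-≢ g real ea ∘ sym)
      ... | inj₁ c′ = edge-≢ g real ea (sym (stuck (del g v a) v c′))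
      ... | inj₂ (z , (e , ns) , _ , c′) = single z e (λ { refl → ns same-refl })
             (conn-sym (g ∖ v) (conn-sub (del g v a ∖ v) (g ∖ v) (λ { ((e , _) , p) → e , p }) c′))

    module _ {g g′ : Graph n} (real : Realizes d g) {v z x y : Fin n} (s : Switch g g′ v z x y) where

      private
        v≢z : v ≢ z
        v≢z = edge-≢ g real (up s)

        not-in-v : ∀ {a} → Conn g v a → a ≢ x
        not-in-v c refl = apart s c

        x-apart : ∀ {a} → Conn g x a → ¬ Conn g v a
        x-apart c c′ = apart s (c′ ◅◅ conn-sym g c)

      keep-neighbour : ∀ {z₂} → E g v z₂ → z₂ ≢ z → E g′ v z₂
      keep-neighbour e ne = keep s e (λ { (inj₁ (_ , r)) → ne r ; (inj₂ (r , _)) → v≢z r })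
                                     (λ { (inj₁ (r , _)) → u≢x s r ; (inj₂ (r , _)) → u≢q s r })

      old-neighbour : ∀ {w} → E g′ v w → w ≢ y → E g v w
      old-neighbour e ne with old s e
      ... | inj₁ (e′ , _) = e′
      ... | inj₂ (inj₁ (inj₁ (_ , r))) = contradiction r ne
      ... | inj₂ (inj₁ (inj₂ (r , _))) = contradiction r (u≢q s)
      ... | inj₂ (inj₂ (inj₁ (r , _))) = contradiction r (u≢x s)
      ... | inj₂ (inj₂ (inj₂ (r , _))) = contradiction r v≢z

      -- The leaf x is traded for v: its component without x now hangs on v by the edge vy, while x
      -- is moved to z.
      graft-new : Leaf g x y → Hanging g′ v y
      graft-new (_ , dx , big) = uq′ s , single , ≤-trans (≤-pred (≤-trans big vol≤)) (branch-front real s)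
        where
        vol≤ : volume g x ≤ suc (branch g x y)
        vol≤ = ≤-trans (∑-mono (fins n) (λ w → pw w (conn? g x w) (w ≟ᶠ x))) (≤-reflexive (trans (∑-+ (fins n) _ _) (cong₂ _+_ (trans (∑-point x δ) δx) refl)))
          where
          δx : δ x ≡ 1
          δx = trans (cong (_* d x) (𝟙-yes (branching? x) (λ two → contradiction (trans (sym dx) two) (λ ())))) (trans (*-identityˡ (d x)) dx)
          pw : ∀ w (c : Dec (Conn g x w)) (o : Dec (w ≡ x)) → 𝟙 c * δ w ≤ 𝟙 o * δ w + 𝟙 (conn? (g ∖ x) y w) * δ w
          pw w (no _) _ = z≤n
          pw w (yes _) (yes _) = m≤m+n _ _
          pw w (yes c) (no w≢x) with last-exit g x c w≢x
          ... | inj₁ c′ = contradiction (stuck g x c′) w≢x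
          ... | inj₂ (z′ , e , _ , c′) = ≤-reflexive (cong (_* δ w) (sym (𝟙-yes (conn? (g ∖ x) y w) (subst (λ k → Conn (g ∖ x) k w) (leaf-only g real dx (xq s) e) c′))))
        closed : ∀ {a b} → Conn g x a × a ≢ x → E (g′ ∖ v) a b → (Conn g x b × b ≢ x) × ⊤
        closed {a} {b} (ca , a≢x) (e , a≢v , b≢v) with old s e
        ... | inj₂ (inj₁ (inj₁ (r , _))) = contradiction r a≢v
        ... | inj₂ (inj₁ (inj₂ (_ , r))) = contradiction r b≢v
        ... | inj₂ (inj₂ (inj₁ (r , _))) = contradiction r a≢x
        ... | inj₂ (inj₂ (inj₂ (refl , _))) = contradiction (return (up s)) (x-apart ca)
        ... | inj₁ (e′ , _ , ns) = (ca ◅◅ return e′ , (λ { refl → ns (inj₂ (leaf-only g real dx (xq s) (E-sym g e′) , refl)) })) , tt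
        single : ∀ z′ → E g′ v z′ → z′ ≢ y → ¬ Conn (g′ ∖ v) y z′
        single z′ e ne c = x-apart (proj₁ (proj₁ (star-closed {R′ = λ _ _ → ⊤} (λ a → Conn g x a × a ≢ x) closed (return (xq s) , (λ { refl → irr real _ (xq s) })) c))) (return (old-neighbour e ne))

      -- Since x and y come from another component, a branch already hanging on v is disturbed only
      -- if it is the one entered through vz.
      graft-keep : ∀ {y′} → y′ ≢ z → Hanging g v y′ → Hanging g′ v y′
      graft-keep {y′} y′≢z (ey , single , vy) = keep-neighbour ey y′≢z , single′ ,
          ≤-trans vy (vol-mono δ (g ∖ v) (g′ ∖ v) y′ y′ (λ c → proj₂ (star-closed (Conn (g ∖ v) y′) forth ε c)))
        where
        in-v : ∀ {a} → Conn (g ∖ v) y′ a → Conn g v a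
        in-v c = ey ◅ ∖⊆ g v c
        forth : ∀ {a b} → Conn (g ∖ v) y′ a → E (g ∖ v) a b → Conn (g ∖ v) y′ b × E (g′ ∖ v) a b
        forth ca (e , a≢v , b≢v) = ca ◅◅ return (e , a≢v , b≢v) ,
          keep s e (λ { (inj₁ (r , _)) → a≢v r ; (inj₂ (_ , r)) → b≢v r })
                   (λ { (inj₁ (r , _)) → not-in-v (in-v ca) r ; (inj₂ (_ , r)) → not-in-v (in-v ca ◅◅ return e) r }) , a≢v , b≢v
        back : ∀ {a b} → Conn (g ∖ v) y′ a → E (g′ ∖ v) a b → Conn (g ∖ v) y′ b × ⊤
        back ca (e , a≢v , b≢v) with old s e
        ... | inj₁ (e′ , _) = ca ◅◅ return (e′ , a≢v , b≢v) , tt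
        ... | inj₂ (inj₁ (inj₁ (r , _))) = contradiction r a≢v
        ... | inj₂ (inj₁ (inj₂ (_ , r))) = contradiction r b≢v
        ... | inj₂ (inj₂ (inj₁ (r , _))) = contradiction r (not-in-v (in-v ca))
        ... | inj₂ (inj₂ (inj₂ (refl , _))) = contradiction ca (single z (up s) (y′≢z ∘ sym))
        single′ : ∀ z′ → E g′ v z′ → z′ ≢ y′ → ¬ Conn (g′ ∖ v) y′ z′
        single′ z′ e ne c with star-closed {R′ = λ _ _ → ⊤} (Conn (g ∖ v) y′) back ε c | z′ ≟ᶠ y
        ... | c′ , _ | yes refl = x-apart (return (xq s)) (in-v c′)
        ... | c′ , _ | no z′≢y = single z′ (old-neighbour e z′≢y) ne c′

      far-same : ∀ {u} → ¬ Conn g v u → ¬ Conn g x u → ∀ {w} → Conn g u w → Conn g′ u w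
      far-same nv nx c = proj₂ (star-closed (λ a → ¬ Conn g v a × ¬ Conn g x a) step (nv , nx) c)
        where
        step : ∀ {a b} → ¬ Conn g v a × ¬ Conn g x a → E g a b → (¬ Conn g v b × ¬ Conn g x b) × E g′ a b
        step (na , nb) e = ((λ c → na (c ◅◅ return (E-sym g e))) , (λ c → nb (c ◅◅ return (E-sym g e)))) ,
          keep s e (λ { (inj₁ (refl , _)) → na ε ; (inj₂ (refl , _)) → na (return (up s)) })
                   (λ { (inj₁ (refl , _)) → nb ε ; (inj₂ (refl , _)) → nb (return (xq s)) })

      graft-leaf : ∀ {x₂ y₂} → ¬ Conn g v x₂ → ¬ Conn g x x₂ → Leaf g x₂ y₂ → Leaf g′ x₂ y₂
      graft-leaf nv nx (e , dx , big) = keep s e (λ { (inj₁ (refl , _)) → nv ε ; (inj₂ (refl , _)) → nv (return (up s)) })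
          (λ { (inj₁ (refl , _)) → nx ε ; (inj₂ (refl , _)) → nx (return (xq s)) }) , dx , ≤-trans big (vol-mono δ g g′ _ _ (far-same nv nx))

      graft-apart : ∀ {x₂} → ¬ Conn g v x₂ → ¬ Conn g x x₂ → ¬ Conn g′ v x₂
      graft-apart nv nx c = nv (conn-sym g (far-conn real s nv nx (conn-sym g′ c)))

      graft-apart₂ : ∀ {x₂ x₃} → ¬ Conn g v x₂ → ¬ Conn g x x₂ → ¬ Conn g x₂ x₃ → ¬ Conn g′ x₂ x₃
      graft-apart₂ nv nx n₂ c = n₂ (far-conn real s nv nx c)

      graft-attached : ∀ {x₀ z₀} → E g x₀ z₀ → x₀ ≢ v → z₀ ≢ v → x₀ ≢ x → z₀ ≢ x → E g′ x₀ z₀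
      graft-attached e a b c d = keep s e (λ { (inj₁ (r , _)) → a r ; (inj₂ (_ , r)) → b r }) (λ { (inj₁ (r , _)) → c r ; (inj₂ (_ , r)) → d r })

  Move : ℕ → Set
  Move n = Fin n × Fin n × Fin n

  moves : ∀ n → List (Move n)
  moves n = cartesianProduct (fins n) (pairs n)

  ∑-cartesian : {A B : Set} (xs : List A) (ys : List B) (f : A × B → ℕ) → ∑ (cartesianProduct xs ys) f ≡ ∑ xs (λ a → ∑ ys (λ b → f (a , b)))
  ∑-cartesian [] ys f = refl
  ∑-cartesian (x ∷ xs) ys f = trans (∑-++ (map (x ,_) ys) (cartesianProduct xs ys) f) (cong₂ _+_ (∑-map (x ,_) ys f) (∑-cartesian xs ys f))

  Avoids : ∀ {n} → List (Fin n) → Fin n → Set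
  Avoids zs z = All (λ a → z ≢ a) zs

  avoids? : ∀ {n} (zs : List (Fin n)) z → Dec (Avoids zs z)
  avoids? zs z = All.all? (λ a → ¬? (z ≟ᶠ a)) zs

  module _ {n} {P : Fin n → Set} (P? : ∀ z → Dec (P z)) where

    count-avoiding : ∀ zs → ∑ᵛ (λ z → 𝟙 (P? z)) ≤ ∑ᵛ (λ z → 𝟙 (P? z ×-dec avoids? zs z)) + length zs
    count-avoiding [] = ≤-trans (∑-mono (fins n) (λ z → 𝟙-mono (P? z) (P? z ×-dec avoids? [] z) (λ p → p , []))) (≤-reflexive (sym (+-identityʳ _)))
    count-avoiding (a ∷ zs) = begin
        ∑ᵛ (λ z → 𝟙 (P? z)) ≤⟨ count-avoiding zs ⟩
        ∑ᵛ (λ z → 𝟙 (P? z ×-dec avoids? zs z)) + length zs ≤⟨ +-monoˡ-≤ (length zs) (∑-mono (fins n) (λ z → pw z (P? z ×-dec avoids? zs z) (z ≟ᶠ a))) ⟩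
        ∑ᵛ (λ z → 𝟙 (P? z ×-dec avoids? (a ∷ zs) z) + 𝟙 (z ≟ᶠ a)) + length zs ≡⟨ cong (_+ length zs) (trans (∑-+ (fins n) _ _) (cong₂ _+_ refl (∑-point₁ a))) ⟩
        ∑ᵛ (λ z → 𝟙 (P? z ×-dec avoids? (a ∷ zs) z)) + 1 + length zs ≡⟨ +-assoc _ 1 (length zs) ⟩
        ∑ᵛ (λ z → 𝟙 (P? z ×-dec avoids? (a ∷ zs) z)) + suc (length zs) ∎
      where
      open ≤-Reasoning
      pw : ∀ z (c : Dec (P z × Avoids zs z)) (o : Dec (z ≡ a)) → 𝟙 c ≤ 𝟙 (P? z ×-dec avoids? (a ∷ zs) z) + 𝟙 o
      pw z (no _) _ = z≤n
      pw z (yes _) (yes _) = m≤n+m 1 _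
      pw z (yes (p , av)) (no ne) = m≤n⇒m≤n+o 0 (≤-reflexive (sym (𝟙-yes (P? z ×-dec avoids? (a ∷ zs) z) (p , ne ∷ av))))

    count-rest : ∀ {a zs} → P a → Avoids zs a → suc (∑ᵛ (λ z → 𝟙 (P? z ×-dec avoids? (a ∷ zs) z))) ≤ ∑ᵛ (λ z → 𝟙 (P? z ×-dec avoids? zs z))
    count-rest {a} {zs} pa av = ≤-trans (≤-reflexive (trans (+-subˡ (sym (∑-point₁ a))) (sym (∑-+ (fins n) _ _)))) (∑-mono (fins n) (λ z → pw z (z ≟ᶠ a)))
      where
      pw : ∀ z (o : Dec (z ≡ a)) → 𝟙 o + 𝟙 (P? z ×-dec avoids? (a ∷ zs) z) ≤ 𝟙 (P? z ×-dec avoids? zs z)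
      pw z (yes refl) = ≤-reflexive (trans (cong suc (𝟙-no (P? a ×-dec avoids? (a ∷ zs) a) (λ { (_ , ne ∷ _) → ne refl }))) (sym (𝟙-yes (P? a ×-dec avoids? zs a) (pa , av))))
      pw z (no _) = 𝟙-mono (P? z ×-dec avoids? (a ∷ zs) z) (P? z ×-dec avoids? zs z) (λ { (p , _ ∷ av) → p , av })

  -- Realizations with many large leaves

  module ManyLeaves {n : ℕ} (D : Vec ℕ n) (t L : ℕ) where

    open Counting D
    open Separators d t
    open Grafting d t

    Bounded : Mat n → Set
    Bounded A = ∀ v → volume (gr A) v ≤ L

    bounded? : ∀ A → Dec (Bounded A)
    bounded? A = all? (λ v → volume (gr A) v ≤? L)

    bigLeaf? : ∀ A x → Dec (d x ≡ 1 × suc t ≤ volume (gr A) x)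
    bigLeaf? A x = (d x ≟ 1) ×-dec (suc t ≤? volume (gr A) x)

    bigLeaves : Mat n → ℕ
    bigLeaves A = ∑ᵛ (λ x → 𝟙 (bigLeaf? A x))

    -- The large leaves still available when up to three components, each of volume at most L, are
    -- excluded: that of v and those of the earlier grafts.
    k : Mat n → ℕ
    k A = bigLeaves A ∸ 3 * L

    private
      Apart : Graph n → List (Fin n) → Fin n → Set
      Apart g us x = All (λ u → ¬ Conn g u x) us

      apart? : ∀ g us x → Dec (Apart g us x)
      apart? g us x = All.all? (λ u → ¬? (conn? g u x)) us

      leaf? : ∀ g x y → Dec (Leaf g x y)
      leaf? g x y = E? g x y ×-dec ((d x ≟ 1) ×-dec (suc t ≤? volume g x))

      Pre : Graph n → Fin n → List (Fin n) → List (Fin n) → Move n → Set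
      Pre g v zs us (z , x , y) = (E g v z × Avoids zs z) × (Leaf g x y × Apart g us x)

      pre? : ∀ g v zs us m → Dec (Pre g v zs us m)
      pre? g v zs us (z , x , y) = (E? g v z ×-dec avoids? zs z) ×-dec (leaf? g x y ×-dec apart? g us x)

      -- The trace by which a graft is recognised afterwards: y is limited by the separating edges
      -- at v, and x, z form a half-edge at a vertex of degree 1, of which there are at most `Mδ`.
      Post : Graph n → Fin n → List (Fin n) → Move n → Set
      Post g v ys (z , x , y) = (Separates g v y × Avoids ys y) × (E g x z × d x ≡ 1)

      post? : ∀ g v ys m → Dec (Post g v ys m)
      post? g v ys (z , x , y) = (separates? g v y ×-dec avoids? ys y) ×-dec (E? g x z ×-dec (d x ≟ 1))

      ∑ᵐᵛ : (Move n → ℕ) → ℕ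
      ∑ᵐᵛ = ∑ (moves n)

      ∑-moves : (f : Move n → ℕ) → ∑ᵐᵛ f ≡ ∑ᵛ (λ z → ∑ᵛ (λ x → ∑ᵛ (λ y → f (z , x , y))))
      ∑-moves f = trans (∑-cartesian (fins n) (pairs n) f) (∑-cong (fins n) (λ z → ∑-cartesian (fins n) (fins n) (λ b → f (z , b))))

      leaf-count : ∀ A → IsReal D A → ∑ᵛ (λ x → ∑ᵛ (λ y → 𝟙 (leaf? (gr A) x y))) ≡ bigLeaves A
      leaf-count A r = ∑-cong (fins n) (λ x → trans (∑-cong (fins n) (λ y → 𝟙-× (E? (gr A) x y) (bigLeaf? A x)))
        (trans (∑-*ʳ (fins n) (𝟙 (bigLeaf? A x)) _) (trans (cong (_* 𝟙 (bigLeaf? A x)) (deg (real⇒ D A r) x)) (one x (bigLeaf? A x)))))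
        where
        one : ∀ x (b : Dec (d x ≡ 1 × suc t ≤ volume (gr A) x)) → d x * 𝟙 b ≡ 𝟙 b
        one x (yes (e , _)) = cong (_* 1) e
        one x (no _) = *-zeroʳ (d x)

      leaf≤δ : ∀ A → IsReal D A → ∀ x → ∑ᵛ (λ y → 𝟙 (leaf? (gr A) x y)) ≤ δ x
      leaf≤δ A r x = ≤-trans (∑-mono (fins n) pw) (≤-reflexive (trans (∑-*ˡ (fins n) (𝟙 (branching? x)) _) (cong (𝟙 (branching? x) *_) (deg (real⇒ D A r) x))))
        where
        pw : ∀ y → 𝟙 (leaf? (gr A) x y) ≤ 𝟙 (branching? x) * 𝟙 (E? (gr A) x y)
        pw y = ≤-trans (𝟙-mono (leaf? (gr A) x y) (branching? x ×-dec E? (gr A) x y)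
                 (λ { (e , dx , _) → (λ two → contradiction (trans (sym dx) two) (λ ())) , e })) (≤-reflexive (𝟙-× (branching? x) (E? (gr A) x y)))

      apart-count : ∀ A → IsReal D A → Bounded A → ∀ us →
        bigLeaves A ≤ ∑ᵛ (λ x → ∑ᵛ (λ y → 𝟙 (leaf? (gr A) x y ×-dec apart? (gr A) us x))) + length us * L
      apart-count A r b [] = ≤-trans (≤-reflexive (sym (leaf-count A r))) (≤-trans (∑-mono (fins n) (λ x → ∑-mono (fins n) (λ y → 𝟙-mono (leaf? (gr A) x y) (leaf? (gr A) x y ×-dec apart? (gr A) [] x) (λ l → l , [])))) (≤-reflexive (sym (+-identityʳ _))))
      apart-count A r b (u ∷ us) = begin
          bigLeaves A ≤⟨ apart-count A r b us ⟩
          ∑ᵛ (λ x → ∑ᵛ (λ y → 𝟙 (leaf? g x y ×-dec apart? g us x))) + length us * L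
            ≤⟨ +-monoˡ-≤ (length us * L) (∑-mono (fins n) (λ x → ∑-mono (fins n) (λ y → pw x y (leaf? g x y) (apart? g us x) (conn? g u x)))) ⟩
          ∑ᵛ (λ x → ∑ᵛ (λ y → 𝟙 (leaf? g x y ×-dec apart? g (u ∷ us) x) + 𝟙 (conn? g u x) * 𝟙 (leaf? g x y))) + length us * L
            ≡⟨ cong (_+ length us * L) (trans (∑-cong (fins n) (λ x → trans (∑-+ (fins n) _ _) (cong₂ _+_ refl (∑-*ˡ (fins n) (𝟙 (conn? g u x)) _)))) (∑-+ (fins n) _ _)) ⟩
          X + ∑ᵛ (λ x → 𝟙 (conn? g u x) * ∑ᵛ (λ y → 𝟙 (leaf? g x y))) + length us * L
            ≤⟨ +-monoˡ-≤ (length us * L) (+-monoʳ-≤ X (≤-trans (∑-mono (fins n) (λ x → *-monoʳ-≤ (𝟙 (conn? g u x)) (leaf≤δ A r x))) (b u))) ⟩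
          X + L + length us * L ≡⟨ +-assoc X L _ ⟩
          X + (L + length us * L) ∎
        where
        open ≤-Reasoning
        g = gr A
        X = ∑ᵛ (λ x → ∑ᵛ (λ y → 𝟙 (leaf? g x y ×-dec apart? g (u ∷ us) x)))
        pw : ∀ x y (l : Dec (Leaf g x y)) (a : Dec (Apart g us x)) (c : Dec (Conn g u x)) →
             𝟙 (l ×-dec a) ≤ 𝟙 (leaf? g x y ×-dec apart? g (u ∷ us) x) + 𝟙 c * 𝟙 l
        pw x y (no _) _ _ = z≤n
        pw x y (yes _) (no _) _ = z≤n
        pw x y (yes _) (yes _) (yes _) = m≤n+m 1 _
        pw x y (yes l) (yes a) (no nc) = m≤n⇒m≤n+o 0 (≤-reflexive (sym (𝟙-yes (leaf? g x y ×-dec apart? g (u ∷ us) x) (l , nc ∷ a))))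

      pre-count : ∀ A → IsReal D A → Bounded A → ∀ v zs us → length us ≤ 3 →
        (d v ∸ length zs) * k A ≤ ∑ᵐᵛ (λ m → 𝟙 (pre? (gr A) v zs us m))
      pre-count A r b v zs us us≤3 = ≤-trans (*-mono-≤ zcount xcount) (≤-reflexive (sym (trans (∑-moves _)
          (trans (∑-cong (fins n) (λ z → ∑-cong (fins n) (λ x → trans (∑-cong (fins n) (λ y → 𝟙-× (E? (gr A) v z ×-dec avoids? zs z) _)) (∑-*ˡ (fins n) (𝟙 (E? (gr A) v z ×-dec avoids? zs z)) _))))
            (∑-product (fins n) (fins n) (λ z → 𝟙 (E? (gr A) v z ×-dec avoids? zs z)) (λ x → ∑ᵛ (λ y → 𝟙 (leaf? (gr A) x y ×-dec apart? (gr A) us x))))))))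
        where
        zcount : d v ∸ length zs ≤ ∑ᵛ (λ z → 𝟙 (E? (gr A) v z ×-dec avoids? zs z))
        zcount = m≤n+o⇒m∸n≤o (d v) (length zs) (≤-trans (≤-reflexive (sym (deg (real⇒ D A r) v))) (≤-trans (count-avoiding (E? (gr A) v) zs) (≤-reflexive (+-comm _ (length zs)))))
        xcount : k A ≤ ∑ᵛ (λ x → ∑ᵛ (λ y → 𝟙 (leaf? (gr A) x y ×-dec apart? (gr A) us x)))
        xcount = m≤n+o⇒m∸n≤o (bigLeaves A) (3 * L) (≤-trans (apart-count A r b us) (≤-trans (+-monoʳ-≤ _ (*-monoˡ-≤ L us≤3)) (≤-reflexive (+-comm _ (3 * L)))))

      hang-count : ∀ A → IsReal D A → ∑ᵛ (λ z → ∑ᵛ (λ x → 𝟙 (E? (gr A) x z ×-dec (d x ≟ 1)))) ≤ Mδ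
      hang-count A r = ≤-trans (≤-reflexive (∑-swap (fins n) (fins n) _)) (∑-mono (fins n) (λ x → ≤-trans (∑-mono (fins n) (pw x))
          (≤-reflexive (trans (∑-*ˡ (fins n) (𝟙 (branching? x)) _) (cong (𝟙 (branching? x) *_) (deg (real⇒ D A r) x))))))
        where
        pw : ∀ x z → 𝟙 (E? (gr A) x z ×-dec (d x ≟ 1)) ≤ 𝟙 (branching? x) * 𝟙 (E? (gr A) x z)
        pw x z = ≤-trans (𝟙-mono (E? (gr A) x z ×-dec (d x ≟ 1)) (branching? x ×-dec E? (gr A) x z)
                 (λ { (e , dx) → (λ two → contradiction (trans (sym dx) two) (λ ())) , e })) (≤-reflexive (𝟙-× (branching? x) (E? (gr A) x z)))

      post-count : ∀ A → IsReal D A → ∀ v ys → ∑ᵐᵛ (λ m → 𝟙 (post? (gr A) v ys m)) ≤ ∑ᵛ (λ y → 𝟙 (separates? (gr A) v y ×-dec avoids? ys y)) * Mδ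
      post-count A r v ys = ≤-trans (≤-reflexive (trans (∑-moves _) (trans (∑-cong (fins n) (λ z → ∑-cong (fins n) (λ x → trans (∑-cong (fins n) (λ y → 𝟙-× (separates? (gr A) v y ×-dec avoids? ys y) (hg z x)))
            (∑-*ʳ (fins n) (𝟙 (hg z x)) _)))) (trans (∑-cong (fins n) (λ z → ∑-*ˡ (fins n) σ _)) (∑-*ˡ (fins n) σ _))))) (*-monoʳ-≤ σ (hang-count A r))
        where
        σ = ∑ᵛ (λ y → 𝟙 (separates? (gr A) v y ×-dec avoids? ys y))
        hg : ∀ z x → Dec (E (gr A) x z × d x ≡ 1)
        hg z x = E? (gr A) x z ×-dec (d x ≟ 1)

      apply : Fin n → Move n → Mat n → Mat n
      apply v (z , x , y) = sw v z x y

      Pre₃ : Mat n → Fin n → Move n → Move n → Move n → Set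
      Pre₃ A v m₁ m₂ m₃ = Pre (gr A) v [] (v ∷ []) m₁ × Pre (gr A) v (proj₁ m₁ ∷ []) (v ∷ X m₁ ∷ []) m₂
                        × Pre (gr A) v (proj₁ m₁ ∷ proj₁ m₂ ∷ []) (v ∷ X m₁ ∷ X m₂ ∷ []) m₃
        where
        X : Move n → Fin n
        X m = proj₁ (proj₂ m)

      Post₃ : Mat n → Fin n → Move n → Move n → Move n → Set
      Post₃ A v m₁ m₂ m₃ = Post (gr A) v [] m₁ × Post (gr A) v (yy m₁ ∷ []) m₂ × Post (gr A) v (yy m₂ ∷ yy m₁ ∷ []) m₃
        where
        yy : Move n → Fin n
        yy m = proj₂ (proj₂ m)

      -- All conditions are stated in the original graph. They persist because the three leaves lie
      -- in components apart from each other and from v, so a graft leaves the later ones possible.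
      -- At the end the three hanging branches certify one another as separated.
      grafted : ∀ A v m₁ m₂ m₃ → IsReal D A → Pre₃ A v m₁ m₂ m₃ → let B = apply v m₃ (apply v m₂ (apply v m₁ A)) in IsReal D B × Post₃ B v m₁ m₂ m₃
      grafted A v (z₁ , x₁ , y₁) (z₂ , x₂ , y₂) (z₃ , x₃ , y₃) r
        (((e₁ , _) , l₁ , (a₁ ∷ [])) , ((e₂ , (z₂≢z₁ ∷ [])) , l₂ , (a₂ ∷ a₁₂ ∷ [])) , ((e₃ , (z₃≢z₁ ∷ z₃≢z₂ ∷ [])) , l₃ , (a₃ ∷ a₁₃ ∷ a₂₃ ∷ []))) =
        r₃ , ((sep₁ , []) , at₁‴ , dx₁) , ((sep₂ , (y₂≢y₁ ∷ [])) , at₂‴ , dx₂) , ((sep₃ , (y₃≢y₂ ∷ y₃≢y₁ ∷ [])) , xp′ s₃ , dx₃)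
        where
        g₀ = gr A
        A₁ = sw v z₁ x₁ y₁ A
        A₂ = sw v z₂ x₂ y₂ A₁
        A₃ = sw v z₃ x₃ y₃ A₂
        dx₁ = proj₁ (proj₂ l₁)
        dx₂ = proj₁ (proj₂ l₂)
        dx₃ = proj₁ (proj₂ l₃)
        R₀ = real⇒ D A r
        rs₁ = sw-real D A r e₁ (proj₁ l₁) a₁
        r₁ = proj₁ rs₁
        s₁ = proj₂ rs₁
        R₁ = real⇒ D A₁ r₁
        l₂′ = graft-leaf R₀ s₁ a₂ a₁₂ l₂
        l₃′ = graft-leaf R₀ s₁ a₃ a₁₃ l₃
        a₂′ = graft-apart R₀ s₁ a₂ a₁₂
        a₃′ = graft-apart R₀ s₁ a₃ a₁₃
        a₂₃′ = graft-apart₂ R₀ s₁ a₂ a₁₂ a₂₃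
        rs₂ = sw-real D A₁ r₁ (keep-neighbour R₀ s₁ e₂ z₂≢z₁) (proj₁ l₂′) a₂′
        r₂ = proj₁ rs₂
        s₂ = proj₂ rs₂
        R₂ = real⇒ D A₂ r₂
        l₃″ = graft-leaf R₁ s₂ a₃′ a₂₃′ l₃′
        a₃″ = graft-apart R₁ s₂ a₃′ a₂₃′
        rs₃ = sw-real D A₂ r₂ (keep-neighbour R₁ s₂ (keep-neighbour R₀ s₁ e₃ z₃≢z₁) z₃≢z₂) (proj₁ l₃″) a₃″
        r₃ = proj₁ rs₃
        s₃ = proj₂ rs₃
        R₃ = real⇒ D A₃ r₃
        far : ∀ {x y z} → ¬ Conn g₀ v x → E g₀ x y → E g₀ v z → y ≢ z
        far na ey ez refl = na (ez ◅ return (E-sym g₀ ey))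
        y₂≢y₁ : y₂ ≢ y₁
        y₂≢y₁ refl = a₁₂ (proj₁ l₁ ◅ return (E-sym g₀ (proj₁ l₂)))
        y₃≢y₁ : y₃ ≢ y₁
        y₃≢y₁ refl = a₁₃ (proj₁ l₁ ◅ return (E-sym g₀ (proj₁ l₃)))
        y₃≢y₂ : y₃ ≢ y₂
        y₃≢y₂ refl = a₂₃ (proj₁ l₂ ◅ return (E-sym g₀ (proj₁ l₃)))
        h₁ : Hanging (gr A₃) v y₁
        h₁ = graft-keep R₂ s₃ (far a₁ (proj₁ l₁) e₃) (graft-keep R₁ s₂ (far a₁ (proj₁ l₁) e₂) (graft-new R₀ s₁ l₁))
        h₂ : Hanging (gr A₃) v y₂
        h₂ = graft-keep R₂ s₃ (far a₂ (proj₁ l₂) e₃) (graft-new R₁ s₂ l₂′)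
        h₃ : Hanging (gr A₃) v y₃
        h₃ = graft-new R₂ s₃ l₃″
        sep₁ = hanging-separates (gr A₃) R₃ (y₂≢y₁ ∘ sym) h₁ h₂
        sep₂ = hanging-separates (gr A₃) R₃ y₂≢y₁ h₂ h₁
        sep₃ = hanging-separates (gr A₃) R₃ y₃≢y₁ h₃ h₁
        x≢v : ∀ {x} → ¬ Conn g₀ v x → x ≢ v
        x≢v na refl = na ε
        z≢v : ∀ {z} → E g₀ v z → z ≢ v
        z≢v e = edge-≢ g₀ R₀ e ∘ sym
        x≢x : ∀ {x x′} → ¬ Conn g₀ x x′ → x ≢ x′
        x≢x na refl = na ε
        z≢x : ∀ {z x} → E g₀ v z → ¬ Conn g₀ v x → z ≢ x
        z≢x e na refl = na (return e)
        at₁‴ : E (gr A₃) x₁ z₁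
        at₁‴ = graft-attached R₂ s₃ (graft-attached R₁ s₂ (xp′ s₁) (x≢v a₁) (z≢v e₁) (x≢x a₁₂) (z≢x e₁ a₂)) (x≢v a₁) (z≢v e₁) (x≢x a₁₃) (z≢x e₁ a₃)
        at₂‴ : E (gr A₃) x₂ z₂
        at₂‴ = graft-attached R₂ s₃ (xp′ s₂) (x≢v a₂) (z≢v e₂) (x≢x a₂₃) (z≢x e₂ a₃)

      nested-≥ : {A B C : Set} (as : List A) (bs : List B) (cs : List C) (f : A → ℕ) (g : A → B → ℕ) (h : A → B → C → ℕ) (p q r : ℕ) →
        p ≤ ∑ as f → (∀ a → q ≤ ∑ bs (g a)) → (∀ a b → r ≤ ∑ cs (h a b)) →
        p * (q * r) ≤ ∑ as (λ a → ∑ bs (λ b → ∑ cs (λ c → f a * (g a b * h a b c))))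
      nested-≥ as bs cs f g h p q r hp hq hr = begin
          p * (q * r) ≤⟨ *-monoˡ-≤ (q * r) hp ⟩
          ∑ as f * (q * r) ≡⟨ sym (∑-*ʳ as (q * r) f) ⟩
          ∑ as (λ a → f a * (q * r)) ≤⟨ ∑-mono as (λ a → *-monoʳ-≤ (f a) (inner a)) ⟩
          ∑ as (λ a → f a * ∑ bs (λ b → ∑ cs (λ c → g a b * h a b c)))
            ≡⟨ ∑-cong as (λ a → trans (sym (∑-*ˡ bs (f a) _)) (∑-cong bs (λ b → sym (∑-*ˡ cs (f a) _)))) ⟩
          ∑ as (λ a → ∑ bs (λ b → ∑ cs (λ c → f a * (g a b * h a b c)))) ∎
        where
        open ≤-Reasoning
        inner : ∀ a → q * r ≤ ∑ bs (λ b → ∑ cs (λ c → g a b * h a b c))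
        inner a = ≤-trans (*-monoˡ-≤ r (hq a)) (≤-trans (≤-reflexive (sym (∑-*ʳ bs r (g a))))
          (∑-mono bs (λ b → ≤-trans (*-monoʳ-≤ (g a b) (hr a b)) (≤-reflexive (sym (∑-*ˡ cs (g a b) _))))))

      nested-≤ : {A B C : Set} (as : List A) (bs : List B) (cs : List C) {F : A → Set} {G : A → B → Set}
        (f : ∀ a → Dec (F a)) (g : ∀ a b → Dec (G a b)) (h : A → B → C → ℕ) (p q r : ℕ) →
        ∑ as (λ a → 𝟙 (f a)) ≤ p → (∀ a → F a → ∑ bs (λ b → 𝟙 (g a b)) ≤ q) → (∀ a b → F a → G a b → ∑ cs (h a b) ≤ r) →
        ∑ as (λ a → ∑ bs (λ b → ∑ cs (λ c → 𝟙 (f a) * (𝟙 (g a b) * h a b c)))) ≤ p * (q * r)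
      nested-≤ as bs cs {F} {G} f g h p q r hp hq hr = begin
          ∑ as (λ a → ∑ bs (λ b → ∑ cs (λ c → 𝟙 (f a) * (𝟙 (g a b) * h a b c))))
            ≡⟨ ∑-cong as (λ a → trans (∑-cong bs (λ b → ∑-*ˡ cs (𝟙 (f a)) _)) (∑-*ˡ bs (𝟙 (f a)) _)) ⟩
          ∑ as (λ a → 𝟙 (f a) * ∑ bs (λ b → ∑ cs (λ c → 𝟙 (g a b) * h a b c)))
            ≤⟨ ∑-mono as (λ a → 𝟙*-mono (f a) (f a) (λ fa → fa , inner a fa)) ⟩
          ∑ as (λ a → 𝟙 (f a) * (q * r)) ≡⟨ ∑-*ʳ as (q * r) _ ⟩
          ∑ as (λ a → 𝟙 (f a)) * (q * r) ≤⟨ *-monoˡ-≤ (q * r) hp ⟩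
          p * (q * r) ∎
        where
        open ≤-Reasoning
        inner : ∀ a → F a → ∑ bs (λ b → ∑ cs (λ c → 𝟙 (g a b) * h a b c)) ≤ q * r
        inner a fa = ≤-trans (∑-mono bs (λ b → ≤-trans (≤-reflexive (∑-*ˡ cs (𝟙 (g a b)) _)) (𝟙*-mono (g a b) (g a b) (λ gb → gb , hr a b fa gb))))
                     (≤-trans (≤-reflexive (∑-*ʳ bs r _)) (*-monoˡ-≤ r (hq a fa)))

    module _ (v : Fin n) where

      private
        pre₃ post₃ : Mat n → Move n → Move n → Move n → ℕ
        pre₃ A m₁ m₂ m₃ = 𝟙 (pre? (gr A) v [] (v ∷ []) m₁) * (𝟙 (pre? (gr A) v (proj₁ m₁ ∷ []) (v ∷ proj₁ (proj₂ m₁) ∷ []) m₂)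
          * 𝟙 (pre? (gr A) v (proj₁ m₁ ∷ proj₁ m₂ ∷ []) (v ∷ proj₁ (proj₂ m₁) ∷ proj₁ (proj₂ m₂) ∷ []) m₃))
        post₃ A m₁ m₂ m₃ = 𝟙 (post? (gr A) v [] m₁) * (𝟙 (post? (gr A) v (proj₂ (proj₂ m₁) ∷ []) m₂)
          * 𝟙 (post? (gr A) v (proj₂ (proj₂ m₂) ∷ proj₂ (proj₂ m₁) ∷ []) m₃))

        ∑³ : (Move n → Move n → Move n → ℕ) → ℕ
        ∑³ f = ∑ (moves n) (λ a → ∑ (moves n) (λ b → ∑ (moves n) (λ c → f a b c)))

        ∑³-out : (f : Mat n → Move n → Move n → Move n → ℕ) → ∑ mats (λ A → ∑³ (f A)) ≡ ∑³ (λ a b c → ∑ mats (λ A → f A a b c))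
        ∑³-out f = trans (∑-swap mats (moves n) _) (∑-cong (moves n) (λ a → trans (∑-swap mats (moves n) _) (∑-cong (moves n) (λ b → ∑-swap mats (moves n) _))))

        ∑³-*ˡ : ∀ x f → x * ∑³ f ≡ ∑³ (λ a b c → x * f a b c)
        ∑³-*ˡ x f = trans (sym (∑-*ˡ (moves n) x _)) (∑-cong (moves n) (λ a → trans (sym (∑-*ˡ (moves n) x _)) (∑-cong (moves n) (λ b → sym (∑-*ˡ (moves n) x _)))))

        wpre wpost : Mat n → Move n → Move n → Move n → ℕ
        wpre A a b c = 𝟙 (isReal? D A) * (𝟙 (bounded? A) * pre₃ A a b c)
        wpost A a b c = 𝟙 (isReal? D A) * post₃ A a b c

        pw : ∀ A a b c → wpre A a b c ≤ wpost (apply v c (apply v b (apply v a A))) a b c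
        pw A a b c = go (isReal? D A) (pre? (gr A) v [] (v ∷ []) a) (pre? (gr A) v (proj₁ a ∷ []) (v ∷ proj₁ (proj₂ a) ∷ []) b)
                        (pre? (gr A) v (proj₁ a ∷ proj₁ b ∷ []) (v ∷ proj₁ (proj₂ a) ∷ proj₁ (proj₂ b) ∷ []) c)
          where
          A′ = apply v c (apply v b (apply v a A))
          zero-out : ∀ x → 1 * (x * 0) ≤ wpost A′ a b c
          zero-out x = ≤-trans (≤-reflexive (cong (1 *_) (*-zeroʳ x))) z≤n
          go : ∀ {P Q R} (r : Dec (IsReal D A)) (p : Dec P) (q : Dec Q) (s : Dec R) →
               {{P ≡ Pre (gr A) v [] (v ∷ []) a}} → {{Q ≡ Pre (gr A) v (proj₁ a ∷ []) (v ∷ proj₁ (proj₂ a) ∷ []) b}} →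
               {{R ≡ Pre (gr A) v (proj₁ a ∷ proj₁ b ∷ []) (v ∷ proj₁ (proj₂ a) ∷ proj₁ (proj₂ b) ∷ []) c}} →
               𝟙 r * (𝟙 (bounded? A) * (𝟙 p * (𝟙 q * 𝟙 s))) ≤ wpost A′ a b c
          go (no _) _ _ _ = z≤n
          go (yes _) (no _) _ _ = zero-out (𝟙 (bounded? A))
          go (yes _) (yes _) (no _) _ = zero-out (𝟙 (bounded? A))
          go (yes _) (yes _) (yes _) (no _) = zero-out (𝟙 (bounded? A))
          go (yes r) (yes p) (yes q) (yes s) {{refl}} {{refl}} {{refl}} = ≤-trans (*-monoʳ-≤ 1 (*-monoˡ-≤ 1 (𝟙≤1 (bounded? A)))) (≤-reflexive (sym (cong₂ _*_ (𝟙-yes (isReal? D A′) (proj₁ gf))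
              (cong₂ _*_ (𝟙-yes (post? (gr A′) v [] a) (proj₁ (proj₂ gf))) (cong₂ _*_ (𝟙-yes (post? (gr A′) v (proj₂ (proj₂ a) ∷ []) b) (proj₁ (proj₂ (proj₂ gf))))
                (𝟙-yes (post? (gr A′) v (proj₂ (proj₂ b) ∷ proj₂ (proj₂ a) ∷ []) c) (proj₂ (proj₂ (proj₂ gf)))))))))
            where
            gf = grafted A v a b c r (p , q , s)

        s : Mat n → ℕ
        s A = sepDeg (gr A) v

        lower : ∀ A → IsReal D A → 𝟙 (bounded? A) * ((d v * k A) * (((d v ∸ 1) * k A) * ((d v ∸ 2) * k A))) ≤ 𝟙 (bounded? A) * ∑³ (pre₃ A)
        lower A r = 𝟙*-mono (bounded? A) (bounded? A) (λ b → b , nested-≥ (moves n) (moves n) (moves n) _ _ _ _ _ _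
            (pre-count A r b v [] (v ∷ []) (s≤s z≤n))
            (λ m₁ → pre-count A r b v (proj₁ m₁ ∷ []) (v ∷ proj₁ (proj₂ m₁) ∷ []) (s≤s (s≤s z≤n)))
            (λ m₁ m₂ → pre-count A r b v (proj₁ m₁ ∷ proj₁ m₂ ∷ []) (v ∷ proj₁ (proj₂ m₁) ∷ proj₁ (proj₂ m₂) ∷ []) (s≤s (s≤s (s≤s z≤n)))))

        upper : ∀ A → IsReal D A → ∑³ (post₃ A) ≤ (s A * Mδ) * (((s A ∸ 1) * Mδ) * ((s A ∸ 2) * Mδ))
        upper A r = nested-≤ (moves n) (moves n) (moves n) (post? (gr A) v []) (λ a b → post? (gr A) v (proj₂ (proj₂ a) ∷ []) b) _ _ _ _
            (≤-trans (post-count A r v []) (*-monoˡ-≤ Mδ σ₀))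
            (λ { (_ , _ , y₁) ((sp , _) , _) → ≤-trans (post-count A r v (y₁ ∷ [])) (*-monoˡ-≤ Mδ (σ₁ y₁ sp)) })
            (λ { (_ , _ , y₁) (_ , _ , y₂) ((sp , _) , _) ((sp′ , av) , _) → ≤-trans (post-count A r v (y₂ ∷ y₁ ∷ [])) (*-monoˡ-≤ Mδ (σ₂ y₁ y₂ sp sp′ av)) })
          where
          σ : List (Fin n) → ℕ
          σ ys = ∑ᵛ (λ y → 𝟙 (separates? (gr A) v y ×-dec avoids? ys y))
          σ₀ : σ [] ≤ s A
          σ₀ = ∑-mono (fins n) (λ y → 𝟙-mono (separates? (gr A) v y ×-dec avoids? [] y) (separates? (gr A) v y) proj₁)
          σ₁′ : ∀ y → Separates (gr A) v y → suc (σ (y ∷ [])) ≤ s A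
          σ₁′ y sp = ≤-trans (count-rest (separates? (gr A) v) sp []) σ₀
          σ₁ : ∀ y → Separates (gr A) v y → σ (y ∷ []) ≤ s A ∸ 1
          σ₁ y sp = ∸-monoˡ-≤ 1 (σ₁′ y sp)
          σ₂ : ∀ y y′ → Separates (gr A) v y → Separates (gr A) v y′ → Avoids (y ∷ []) y′ → σ (y′ ∷ y ∷ []) ≤ s A ∸ 2
          σ₂ y y′ sp sp′ av = ∸-monoˡ-≤ 2 (≤-trans (s≤s (count-rest (separates? (gr A) v) sp′ av)) (σ₁′ y sp))

        s≤d : ∀ A → IsReal D A → s A ≤ d v
        s≤d A r = ≤-trans (∑-mono (fins n) (λ z → 𝟙-mono (separates? (gr A) v z) (E? (gr A) v z) proj₁)) (≤-reflexive (deg (real⇒ D A r) v))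

        main : ∑ᴿ (λ A → 𝟙 (bounded? A) * ((d v * k A) * (((d v ∸ 1) * k A) * ((d v ∸ 2) * k A)))) ≤ ∑ᴿ (λ A → (s A * Mδ) * (((s A ∸ 1) * Mδ) * ((s A ∸ 2) * Mδ)))
        main = begin
            ∑ᴿ (λ A → 𝟙 (bounded? A) * ((d v * k A) * (((d v ∸ 1) * k A) * ((d v ∸ 2) * k A)))) ≤⟨ ∑ᴿ-mono lower ⟩
            ∑ᴿ (λ A → 𝟙 (bounded? A) * ∑³ (pre₃ A)) ≡⟨ ∑-cong mats (λ A → trans (cong (𝟙 (isReal? D A) *_) (∑³-*ˡ (𝟙 (bounded? A)) (pre₃ A))) (∑³-*ˡ (𝟙 (isReal? D A)) _)) ⟩
            ∑ mats (λ A → ∑³ (wpre A)) ≡⟨ ∑³-out wpre ⟩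
            ∑³ (λ a b c → ∑ mats (λ A → wpre A a b c)) ≤⟨ ∑-mono (moves n) (λ a → ∑-mono (moves n) (λ b → ∑-mono (moves n) (λ c → step a b c))) ⟩
            ∑³ (λ a b c → ∑ mats (λ A → wpost A a b c)) ≡⟨ sym (∑³-out wpost) ⟩
            ∑ mats (λ A → ∑³ (wpost A)) ≡⟨ ∑-cong mats (λ A → sym (∑³-*ˡ (𝟙 (isReal? D A)) (post₃ A))) ⟩
            ∑ᴿ (λ A → ∑³ (post₃ A)) ≤⟨ ∑ᴿ-mono upper ⟩
            ∑ᴿ (λ A → (s A * Mδ) * (((s A ∸ 1) * Mδ) * ((s A ∸ 2) * Mδ))) ∎
          where
          open ≤-Reasoning
          invariant : ∀ m (f : Mat n → ℕ) → ∑ mats f ≡ ∑ mats (f ∘ apply v m)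
          invariant (z , x , y) f = ∑-sw v z x y D f
          step : ∀ a b c → ∑ mats (λ A → wpre A a b c) ≤ ∑ mats (λ A → wpost A a b c)
          step a b c = ≤-trans (∑-mono mats (λ A → pw A a b c)) (≤-reflexive (sym (trans (invariant c W) (trans (invariant b (W ∘ apply v c)) (invariant a (W ∘ apply v c ∘ apply v b))))))
            where
            W : Mat n → ℕ
            W A = wpost A a b c

      -- Counting triples of grafts sets d(d-1)(d-2) k³ against s(s-1)(s-2) M³, where s is the
      -- number of separating edges at v. As s is at most d, two factors cancel, and the remaining s
      -- - 2 is what `separator-branching` bounds.
      vertex-leaves : (d v ∸ 2) * ∑ᴿ (λ A → 𝟙 (bounded? A) * (k A * k A * k A)) ≤ Mδ * Mδ * Mδ * ∑ᴿ (λ A → s A ∸ 2)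
      vertex-leaves with d v in dv
      ... | zero = z≤n
      ... | suc zero = z≤n
      ... | suc (suc e) = *-cancelˡ-≤ (suc (suc e) * suc e) (begin
            suc (suc e) * suc e * (e * ∑ᴿ (λ A → 𝟙 (bounded? A) * (k A * k A * k A))) ≡⟨ sym (*-assoc (suc (suc e) * suc e) e _) ⟩
            suc (suc e) * suc e * e * ∑ᴿ (λ A → 𝟙 (bounded? A) * (k A * k A * k A)) ≡⟨ sym (∑ᴿ-*ˡ (suc (suc e) * suc e * e) _) ⟩
            ∑ᴿ (λ A → suc (suc e) * suc e * e * (𝟙 (bounded? A) * (k A * k A * k A))) ≡⟨ ∑-cong mats (λ A → cong (𝟙 (isReal? D A) *_) (eq₁ (suc (suc e)) (suc e) e (𝟙 (bounded? A)) (k A))) ⟩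
            ∑ᴿ (λ A → 𝟙 (bounded? A) * ((suc (suc e) * k A) * ((suc e * k A) * (e * k A)))) ≤⟨ subst (λ x → ∑ᴿ (λ A → 𝟙 (bounded? A) * ((x * k A) * (((x ∸ 1) * k A) * ((x ∸ 2) * k A)))) ≤ ∑ᴿ (λ A → (s A * Mδ) * (((s A ∸ 1) * Mδ) * ((s A ∸ 2) * Mδ)))) dv main ⟩
            ∑ᴿ (λ A → (s A * Mδ) * (((s A ∸ 1) * Mδ) * ((s A ∸ 2) * Mδ))) ≤⟨ ∑ᴿ-mono (λ A r → ≤-trans (*-mono-≤ (*-monoˡ-≤ Mδ (s≤ A r)) (*-monoˡ-≤ ((s A ∸ 2) * Mδ) (*-monoˡ-≤ Mδ (∸-monoˡ-≤ 1 (s≤ A r))))) (≤-reflexive (eq₂ (suc (suc e)) (suc e) Mδ (s A ∸ 2)))) ⟩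
            ∑ᴿ (λ A → suc (suc e) * suc e * (Mδ * Mδ * Mδ) * (s A ∸ 2)) ≡⟨ ∑ᴿ-*ˡ (suc (suc e) * suc e * (Mδ * Mδ * Mδ)) _ ⟩
            suc (suc e) * suc e * (Mδ * Mδ * Mδ) * ∑ᴿ (λ A → s A ∸ 2) ≡⟨ *-assoc (suc (suc e) * suc e) (Mδ * Mδ * Mδ) _ ⟩
            suc (suc e) * suc e * (Mδ * Mδ * Mδ * ∑ᴿ (λ A → s A ∸ 2)) ∎)
        where
        open ≤-Reasoning
        s≤ : ∀ A → IsReal D A → s A ≤ suc (suc e)
        s≤ A r = subst (s A ≤_) dv (s≤d A r)
        eq₁ : ∀ a b c w k → a * b * c * (w * (k * k * k)) ≡ w * ((a * k) * ((b * k) * (c * k)))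
        eq₁ = solve-∀
        eq₂ : ∀ a b m z → (a * m) * ((b * m) * (z * m)) ≡ a * b * (m * m * m) * z
        eq₂ = solve-∀

    -- Grafting three large components onto one vertex creates a branching of separating edges,
    -- of which any graph has few.
    few-big-leaves : t * (∑ᵛ (λ v → d v ∸ 2) * ∑ᴿ (λ A → 𝟙 (bounded? A) * (k A * k A * k A))) ≤ Mδ * Mδ * Mδ * (Mδ * Tot)
    few-big-leaves = begin
        t * (∑ᵛ (λ v → d v ∸ 2) * K) ≡⟨ cong (t *_) (sym (∑-*ʳ (fins n) K _)) ⟩
        t * ∑ᵛ (λ v → (d v ∸ 2) * K) ≤⟨ *-monoʳ-≤ t (∑-mono (fins n) vertex-leaves) ⟩
        t * ∑ᵛ (λ v → Mδ * Mδ * Mδ * ∑ᴿ (λ A → sepDeg (gr A) v ∸ 2)) ≡⟨ cong (t *_) (∑-*ˡ (fins n) (Mδ * Mδ * Mδ) _) ⟩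
        t * (Mδ * Mδ * Mδ * ∑ᵛ (λ v → ∑ᴿ (λ A → sepDeg (gr A) v ∸ 2))) ≡⟨ eq t (Mδ * Mδ * Mδ) _ ⟩
        Mδ * Mδ * Mδ * (t * ∑ᵛ (λ v → ∑ᴿ (λ A → sepDeg (gr A) v ∸ 2)))
          ≡⟨ cong (λ z → Mδ * Mδ * Mδ * (t * z)) (trans (∑-swap (fins n) mats _) (∑-cong mats (λ A → ∑-*ˡ (fins n) (𝟙 (isReal? D A)) _))) ⟩
        Mδ * Mδ * Mδ * (t * ∑ᴿ (λ A → ∑ᵛ (λ v → sepDeg (gr A) v ∸ 2))) ≡⟨ cong (Mδ * Mδ * Mδ *_) (sym (∑ᴿ-*ˡ t _)) ⟩
        Mδ * Mδ * Mδ * ∑ᴿ (λ A → t * ∑ᵛ (λ v → sepDeg (gr A) v ∸ 2)) ≤⟨ *-monoʳ-≤ (Mδ * Mδ * Mδ) (∑ᴿ-mono (λ A r → separator-branching (gr A) (real⇒ D A r))) ⟩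
        Mδ * Mδ * Mδ * ∑ᴿ (λ _ → Mδ) ≡⟨ cong (Mδ * Mδ * Mδ *_) (∑ᴿ-const Mδ) ⟩
        Mδ * Mδ * Mδ * (Mδ * Tot) ∎
      where
      open ≤-Reasoning
      K = ∑ᴿ (λ A → 𝟙 (bounded? A) * (k A * k A * k A))
      eq : ∀ a b c → a * (b * c) ≡ b * (a * c)
      eq = solve-∀

  -- Cycle-closing edges and two-edge cuts

  ∑-filter : {A : Set} {P : A → Set} (P? : ∀ x → Dec (P x)) (xs : List A) (f : A → ℕ) → ∑ (filter P? xs) f ≡ ∑ xs (λ x → 𝟙 (P? x) * f x)
  ∑-filter P? [] f = refl
  ∑-filter P? (x ∷ xs) f with P? x
  ... | yes _ = cong₂ _+_ (sym (*-identityˡ (f x))) (∑-filter P? xs f)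
  ... | no _ = ∑-filter P? xs f

  ∑-cong-∈ : {A : Set} (xs : List A) {f g : A → ℕ} → (∀ x → x ∈ xs → f x ≡ g x) → ∑ xs f ≡ ∑ xs g
  ∑-cong-∈ [] e = refl
  ∑-cong-∈ (x ∷ xs) e = cong₂ _+_ (e x (here refl)) (∑-cong-∈ xs (λ x m → e x (there m)))

  ∑-mono-∈ : {A : Set} (xs : List A) {f g : A → ℕ} → (∀ x → x ∈ xs → f x ≤ g x) → ∑ xs f ≤ ∑ xs g
  ∑-mono-∈ [] e = z≤n
  ∑-mono-∈ (x ∷ xs) e = +-mono-≤ (e x (here refl)) (∑-mono-∈ xs (λ x m → e x (there m)))

  ∑-exclusive : {A : Set} {P : A → Set} (P? : ∀ x → Dec (P x)) (xs : List A) → Unique xs →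
                (∀ {x y} → x ∈ xs → y ∈ xs → x ≢ y → P x → P y → ⊥) → ∑ xs (λ x → 𝟙 (P? x)) ≤ 1
  ∑-exclusive P? [] u ex = z≤n
  ∑-exclusive {P = P} P? (x ∷ xs) (fresh ∷ u) ex = go (P? x)
    where
    go : (p : Dec (P x)) → 𝟙 p + ∑ xs (λ x → 𝟙 (P? x)) ≤ 1
    go (no _) = ∑-exclusive P? xs u (λ p q → ex (there p) (there q))
    go (yes px) = ≤-reflexive (cong suc (trans (∑-cong-∈ xs (λ y m → 𝟙-no (P? y) (λ py → ex (here refl) (there m) (All.lookup fresh m) px py))) (∑-0 xs)))

  -- The edges of a list, added from the end, that join two components (tr) or close a cycle (nt).
  module _ {n : ℕ} (base : List (Fin n × Fin n)) where

    tr nt : List (Fin n × Fin n) → List (Fin n × Fin n)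
    tr-step nt-step : ∀ e xs → Dec (Joins (xs ++ base) e) → List (Fin n × Fin n)
    tr [] = []
    tr (e ∷ xs) = tr-step e xs (joins? (xs ++ base) e)
    tr-step e xs (yes _) = e ∷ tr xs
    tr-step e xs (no _) = tr xs
    nt [] = []
    nt (e ∷ xs) = nt-step e xs (joins? (xs ++ base) e)
    nt-step e xs (yes _) = nt xs
    nt-step e xs (no _) = e ∷ nt xs

    tr⊆ : ∀ xs {e} → e ∈ tr xs → e ∈ xs
    tr⊆ (f ∷ xs) p = go (joins? (xs ++ base) f) p
      where
      go : ∀ j {e} → e ∈ tr-step f xs j → e ∈ f ∷ xs
      go (yes _) (here r) = here r
      go (yes _) (there q) = there (tr⊆ xs q)
      go (no _) q = there (tr⊆ xs q)

    nt⊆ : ∀ xs {e} → e ∈ nt xs → e ∈ xs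
    nt⊆ (f ∷ xs) p = go (joins? (xs ++ base) f) p
      where
      go : ∀ j {e} → e ∈ nt-step f xs j → e ∈ f ∷ xs
      go (yes _) q = there (nt⊆ xs q)
      go (no _) (here r) = here r
      go (no _) (there q) = there (nt⊆ xs q)

    nt-unique : ∀ xs → Unique xs → Unique (nt xs)
    nt-unique [] u = u
    nt-unique (f ∷ xs) (fresh ∷ u) = go (joins? (xs ++ base) f)
      where
      go : ∀ j → Unique (nt-step f xs j)
      go (yes _) = nt-unique xs u
      go (no _) = All.tabulate (λ q → All.lookup fresh (nt⊆ xs q)) ∷ nt-unique xs u

    nt-tr-disjoint : ∀ xs → Unique xs → ∀ {e f} → e ∈ nt xs → f ∈ tr xs → e ≢ f
    nt-tr-disjoint (h ∷ xs) (fresh ∷ u) p q = go (joins? (xs ++ base) h) p q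
      where
      go : ∀ j {e f} → e ∈ nt-step h xs j → f ∈ tr-step h xs j → e ≢ f
      go (yes _) p (here refl) refl = All.lookup fresh (nt⊆ xs p) refl
      go (yes _) p (there q) = nt-tr-disjoint xs u p q
      go (no _) (here refl) q refl = All.lookup fresh (tr⊆ xs q) refl
      go (no _) (there p) q = nt-tr-disjoint xs u p q

    tr-spans : ∀ xs {a b} → Star (Adj (xs ++ base)) a b → Star (Adj (tr xs ++ base)) a b
    tr-spans [] c = c
    tr-spans ((a , b) ∷ xs) = go (joins? (xs ++ base) (a , b))
      where
      go : ∀ j {i k} → Star (Adj ((a , b) ∷ xs ++ base)) i k → Star (Adj (tr-step (a , b) xs j ++ base)) i k
      go (yes _) = kleisliStar id λ { (inj₁ (here r)) → return (inj₁ (here r)) ; (inj₂ (here r)) → return (inj₂ (here r))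
                                    ; (inj₁ (there p)) → star-there (tr-spans xs (return (inj₁ p))) ; (inj₂ (there p)) → star-there (tr-spans xs (return (inj₂ p))) }
      go (no nj) = kleisliStar id λ { (inj₁ (here refl)) → eq (lab (xs ++ base) a ≟ᶠ lab (xs ++ base) b) ; (inj₂ (here refl)) → reverse (adj-sym _) (eq (lab (xs ++ base) a ≟ᶠ lab (xs ++ base) b))
                                    ; (inj₁ (there p)) → tr-spans xs (return (inj₁ p)) ; (inj₂ (there p)) → tr-spans xs (return (inj₂ p)) }
        where
        eq : Dec (lab (xs ++ base) a ≡ lab (xs ++ base) b) → Star (Adj (tr xs ++ base)) a b
        eq (yes r) = tr-spans xs (lab-sound (xs ++ base) r)
        eq (no ne) = contradiction ne nj

    forest-tr : ∀ {W : Fin n → Set} (W? : ∀ v → Dec (W v)) xs →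
      ∑ xs (λ e → 𝟙 (W? (proj₁ e))) + forest W? base ≤ forest W? (xs ++ base) + length (nt xs)
    forest-tr W? [] = ≤-reflexive (sym (+-identityʳ _))
    forest-tr W? (e ∷ xs) = go (joins? (xs ++ base) e)
      where
      w = 𝟙 (W? (proj₁ e))
      rest = ∑ xs (λ e → 𝟙 (W? (proj₁ e)))
      F = forest W? (xs ++ base)
      go : ∀ j → w + rest + forest W? base ≤ w * 𝟙 j + F + length (nt-step e xs j)
      go (yes _) = ≤-trans (≤-reflexive (+-assoc w rest _)) (≤-trans (+-monoʳ-≤ w (forest-tr W? xs)) (≤-reflexive (trans (sym (+-assoc w F _)) (cong (λ k → k + F + length (nt xs)) (sym (*-identityʳ w))))))
      go (no _) = ≤-trans (≤-reflexive (+-assoc w rest _)) (≤-trans (+-mono-≤ (𝟙≤1 (W? (proj₁ e))) (forest-tr W? xs)) (≤-reflexive (trans (sym (+-suc F _)) (cong (_+ suc (length (nt xs))) (sym (cong (_+ F) (*-zeroʳ w)))))))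

  module Cycles {n : ℕ} (d : Fin n → ℕ) where

    open Degrees d

    -- Cutting e turns the non-bridge f into a bridge, i.e. {e, f} is a 2-edge-cut.
    Mate : Graph n → Fin n → Fin n → Fin n → Fin n → Set
    Mate g u p a b = Conn (del g a b) a b × ¬ Conn (del (del g u p) a b) a b

    mate? : ∀ g u p a b → Dec (Mate g u p a b)
    mate? g u p a b = conn? (del g a b) a b ×-dec ¬? (conn? (del (del g u p) a b) a b)

    mates : Graph n → Fin n → Fin n → ℕ
    mates g u p = ∑ʰ g (λ a b → 𝟙 (mate? g u p a b))

    -- If ij formed a 2-edge-cut with ab and with cd, then ab and cd would form one themselves; but
    -- deleting both leaves all connections intact.
    mate-exclusive : ∀ (g : Graph n) {a b c d i j} → E g c d → ¬ Same c d a b →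
      (∀ {v w} → Conn g v w → Conn (del (del g a b) c d) v w) → Mate g a b i j → Mate g c d i j → ⊥
    mate-exclusive g {a} {b} {c} {d} {i} {j} ecd ne spans (nonbridge , m₁) (_ , m₂) with same? c d i j
    ... | yes (inj₁ (refl , refl)) = m₁ (spans (return ecd))
    ... | yes (inj₂ (refl , refl)) = m₁ (conn-sub (del (del g a b) c d) (del (del g a b) d c) (λ { (e , ns) → e , (λ { (inj₁ r) → ns (inj₂ r) ; (inj₂ r) → ns (inj₁ r) }) }) (spans (return (E-sym g ecd))))
    ... | no ncd = m₂ (conv replace nonbridge)
      where
      K : Graph n
      K = del (del (del g a b) c d) i j
      K⊆₁ : ∀ {v w} → Conn K v w → Conn (del (del g a b) i j) v w
      K⊆₁ = conn-sub K (del (del g a b) i j) (λ { ((e , _) , ns) → e , ns })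
      K⊆₂ : ∀ {v w} → Conn K v w → Conn (del (del g c d) i j) v w
      K⊆₂ = conn-sub K (del (del g c d) i j) (λ { (((e , _) , ns) , ns′) → (e , ns) , ns′ })
      back : ∀ {v w} → Conn (del (del g a b) i j) v w → Conn (del (del g a b) i j) w v
      back = conn-sym (del (del g a b) i j)
      cd : E (del (del g a b) i j) c d
      cd = (ecd , ne) , ncd
      cd-in-K : Conn K c d
      cd-in-K with star-add {R = E (del (del g a b) c d)} {R′ = E K} i j (λ {v} {w} e → dec e (same? v w i j)) (spans (return ecd))
        where
        dec : ∀ {v w} → E (del (del g a b) c d) v w → Dec (Same v w i j) → E K v w ⊎ Same v w i j
        dec e (yes s) = inj₂ s
        dec e (no ns) = inj₁ (e , ns)
      ... | inj₁ k = k
      ... | inj₂ (inj₁ (ci , jd)) = contradiction (back (K⊆₁ ci) ◅◅ (cd ◅ back (K⊆₁ jd))) m₁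
      ... | inj₂ (inj₂ (cj , id′)) = contradiction (K⊆₁ id′ ◅◅ (E-sym (del (del g a b) i j) cd ◅ K⊆₁ cj)) m₁
      replace : ∀ {v w} → E (del g i j) v w → Conn (del (del g c d) i j) v w
      replace {v} {w} (e , ns) with same? v w c d
      ... | no nvw = return ((e , nvw) , ns)
      ... | yes (inj₁ (refl , refl)) = K⊆₂ cd-in-K
      ... | yes (inj₂ (refl , refl)) = conn-sym (del (del g c d) i j) (K⊆₂ cd-in-K)

    module _ (g : Graph n) (real : Realizes d g) where

      private
        oriented? : ∀ (e : Fin n × Fin n) → Dec (toℕ (proj₁ e) < toℕ (proj₂ e) × E g (proj₁ e) (proj₂ e))
        oriented? (a , b) = (toℕ a <? toℕ b) ×-dec E? g a b

        Outer : Fin n × Fin n → Set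
        Outer (a , b) = Branching a ⊎ Branching b

        outer? : ∀ e → Dec (Outer e)
        outer? (a , b) = branching? a ⊎-dec branching? b

        all-edges outer inner : List (Fin n × Fin n)
        all-edges = filter oriented? (pairs n)
        outer = filter outer? all-edges
        inner = filter (λ e → ¬? (outer? e)) all-edges

      -- Edges at branching vertices closing a cycle; the inner edges of suppressed paths come first.
      extra : List (Fin n × Fin n)
      extra = nt inner outer

      private
        all-edge : ∀ {e} → e ∈ all-edges → toℕ (proj₁ e) < toℕ (proj₂ e) × E g (proj₁ e) (proj₂ e)
        all-edge p = proj₂ (∈-filter⁻ oriented? {xs = pairs n} p)

        outer-edge : ∀ {e} → e ∈ outer → (toℕ (proj₁ e) < toℕ (proj₂ e) × E g (proj₁ e) (proj₂ e)) × Outer e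
        outer-edge p = all-edge (proj₁ (∈-filter⁻ outer? {xs = all-edges} p)) , proj₂ (∈-filter⁻ outer? {xs = all-edges} p)

        inner-edge : ∀ {e} → e ∈ inner → (toℕ (proj₁ e) < toℕ (proj₂ e) × E g (proj₁ e) (proj₂ e)) × ¬ Outer e
        inner-edge p = all-edge (proj₁ (∈-filter⁻ (λ e → ¬? (outer? e)) {xs = all-edges} p)) , proj₂ (∈-filter⁻ (λ e → ¬? (outer? e)) {xs = all-edges} p)

        all-unique : Unique all-edges
        all-unique = filter⁺ oriented? (pairs-unique n)

        outer-unique : Unique outer
        outer-unique = filter⁺ outer? all-unique

        inner-unique : Unique inner
        inner-unique = filter⁺ (λ e → ¬? (outer? e)) all-unique

        edge-in-list : ∀ {i j} → E g i j → Adj (outer ++ inner) i j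
        edge-in-list {i} {j} e = go (<-cmp (toℕ i) (toℕ j))
          where
          place : ∀ {i j} → toℕ i < toℕ j → E g i j → (i , j) ∈ outer ++ inner
          place {i} {j} lt e with outer? (i , j)
          ... | yes o = ∈-++⁺ˡ (∈-filter⁺ outer? (∈-filter⁺ oriented? (∈-cartesianProduct⁺ (∈fins i) (∈fins j)) (lt , e)) o)
          ... | no no′ = ∈-++⁺ʳ outer (∈-filter⁺ (λ e → ¬? (outer? e)) (∈-filter⁺ oriented? (∈-cartesianProduct⁺ (∈fins i) (∈fins j)) (lt , e)) no′)
          go : Tri (toℕ i < toℕ j) (toℕ i ≡ toℕ j) (toℕ j < toℕ i) → Adj (outer ++ inner) i j
          go (tri< lt _ _) = inj₁ (place lt e)
          go (tri> _ _ gt) = inj₂ (place gt (E-sym g e))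
          go (tri≈ _ eq _) = contradiction (toℕ-injective eq) (edge-≢ g real e)

        list-edge : ∀ {e} → e ∈ outer ++ inner → toℕ (proj₁ e) < toℕ (proj₂ e) × E g (proj₁ e) (proj₂ e)
        list-edge p = [ proj₁ ∘ outer-edge , proj₁ ∘ inner-edge ]′ (∈-++⁻ outer p)

        tree-avoids : ∀ {a b i j} → (a , b) ∈ extra → (i , j) ∈ tr inner outer ++ inner → E g i j × ¬ Same i j a b
        tree-avoids {a} {b} {i} {j} p q = proj₂ ij , (λ { (inj₁ (refl , refl)) → ne q refl ; (inj₂ (refl , refl)) → <-asym (proj₁ (proj₁ (outer-edge ab))) (proj₁ ij) })
          where
          ab : (a , b) ∈ outer
          ab = nt⊆ inner outer p
          ij : toℕ i < toℕ j × E g i j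
          ij = [ (λ r → proj₁ (outer-edge (tr⊆ inner outer r))) , (λ r → proj₁ (inner-edge r)) ]′ (∈-++⁻ (tr inner outer) q)
          ne : ∀ {f} → f ∈ tr inner outer ++ inner → (a , b) ≢ f
          ne r with ∈-++⁻ (tr inner outer) r
          ... | inj₁ r′ = nt-tr-disjoint inner outer outer-unique p r′
          ... | inj₂ r′ = λ { refl → proj₂ (inner-edge r′) (proj₂ (outer-edge ab)) }

        spanning : ∀ {v w} → Conn g v w → Star (Adj (tr inner outer ++ inner)) v w
        spanning c = tr-spans inner outer (conv (λ e → return (edge-in-list e)) c)

      extra-edge : ∀ {a b} → (a , b) ∈ extra → E g a b × Outer (a , b)
      extra-edge p = proj₂ (proj₁ (outer-edge (nt⊆ inner outer p))) , proj₂ (outer-edge (nt⊆ inner outer p))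

      extra-unique : Unique extra
      extra-unique = nt-unique inner outer outer-unique

      extra-oriented : ∀ {a b} → (a , b) ∈ extra → toℕ a < toℕ b
      extra-oriented p = proj₁ (proj₁ (outer-edge (nt⊆ inner outer p)))

      extra-nonbridge : ∀ {a b} → (a , b) ∈ extra → Conn (del g a b) a b
      extra-nonbridge {a} {b} p = conv (λ { (inj₁ q) → return (tree-avoids p q) ; (inj₂ q) → return (E-sym (del g a b) (tree-avoids p q)) }) (spanning (return (proj₁ (extra-edge p))))

      extra-spans : ∀ {a b c d} → (a , b) ∈ extra → (c , d) ∈ extra → ∀ {v w} → Conn g v w → Conn (del (del g a b) c d) v w
      extra-spans {a} {b} {c} {d} p p′ k = conv (λ { (inj₁ q) → return (both q) ; (inj₂ q) → return (E-sym (del (del g a b) c d) (both q)) }) (spanning k)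
        where
        both : ∀ {i j} → (i , j) ∈ tr inner outer ++ inner → E (del (del g a b) c d) i j
        both q = tree-avoids p q , proj₂ (tree-avoids p′ q)

      extra-distinct : ∀ {a b c d} → (a , b) ∈ extra → (c , d) ∈ extra → (a , b) ≢ (c , d) → ¬ Same c d a b
      extra-distinct p q ne (inj₁ (refl , refl)) = ne refl
      extra-distinct p q ne (inj₂ (refl , refl)) = <-asym (proj₁ (proj₁ (outer-edge (nt⊆ inner outer p)))) (proj₁ (proj₁ (outer-edge (nt⊆ inner outer q))))

      -- Two edges of `extra` avoid a common spanning subgraph, so they can be deleted together.
      -- Hence each half-edge is a mate of at most one of them, and all mates together are at most
      -- the half-edges.
      few-mates : ∑ extra (λ e → mates g (proj₁ e) (proj₂ e)) ≤ Mδ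
      few-mates = ≤-trans (≤-reflexive (trans (∑-swap extra (fins n) _) (∑-cong (fins n) (λ a → trans (∑-swap extra (fins n) _) (∑-cong (fins n) (λ b → ∑-*ˡ extra (𝟙 (branching? a) * 𝟙 (E? g a b)) _))))))
        (≤-trans (∑-mono (fins n) (λ a → ∑-mono (fins n) (λ b → *-monoʳ-≤ (𝟙 (branching? a) * 𝟙 (E? g a b)) (once a b)))) (≤-reflexive (∑ʰ-1 g real)))
        where
        once : ∀ a b → ∑ extra (λ e → 𝟙 (mate? g (proj₁ e) (proj₂ e) a b)) ≤ 1
        once a b = ∑-exclusive (λ e → mate? g (proj₁ e) (proj₂ e) a b) extra extra-unique
          (λ p q ne m m′ → mate-exclusive g (proj₁ (extra-edge q)) (extra-distinct p q ne) (extra-spans p q) m m′)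

      private
        J : Graph n
        J = record
          { E = λ i j → E g i j × ¬ Branching i × ¬ Branching j
          ; E? = λ i j → E? g i j ×-dec (¬? (branching? i) ×-dec ¬? (branching? j))
          ; E-sym = λ { (e , p , q) → E-sym g e , q , p } }

        J-≢ : ∀ {a b} → E J a b → a ≢ b
        J-≢ (e , _) = edge-≢ g real e

        degree-two : ∀ {v} → ¬ Branching v → d v ≡ 2
        degree-two {v} nb with d v ≟ 2
        ... | yes e = e
        ... | no ne = contradiction ne nb

        cycle-closed : ∀ {v w} → Cyc J v → E g v w → Cyc J w
        cycle-closed {v} {w} (a , b , ea , eb , a≢b , c) e with two-elements (E? g v) (trans (deg real v) (degree-two (proj₁ (proj₂ ea))))
        ... | p , q , _ , _ , _ , only = [ (λ { refl → cyc-step J J-≢ ea eb a≢b c }) , (λ { refl → cyc-step J J-≢ eb ea (a≢b ∘ sym) (conn-sym (J ∖ v) c) }) ]′ (ab (only a (proj₁ ea)) (only b (proj₁ eb)) (only _ e))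
          where
          ab : ∀ {z} → a ≡ p ⊎ a ≡ q → b ≡ p ⊎ b ≡ q → z ≡ p ⊎ z ≡ q → z ≡ a ⊎ z ≡ b
          ab (inj₁ refl) (inj₁ refl) _ = contradiction refl a≢b
          ab (inj₂ refl) (inj₂ refl) _ = contradiction refl a≢b
          ab (inj₁ refl) (inj₂ refl) h = h
          ab (inj₂ refl) (inj₁ refl) (inj₁ h) = inj₂ h
          ab (inj₂ refl) (inj₁ refl) (inj₂ h) = inj₁ h

        cycle-component : ∀ {v m} → Cyc J v → Conn g v m → ¬ Branching m
        cycle-component (_ , _ , ea , _) ε = proj₁ (proj₂ ea)
        cycle-component cy (e ◅ c) = cycle-component (cycle-closed cy e) c

        -- Inner edges run between vertices of degree 2, so a cycle of them is a whole component and
        -- cannot reach the branching vertex m.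
        inner-joins : ∀ {a b m} xs → (∀ {e} → e ∈ (a , b) ∷ xs → e ∈ inner) → Unique ((a , b) ∷ xs) → Conn g a m → Branching m → Joins xs (a , b)
        inner-joins {a} {b} {m} xs sub (fresh ∷ _) c bm eq = cycle-component cy c bm
          where
          J-edge : ∀ {i j} → (i , j) ∈ inner → E J i j
          J-edge p = proj₂ (proj₁ (inner-edge p)) , (λ b → proj₂ (inner-edge p) (inj₁ b)) , (λ b → proj₂ (inner-edge p) (inj₂ b))
          step : ∀ {i j} → (i , j) ∈ xs → E (del J a b) i j
          step p = J-edge (sub (there p)) , (λ { (inj₁ (refl , refl)) → All.lookup fresh p refl
                                               ; (inj₂ (refl , refl)) → <-asym (proj₁ (proj₁ (inner-edge (sub (here refl))))) (proj₁ (proj₁ (inner-edge (sub (there p))))) })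
          ab : E J a b
          ab = J-edge (sub (here refl))
          loop : Conn (del J a b) a b
          loop = conv (λ { (inj₁ p) → return (step p) ; (inj₂ p) → return (E-sym (del J a b) (step p)) }) (lab-sound xs eq)
          cy : Cyc J a
          cy with last-exit (del J a b) a loop (J-≢ ab ∘ sym)
          ... | inj₁ k = contradiction (sym (stuck (del J a b) a k)) (J-≢ ab)
          ... | inj₂ (z , (e , ns) , _ , k) = z , b , e , ab , (λ { refl → ns same-refl }) , conn-sub (del J a b ∖ a) (J ∖ a) (λ { ((e , _) , p) → e , p }) k

      module _ {W : Fin n → Set} (W? : ∀ v → Dec (W v)) (W-closed : ∀ {a b} → E g a b → W a → W b)
               (W-branching : ∀ {v} → W v → ∃ λ m → Conn g v m × Branching m) where

        private
          inner-forest : ∀ xs → (∀ {e} → e ∈ xs → e ∈ inner) → Unique xs → ∑ xs (λ e → 𝟙 (W? (proj₁ e))) ≤ forest W? xs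
          inner-forest [] sub u = z≤n
          inner-forest ((a , b) ∷ xs) sub u@(_ ∷ u′) = +-mono-≤ (first (W? a)) (inner-forest xs (sub ∘ there) u′)
            where
            first : (w : Dec (W a)) → 𝟙 w ≤ 𝟙 w * 𝟙 (joins? xs (a , b))
            first (no _) = z≤n
            first (yes w) with W-branching w
            ... | m , c , bm = ≤-reflexive (sym (trans (*-identityˡ _) (𝟙-yes (joins? xs (a , b)) (inner-joins xs sub u c bm))))

          closed : ∀ {a b} → Adj (outer ++ inner) a b → W a → W b
          closed (inj₁ p) w = W-closed (proj₂ (list-edge p)) w
          closed (inj₂ p) w = W-closed (E-sym g (proj₂ (list-edge p))) w

          edges : ∑ outer (λ e → 𝟙 (W? (proj₁ e))) + ∑ inner (λ e → 𝟙 (W? (proj₁ e))) ≤ ∑ᵛ (λ v → 𝟙 (W? v)) + length extra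
          edges = ≤-trans (+-monoʳ-≤ _ (inner-forest inner id inner-unique)) (≤-trans (forest-tr inner W? outer)
            (+-monoˡ-≤ (length extra) (≤-trans (m≤m+n _ (roots W? (outer ++ inner))) (≤-reflexive (forest+roots W? (outer ++ inner) closed)))))

          split : ∑ all-edges (λ e → 𝟙 (W? (proj₁ e))) ≡ ∑ outer (λ e → 𝟙 (W? (proj₁ e))) + ∑ inner (λ e → 𝟙 (W? (proj₁ e)))
          split = sym (trans (cong₂ _+_ (∑-filter outer? all-edges _) (∑-filter (λ e → ¬? (outer? e)) all-edges _))
            (trans (sym (∑-+ all-edges _ _)) (∑-cong all-edges (λ e → trans (sym (*-distribʳ-+ (𝟙 (W? (proj₁ e))) (𝟙 (outer? e)) _)) (trans (cong (_* 𝟙 (W? (proj₁ e))) (𝟙-¬ (outer? e))) (*-identityˡ _))))))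

          handshake : ∑ᵛ (λ v → 𝟙 (W? v) * d v) ≡ 2 * ∑ all-edges (λ e → 𝟙 (W? (proj₁ e)))
          handshake = begin
              ∑ᵛ (λ v → 𝟙 (W? v) * d v) ≡⟨ ∑-cong (fins n) (λ v → trans (cong (𝟙 (W? v) *_) (sym (deg real v))) (sym (∑-*ˡ (fins n) (𝟙 (W? v)) _))) ⟩
              ∑ᵛ (λ a → ∑ᵛ (λ b → 𝟙 (W? a) * 𝟙 (E? g a b))) ≡⟨ ∑-cong (fins n) (λ a → trans (∑-cong (fins n) (λ b → parts a b)) (∑-+ (fins n) _ _)) ⟩
              ∑ᵛ (λ a → ∑ᵛ (λ b → h a b) + ∑ᵛ (λ b → h b a)) ≡⟨ trans (∑-+ (fins n) _ _) (cong₂ _+_ refl (∑-swap (fins n) (fins n) _)) ⟩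
              ∑ᵛ (λ a → ∑ᵛ (λ b → h a b)) + ∑ᵛ (λ b → ∑ᵛ (λ a → h b a)) ≡⟨ cong₂ _+_ half half ⟩
              sumᵂ + sumᵂ ≡⟨ cong (sumᵂ +_) (sym (+-identityʳ sumᵂ)) ⟩
              2 * sumᵂ ∎
            where
            open ≡-Reasoning
            sumᵂ = ∑ all-edges (λ e → 𝟙 (W? (proj₁ e)))
            h : Fin n → Fin n → ℕ
            h a b = 𝟙 (oriented? (a , b)) * 𝟙 (W? a)
            half : ∑ᵛ (λ a → ∑ᵛ (λ b → h a b)) ≡ sumᵂ
            half = sym (trans (∑-filter oriented? (pairs n) _) (∑-cartesian (fins n) (fins n) _))
            parts : ∀ a b → 𝟙 (W? a) * 𝟙 (E? g a b) ≡ h a b + h b a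
            parts a b = go (E? g a b) (<-cmp (toℕ a) (toℕ b))
              where
              go : Dec (E g a b) → Tri (toℕ a < toℕ b) (toℕ a ≡ toℕ b) (toℕ b < toℕ a) → 𝟙 (W? a) * 𝟙 (E? g a b) ≡ h a b + h b a
              go (no ne) _ = trans (cong (𝟙 (W? a) *_) (𝟙-no (E? g a b) ne)) (trans (*-zeroʳ (𝟙 (W? a))) (sym (cong₂ (λ x y → x * 𝟙 (W? a) + y * 𝟙 (W? b))
                (𝟙-no (oriented? (a , b)) (ne ∘ proj₂)) (𝟙-no (oriented? (b , a)) (ne ∘ E-sym g ∘ proj₂)))))
              go (yes e) (tri< lt _ ngt) = trans (cong (𝟙 (W? a) *_) (𝟙-yes (E? g a b) e)) (trans (*-comm (𝟙 (W? a)) 1) (sym (trans (cong₂ (λ x y → x * 𝟙 (W? a) + y * 𝟙 (W? b))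
                (𝟙-yes (oriented? (a , b)) (lt , e)) (𝟙-no (oriented? (b , a)) (ngt ∘ proj₁))) (+-identityʳ _))))
              go (yes e) (tri> nlt _ gt) = trans (cong (𝟙 (W? a) *_) (𝟙-yes (E? g a b) e)) (trans (*-comm (𝟙 (W? a)) 1) (trans (cong (1 *_) (𝟙-cong (W? a) (W? b) (W-closed e) (W-closed (E-sym g e))))
                (sym (cong₂ (λ x y → x * 𝟙 (W? a) + y * 𝟙 (W? b)) (𝟙-no (oriented? (a , b)) (nlt ∘ proj₁)) (𝟙-yes (oriented? (b , a)) (gt , E-sym g e))))))
              go (yes e) (tri≈ _ eq _) = contradiction (toℕ-injective eq) (edge-≢ g real e)

        -- Euler's formula: since no inner edge in W closes a cycle with inner edges, all edges in W
        -- beyond a spanning forest belong to `extra`.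
        degree-excess : ∑ᵛ (λ v → 𝟙 (W? v) * d v) ≤ 2 * (∑ᵛ (λ v → 𝟙 (W? v)) + length extra)
        degree-excess = ≤-trans (≤-reflexive handshake) (*-monoʳ-≤ 2 (≤-trans (≤-reflexive split) edges))

  -- Merging components through non-bridges

  ∑-sublist : ∀ {n} {P : Fin n × Fin n → Set} (P? : ∀ e → Dec (P e)) (xs : List (Fin n × Fin n)) → Unique xs → (∀ {e} → e ∈ xs → P e) →
              (f : Fin n × Fin n → ℕ) → ∑ xs f ≤ ∑ᵛ (λ a → ∑ᵛ (λ b → 𝟙 (P? (a , b)) * f (a , b)))
  ∑-sublist {n} {P} P? xs u all f = begin
      ∑ xs f ≤⟨ ∑-mono-∈ xs at ⟩
      ∑ xs (λ e → ∑ᵛ (λ a → ∑ᵛ (λ b → 𝟙 (e ≟ᵉ (a , b)) * g a b))) ≡⟨ trans (∑-swap xs (fins n) _) (∑-cong (fins n) (λ a → trans (∑-swap xs (fins n) _) (∑-cong (fins n) (λ b → ∑-*ʳ xs (g a b) _)))) ⟩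
      ∑ᵛ (λ a → ∑ᵛ (λ b → ∑ xs (λ e → 𝟙 (e ≟ᵉ (a , b))) * g a b))
        ≤⟨ ∑-mono (fins n) (λ a → ∑-mono (fins n) (λ b → ≤-trans (*-monoˡ-≤ (g a b) (∑-exclusive (λ e → e ≟ᵉ (a , b)) xs u (λ _ _ ne p q → ne (trans p (sym q))))) (≤-reflexive (*-identityˡ _)))) ⟩
      ∑ᵛ (λ a → ∑ᵛ (λ b → g a b)) ∎
    where
    open ≤-Reasoning
    _≟ᵉ_ : (e f : Fin n × Fin n) → Dec (e ≡ f)
    _≟ᵉ_ = ≡-dec _≟ᶠ_ _≟ᶠ_
    g : Fin n → Fin n → ℕ
    g a b = 𝟙 (P? (a , b)) * f (a , b)
    at : ∀ e → e ∈ xs → f e ≤ ∑ᵛ (λ a → ∑ᵛ (λ b → 𝟙 (e ≟ᵉ (a , b)) * g a b))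
    at (a , b) m = ≤-trans (≤-reflexive (sym (trans (cong₂ _*_ (𝟙-yes ((a , b) ≟ᵉ (a , b)) refl) (cong (_* f (a , b)) (𝟙-yes (P? (a , b)) (all m)))) (trans (*-identityˡ _) (*-identityˡ _)))))
      (≤-trans (∑-term b (λ b′ → 𝟙 ((a , b) ≟ᵉ (a , b′)) * g a b′)) (∑-term a (λ a′ → ∑ᵛ (λ b′ → 𝟙 ((a , b) ≟ᵉ (a′ , b′)) * g a′ b′))))

  module Merging {n : ℕ} (d : Fin n → ℕ) (K : ℕ) where

    open Degrees d
    open Transfer d
    open Cycles d

    Loose : Graph n → Fin n → Fin n → Set
    Loose g u p = Conn (del g u p) u p × mates g u p ≤ K

    loose? : ∀ g u p → Dec (Loose g u p)
    loose? g u p = conn? (del g u p) u p ×-dec (mates g u p ≤? K)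

    loose : Graph n → ℕ
    loose g = ∑ʰ g (λ u p → 𝟙 (loose? g u p))

    del-comm : ∀ (g : Graph n) {a b i j} → Conn (del g a b) i j → Conn (del g b a) i j
    del-comm g {a} {b} = conn-sub (del g a b) (del g b a) (λ { (e , ns) → e , (λ { (inj₁ r) → ns (inj₂ r) ; (inj₂ r) → ns (inj₁ r) }) })

    mates-comm : ∀ (g : Graph n) a b → mates g a b ≤ mates g b a
    mates-comm g a b = ∑-mono (fins n) (λ i → ∑-mono (fins n) (λ j → *-monoʳ-≤ (𝟙 (branching? i) * 𝟙 (E? g i j)) (𝟙-mono (mate? g a b i j) (mate? g b a i j)
      (λ { (c , nc) → c , (λ k → nc (conn-sub (del (del g b a) i j) (del (del g a b) i j) (λ { ((e , ns) , ns′) → (e , (λ { (inj₁ r) → ns (inj₂ r) ; (inj₂ r) → ns (inj₁ r) })) , ns′ }) k)) }))))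

    module _ (g : Graph n) (real : Realizes d g) where

      -- Markov's inequality: by `few-mates`, at most Mδ/(K + 1) edges of `extra` have more than K
      -- mates. Each of the others gives a loose half-edge at one of its branching ends.
      extra≤loose : suc K * length (extra g real) ≤ suc K * loose g + Mδ
      extra≤loose = begin
          suc K * length X ≡⟨ *-comm (suc K) _ ⟩
          length X * suc K ≡⟨ sym (∑-const X (suc K)) ⟩
          ∑ X (λ _ → suc K) ≤⟨ ∑-mono X (λ e → bound e (few? e)) ⟩
          ∑ X (λ e → suc K * 𝟙 (few? e) + m e) ≡⟨ trans (∑-+ X _ _) (cong₂ _+_ (∑-*ˡ X (suc K) _) refl) ⟩
          suc K * ∑ X (λ e → 𝟙 (few? e)) + ∑ X m ≤⟨ +-mono-≤ (*-monoʳ-≤ (suc K) few≤) (few-mates g real) ⟩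
          suc K * loose g + Mδ ∎
        where
        open ≤-Reasoning
        X = extra g real
        m : Fin n × Fin n → ℕ
        m e = mates g (proj₁ e) (proj₂ e)
        few? : ∀ e → Dec (m e ≤ K)
        few? e = m e ≤? K
        bound : ∀ e (f : Dec (m e ≤ K)) → suc K ≤ suc K * 𝟙 f + m e
        bound e (yes _) = m≤n⇒m≤n+o (m e) (≤-reflexive (sym (*-identityʳ (suc K))))
        bound e (no nf) = m≤n⇒m≤o+n (suc K * 0) (≰⇒> nf)
        h : Fin n → Fin n → ℕ
        h a b = 𝟙 (branching? a) * 𝟙 (E? g a b) * 𝟙 (loose? g a b)
        ord? : ∀ (e : Fin n × Fin n) → Dec (toℕ (proj₁ e) < toℕ (proj₂ e))
        ord? (a , b) = toℕ a <? toℕ b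
        h≡1 : ∀ {a b} → Branching a → E g a b → Loose g a b → h a b ≡ 1
        h≡1 {a} {b} ba e l = cong₂ _*_ (cong₂ _*_ (𝟙-yes (branching? a) ba) (𝟙-yes (E? g a b) e)) (𝟙-yes (loose? g a b) l)
        each : ∀ e → e ∈ X → 𝟙 (few? e) ≤ h (proj₁ e) (proj₂ e) + h (proj₂ e) (proj₁ e)
        each (a , b) p = go (few? (a , b)) (proj₂ (extra-edge g real p))
          where
          e = proj₁ (extra-edge g real p)
          nb = extra-nonbridge g real p
          go : (f : Dec (mates g a b ≤ K)) → Branching a ⊎ Branching b → 𝟙 f ≤ h a b + h b a
          go (no _) _ = z≤n
          go (yes f) (inj₁ ba) = m≤n⇒m≤n+o (h b a) (≤-reflexive (sym (h≡1 ba e (nb , f))))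
          go (yes f) (inj₂ bb) = m≤n⇒m≤o+n (h a b) (≤-reflexive (sym (h≡1 bb (E-sym g e) (conn-sym (del g b a) (del-comm g nb) , ≤-trans (mates-comm g b a) f))))
        few≤ : ∑ X (λ e → 𝟙 (few? e)) ≤ loose g
        few≤ = begin
          ∑ X (λ e → 𝟙 (few? e)) ≤⟨ ∑-mono-∈ X each ⟩
          ∑ X (λ e → h (proj₁ e) (proj₂ e) + h (proj₂ e) (proj₁ e)) ≤⟨ ∑-sublist ord? X (extra-unique g real) (λ { {a , b} p → extra-oriented g real p }) _ ⟩
          ∑ᵛ (λ a → ∑ᵛ (λ b → 𝟙 (ord? (a , b)) * (h a b + h b a)))
            ≡⟨ trans (∑-cong (fins n) (λ a → trans (∑-cong (fins n) (λ b → *-distribˡ-+ (𝟙 (ord? (a , b))) (h a b) (h b a))) (∑-+ (fins n) _ _))) (trans (∑-+ (fins n) _ _) (cong₂ _+_ refl (∑-swap (fins n) (fins n) _))) ⟩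
          ∑ᵛ (λ a → ∑ᵛ (λ b → 𝟙 (ord? (a , b)) * h a b)) + ∑ᵛ (λ b → ∑ᵛ (λ a → 𝟙 (ord? (a , b)) * h b a))
            ≡⟨ sym (trans (∑-cong (fins n) (λ a → ∑-+ (fins n) _ _)) (∑-+ (fins n) _ _)) ⟩
          ∑ᵛ (λ a → ∑ᵛ (λ b → 𝟙 (ord? (a , b)) * h a b + 𝟙 (ord? (b , a)) * h a b)) ≤⟨ ∑-mono (fins n) (λ a → ∑-mono (fins n) (λ b → one a b (ord? (a , b)) (ord? (b , a)))) ⟩
          loose g ∎
          where
          one : ∀ a b (p : Dec (toℕ a < toℕ b)) (q : Dec (toℕ b < toℕ a)) → 𝟙 p * h a b + 𝟙 q * h a b ≤ h a b
          one a b (yes p) (yes q) = contradiction q (<-asym p)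
          one a b (yes _) (no _) = ≤-reflexive (trans (+-identityʳ _) (+-identityʳ _))
          one a b (no _) (yes _) = ≤-reflexive (+-identityʳ _)
          one a b (no _) (no _) = z≤n

    module _ {g g′ : Graph n} (real : Realizes d g) {u p x q : Fin n} (s : Switch g g′ u p x q)
             (nb₁ : Conn (del g u p) u p) (nb₂ : Conn (del g x q) x q) where

      private
        u≢p : u ≢ p
        u≢p = edge-≢ g real (up s)

        x-side : ∀ {a} → Conn g x a → ¬ Conn g u a
        x-side c c′ = apart s (c′ ◅◅ conn-sym g c)

        pu : Conn g u p
        pu = return (up s)

      -- Both old components stay connected without the removed edges, and uq, xp are the only edges
      -- between them; so the two form a 2-edge-cut.
      merged-mate : Mate g′ u q x p
      merged-mate = (xq-path ◅◅ (E-sym (del g′ x p) uq ◅ up-path)) , cut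
        where
        uq : E (del g′ x p) u q
        uq = uq′ s , (λ { (inj₁ (r , _)) → u≢x s r ; (inj₂ (r , _)) → u≢p r })
        xq-path : Conn (del g′ x p) x q
        xq-path = proj₂ (star-closed (Conn g x) step ε nb₂)
          where
          step : ∀ {a b} → Conn g x a → E (del g x q) a b → Conn g x b × E (del g′ x p) a b
          step ca (e , ns) = cb , keep s e (λ { (inj₁ (refl , _)) → x-side ca ε ; (inj₂ (_ , refl)) → x-side cb ε }) ns ,
              (λ { (inj₁ (_ , refl)) → x-side cb pu ; (inj₂ (refl , _)) → x-side ca pu })
            where cb = ca ◅◅ return e
        up-path : Conn (del g′ x p) u p
        up-path = proj₂ (star-closed (Conn g u) step ε nb₁)
          where
          step : ∀ {a b} → Conn g u a → E (del g u p) a b → Conn g u b × E (del g′ x p) a b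
          step ca (e , ns) = cb , keep s e ns (λ { (inj₁ (refl , _)) → apart s ca ; (inj₂ (_ , refl)) → apart s cb }) ,
              (λ { (inj₁ (refl , _)) → apart s ca ; (inj₂ (_ , refl)) → apart s cb })
            where cb = ca ◅◅ return e
        cut : ¬ Conn (del (del g′ u q) x p) x p
        cut c = apart s (pu ◅◅ conn-sym g (conn-sub (del (del g′ u q) x p) g back c))
          where
          back : ∀ {a b} → E (del (del g′ u q) x p) a b → E g a b
          back ((e , n₁) , n₂) = [ proj₁ , (λ r → contradiction r [ n₁ , n₂ ]′) ]′ (old s e)

    -- A mate of uq in the merged component is either xp or a mate of one of the old edges.
    module _ {g g′ : Graph n} (real : Realizes d g) {u p x q : Fin n} (s : Switch g g′ u p x q) where

      private
        within : ∀ {r a b} → Conn g r a → E g a b → Conn g r b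
        within c e = c ◅◅ return e

      old-mate : ∀ {a b} → E g a b → ¬ Same a b u p → ¬ Same a b x q → Conn g u a → Conn (del g′ a b) a b →
                 (h : Graph n) → (∀ {i j} → E (del (del g u p) a b) i j → Conn g u i → E h i j) →
                 ¬ Conn h a b → Mate g u p a b
      old-mate {a} {b} e ns₁ ns₂ ca nonbridge h sub cut = subst₂ (Conn (del g a b)) (Φ-in ca) (Φ-in (within ca e)) (conn-map (del g′ a b) (del g a b) Φ hom nonbridge) ,
          (λ c → cut (proj₂ (star-closed (Conn g u) (λ {i} {j} ci ed → within ci (proj₁ (proj₁ ed)) , sub ed ci) ca c)))
        where
        -- Everything outside the old component of u is contracted to u: uq collapses and xp becomes
        -- up, so a walk that avoids ab projects to such a walk in the old graph.
        Φ′ : ∀ w → Dec (Conn g u w) → Fin n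
        Φ′ w (yes _) = w
        Φ′ w (no _) = u
        Φ : Fin n → Fin n
        Φ w = Φ′ w (conn? g u w)
        Φ-in : ∀ {w} → Conn g u w → Φ w ≡ w
        Φ-in {w} cw with conn? g u w
        ... | yes _ = refl
        ... | no nc = contradiction cw nc
        Φ-out : ∀ {w} → ¬ Conn g u w → Φ w ≡ u
        Φ-out {w} nw with conn? g u w
        ... | yes cw = contradiction cw nw
        ... | no _ = refl
        Φx : Φ x ≡ u
        Φx = Φ-out (apart s)
        Φq : Φ q ≡ u
        Φq = Φ-out (λ c → apart s (within c (E-sym g (xq s))))
        Φu : Φ u ≡ u
        Φu = Φ-in ε
        Φp : Φ p ≡ p
        Φp = Φ-in (return (up s))
        up-edge : E (del g a b) u p
        up-edge = up s , (λ { (inj₁ (refl , refl)) → ns₁ same-refl ; (inj₂ (refl , refl)) → ns₁ (inj₂ (refl , refl)) })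
        eqε : ∀ {a′ b′ c} → a′ ≡ c → b′ ≡ c → Conn (del g a b) a′ b′
        eqε refl refl = ε
        edge : ∀ {a₁ b₁ a₂ b₂} → a₁ ≡ a₂ → b₁ ≡ b₂ → E (del g a b) a₂ b₂ → Conn (del g a b) a₁ b₁
        edge refl refl e = return e
        hom : ∀ {i j} → E (del g′ a b) i j → Conn (del g a b) (Φ i) (Φ j)
        hom {i} {j} (e′ , ns) with old s e′
        ... | inj₂ (inj₁ (inj₁ (refl , refl))) = eqε Φu Φq
        ... | inj₂ (inj₁ (inj₂ (refl , refl))) = eqε Φq Φu
        ... | inj₂ (inj₂ (inj₁ (refl , refl))) = edge Φx Φp up-edge
        ... | inj₂ (inj₂ (inj₂ (refl , refl))) = edge Φp Φx (E-sym (del g a b) up-edge)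
        ... | inj₁ (e , _) with conn? g u i
        ... | yes ci = edge refl (Φ-in (within ci e)) (e , ns)
        ... | no ni = eqε refl (Φ-out (λ cj → ni (within cj (E-sym g e))))

    module _ {g g′ : Graph n} (real : Realizes d g) {u p x q : Fin n} (s : Switch g g′ u p x q) where

      private
        within : ∀ {r a b} → Conn g r a → E g a b → Conn g r b
        within c e = c ◅◅ return e

      -- An old edge ab lies in the component of u, in that of x, or in neither; in the last case
      -- deleting uq cannot affect it. Of the new edges, uq is no mate of itself, since deleting it
      -- twice is deleting it once.
      merged-mates : ∀ {a b} → E g′ a b → Mate g′ u q a b → Same a b x p ⊎ (E g a b × (Mate g u p a b ⊎ Mate g x q a b))
      merged-mates {a} {b} e′ (nonbridge , cut) with old s e′
      ... | inj₂ (inj₂ r) = inj₁ r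
      ... | inj₂ (inj₁ r) = contradiction (conn-sub (del g′ a b) (del (del g′ u q) a b) (λ { (f , ns) → (f , (λ r′ → ns (re r′ r))) , ns }) nonbridge) cut
        where
        re : ∀ {i j} → Same i j u q → Same a b u q → Same i j a b
        re (inj₁ (refl , refl)) (inj₁ (refl , refl)) = same-refl
        re (inj₁ (refl , refl)) (inj₂ (refl , refl)) = inj₂ (refl , refl)
        re (inj₂ (refl , refl)) (inj₁ (refl , refl)) = inj₂ (refl , refl)
        re (inj₂ (refl , refl)) (inj₂ (refl , refl)) = same-refl
      ... | inj₁ (e , ns₁ , ns₂) with conn? g u a | conn? g x a
      ... | yes cu | _ = inj₂ (e , inj₁ (old-mate real s e ns₁ ns₂ cu nonbridge (del (del g′ u q) a b) sub cut))
        where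
        sub : ∀ {i j} → E (del (del g u p) a b) i j → Conn g u i → E (del (del g′ u q) a b) i j
        sub ((f , n₁) , n₂) ci = (keep s f n₁ (λ { (inj₁ (refl , _)) → apart s ci ; (inj₂ (_ , refl)) → apart s (within ci f) }) ,
          (λ { (inj₁ (_ , refl)) → apart s (within (within ci f) (E-sym g (xq s))) ; (inj₂ (refl , _)) → apart s (within ci (E-sym g (xq s))) })) , n₂
      ... | no _ | yes cx = inj₂ (e , inj₂ (old-mate real (switch-swap s) e ns₂ ns₁ cx nonbridge (del (del g′ u q) a b) sub cut))
        where
        sub : ∀ {i j} → E (del (del g x q) a b) i j → Conn g x i → E (del (del g′ u q) a b) i j
        sub ((f , n₁) , n₂) ci = (keep s f (λ { (inj₁ (refl , _)) → apart s (conn-sym g ci) ; (inj₂ (_ , refl)) → apart s (conn-sym g (within ci f)) }) n₁ ,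
          (λ { (inj₁ (refl , _)) → apart s (conn-sym g ci) ; (inj₂ (_ , refl)) → apart s (conn-sym g (within ci f)) })) , n₂
      ... | no nu | no nx = contradiction (proj₂ (star-closed (λ w → ¬ Conn g u w × ¬ Conn g x w) step (nu , nx) nonbridge)) cut
        where
        step : ∀ {i j} → ¬ Conn g u i × ¬ Conn g x i → E (del g′ a b) i j → (¬ Conn g u j × ¬ Conn g x j) × E (del (del g′ u q) a b) i j
        step h (f , ns) = proj₁ (far-closed real s h f) , (f , (λ { (inj₁ (refl , _)) → proj₁ h ε ; (inj₂ (refl , _)) → proj₂ h (return (xq s)) })) , ns

  -- Bounded realizations are rare

  module ManyCycles {n : ℕ} (D : Vec ℕ n) (K L : ℕ) where

    open Counting D
    open Cycles d
    open Merging d K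

    bounded? : ∀ A → Dec (∀ v → volume (gr A) v ≤ L)
    bounded? A = all? (λ v → volume (gr A) v ≤? L)

    private
      F F′ : Mat n → Fin n → Fin n → Fin n → Fin n → ℕ
      F A u p x q = 𝟙 (bounded? A) * (𝟙 (loose? (gr A) u p) * 𝟙 (loose? (gr A) x q))
      F′ A u q x p = 𝟙 (mates (gr A) u q ≤? suc K + suc K) * 𝟙 (mate? (gr A) u q x p)

      -- The 1 + 1 stands for xp in its two directions; every other mate of uq is inherited from up
      -- or from xq.
      mates-bound : ∀ A u p x q → IsReal D A → Switch (gr A) (gr (sw u p x q A)) u p x q →
                    mates (gr (sw u p x q A)) u q ≤ (1 + 1) + (mates (gr A) u p + mates (gr A) x q)
      mates-bound A u p x q r s = ≤-trans (∑-mono (fins n) (λ a → ∑-mono (fins n) (λ b → pw a b (branching? a) (E? g′ a b) (mate? g′ u q a b))))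
          (≤-reflexive (trans (∑∑-+ _ _) (cong₂ _+_ (trans (∑∑-+ _ _) (cong₂ _+_ (point x p) (point p x))) (∑∑-+ _ _))))
        where
        g = gr A
        g′ = gr (sw u p x q A)
        ∑∑-+ : (f h : Fin n → Fin n → ℕ) → ∑ᵛ (λ a → ∑ᵛ (λ b → f a b + h a b)) ≡ ∑ᵛ (λ a → ∑ᵛ (f a)) + ∑ᵛ (λ a → ∑ᵛ (h a))
        ∑∑-+ f h = trans (∑-cong (fins n) (λ a → ∑-+ (fins n) (f a) (h a))) (∑-+ (fins n) _ _)
        point : ∀ x p → ∑ᵛ (λ a → ∑ᵛ (λ b → 𝟙 (a ≟ᶠ x) * 𝟙 (b ≟ᶠ p))) ≡ 1
        point x p = trans (∑-product (fins n) (fins n) _ _) (cong₂ _*_ (∑-point₁ x) (∑-point₁ p))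
        m₁ m₂ : Fin n → Fin n → ℕ
        m₁ a b = 𝟙 (branching? a) * 𝟙 (E? g a b) * 𝟙 (mate? g u p a b)
        m₂ a b = 𝟙 (branching? a) * 𝟙 (E? g a b) * 𝟙 (mate? g x q a b)
        pw : ∀ a b (ba : Dec (Branching a)) (e : Dec (E g′ a b)) (m : Dec (Mate g′ u q a b)) →
             𝟙 ba * 𝟙 e * 𝟙 m ≤ (𝟙 (a ≟ᶠ x) * 𝟙 (b ≟ᶠ p) + 𝟙 (a ≟ᶠ p) * 𝟙 (b ≟ᶠ x)) + (m₁ a b + m₂ a b)
        pw a b (no _) _ _ = z≤n
        pw a b (yes _) (no _) _ = z≤n
        pw a b (yes _) (yes _) (no _) = z≤n
        pw a b (yes ba) (yes e) (yes m) with merged-mates (real⇒ D A r) s e m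
        ... | inj₁ (inj₁ (refl , refl)) = m≤n⇒m≤n+o (m₁ a b + m₂ a b) (m≤n⇒m≤n+o (𝟙 (a ≟ᶠ p) * 𝟙 (b ≟ᶠ x)) (≤-reflexive (sym (cong₂ _*_ (𝟙-yes (x ≟ᶠ x) refl) (𝟙-yes (p ≟ᶠ p) refl)))))
        ... | inj₁ (inj₂ (refl , refl)) = m≤n⇒m≤n+o (m₁ a b + m₂ a b) (m≤n⇒m≤o+n (𝟙 (a ≟ᶠ x) * 𝟙 (b ≟ᶠ p)) (≤-reflexive (sym (cong₂ _*_ (𝟙-yes (p ≟ᶠ p) refl) (𝟙-yes (x ≟ᶠ x) refl)))))
        ... | inj₂ (e₀ , inj₁ m′) = m≤n⇒m≤o+n (𝟙 (a ≟ᶠ x) * 𝟙 (b ≟ᶠ p) + 𝟙 (a ≟ᶠ p) * 𝟙 (b ≟ᶠ x)) (m≤n⇒m≤n+o (m₂ a b)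
               (≤-reflexive (sym (cong₂ _*_ (cong₂ _*_ (𝟙-yes (branching? a) ba) (𝟙-yes (E? g a b) e₀)) (𝟙-yes (mate? g u p a b) m′)))))
        ... | inj₂ (e₀ , inj₂ m′) = m≤n⇒m≤o+n (𝟙 (a ≟ᶠ x) * 𝟙 (b ≟ᶠ p) + 𝟙 (a ≟ᶠ p) * 𝟙 (b ≟ᶠ x)) (m≤n⇒m≤o+n (m₁ a b)
               (≤-reflexive (sym (cong₂ _*_ (cong₂ _*_ (𝟙-yes (branching? a) ba) (𝟙-yes (E? g a b) e₀)) (𝟙-yes (mate? g x q a b) m′)))))

      F≤F′ : ∀ A u p x q → IsReal D A → Switch (gr A) (gr (sw u p x q A)) u p x q → F A u p x q ≤ F′ (sw u p x q A) u q x p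
      F≤F′ A u p x q r s = go (bounded? A) (loose? (gr A) u p) (loose? (gr A) x q)
        where
        go : (b : Dec (∀ v → volume (gr A) v ≤ L)) (l₁ : Dec (Loose (gr A) u p)) (l₂ : Dec (Loose (gr A) x q)) → 𝟙 b * (𝟙 l₁ * 𝟙 l₂) ≤ F′ (sw u p x q A) u q x p
        go (no _) _ _ = z≤n
        go (yes _) (no _) _ = z≤n
        go (yes _) (yes _) (no _) = z≤n
        go (yes _) (yes (nb₁ , f₁)) (yes (nb₂ , f₂)) = ≤-reflexive (sym (cong₂ _*_
          (𝟙-yes (mates (gr (sw u p x q A)) u q ≤? suc K + suc K) (≤-trans (mates-bound A u p x q r s) (≤-trans (+-monoʳ-≤ 2 (+-mono-≤ f₁ f₂)) (≤-reflexive (cong suc (sym (+-suc K K)))))))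
          (𝟙-yes (mate? (gr (sw u p x q A)) u q x p) (merged-mate (real⇒ D A r) s nb₁ nb₂))))

      forward : ∀ A → IsReal D A → 𝟙 (bounded? A) * (loose (gr A) * (loose (gr A) ∸ L)) ≤
                ∑ʰ (gr A) (λ u p → ∑ʰ (gr A) (λ x q → 𝟙 (¬? (conn? (gr A) u x)) * F A u p x q))
      forward A r = go (bounded? A)
        where
        g = gr A
        J : Fin n → ℕ
        J u = ∑ʰ g (λ x q → 𝟙 (¬? (conn? g u x)) * 𝟙 (loose? g x q))
        eq : ∀ a b c d → c * (a * (b * d)) ≡ a * b * (c * d)
        eq = solve-∀
        go : (b : Dec (∀ v → volume g v ≤ L)) → 𝟙 b * (loose g * (loose g ∸ L)) ≤ ∑ʰ g (λ u p → ∑ʰ g (λ x q → 𝟙 (¬? (conn? g u x)) * (𝟙 b * (𝟙 (loose? g u p) * 𝟙 (loose? g x q)))))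
        go (no _) = z≤n
        go (yes b) = ≤-trans (≤-reflexive (trans (*-identityˡ _) (sym (∑ʰ-*ʳ g (loose g ∸ L) _)))) (≤-trans (∑ʰ-mono g (λ u p _ _ → *-monoʳ-≤ (𝟙 (loose? g u p)) (J≥ u)))
            (≤-reflexive (∑ʰ-cong g (λ u p → trans (sym (∑ʰ-*ˡ g (𝟙 (loose? g u p)) _)) (∑ʰ-cong g (λ x q → sym (trans (eq 1 (𝟙 (loose? g u p)) (𝟙 (¬? (conn? g u x))) (𝟙 (loose? g x q))) (cong (_* (𝟙 (¬? (conn? g u x)) * 𝟙 (loose? g x q))) (*-identityˡ (𝟙 (loose? g u p)))))))))))
          where
          J≥ : ∀ u → loose g ∸ L ≤ J u
          J≥ u = m≤n+o⇒m∸n≤o (loose g) L (≤-trans (∑ʰ-mono g (λ x q _ _ → cover x q (conn? g u x)))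
                 (≤-trans (≤-reflexive (trans (∑ʰ-+ g _ _) (cong (_+ J u) (∑ʰ-conn g (real⇒ D A r) u)))) (+-monoˡ-≤ (J u) (b u))))
            where
            cover : ∀ x q (c : Dec (Conn g u x)) → 𝟙 (loose? g x q) ≤ 𝟙 c + 𝟙 (¬? c) * 𝟙 (loose? g x q)
            cover x q (yes _) = ≤-trans (𝟙≤1 (loose? g x q)) (m≤m+n 1 _)
            cover x q (no _) = ≤-reflexive (sym (+-identityʳ _))

      reverse≤ : ∀ A → IsReal D A → ∑ʰ (gr A) (λ u q → ∑ʰ (gr A) (λ x p → F′ A u q x p)) ≤ (suc K + suc K) * Mδ
      reverse≤ A r = ≤-trans (∑ʰ-mono (gr A) (λ u q _ _ → ≤-trans (≤-reflexive (∑ʰ-*ˡ (gr A) (𝟙 (mates (gr A) u q ≤? suc K + suc K)) _)) (𝟙*-≤ (mates (gr A) u q ≤? suc K + suc K) id)))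
                     (≤-reflexive (∑ʰ-const (gr A) (real⇒ D A r) (suc K + suc K)))

    -- Once uq is known, xp is among its mates, of which there are at most 2(K + 1). So linearly
    -- many outcomes face the product of the loose half-edges and those left after excluding one
    -- component.
    few-cycles : ∑ᴿ (λ A → 𝟙 (bounded? A) * (loose (gr A) * (loose (gr A) ∸ L))) ≤ (suc K + suc K) * Mδ * Tot
    few-cycles = ≤-trans (∑ᴿ-mono forward) (≤-trans (switch-count F F′ F≤F′) (≤-trans (∑ᴿ-mono reverse≤) (≤-reflexive (∑ᴿ-const _))))

  -- Choice of the thresholds and union of the three cases

  ratio : ℕ → ℕ → ℕ
  ratio e B = 16 * (e * B)

  -- Fixed by `leafy-part`: 4096 Q³ is the cube of the 16 Q in `spare-large`, 3 B comes from
  -- `branching-mass`, and 3 dl from the target fraction.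
  threshold : ℕ → ℕ → ℕ → ℕ
  threshold e B dl = 9 * 4096 * B * (ratio e B * ratio e B * ratio e B) * dl

  module Assembly {n : ℕ} (D : Vec ℕ n) (e B dl Q t : ℕ) (t≡ : t ≡ 9 * 4096 * B * (Q * Q * Q) * dl) where

    open Counting D
    open Cycles d using (extra; degree-excess)

    c : Fin n → ℕ
    c v = (d v ∸ 1) ⊓ B

    module Bound (L : ℕ) (L-small : 48 * Q * L ≤ Mδ) (positive : ∀ v → 1 ≤ d v) (1≤e : 1 ≤ e) (1≤B : 1 ≤ B) (1≤Q : 1 ≤ Q)
      (supercritical : (2 * e + 1) * Mδ ≤ 2 * e * ∑ᵛ (λ v → δ v * c v))
      (M>0 : 0 < Mδ) (t-small : 8 * t ≤ Mδ) (M-large : 3 * dl * (1152 * 48 * (Q * Q * Q)) ≤ Mδ)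
      (sb : ℕ) (M-large′ : 3 * dl * sb ≤ Mδ)
      (mostly : Mδ * ∑ᴿ (λ A → 𝟙 (Q * heavy t (gr A) ≤? Mδ)) ≤ Tot * sb)
      where

      private
        K : ℕ
        -- Chosen so that K + 1 is 24 Q: discarding the edges with more than K mates costs at most
        -- M/(24 Q), half of what `heavy≤` guarantees in the cyclic case.
        K = 24 * Q ∸ 1

        sucK : suc K ≡ 24 * Q
        sucK = m+[n∸m]≡n (≤-trans 1≤Q (m≤n*m Q 24))

      open ManyLeaves D t L using (Bounded; bounded?; bigLeaf?; bigLeaves; few-big-leaves) renaming (k to spare)
      open Merging d K using (loose; extra≤loose)
      open ManyCycles D K L using (few-cycles)

      private
        Small Leafy : Mat n → Set
        Small A = Q * heavy t (gr A) ≤ Mδ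
        Leafy A = Mδ ≤ 8 * Q * bigLeaves A

        small? : ∀ A → Dec (Small A)
        small? A = Q * heavy t (gr A) ≤? Mδ

        leafy? : ∀ A → Dec (Leafy A)
        leafy? A = Mδ ≤? 8 * Q * bigLeaves A

        -- Pointwise, δ + 6 is at most 3d, plus 4 if d is 1. Summed over the components of volume
        -- above t, Euler's bound on the degree sum cancels the sixes and leaves leaves and
        -- cycle-closing edges.
        heavy≤ : ∀ A r → heavy t (gr A) ≤ 4 * bigLeaves A + 6 * length (extra (gr A) (real⇒ D A r))
        heavy≤ A r = lin (+-mono-≤ pointwise (*-monoʳ-≤ 3 (degree-excess (gr A) (real⇒ D A r) W? W-closed W-branching))) 0
            (eq (heavy t (gr A)) (∑ᵛ (λ v → 𝟙 (W? v))) (∑ᵛ (λ v → 𝟙 (W? v) * d v)) (bigLeaves A) (length (extra (gr A) (real⇒ D A r))))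
          where
          g = gr A
          eq : ∀ h w wd b x → h + (3 * wd + 4 * b + 3 * (2 * (w + x))) + 0 ≡ 4 * b + 6 * x + (h + 6 * w + 3 * wd)
          eq = solve-∀
          W? : ∀ v → Dec (suc t ≤ volume g v)
          W? v = suc t ≤? volume g v
          W-closed : ∀ {a b} → E g a b → suc t ≤ volume g a → suc t ≤ volume g b
          W-closed ab = subst (suc t ≤_) (vol-conn δ g (return ab))
          W-branching : ∀ {v} → suc t ≤ volume g v → ∃ λ m → Conn g v m × Branching m
          W-branching {v} w with ∑-pos (fins n) (λ m → 𝟙 (conn? g v m) * δ m) (≤-trans (s≤s z≤n) w)
          ... | m , h = m , 𝟙-pos (conn? g v m) (*-posˡ (𝟙 (conn? g v m)) (δ m) h) , 𝟙-pos (branching? m) (*-posˡ (𝟙 (branching? m)) (d m) (*-posʳ (𝟙 (conn? g v m)) (δ m) h))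
          pointwise : heavy t g + 6 * ∑ᵛ (λ v → 𝟙 (W? v)) ≤ 3 * ∑ᵛ (λ v → 𝟙 (W? v) * d v) + 4 * bigLeaves A
          pointwise = ≤-trans (≤-reflexive (trans (cong (heavy t g +_) (sym (∑-*ˡ (fins n) 6 _))) (sym (∑-+ (fins n) _ _))))
            (≤-trans (∑-mono (fins n) (λ v → pw v (W? v))) (≤-reflexive (trans (∑-+ (fins n) _ _) (cong₂ _+_ (∑-*ˡ (fins n) 3 _) (∑-*ˡ (fins n) 4 _)))))
            where
            degree : ∀ v → suc t ≤ volume g v → ∀ k → d v ≡ k → 1 ≤ k → δ v + 6 ≤ 3 * k + 4 * 𝟙 (bigLeaf? A v)
            degree v w 1 eq _ = ≤-trans (+-monoˡ-≤ 6 (≤-trans (𝟙*-le (branching? v) (d v)) (≤-reflexive eq))) (≤-reflexive (cong (λ k → 3 + 4 * k) (sym (𝟙-yes (bigLeaf? A v) (eq , w)))))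
            degree v w 2 eq _ = ≤-trans (+-monoˡ-≤ 6 (≤-reflexive (cong (_* d v) (𝟙-no (branching? v) (λ b → b eq))))) (m≤m+n 6 _)
            degree v w (suc (suc (suc k))) eq _ = m≤n⇒m≤n+o (4 * 𝟙 (bigLeaf? A v)) (≤-trans (+-monoˡ-≤ 6 (≤-trans (𝟙*-le (branching? v) (d v)) (≤-reflexive eq))) (≤-trans (m≤m+n _ (2 * k)) (≤-reflexive (eq′ k))))
              where
              eq′ : ∀ k → 3 + k + 6 + 2 * k ≡ 3 * (3 + k)
              eq′ = solve-∀
            pw : ∀ v (w : Dec (suc t ≤ volume g v)) → 𝟙 w * δ v + 6 * 𝟙 w ≤ 3 * (𝟙 w * d v) + 4 * 𝟙 (bigLeaf? A v)
            pw v (no _) = z≤n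
            pw v (yes w) = ≤-trans (+-monoˡ-≤ 6 (≤-reflexive (*-identityˡ (δ v)))) (≤-trans (degree v w (d v) refl (positive v)) (≤-reflexive (cong (λ k → 3 * k + 4 * 𝟙 (bigLeaf? A v)) (sym (*-identityˡ (d v))))))

        Σsmall Σleafy Σcyclic : ℕ
        Σsmall = ∑ᴿ (λ A → 𝟙 (small? A))
        Σleafy = ∑ᴿ (λ A → 𝟙 (bounded? A) * 𝟙 (leafy? A))
        Σcyclic = ∑ᴿ (λ A → 𝟙 (bounded? A) * (𝟙 (¬? (small? A)) * 𝟙 (¬? (leafy? A))))

        small-part : 3 * dl * Σsmall ≤ Tot
        small-part = *-cancelˡ-≤ Mδ {{>-nonZero M>0}} (begin
            Mδ * (3 * dl * Σsmall) ≡⟨ eq Mδ (3 * dl) Σsmall ⟩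
            3 * dl * (Mδ * Σsmall) ≤⟨ *-monoʳ-≤ (3 * dl) mostly ⟩
            3 * dl * (Tot * sb) ≡⟨ eq₂ (3 * dl) Tot sb ⟩
            3 * dl * sb * Tot ≤⟨ *-monoˡ-≤ Tot M-large′ ⟩
            Mδ * Tot ∎)
          where
          open ≤-Reasoning
          eq : ∀ a b c → a * (b * c) ≡ b * (a * c)
          eq = solve-∀
          eq₂ : ∀ a b c → a * (b * c) ≡ a * c * b
          eq₂ = solve-∀

        -- From heavy volume above M/Q the leaves account for less than M/(2Q), so `extra` has at
        -- least M/(12 Q) edges, of which M/(24 Q) are loose. The component lost in a switch has
        -- volume at most L ≤ M/(48 Q), so half of these remain.
        cyclic-large : ∀ A → IsReal D A → ¬ Small A → ¬ Leafy A → Mδ * Mδ ≤ 1152 * (Q * Q) * (loose (gr A) * (loose (gr A) ∸ L))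
        cyclic-large A r ns nl = ≤-trans (*-mono-≤ l₁ l₂) (≤-reflexive (eq Q (loose (gr A)) (loose (gr A) ∸ L)))
          where
          X = length (extra (gr A) (real⇒ D A r))
          l = loose (gr A)
          eq : ∀ q a b → 24 * q * a * (48 * q * b) ≡ 1152 * (q * q) * (a * b)
          eq = solve-∀
          l₁ : Mδ ≤ 24 * Q * l
          l₁ = lin (+-mono-≤ (*-monoʳ-≤ 4 (<⇒≤ (≰⇒> ns))) (+-mono-≤ (*-monoʳ-≤ (4 * Q) (heavy≤ A r)) (+-mono-≤ (*-monoʳ-≤ 2 (<⇒≤ (≰⇒> nl)))
                 (subst (λ k → k * X ≤ k * l + Mδ) sucK (extra≤loose (gr A) (real⇒ D A r)))))) 0 (eq′ Mδ Q (heavy t (gr A)) (bigLeaves A) X l)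
            where
            eq′ : ∀ m q h b x l → m + (4 * (q * h) + (4 * q * (4 * b + 6 * x) + (2 * m + (24 * q * l + m)))) + 0 ≡ 24 * q * l + (4 * m + (4 * q * h + (2 * (8 * q * b) + 24 * q * x)))
            eq′ = solve-∀
          l₂ : Mδ ≤ 48 * Q * (l ∸ L)
          l₂ = lin (+-mono-≤ (*-monoʳ-≤ 2 l₁) (+-mono-≤ (*-monoʳ-≤ (48 * Q) (m≤n+m∸n l L)) L-small)) 0 (eq′ Mδ Q l L (l ∸ L))
            where
            eq′ : ∀ m q l L k → m + (2 * (24 * q * l) + (48 * q * (L + k) + m)) + 0 ≡ 48 * q * k + (2 * m + (48 * q * l + 48 * q * L))
            eq′ = solve-∀

        cyclic-part : 3 * dl * Σcyclic ≤ Tot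
        cyclic-part = *-cancelˡ-≤ Mδ {{>-nonZero M>0}} (*-cancelˡ-≤ Mδ {{>-nonZero M>0}} (begin
            Mδ * (Mδ * (3 * dl * Σcyclic)) ≡⟨ eq Mδ (3 * dl) Σcyclic ⟩
            3 * dl * (Mδ * Mδ * Σcyclic) ≡⟨ cong (3 * dl *_) (sym (∑ᴿ-*ˡ (Mδ * Mδ) _)) ⟩
            3 * dl * ∑ᴿ (λ A → Mδ * Mδ * (𝟙 (bounded? A) * (𝟙 (¬? (small? A)) * 𝟙 (¬? (leafy? A))))) ≤⟨ *-monoʳ-≤ (3 * dl) (∑ᴿ-mono perA) ⟩
            3 * dl * ∑ᴿ (λ A → 1152 * (Q * Q) * (𝟙 (bounded? A) * (loose (gr A) * (loose (gr A) ∸ L)))) ≡⟨ cong (3 * dl *_) (∑ᴿ-*ˡ (1152 * (Q * Q)) _) ⟩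
            3 * dl * (1152 * (Q * Q) * ∑ᴿ (λ A → 𝟙 (bounded? A) * (loose (gr A) * (loose (gr A) ∸ L)))) ≤⟨ *-monoʳ-≤ (3 * dl) (*-monoʳ-≤ (1152 * (Q * Q)) few-cycles) ⟩
            3 * dl * (1152 * (Q * Q) * ((suc K + suc K) * Mδ * Tot)) ≡⟨ cong (λ k → 3 * dl * (1152 * (Q * Q) * ((k + k) * Mδ * Tot))) sucK ⟩
            3 * dl * (1152 * (Q * Q) * ((24 * Q + 24 * Q) * Mδ * Tot)) ≡⟨ eq₂ 1152 (3 * dl) Q Mδ Tot ⟩
            3 * dl * (1152 * 48 * (Q * Q * Q)) * (Mδ * Tot) ≤⟨ *-monoˡ-≤ (Mδ * Tot) M-large ⟩
            Mδ * (Mδ * Tot) ∎))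
          where
          open ≤-Reasoning
          eq : ∀ m a s → m * (m * (a * s)) ≡ a * (m * m * s)
          eq = solve-∀
          eq₂ : ∀ k a q m t → a * (k * (q * q) * ((24 * q + 24 * q) * m * t)) ≡ a * (k * 48 * (q * q * q)) * (m * t)
          eq₂ = solve-∀
          perA : ∀ A → IsReal D A → Mδ * Mδ * (𝟙 (bounded? A) * (𝟙 (¬? (small? A)) * 𝟙 (¬? (leafy? A)))) ≤ 1152 * (Q * Q) * (𝟙 (bounded? A) * (loose (gr A) * (loose (gr A) ∸ L)))
          perA A r = go (𝟙 (bounded? A)) (small? A) (leafy? A)
            where
            go : ∀ b (s : Dec (Small A)) (l : Dec (Leafy A)) → Mδ * Mδ * (b * (𝟙 (¬? s) * 𝟙 (¬? l))) ≤ 1152 * (Q * Q) * (b * (loose (gr A) * (loose (gr A) ∸ L)))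
            go b (yes _) _ = ≤-trans (≤-reflexive (trans (cong (Mδ * Mδ *_) (*-zeroʳ b)) (*-zeroʳ (Mδ * Mδ)))) z≤n
            go b (no _) (yes _) = ≤-trans (≤-reflexive (trans (cong (Mδ * Mδ *_) (*-zeroʳ b)) (*-zeroʳ (Mδ * Mδ)))) z≤n
            go b (no ns) (no nl) = ≤-trans (≤-reflexive (trans (cong (Mδ * Mδ *_) (*-identityʳ b)) (*-comm _ b))) (≤-trans (*-monoʳ-≤ b (cyclic-large A r ns nl)) (≤-reflexive (eq₃ b (1152 * (Q * Q)) _)))
              where
              eq₃ : ∀ a b c → a * (b * c) ≡ b * (a * c)
              eq₃ = solve-∀

        -- Supercriticality makes the sum of δ c at least M, and δ c vanishes at degrees up to 2 and
        -- is at most 3B(d - 2) above. So there is enough excess degree to graft onto.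
        branching-mass : Mδ ≤ 3 * B * ∑ᵛ (λ v → d v ∸ 2)
        branching-mass = *-cancelˡ-≤ (2 * e) {{>-nonZero (≤-trans 1≤e (m≤n*m e 2))}} (≤-trans (≤-trans (*-monoˡ-≤ Mδ (m≤m+n (2 * e) 1)) supercritical) (*-monoʳ-≤ (2 * e)
            (≤-trans (∑-mono (fins n) (λ v → pw v (d v) refl)) (≤-reflexive (∑-*ˡ (fins n) (3 * B) _)))))
          where
          pw : ∀ v k → d v ≡ k → δ v * c v ≤ 3 * B * (d v ∸ 2)
          pw v 0 eq = ≤-trans (≤-reflexive (cong (_* c v) (trans (cong (𝟙 (branching? v) *_) eq) (*-zeroʳ (𝟙 (branching? v)))))) z≤n
          pw v 1 eq = ≤-trans (≤-reflexive (trans (cong (λ k → δ v * ((k ∸ 1) ⊓ B)) eq) (*-zeroʳ (δ v)))) z≤n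
          pw v 2 eq = ≤-trans (≤-reflexive (cong (λ k → k * d v * c v) (𝟙-no (branching? v) (λ b → b eq)))) z≤n
          pw v (suc (suc (suc k))) eq = ≤-trans (*-mono-≤ (≤-trans (𝟙*-le (branching? v) (d v)) (≤-reflexive eq)) (m⊓n≤n (d v ∸ 1) B))
            (≤-trans (≤-trans (m≤m+n _ (2 * k * B)) (≤-reflexive (eq′ k B))) (≤-reflexive (cong (λ j → 3 * B * (j ∸ 2)) (sym eq))))
            where
            eq′ : ∀ k b → (3 + k) * b + 2 * k * b ≡ 3 * b * (1 + k)
            eq′ = solve-∀

        -- A leafy realization has at least M/(8Q) large leaves, and the 3L excluded ones are at
        -- most half of that, since 48 is 3 times 16.
        spare-large : ∀ A → Leafy A → Mδ ≤ 16 * Q * spare A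
        spare-large A l = lin (+-mono-≤ (*-monoʳ-≤ 2 l) (+-mono-≤ (*-monoʳ-≤ (16 * Q) (m≤n+m∸n (bigLeaves A) (3 * L))) L-small)) 0 (eq Mδ Q (bigLeaves A) L (spare A))
          where
          eq : ∀ m q b L s → m + (2 * (8 * q * b) + (16 * q * (3 * L + s) + m)) + 0 ≡ 16 * q * s + (2 * m + (16 * q * b + 48 * q * L))
          eq = solve-∀

        -- With `spare` of order M/(16 Q) and total excess degree of order M/(3B), the left side of
        -- `few-big-leaves` is t M⁴ times the number of leafy realizations up to constants, against
        -- M⁴ on the right; t absorbs the constants.
        leafy-part : 3 * dl * Σleafy ≤ Tot
        leafy-part = *-cancelˡ-≤ (3 * 4096 * B * (Q * Q * Q)) {{>-nonZero (*-mono-≤ {1} {3 * 4096 * B} (≤-trans 1≤B (m≤n*m B (3 * 4096))) (*-mono-≤ {1} (*-mono-≤ {1} 1≤Q 1≤Q) 1≤Q))}}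
          (*-cancelˡ-≤ (Mδ * Mδ * Mδ * Mδ) {{>-nonZero (*-mono-≤ {1} (*-mono-≤ {1} (*-mono-≤ {1} M>0 M>0) M>0) M>0)}} (begin
            Mδ * Mδ * Mδ * Mδ * (3 * 4096 * B * (Q * Q * Q) * (3 * dl * Σleafy)) ≡⟨ trans (eq₁ 4096 Mδ B Q dl Σleafy) (cong (_* (Mδ * (Mδ * Mδ * Mδ * Σleafy))) (sym t≡)) ⟩
            t * (Mδ * (Mδ * Mδ * Mδ * Σleafy)) ≤⟨ *-monoʳ-≤ t (*-monoʳ-≤ Mδ leafy≤) ⟩
            t * (Mδ * (4096 * (Q * Q * Q) * S)) ≤⟨ *-monoʳ-≤ t (*-monoˡ-≤ (4096 * (Q * Q * Q) * S) branching-mass) ⟩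
            t * (3 * B * Σd * (4096 * (Q * Q * Q) * S)) ≡⟨ eq₂ 4096 t B Σd Q S ⟩
            3 * 4096 * B * (Q * Q * Q) * (t * (Σd * S)) ≤⟨ *-monoʳ-≤ (3 * 4096 * B * (Q * Q * Q)) few-big-leaves ⟩
            3 * 4096 * B * (Q * Q * Q) * (Mδ * Mδ * Mδ * (Mδ * Tot)) ≡⟨ eq₃ (3 * 4096 * B * (Q * Q * Q)) Mδ Tot ⟩
            Mδ * Mδ * Mδ * Mδ * (3 * 4096 * B * (Q * Q * Q) * Tot) ∎))
          where
          open ≤-Reasoning
          S Σd : ℕ
          S = ∑ᴿ (λ A → 𝟙 (bounded? A) * (spare A * spare A * spare A))
          Σd = ∑ᵛ (λ v → d v ∸ 2)
          eq₁ : ∀ k m b q l s → m * m * m * m * (3 * k * b * (q * q * q) * (3 * l * s)) ≡ 9 * k * b * (q * q * q) * l * (m * (m * m * m * s))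
          eq₁ = solve-∀
          eq₂ : ∀ k t b x q s → t * (3 * b * x * (k * (q * q * q) * s)) ≡ 3 * k * b * (q * q * q) * (t * (x * s))
          eq₂ = solve-∀
          eq₃ : ∀ a m t → a * (m * m * m * (m * t)) ≡ m * m * m * m * (a * t)
          eq₃ = solve-∀
          leafy≤ : Mδ * Mδ * Mδ * Σleafy ≤ 4096 * (Q * Q * Q) * S
          leafy≤ = begin
            Mδ * Mδ * Mδ * Σleafy ≡⟨ sym (∑ᴿ-*ˡ (Mδ * Mδ * Mδ) _) ⟩
            ∑ᴿ (λ A → Mδ * Mδ * Mδ * (𝟙 (bounded? A) * 𝟙 (leafy? A))) ≤⟨ ∑ᴿ-mono (λ A _ → perA A (𝟙 (bounded? A)) (leafy? A)) ⟩
            ∑ᴿ (λ A → 4096 * (Q * Q * Q) * (𝟙 (bounded? A) * (spare A * spare A * spare A))) ≡⟨ ∑ᴿ-*ˡ (4096 * (Q * Q * Q)) _ ⟩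
            4096 * (Q * Q * Q) * S ∎
            where
            perA : ∀ A b (l : Dec (Leafy A)) → Mδ * Mδ * Mδ * (b * 𝟙 l) ≤ 4096 * (Q * Q * Q) * (b * (spare A * spare A * spare A))
            perA A b (no _) = ≤-trans (≤-reflexive (trans (cong (Mδ * Mδ * Mδ *_) (*-zeroʳ b)) (*-zeroʳ (Mδ * Mδ * Mδ)))) z≤n
            perA A b (yes l) = ≤-trans (*-monoˡ-≤ (b * 1) (*-mono-≤ (*-mono-≤ (spare-large A l) (spare-large A l)) (spare-large A l))) (≤-reflexive (eq₄ Q (spare A) b))
              where
              eq₄ : ∀ q s b → 16 * q * s * (16 * q * s) * (16 * q * s) * (b * 1) ≡ 4096 * (q * q * q) * (b * (s * s * s))
              eq₄ = solve-∀

      bounded-rare : dl * ∑ᴿ (λ A → 𝟙 (bounded? A)) ≤ Tot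
      bounded-rare = *-cancelˡ-≤ 3 (begin
          3 * (dl * ∑ᴿ (λ A → 𝟙 (bounded? A))) ≤⟨ *-monoʳ-≤ 3 (*-monoʳ-≤ dl cover) ⟩
          3 * (dl * (Σsmall + Σleafy + Σcyclic)) ≡⟨ eq dl Σsmall Σleafy Σcyclic ⟩
          3 * dl * Σsmall + 3 * dl * Σleafy + 3 * dl * Σcyclic ≤⟨ +-mono-≤ (+-mono-≤ small-part leafy-part) cyclic-part ⟩
          Tot + Tot + Tot ≡⟨ eq₂ Tot ⟩
          3 * Tot ∎)
        where
        open ≤-Reasoning
        eq : ∀ d a b c → 3 * (d * (a + b + c)) ≡ 3 * d * a + 3 * d * b + 3 * d * c
        eq = solve-∀
        eq₂ : ∀ t → t + t + t ≡ 3 * t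
        eq₂ = solve-∀
        cover : ∑ᴿ (λ A → 𝟙 (bounded? A)) ≤ Σsmall + Σleafy + Σcyclic
        cover = ≤-trans (∑ᴿ-mono (λ A _ → go (𝟙 (bounded? A)) (𝟙≤1 (bounded? A)) (small? A) (leafy? A))) (≤-reflexive (trans (∑ᴿ-+ _ _) (cong (_+ Σcyclic) (∑ᴿ-+ _ _))))
          where
          go : ∀ {S L : Set} b → b ≤ 1 → (s : Dec S) (l : Dec L) → b ≤ 𝟙 s + b * 𝟙 l + b * (𝟙 (¬? s) * 𝟙 (¬? l))
          go b b≤1 (yes _) l = ≤-trans b≤1 (s≤s z≤n)
          go b b≤1 (no _) (yes _) = m≤n⇒m≤n+o (b * 0) (≤-reflexive (sym (*-identityʳ b)))
          go b b≤1 (no _) (no _) = m≤n⇒m≤o+n (b * 0) (≤-reflexive (sym (*-identityʳ b)))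

  -- Supercriticality

  ∑-↭ : {A : Set} {xs ys : List A} → xs ↭ ys → (f : A → ℕ) → ∑ xs f ≡ ∑ ys f
  ∑-↭ ↭-refl f = refl
  ∑-↭ (prep x p) f = cong (f x +_) (∑-↭ p f)
  ∑-↭ (↭-swap x y p) f = trans (cong (λ k → f x + (f y + k)) (∑-↭ p f)) (eq (f x) (f y) _)
    where
    eq : ∀ a b c → a + (b + c) ≡ b + (a + c)
    eq = solve-∀
  ∑-↭ (↭-trans p q) f = trans (∑-↭ p f) (∑-↭ q f)

  ∑-toList : ∀ {n} (D : Vec ℕ n) (f : ℕ → ℕ) → ∑ (toList D) f ≡ ∑ᵛ (λ v → f (lookup D v))
  ∑-toList Vec.[] f = refl
  ∑-toList {suc n} (x Vec.∷ D) f = cong (f x +_) (trans (∑-toList D f) (sym (∑-map suc (fins n) _)))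

  sum≡∑ : (xs : List ℕ) → sum xs ≡ ∑ xs id
  sum≡∑ [] = refl
  sum≡∑ (x ∷ xs) = cong (x +_) (sum≡∑ xs)

  ∑-mono-All : {A : Set} {P : A → Set} {f g : A → ℕ} → (∀ x → P x → f x ≤ g x) → ∀ {xs} → All P xs → ∑ xs f ≤ ∑ xs g
  ∑-mono-All h [] = z≤n
  ∑-mono-All h (p ∷ ps) = +-mono-≤ (h _ p) (∑-mono-All h ps)

  sq dbl : ℕ → ℕ
  sq x = x * x
  dbl x = 2 * x

  -- The integer prefix sum s of d(d - 2) is kept as a difference a - b of naturals, squares against
  -- doubles, so that the comparison can be made without integers.
  weight-eq : ∀ x s a b → s ℤ.+ pos b ≡ pos a → (s ℤ.+ Defs.w x) ℤ.+ pos (b + dbl x) ≡ pos (a + sq x)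
  weight-eq x s a b h = trans (cong (λ z → (s ℤ.+ Defs.w x) ℤ.+ z) (trans (ℤP.pos-+ b (dbl x)) (cong (λ z → pos b ℤ.+ z) (ℤP.pos-* 2 x))))
    (trans (eq s (pos x) (pos b)) (trans (cong (ℤ._+ (pos x ℤ.* pos x)) h) (trans (cong (λ z → pos a ℤ.+ z) (sym (ℤP.pos-* x x))) (sym (ℤP.pos-+ a (sq x))))))
    where
    eq : ∀ s x b → (s ℤ.+ x ℤ.* (x ℤ.- pos 2)) ℤ.+ (b ℤ.+ pos 2 ℤ.* x) ≡ (s ℤ.+ b) ℤ.+ x ℤ.* x
    eq = solveℤ-∀

  ∑-filterᵇ : {A : Set} (p : A → Bool) (xs : List A) (f : A → ℕ) → ∑ (filterᵇ p xs) f ≡ ∑ xs (λ x → 𝟙 (T? (p x)) * f x)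
  ∑-filterᵇ p [] f = refl
  ∑-filterᵇ p (x ∷ xs) f with p x
  ... | true = cong₂ _+_ (sym (*-identityˡ (f x))) (∑-filterᵇ p xs f)
  ... | false = ∑-filterᵇ p xs f

  -- The sorted degrees cut at the stopping index: x is the degree there and r is R. An empty `post`
  -- covers the default index n; otherwise `stop` says that the prefix sum is positive.
  record Split (a b : ℕ) (l : List ℕ) (r : ℕ) : Set where
    field
      pre post : List ℕ
      x : ℕ
      l≡ : l ≡ pre ++ x ∷ post
      r≡ : r ≡ x + ∑ post id
      below : All (_≤ x) pre
      above : All (x ≤_) post
      stop : post ≡ [] ⊎ suc (b + ∑ pre dbl + dbl x) ≤ a + ∑ pre sq + sq x

  Rgo-split : ∀ l s a b → s ℤ.+ pos b ≡ pos a → AllPairs _≤_ l → l ≡ [] ⊎ Split a b l (Rgo s l)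
  Rgo-split [] s a b h ap = inj₁ refl
  Rgo-split (d ∷ []) s a b h ap = inj₂ record { pre = [] ; post = [] ; x = d ; l≡ = refl ; r≡ = sym (+-identityʳ d) ; below = [] ; above = [] ; stop = inj₁ refl }
  Rgo-split (d ∷ ds@(d′ ∷ ds′)) s a b h (le ∷ ap) with pos 1 ℤ.≤ᵇ (s ℤ.+ Defs.w d) in eq
  ... | true = inj₂ record { pre = [] ; post = ds ; x = d ; l≡ = refl ; r≡ = cong (d +_) (sum≡∑ ds) ; below = [] ; above = le ; stop = inj₂ positive }
    where
    positive : suc (b + 0 + dbl d) ≤ a + 0 + sq d
    positive = subst₂ (λ p q → suc (p + dbl d) ≤ q + sq d) (sym (+-identityʳ b)) (sym (+-identityʳ a)) (ℤP.drop‿+≤+ (ℤP.≤-trans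
      (ℤP.+-monoˡ-≤ (pos (b + dbl d)) (ℤP.≤ᵇ⇒≤ {pos 1} {s ℤ.+ Defs.w d} (Equivalence.from T-≡ eq))) (ℤP.≤-reflexive (weight-eq d s a b h))))
  ... | false with Rgo-split ds (s ℤ.+ Defs.w d) (a + sq d) (b + dbl d) (weight-eq d s a b h) ap
  ... | inj₂ sp = inj₂ record { pre = d ∷ Split.pre sp ; post = Split.post sp ; x = Split.x sp ; l≡ = cong (d ∷_) (Split.l≡ sp) ; r≡ = Split.r≡ sp
      ; below = All.lookup le (subst (Split.x sp ∈_) (sym (Split.l≡ sp)) (∈-++⁺ʳ (Split.pre sp) (here refl))) ∷ Split.below sp ; above = Split.above sp
      ; stop = [ inj₁ , (λ h′ → inj₂ (subst₂ (λ p q → suc (p + dbl (Split.x sp)) ≤ q + sq (Split.x sp)) (+-assoc b (dbl d) _) (+-assoc a (sq d) _) h′)) ]′ (Split.stop sp) }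

  module Supercritical (e L : ℕ) (1≤e : 1 ≤ e) where

    -- If the stopping degree exceeds the cap, the gain is at least B R, and R ≥ M/e turns this into
    -- 4M, more than enough. The same B caps the offspring everywhere else.
    B : ℕ
    B = 4 * e

    bt? : ∀ x → Dec (x ≢ 2)
    bt? x = ¬? (x ≟ 2)

    mass gain : ℕ → ℕ
    mass x = 𝟙 (bt? x) * x
    gain x = mass x * ((x ∸ 1) ⊓ B)

    private
      -- Up to the cap, gain minus mass is x(x - 2), the summand of the stopping rule; moving terms
      -- across keeps it in the naturals.
      balance : ∀ x → x ≤ suc B → mass x + sq x ≡ gain x + dbl x
      balance 0 _ = refl
      balance 1 _ = refl
      balance 2 _ = refl
      balance (suc (suc (suc k))) (s≤s le) = trans (eq k) (cong (λ z → 1 * (3 + k) * z + dbl (3 + k)) (sym (m≤n⇒m⊓n≡m le)))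
        where
        eq : ∀ k → 1 * (3 + k) + (3 + k) * (3 + k) ≡ 1 * (3 + k) * (2 + k) + 2 * (3 + k)
        eq = solve-∀

      2≤B : 2 ≤ B
      2≤B = ≤-trans (s≤s (s≤s z≤n)) (*-monoʳ-≤ 4 1≤e)

      surplus : ∀ x → 3 ≤ x → mass x + x ≤ gain x
      surplus 1 (s≤s ())
      surplus 2 (s≤s (s≤s ()))
      surplus (suc (suc (suc k))) _ = ≤-trans (≤-reflexive (eq (3 + k))) (*-monoʳ-≤ (1 * (3 + k)) (⊓-glb (s≤s (s≤s z≤n)) 2≤B))
        where
        eq : ∀ x → 1 * x + x ≡ 1 * x * 2
        eq = solve-∀

      capped : ∀ x → suc B ≤ x → B * x ≤ gain x
      capped (suc x) le = ≤-reflexive (trans (*-comm B (suc x)) (cong₂ _*_ (trans (sym (*-identityˡ (suc x))) (cong (_* suc x) (sym (𝟙-yes (bt? (suc x)) (λ eq → 1+n≰n (≤-trans (subst (suc B ≤_) eq le) 2≤B))))))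
                    (sym (m≥n⇒m⊓n≡n (≤-pred le)))))

    -- The prefix sum of d(d - 2) up to the stopping index is positive; beyond it every degree is at least 3.
    supercritical-list : ∀ l → All (λ x → x ≢ 2 → x ≤ L) l → 2 * e * L ≤ ∑ l mass → e * (L + 2) < ∑ l mass →
      AllPairs _≤_ l → ∑ l mass ≤ e * Rgo (pos 0) l → (2 * e + 1) * ∑ l mass ≤ 2 * e * ∑ l gain
    supercritical-list l small h₁ h₂ ap big with Rgo-split l (pos 0) 0 0 refl ap
    ... | inj₁ refl = contradiction h₂ (λ ())
    ... | inj₂ sp = go (Split.stop sp)
      where
      open Split sp
      m = ∑ l mass
      x-small : x ≢ 2 → x ≤ L
      x-small = All.lookup small (subst (x ∈_) (sym l≡) (∈-++⁺ʳ pre (here refl)))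
      ∑l : ∀ f → ∑ l f ≡ ∑ pre f + (f x + ∑ post f)
      ∑l f = trans (cong (λ z → ∑ z f) l≡) (∑-++ pre (x ∷ post) f)
      big′ : m ≤ e * (x + ∑ post id)
      big′ = ≤-trans big (≤-reflexive (cong (e *_) r≡))
      go : post ≡ [] ⊎ suc (∑ pre dbl + dbl x) ≤ ∑ pre sq + sq x → (2 * e + 1) * m ≤ 2 * e * ∑ l gain
      -- At the last index R is a single degree, at most L + 2, which is too small for e R ≥ M. The
      -- 2 covers a last degree equal to 2, to which the bound by L does not apply.
      go (inj₁ none) = contradiction h₂ (≤⇒≯ (≤-trans big′ (*-monoʳ-≤ e (≤-trans (≤-reflexive (trans (cong (λ z → x + ∑ z id) none) (+-identityʳ x))) x≤))))
        where
        x≤ : x ≤ L + 2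
        x≤ with x ≟ 2
        ... | yes eq = ≤-trans (≤-reflexive eq) (m≤n+m 2 L)
        ... | no ne = ≤-trans (x-small ne) (m≤m+n L 2)
      go (inj₂ over) with x ≤? suc B
      -- Every degree from the stopping index on is above the cap and gains B per unit of degree.
      ... | no x≰B = begin
          (2 * e + 1) * m ≤⟨ *-monoˡ-≤ m (lin 1≤e {2 * e + 1} {8 * e} (5 * e) (eq₁ e)) ⟩
          8 * e * m ≤⟨ *-monoʳ-≤ (8 * e) big′ ⟩
          8 * e * (e * (x + ∑ post id)) ≡⟨ eq₂ e (x + ∑ post id) ⟩
          2 * e * (B * (x + ∑ post id)) ≤⟨ *-monoʳ-≤ (2 * e) large ⟩
          2 * e * ∑ l gain ∎
        where
        open ≤-Reasoning
        eq₁ : ∀ e → 2 * e + 1 + e + 5 * e ≡ 8 * e + 1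
        eq₁ = solve-∀
        eq₂ : ∀ e r → 8 * e * (e * r) ≡ 2 * e * (4 * e * r)
        eq₂ = solve-∀
        large : B * (x + ∑ post id) ≤ ∑ l gain
        large = ≤-trans (≤-reflexive (trans (*-distribˡ-+ B x _) (cong (B * x +_) (sym (∑-*ˡ post B id)))))
          (≤-trans (+-mono-≤ (capped x (<⇒≤ (≰⇒> x≰B))) (∑-mono-All (λ y le → capped y (≤-trans (<⇒≤ (≰⇒> x≰B)) le)) above))
            (≤-trans (m≤n+m _ (∑ pre gain)) (≤-reflexive (sym (∑l gain)))))
      -- By `whole` the gain is at least 1 + M + P. Here P is R - x, at least M/e - L, and 2eL ≤ M
      -- makes this a surplus of at least M/(2e).
      ... | yes x≤B = lin (+-mono-≤ (*-monoʳ-≤ (2 * e) whole) (+-mono-≤ (*-monoʳ-≤ 2 big′) (+-mono-≤ (*-monoʳ-≤ (2 * e) (x-small x≢2)) h₁))) (2 * e)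
          (eq e m (∑ l gain) x P L)
        where
        P = ∑ post id
        eq : ∀ e m g x p L → (2 * e + 1) * m + (2 * e * g + (2 * (e * (x + p)) + (2 * e * L + m))) + 2 * e
             ≡ 2 * e * g + (2 * e * (1 + m + p) + (2 * m + (2 * e * x + 2 * e * L)))
        eq = solve-∀
        -- Were the stopping degree at most 2, so would be all degrees before it, and the sum of d(d
        -- - 2) could not be positive.
        3≤x : 3 ≤ x
        3≤x with 3 ≤? x
        ... | yes le = le
        ... | no nle = contradiction over (≤⇒≯ (+-mono-≤ (∑-mono-All (λ y le → *-monoˡ-≤ y (≤-trans le x≤2)) below) (*-monoˡ-≤ x x≤2)))
          where
          x≤2 : x ≤ 2
          x≤2 = ≤-pred (≰⇒> nle)
        x≢2 : x ≢ 2
        x≢2 refl = contradiction 3≤x λ { (s≤s (s≤s ())) }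
        before : ∑ pre mass + ∑ pre sq ≤ ∑ pre gain + ∑ pre dbl
        before = ≤-trans (≤-reflexive (sym (∑-+ pre mass sq))) (≤-trans (∑-mono-All (λ y le → ≤-reflexive (balance y (≤-trans le x≤B))) below) (≤-reflexive (∑-+ pre gain dbl)))
        after : ∑ post mass + P ≤ ∑ post gain
        after = ≤-trans (≤-reflexive (sym (∑-+ post mass id))) (∑-mono-All (λ y le → surplus y (≤-trans 3≤x le)) above)
        whole : 1 + m + P ≤ ∑ l gain
        whole = subst₂ (λ p q → 1 + p + P ≤ q) (sym (∑l mass)) (sym (∑l gain))
          (lin (+-mono-≤ before (+-mono-≤ (≤-reflexive (balance x x≤B)) (+-mono-≤ over after))) 0
            (eq′ (∑ pre mass) (mass x) (∑ post mass) P (∑ pre gain) (gain x) (∑ post gain) (∑ pre sq) (sq x) (∑ pre dbl) (dbl x)))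
          where
          eq′ : ∀ pm mx qm P pg gx qg ps sx pd dx → 1 + (pm + (mx + qm)) + P + (pg + pd + (gx + dx + (ps + sx + qg))) + 0
                ≡ pg + (gx + qg) + (pm + ps + (mx + sx + (suc (pd + dx) + (qm + P))))
          eq′ = solve-∀

    module _ {n} (D : Vec ℕ n) where

      open Counting D using (d; δ; Mδ)

      M≡Mδ : M D ≡ Mδ
      M≡Mδ = trans (sum≡∑ (filterᵇ (λ d → not (d ≡ᵇ 2)) (toList D))) (trans (∑-filterᵇ (λ d → not (d ≡ᵇ 2)) (toList D) id)
          (trans (∑-cong (toList D) (λ x → cong (_* x) (𝟙-cong (T? (not (x ≡ᵇ 2))) (bt? x) (to x) (from x)))) (∑-toList D mass)))
        where
        to : ∀ x → T (not (x ≡ᵇ 2)) → x ≢ 2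
        to .2 () refl
        from : ∀ x → x ≢ 2 → T (not (x ≡ᵇ 2))
        from x ne with x ≡ᵇ 2 in eq
        ... | true = contradiction (≡ᵇ⇒≡ x 2 (subst T (sym eq) tt)) ne
        ... | false = tt

      supercritical : (∀ v → d v ≢ 2 → d v ≤ L) → 2 * e * L ≤ Mδ → e * (L + 2) < Mδ → Mδ ≤ e * R D →
                      (2 * e + 1) * Mδ ≤ 2 * e * ∑ᵛ (λ v → δ v * ((d v ∸ 1) ⊓ B))
      supercritical small h₁ h₂ big = subst₂ (λ p q → (2 * e + 1) * p ≤ 2 * e * q) (l≡ mass) (l≡ gain)
          (supercritical-list l l-small (subst (2 * e * L ≤_) (sym (l≡ mass)) h₁) (subst (e * (L + 2) <_) (sym (l≡ mass)) h₂)
            (Linked⇒AllPairs ≤-trans (sort-↗ (toList D))) (subst (_≤ e * R D) (sym (l≡ mass)) big))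
        where
        l = sort (toList D)
        l≡ : ∀ f → ∑ l f ≡ ∑ᵛ (λ v → f (d v))
        l≡ f = trans (∑-↭ (sort-↭ (toList D)) f) (∑-toList D f)
        in-list : ∀ {n} (D : Vec ℕ n) {x} → x ∈ toList D → ∃ λ v → x ≡ lookup D v
        in-list (y Vec.∷ D) (here refl) = zero , refl
        in-list (y Vec.∷ D) (there p) with in-list D p
        ... | v , eq = suc v , eq
        l-small : All (λ x → x ≢ 2 → x ≤ L) l
        l-small = All.tabulate λ p ne → let v , eq = in-list D (Perm.∈-resp-↭ (sort-↭ (toList D)) p) in
          ≤-trans (≤-reflexive eq) (small v (λ h → ne (trans eq h)))

  -- Suppression of the vertices of degree 2

  any-∃ : {A : Set} (p : A → Bool) (xs : List A) → T (BL.any p xs) → ∃ λ x → x ∈ xs × T (p x)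
  any-∃ p (x ∷ xs) h with Equivalence.to (T-∨ {p x}) h
  ... | inj₁ px = x , here refl , px
  ... | inj₂ h′ with any-∃ p xs h′
  ... | y , m , py = y , there m , py

  ∃-any : {A : Set} (p : A → Bool) {xs : List A} {x : A} → x ∈ xs → T (p x) → T (BL.any p xs)
  ∃-any p (here refl) px = Equivalence.from (T-∨ {p _}) (inj₁ px)
  ∃-any p {y ∷ _} (there m) px = Equivalence.from (T-∨ {p y}) (inj₂ (∃-any p m px))

  ∈-filterᵇ : {A : Set} (p : A → Bool) {xs : List A} {x : A} → x ∈ filterᵇ p xs → x ∈ xs × T (p x)
  ∈-filterᵇ p {xs} m = ∈-filter⁻ (λ x → T? (p x)) {xs = xs} m

  filterᵇ-∈ : {A : Set} (p : A → Bool) {xs : List A} {x : A} → x ∈ xs → T (p x) → x ∈ filterᵇ p xs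
  filterᵇ-∈ p m px = ∈-filter⁺ (λ x → T? (p x)) m px

  module Multigraph {n : ℕ} where

    eqᵇ-sound : ∀ (i j : Fin n) → T (eqᵇ i j) → i ≡ j
    eqᵇ-sound i j h = toWitness h

    eqᵇ-refl : ∀ {i j : Fin n} → i ≡ j → T (eqᵇ i j)
    eqᵇ-refl {i} refl = fromWitness {a? = i ≟ᶠ i} refl

    touches⇒ : ∀ v (e : Fin n × Fin n) → T (touches v e) → v ≡ proj₁ e ⊎ v ≡ proj₂ e
    touches⇒ v (a , b) h = [ (λ h → inj₁ (eqᵇ-sound v a h)) , (λ h → inj₂ (eqᵇ-sound v b h)) ]′ (Equivalence.to (T-∨ {eqᵇ v a}) h)

    ⇒touches : ∀ v (e : Fin n × Fin n) → v ≡ proj₁ e ⊎ v ≡ proj₂ e → T (touches v e)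
    ⇒touches v (a , b) h = Equivalence.from (T-∨ {eqᵇ v a}) ([ (λ r → inj₁ (eqᵇ-refl r)) , (λ r → inj₂ (eqᵇ-refl r)) ]′ h)

    In : Vec Bool n → Fin n → Set
    In S u = T (lookup S u)

    module _ (E : MG n) where

      step⇒ : ∀ S u → In (Defs.step E S) u → In S u ⊎ ∃ λ w → In S w × Star (Adj E) w u
      step⇒ S u h with Equivalence.to (T-∨ {lookup S u}) (subst T (lookup∘tabulate _ u) h)
      ... | inj₁ i = inj₁ i
      ... | inj₂ h′ with any-∃ (λ e → touches u e ∧ (lookup S (proj₁ e) ∨ lookup S (proj₂ e))) E h′
      ... | (a , b) , m , h″ with Equivalence.to (T-∧ {touches u (a , b)}) h″
      ... | t , c with touches⇒ u (a , b) t | Equivalence.to (T-∨ {lookup S a}) c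
      ... | inj₁ refl | inj₁ i = inj₁ i
      ... | inj₁ refl | inj₂ i = inj₂ (b , i , return (inj₂ m))
      ... | inj₂ refl | inj₁ i = inj₂ (a , i , return (inj₁ m))
      ... | inj₂ refl | inj₂ i = inj₁ i

      step-mono : ∀ S u → In S u → In (Defs.step E S) u
      step-mono S u i = subst T (sym (lookup∘tabulate _ u)) (Equivalence.from (T-∨ {lookup S u}) (inj₁ i))

      step-edge : ∀ S {a b} → Adj E a b → In S a → In (Defs.step E S) b
      step-edge S {a} {b} (inj₁ m) i = subst T (sym (lookup∘tabulate _ b)) (Equivalence.from (T-∨ {lookup S b}) (inj₂ (∃-any (λ e → touches b e ∧ (lookup S (proj₁ e) ∨ lookup S (proj₂ e))) m
        (Equivalence.from (T-∧ {touches b (a , b)}) (⇒touches b (a , b) (inj₂ refl) , Equivalence.from (T-∨ {lookup S a}) (inj₁ i))))))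
      step-edge S {a} {b} (inj₂ m) i = subst T (sym (lookup∘tabulate _ b)) (Equivalence.from (T-∨ {lookup S b}) (inj₂ (∃-any (λ e → touches b e ∧ (lookup S (proj₁ e) ∨ lookup S (proj₂ e))) m
        (Equivalence.from (T-∧ {touches b (b , a)}) (⇒touches b (b , a) (inj₁ refl) , Equivalence.from (T-∨ {lookup S b}) (inj₂ i))))))

      ClosedSet : Vec Bool n → Set
      ClosedSet S = ∀ {a b} → Adj E a b → In S a → In S b

      size : Vec Bool n → ℕ
      size S = ∑ᵛ (λ u → 𝟙 (T? (lookup S u)))

      stable : ∀ S → size (Defs.step E S) ≤ size S → ∀ u → In (Defs.step E S) u → In S u
      stable S le u i with T? (lookup S u)
      ... | yes j = j
      ... | no nj = contradiction le (<⇒≱ (≤-trans (≤-reflexive (cong (_+ size S) (sym (∑-point₁ u)))) (≤-trans (≤-reflexive (sym (∑-+ (fins n) _ _))) (∑-mono (fins n) pw))))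
        where
        pw : ∀ w → 𝟙 (w ≟ᶠ u) + 𝟙 (T? (lookup S w)) ≤ 𝟙 (T? (lookup (Defs.step E S) w))
        pw w with w ≟ᶠ u
        ... | yes refl = ≤-reflexive (trans (cong suc (𝟙-no (T? (lookup S u)) nj)) (sym (𝟙-yes (T? (lookup (Defs.step E S) u)) i)))
        ... | no _ = 𝟙-mono (T? (lookup S w)) (T? (lookup (Defs.step E S) w)) (step-mono S w)

      closed-step : ∀ S → ClosedSet S → ClosedSet (Defs.step E S)
      closed-step S cl {a} {b} e i with step⇒ S a i
      ... | inj₁ j = step-edge S e j
      ... | inj₂ (w , j , c) = step-mono S b (walk c j)
        where
        walk : ∀ {w} → Star (Adj E) w a → In S w → In S b
        walk ε j = cl e j
        walk (r ◅ rs) j = walk rs (cl r j)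

      closed-iter : ∀ k S → ClosedSet S → ClosedSet (iter k (Defs.step E) S)
      closed-iter zero S cl = cl
      closed-iter (suc k) S cl = closed-iter k (Defs.step E S) (closed-step S cl)

      -- Each round either adds a vertex or changes nothing, and a set that one round leaves
      -- unchanged is closed; so n rounds suffice.
      saturates : ∀ k S → n ≤ size S + k → ClosedSet (iter k (Defs.step E) S)
      saturates zero S le {a} {b} e i with T? (lookup S b)
      ... | yes j = j
      ... | no nj = contradiction le (<⇒≱ (≤-trans (≤-reflexive (cong suc (+-identityʳ (size S)))) (≤-trans (≤-trans (≤-reflexive (cong (_+ size S) (sym (∑-point₁ b)))) (≤-trans (≤-reflexive (sym (∑-+ (fins n) _ _))) (∑-mono (fins n) pw)))
          (≤-reflexive (trans (∑-const (fins n) 1) (trans (*-identityʳ _) (length-fins n)))))))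
        where
        length-fins : ∀ n → length (fins n) ≡ n
        length-fins zero = refl
        length-fins (suc n) = cong suc (trans (length-map suc (fins n)) (length-fins n))
        pw : ∀ w → 𝟙 (w ≟ᶠ b) + 𝟙 (T? (lookup S w)) ≤ 1
        pw w with w ≟ᶠ b
        ... | yes refl = s≤s (≤-reflexive (𝟙-no (T? (lookup S b)) nj))
        ... | no _ = 𝟙≤1 (T? (lookup S w))
      saturates (suc k) S le with size (Defs.step E S) ≤? size S
      ... | yes st = closed-iter k (Defs.step E S) (closed-step S (λ {a} {b} e i → stable S st b (step-edge S e i)))
      ... | no grow = saturates k (Defs.step E S) (≤-trans le (≤-trans (≤-reflexive (+-suc (size S) k)) (+-monoˡ-≤ k (≰⇒> grow))))

      iter-mono : ∀ k S u → In S u → In (iter k (Defs.step E) S) u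
      iter-mono zero S u i = i
      iter-mono (suc k) S u i = iter-mono k (Defs.step E S) u (step-mono S u i)


      private
        start : Fin n → Vec Bool n
        start v = Vec.tabulate (eqᵇ v)

        start-in : ∀ v → In (start v) v
        start-in v = subst T (sym (lookup∘tabulate (eqᵇ v) v)) (eqᵇ-refl {v} refl)

      reach-complete : ∀ v u → Star (Adj E) v u → In (reach E v) u
      reach-complete v u c = walk c (iter-mono n (start v) v (start-in v))
        where
        cl : ClosedSet (reach E v)
        cl = saturates n (start v) (m≤n+m n (size (start v)))
        walk : ∀ {w} → Star (Adj E) w u → In (reach E v) w → In (reach E v) u
        walk ε i = i
        walk (r ◅ rs) i = walk rs (cl r i)

    -- A loop counts twice, so that degrees in the multigraph are preserved by suppression.
    incidence : Fin n → Fin n × Fin n → ℕ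
    incidence w e = 𝟙 (proj₁ e ≟ᶠ w) + 𝟙 (proj₂ e ≟ᶠ w)

    degᴱ : MG n → Fin n → ℕ
    degᴱ E w = ∑ E (incidence w)

    incidence-other : ∀ {v w} → w ≢ v → ∀ e → v ≡ proj₁ e ⊎ v ≡ proj₂ e → incidence w e ≡ 𝟙 (other v e ≟ᶠ w)
    incidence-other {v} {w} w≢v (a , b) t with v ≟ᶠ a
    ... | yes refl = cong (_+ 𝟙 (b ≟ᶠ w)) (𝟙-no (v ≟ᶠ w) (w≢v ∘ sym))
    incidence-other {v} {w} w≢v (a , b) (inj₁ r) | no ne = contradiction r ne
    incidence-other {v} {w} w≢v (a , b) (inj₂ refl) | no ne = trans (cong (𝟙 (a ≟ᶠ w) +_) (𝟙-no (v ≟ᶠ w) (w≢v ∘ sym))) (+-identityʳ _)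

    module _ (D : Vec ℕ n) where

      open Degrees (lookup D)

      -- Suppression keeps the degrees of, and the connections between, branching vertices.
      record Preserves (E E′ : MG n) : Set where
        field
          degrees : ∀ w → Branching w → degᴱ E′ w ≡ degᴱ E w
          connections : ∀ {a b} → Branching a → Branching b → Star (Adj E) a b → Star (Adj E′) a b
      open Preserves public

      suppress-preserves : ∀ E v → Preserves E (suppress D E v)
      suppress-preserves E v with lookup D v ≡ᵇ 2 in dv | filterᵇ (touches v) E in fl
      ... | false | _ = record { degrees = λ _ _ → refl ; connections = λ _ _ c → c }
      ... | true | [] = record { degrees = λ _ _ → refl ; connections = λ _ _ c → c }
      ... | true | _ ∷ [] = record { degrees = λ _ _ → refl ; connections = λ _ _ c → c }
      ... | true | _ ∷ _ ∷ _ ∷ _ = record { degrees = λ _ _ → refl ; connections = λ _ _ c → c }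
      ... | true | e₁ ∷ e₂ ∷ [] = record { degrees = degrees′ ; connections = λ {a} {b} ba bb c → subst₂ (Star (Adj E′)) (Φ-other (b≢v ba)) (Φ-other (b≢v bb)) (kleisliStar Φ hom c) }
        where
        o₁ = other v e₁
        o₂ = other v e₂
        E′ : MG n
        E′ = (o₁ , o₂) ∷ filterᵇ (λ e → not (touches v e)) E
        b≢v : ∀ {w} → Branching w → w ≢ v
        b≢v bw refl = bw (≡ᵇ⇒≡ (lookup D v) 2 (subst T (sym dv) tt))
        t₁ : v ≡ proj₁ e₁ ⊎ v ≡ proj₂ e₁
        t₁ = touches⇒ v e₁ (proj₂ (∈-filterᵇ (touches v) {E} (subst (e₁ ∈_) (sym fl) (here refl))))
        t₂ : v ≡ proj₁ e₂ ⊎ v ≡ proj₂ e₂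
        t₂ = touches⇒ v e₂ (proj₂ (∈-filterᵇ (touches v) {E} (subst (e₂ ∈_) (sym fl) (there (here refl)))))
        degrees′ : ∀ w → Branching w → degᴱ E′ w ≡ degᴱ E w
        degrees′ w bw = begin
            𝟙 (o₁ ≟ᶠ w) + 𝟙 (o₂ ≟ᶠ w) + degᴱ (filterᵇ (λ e → not (touches v e)) E) w
              ≡⟨ cong (_+ degᴱ (filterᵇ (λ e → not (touches v e)) E) w) (sym (trans (cong (incidence w e₁ +_) (+-identityʳ _)) (cong₂ _+_ (incidence-other (b≢v bw) e₁ t₁) (incidence-other (b≢v bw) e₂ t₂)))) ⟩
            ∑ (e₁ ∷ e₂ ∷ []) (incidence w) + degᴱ (filterᵇ (λ e → not (touches v e)) E) w
              ≡⟨ cong (λ l → ∑ l (incidence w) + degᴱ (filterᵇ (λ e → not (touches v e)) E) w) (sym fl) ⟩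
            ∑ (filterᵇ (touches v) E) (incidence w) + degᴱ (filterᵇ (λ e → not (touches v e)) E) w
              ≡⟨ cong₂ _+_ (∑-filterᵇ (touches v) E (incidence w)) (∑-filterᵇ (λ e → not (touches v e)) E (incidence w)) ⟩
            ∑ E (λ e → 𝟙 (T? (touches v e)) * incidence w e) + ∑ E (λ e → 𝟙 (T? (not (touches v e))) * incidence w e)
              ≡⟨ sym (∑-+ E _ _) ⟩
            ∑ E (λ e → 𝟙 (T? (touches v e)) * incidence w e + 𝟙 (T? (not (touches v e))) * incidence w e) ≡⟨ ∑-cong E (λ e → either (touches v e) (incidence w e)) ⟩
            degᴱ E w ∎
          where
          open ≡-Reasoning
          either : ∀ b k → 𝟙 (T? b) * k + 𝟙 (T? (not b)) * k ≡ k
          either true k = trans (+-identityʳ _) (*-identityˡ k)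
          either false k = *-identityˡ k
        -- The suppressed vertex is sent to `o₁` and every other vertex to itself; each old edge
        -- then becomes a walk of at most one edge.
        Φ′ : ∀ w → Dec (w ≡ v) → Fin n
        Φ′ w (yes _) = o₁
        Φ′ w (no _) = w
        Φ : Fin n → Fin n
        Φ w = Φ′ w (w ≟ᶠ v)
        Φ-other : ∀ {w} → w ≢ v → Φ w ≡ w
        Φ-other {w} ne with w ≟ᶠ v
        ... | yes eq = contradiction eq ne
        ... | no _ = refl
        Φv : Φ v ≡ o₁
        Φv with v ≟ᶠ v
        ... | yes _ = refl
        ... | no ne = contradiction refl ne
        -- An edge at v is sent to the vertex o₁ and the image of its other end.
        ends : ∀ e → v ≡ proj₁ e ⊎ v ≡ proj₂ e → (Φ (proj₁ e) ≡ o₁ × Φ (proj₂ e) ≡ Φ (other v e)) ⊎ (Φ (proj₁ e) ≡ Φ (other v e) × Φ (proj₂ e) ≡ o₁)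
        ends (a , b) t with v ≟ᶠ a
        ... | yes refl = inj₁ (Φv , refl)
        ends (a , b) (inj₁ r) | no ne = contradiction r ne
        ends (a , b) (inj₂ refl) | no ne = inj₂ (refl , Φv)
        link : ∀ e → e ≡ e₁ ⊎ e ≡ e₂ → Star (Adj E′) o₁ (Φ (other v e))
        -- `o₁` is v itself when the first edge is a loop; the image is `o₁` in either case.
        link e (inj₁ refl) with o₁ ≟ᶠ v
        ... | yes _ = ε
        ... | no _ = ε
        link e (inj₂ refl) with o₂ ≟ᶠ v
        ... | yes _ = ε
        ... | no _ = return (inj₁ (here refl))
        hom₁ : ∀ {a b} → (a , b) ∈ E → Star (Adj E′) (Φ a) (Φ b)
        hom₁ {a} {b} m with T? (touches v (a , b))
        ... | yes t with subst ((a , b) ∈_) fl (filterᵇ-∈ (touches v) m t) | ends (a , b) (touches⇒ v (a , b) t)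
        ... | here r | inj₁ (p , q) = subst₂ (Star (Adj E′)) (sym p) (sym q) (link (a , b) (inj₁ r))
        ... | there (here r) | inj₁ (p , q) = subst₂ (Star (Adj E′)) (sym p) (sym q) (link (a , b) (inj₂ r))
        ... | here r | inj₂ (p , q) = subst₂ (Star (Adj E′)) (sym p) (sym q) (reverse (adj-sym E′) (link (a , b) (inj₁ r)))
        ... | there (here r) | inj₂ (p , q) = subst₂ (Star (Adj E′)) (sym p) (sym q) (reverse (adj-sym E′) (link (a , b) (inj₂ r)))
        hom₁ {a} {b} m | no nt = subst₂ (Star (Adj E′)) (sym (Φ-other (λ { refl → nt (⇒touches v (a , b) (inj₁ refl)) }))) (sym (Φ-other (λ { refl → nt (⇒touches v (a , b) (inj₂ refl)) })))
            (return (inj₁ (there (filterᵇ-∈ (λ e → not (touches v e)) m (not-T nt)))))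
          where
          not-T : ∀ {x} → ¬ T x → T (not x)
          not-T {true} h = h tt
          not-T {false} h = tt
        hom : ∀ {a b} → Adj E a b → Star (Adj E′) (Φ a) (Φ b)
        hom (inj₁ m) = hom₁ m
        hom (inj₂ m) = reverse (adj-sym E′) (hom₁ m)

      suppress-all : ∀ vs E → Preserves E (foldl (suppress D) E vs)
      suppress-all [] E = record { degrees = λ _ _ → refl ; connections = λ _ _ c → c }
      suppress-all (v ∷ vs) E = record
        { degrees = λ w bw → trans (degrees (suppress-all vs (suppress D E v)) w bw) (degrees (suppress-preserves E v) w bw)
        ; connections = λ ba bb c → connections (suppress-all vs (suppress D E v)) ba bb (connections (suppress-preserves E v) ba bb c) }

      not-cycle : ∀ E v {m} → Star (Adj E) v m → Branching m → T (not (inCycleComponent D E v))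
      not-cycle E v {m} c bm = go (inCycleComponent D E v) refl
        where
        go : ∀ b → inCycleComponent D E v ≡ b → T (not b)
        go false _ = tt
        go true eq with Equivalence.to (T-∨ {not (lookup (reach E v) m)}) (all-∀ (λ u → not (lookup (reach E v) u) ∨ (lookup D u ≡ᵇ 2)) (subst T (sym eq) tt) m)
        ... | inj₂ two = contradiction (≡ᵇ⇒≡ (lookup D m) 2 two) bm
        ... | inj₁ nr with lookup (reach E v) m | reach-complete E v m c
        ... | true | _ = ⊥-elim nr
        ... | false | h = ⊥-elim h

      -- An edge connected to a branching vertex is never deleted, and walks between branching
      -- vertices use only such edges.
      delete-preserves : ∀ E → Preserves E (deleteCycles D E)
      delete-preserves E = record { degrees = degrees′ ; connections = λ ba bb c → proj₂ (star-closed (λ a → ∃ λ m → Star (Adj E) a m × Branching m) closed (_ , ε , ba) c) }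
        where
        keep? : Fin n × Fin n → Bool
        keep? e = not (inCycleComponent D E (proj₁ e))
        degrees′ : ∀ w → Branching w → degᴱ (deleteCycles D E) w ≡ degᴱ E w
        degrees′ w bw = trans (∑-filterᵇ keep? E (incidence w)) (∑-cong-∈ E at)
          where
          at : ∀ e → e ∈ E → 𝟙 (T? (keep? e)) * incidence w e ≡ incidence w e
          at (a , b) m = go (a ≟ᶠ w) (b ≟ᶠ w)
            where
            kept : Star (Adj E) a w → 𝟙 (T? (keep? (a , b))) ≡ 1
            kept c = 𝟙-yes (T? (keep? (a , b))) (not-cycle E a c bw)
            go : (p : Dec (a ≡ w)) (q : Dec (b ≡ w)) → 𝟙 (T? (keep? (a , b))) * (𝟙 p + 𝟙 q) ≡ 𝟙 p + 𝟙 q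
            go (yes refl) q = trans (cong (_* (1 + 𝟙 q)) (kept ε)) (*-identityˡ _)
            go (no _) (yes refl) = trans (cong (_* 1) (kept (return (inj₁ m)))) refl
            go (no _) (no _) = *-zeroʳ (𝟙 (T? (keep? (a , b))))
        closed : ∀ {a b} → (∃ λ m → Star (Adj E) a m × Branching m) → Adj E a b → (∃ λ m → Star (Adj E) b m × Branching m) × Adj (deleteCycles D E) a b
        closed {a} {b} (m , c , bm) (inj₁ p) = (m , inj₂ p ◅ c , bm) , inj₁ (filterᵇ-∈ keep? p (not-cycle E a c bm))
        closed {a} {b} (m , c , bm) (inj₂ p) = (m , inj₁ p ◅ c , bm) , inj₂ (filterᵇ-∈ keep? p (not-cycle E b (inj₁ p ◅ c) bm))

      ∈-concatMap : {A B : Set} (f : A → List B) {xs : List A} {x : A} {y : B} → x ∈ xs → y ∈ f x → y ∈ concatMap f xs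
      ∈-concatMap f (here refl) m = ∈-++⁺ˡ m
      ∈-concatMap f {x′ ∷ _} (there p) m = ∈-++⁺ʳ (f x′) (∈-concatMap f p m)

      module _ (A : Mat n) (real : IsReal D A) where

        private
          g : Graph n
          g = gr A

          realises : Realizes (lookup D) g
          realises = real⇒ D A real

          arc : Fin n → Fin n → Bool
          arc i j = adj A i j ∧ (toℕ i <ᵇ toℕ j)

          arcs : Fin n → List (Fin n × Fin n)
          arcs i = map (i ,_) (filterᵇ (arc i) (allFin n))

          edge-adj : ∀ {i j} → E g i j → T (adj A i j)
          edge-adj (p , _) = subst T (sym p) tt

          adj-edge : ∀ {i j} → T (adj A i j) → E g i j
          adj-edge {i} {j} h = p , trans (sym (real-symm D A real i j)) p
            where
            p : adj A i j ≡ true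
            p = Equivalence.to T-≡ h

          E₀ : MG n
          E₀ = edgesOf A

          edge-listed : ∀ {i j} → E g i j → Adj E₀ i j
          edge-listed {i} {j} e = go (<-cmp (toℕ i) (toℕ j))
            where
            ∈allFin : ∀ k → k ∈ allFin n
            ∈allFin k = subst (k ∈_) (sym (allFin≡fins n)) (∈fins k)
            place : ∀ {i j} → toℕ i < toℕ j → E g i j → (i , j) ∈ E₀
            place {i} {j} lt e = ∈-concatMap arcs (∈allFin i) (∈-map⁺ (i ,_) (filterᵇ-∈ (arc i) (∈allFin j) (Equivalence.from (T-∧ {adj A i j}) (edge-adj e , <⇒<ᵇ lt))))
            go : Tri (toℕ i < toℕ j) (toℕ i ≡ toℕ j) (toℕ j < toℕ i) → Adj E₀ i j
            go (tri< lt _ _) = inj₁ (place lt e)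
            go (tri> _ _ gt) = inj₂ (place gt (E-sym g e))
            go (tri≈ _ eq _) = contradiction (toℕ-injective eq) (edge-≢ g realises e)

          degree₀ : ∀ w → degᴱ E₀ w ≡ lookup D w
          degree₀ w = begin
              ∑ (concatMap arcs (allFin n)) (incidence w) ≡⟨ ∑-concatMap arcs (allFin n) (incidence w) ⟩
              ∑ (allFin n) (λ i → ∑ (arcs i) (incidence w)) ≡⟨ cong (λ l → ∑ l (λ i → ∑ (arcs i) (incidence w))) (allFin≡fins n) ⟩
              ∑ᵛ (λ i → ∑ (arcs i) (incidence w)) ≡⟨ ∑-cong (fins n) (λ i → trans (∑-map (i ,_) (filterᵇ (arc i) (allFin n)) (incidence w)) (trans (∑-filterᵇ (arc i) (allFin n) _) (cong (λ l → ∑ l (λ j → c i j * incidence w (i , j))) (allFin≡fins n)))) ⟩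
              ∑ᵛ (λ i → ∑ᵛ (λ j → c i j * (𝟙 (i ≟ᶠ w) + 𝟙 (j ≟ᶠ w)))) ≡⟨ ∑-cong (fins n) (λ i → trans (∑-cong (fins n) (λ j → expand (c i j) (𝟙 (i ≟ᶠ w)) (𝟙 (j ≟ᶠ w)))) (∑-+ (fins n) _ _)) ⟩
              ∑ᵛ (λ i → ∑ᵛ (λ j → 𝟙 (i ≟ᶠ w) * c i j) + ∑ᵛ (λ j → 𝟙 (j ≟ᶠ w) * c i j)) ≡⟨ ∑-+ (fins n) _ _ ⟩
              ∑ᵛ (λ i → ∑ᵛ (λ j → 𝟙 (i ≟ᶠ w) * c i j)) + ∑ᵛ (λ i → ∑ᵛ (λ j → 𝟙 (j ≟ᶠ w) * c i j))
                ≡⟨ cong₂ _+_ (trans (∑-cong (fins n) (λ i → ∑-*ˡ (fins n) (𝟙 (i ≟ᶠ w)) (c i))) (∑-point w (λ i → ∑ᵛ (c i)))) (∑-cong (fins n) (λ i → ∑-point w (c i))) ⟩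
              ∑ᵛ (λ j → c w j) + ∑ᵛ (λ i → c i w) ≡⟨ sym (∑-+ (fins n) _ _) ⟩
              ∑ᵛ (λ j → c w j + c j w) ≡⟨ ∑-cong (fins n) (λ j → both j (<-cmp (toℕ w) (toℕ j))) ⟩
              ∑ᵛ (λ j → 𝟙 (E? g w j)) ≡⟨ deg realises w ⟩
              lookup D w ∎
            where
            open ≡-Reasoning
            c : Fin n → Fin n → ℕ
            c i j = 𝟙 (T? (arc i j))
            expand : ∀ a b d → a * (b + d) ≡ b * a + d * a
            expand = solve-∀
            c⇒ : ∀ i j → T (arc i j) → E g i j × toℕ i < toℕ j
            c⇒ i j h with Equivalence.to (T-∧ {adj A i j}) h
            ... | p , q = adj-edge p , <ᵇ⇒< (toℕ i) (toℕ j) q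
            ⇒c : ∀ i j → E g i j → toℕ i < toℕ j → T (arc i j)
            ⇒c i j e lt = Equivalence.from (T-∧ {adj A i j}) (edge-adj e , <⇒<ᵇ lt)
            both : ∀ j → Tri (toℕ w < toℕ j) (toℕ w ≡ toℕ j) (toℕ j < toℕ w) → c w j + c j w ≡ 𝟙 (E? g w j)
            both j (tri< lt _ ngt) = trans (cong₂ _+_ (𝟙-cong (T? (arc w j)) (E? g w j) (proj₁ ∘ c⇒ w j) (λ e → ⇒c w j e lt)) (𝟙-no (T? (arc j w)) (ngt ∘ proj₂ ∘ c⇒ j w))) (+-identityʳ _)
            both j (tri> nlt _ gt) = cong₂ _+_ (𝟙-no (T? (arc w j)) (nlt ∘ proj₂ ∘ c⇒ w j)) (𝟙-cong (T? (arc j w)) (E? g w j) (E-sym g ∘ proj₁ ∘ c⇒ j w) (λ e → ⇒c j w (E-sym g e) gt))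
            both j (tri≈ nlt eq ngt) = trans (cong₂ _+_ (𝟙-no (T? (arc w j)) (nlt ∘ proj₂ ∘ c⇒ w j)) (𝟙-no (T? (arc j w)) (ngt ∘ proj₂ ∘ c⇒ j w)))
              (sym (𝟙-no (E? g w j) (λ e → edge-≢ g realises e (toℕ-injective eq))))

          Hg : MG n
          Hg = H D A

          deleted : Preserves E₀ (deleteCycles D E₀)
          deleted = delete-preserves E₀

          suppressed : Preserves (deleteCycles D E₀) Hg
          suppressed = suppress-all (allFin n) (deleteCycles D E₀)

          H-degree : ∀ w → Branching w → degᴱ Hg w ≡ lookup D w
          H-degree w bw = trans (degrees suppressed w bw) (trans (degrees deleted w bw) (degree₀ w))

          H-conn : ∀ {a b} → Branching a → Branching b → Conn g a b → Star (Adj Hg) a b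
          H-conn ba bb c = connections suppressed ba bb (connections deleted ba bb (conv (λ e → return (edge-listed e)) c))

        -- The branching vertices of a component keep their degrees and remain connected in H, so
        -- their volume counts edges of one component of H, each at most at its two ends.
        component-volume : ∀ v → 0 < volume g v → ∃ λ e → e ∈ Hg × volume g v ≤ 2 * componentSize Hg e
        component-volume v nonempty with ∑-pos (fins n) (λ m → 𝟙 (conn? g v m) * δ m) nonempty
        ... | m , h = found (𝟙-pos (branching? m) (*-posˡ (𝟙 (branching? m)) (lookup D m) (*-posʳ (𝟙 (conn? g v m)) (δ m) h)))
                            (𝟙-pos (conn? g v m) (*-posˡ (𝟙 (conn? g v m)) (δ m) h)) (*-posʳ (𝟙 (branching? m)) (lookup D m) (*-posʳ (𝟙 (conn? g v m)) (δ m) h))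
          where
          ∑-pos-∈ : (xs : List (Fin n × Fin n)) (f : Fin n × Fin n → ℕ) → 0 < ∑ xs f → ∃ λ e → e ∈ xs × 0 < f e
          ∑-pos-∈ (x ∷ xs) f h with f x in eq
          ... | suc _ = x , here refl , subst (0 <_) (sym eq) (s≤s z≤n)
          ... | zero with ∑-pos-∈ xs f h
          ... | e , m , p = e , there m , p
          found : Branching m → Conn g v m → 0 < lookup D m → ∃ λ e → e ∈ Hg × volume g v ≤ 2 * componentSize Hg e
          found bm cm dm with ∑-pos-∈ Hg (incidence m) (subst (0 <_) (sym (H-degree m bm)) dm)
          ... | e , e∈ , inc = e , e∈ , bound
            where
            touching : ∀ {f w} → f ∈ Hg → 0 < incidence w f → Star (Adj Hg) w (proj₁ f)
            touching {a , b} {w} f∈ h with a ≟ᶠ w | b ≟ᶠ w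
            ... | yes refl | _ = ε
            ... | no _ | yes refl = return (inj₂ f∈)
            ... | no _ | no _ = contradiction h λ ()
            hit? : ∀ (f : Fin n × Fin n) → Dec (In (reach Hg (proj₁ e)) (proj₁ f))
            hit? f = T? (lookup (reach Hg (proj₁ e)) (proj₁ f))
            bound : volume g v ≤ 2 * componentSize Hg e
            bound = begin
                volume g v ≤⟨ ∑-mono (fins n) (λ w → pw w (conn? g v w) (branching? w)) ⟩
                ∑ᵛ (λ w → ∑ Hg (λ f → 𝟙 (hit? f) * incidence w f)) ≡⟨ ∑-swap (fins n) Hg _ ⟩
                ∑ Hg (λ f → ∑ᵛ (λ w → 𝟙 (hit? f) * incidence w f)) ≡⟨ ∑-cong Hg (λ f → trans (∑-*ˡ (fins n) (𝟙 (hit? f)) _) (trans (cong (𝟙 (hit? f) *_) (two f)) (*-comm (𝟙 (hit? f)) 2))) ⟩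
                ∑ Hg (λ f → 2 * 𝟙 (hit? f)) ≡⟨ ∑-*ˡ Hg 2 _ ⟩
                2 * ∑ Hg (λ f → 𝟙 (hit? f)) ≡⟨ cong (2 *_) (sym (length-filterᵇ D (λ f → lookup (reach Hg (proj₁ e)) (proj₁ f)) Hg)) ⟩
                2 * componentSize Hg e ∎
              where
              open ≤-Reasoning
              two : ∀ f → ∑ᵛ (λ w → incidence w f) ≡ 2
              two (a , b) = trans (∑-+ (fins n) _ _) (cong₂ _+_ (trans (∑-cong (fins n) (λ w → 𝟙-cong (a ≟ᶠ w) (w ≟ᶠ a) sym sym)) (∑-point₁ a)) (trans (∑-cong (fins n) (λ w → 𝟙-cong (b ≟ᶠ w) (w ≟ᶠ b) sym sym)) (∑-point₁ b)))
              pw : ∀ w (c : Dec (Conn g v w)) (b : Dec (Branching w)) → 𝟙 c * (𝟙 b * lookup D w) ≤ ∑ Hg (λ f → 𝟙 (hit? f) * incidence w f)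
              pw w (no _) _ = z≤n
              pw w (yes _) (no _) = z≤n
              pw w (yes cw) (yes bw) = ≤-trans (≤-reflexive (trans (*-identityˡ _) (trans (*-identityˡ _) (sym (H-degree w bw))))) (∑-mono-∈ Hg (λ f f∈ → each f f∈ (0 <? incidence w f)))
                where
                each : ∀ f → f ∈ Hg → Dec (0 < incidence w f) → incidence w f ≤ 𝟙 (hit? f) * incidence w f
                each f f∈ (no z) = ≤-trans (≮⇒≥ z) z≤n
                each f f∈ (yes p) = ≤-reflexive (sym (trans (cong (_* incidence w f) (𝟙-yes (hit? f) (reach-complete Hg (proj₁ e) (proj₁ f)
                  (reverse (adj-sym Hg) (touching e∈ inc) ◅◅ (H-conn bm bw (conn-sym g cm ◅◅ cw) ◅◅ touching f∈ p))))) (*-identityˡ _)))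

  -- The constants

  toℚ≃ : ∀ k → toℚᵘ (toℚ k) ℚᵘ.≃ mkℚᵘ (pos k) 0
  toℚ≃ k = ℚP.toℚᵘ-fromℚᵘ (mkℚᵘ (pos k) 0)

  -- e is the denominator of η: the numerator is at least one and may be dropped.
  ε-bound : ∀ η → 0ℚ ℚ.< η → ∃ λ e → 1 ≤ e × (∀ m r → η ℚ.* toℚ m ℚ.≤ toℚ r → m ≤ e * r)
  ε-bound (mkℚ (ℤ.-[1+ _ ]) _ _) (ℚ.*<* ())
  ε-bound (mkℚ (pos 0) _ _) (ℚ.*<* (ℤ.+<+ ()))
  ε-bound η@(mkℚ (pos (suc p)) q c) _ = suc q , s≤s z≤n , bound
    where
    bound : ∀ m r → η ℚ.* toℚ m ℚ.≤ toℚ r → m ≤ suc q * r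
    bound m r h with ℚᵘP.≤-respʳ-≃ (toℚ≃ r) (ℚᵘP.≤-respˡ-≃ (ℚᵘP.≃-trans (ℚP.toℚᵘ-homo-* η (toℚ m)) (ℚᵘP.*-congˡ {toℚᵘ η} (toℚ≃ m))) (ℚP.toℚᵘ-mono-≤ h))
    ... | *≤* le = ≤-trans (m≤n*m m (suc p)) (≤-trans (≤-reflexive (sym (*-identityʳ (suc p * m)))) (≤-trans (ℤP.drop‿+≤+ (subst₂ ℤ._≤_ lhs rhs le)) (≤-reflexive (trans (cong (r *_) (*-identityʳ (suc q))) (*-comm r (suc q))))))
      where
      lhs : (pos (suc p) ℤ.* pos m) ℤ.* pos 1 ≡ pos (suc p * m * 1)
      lhs = trans (cong (ℤ._* pos 1) (sym (ℤP.pos-* (suc p) m))) (sym (ℤP.pos-* (suc p * m) 1))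
      rhs : pos r ℤ.* pos (suc q * 1) ≡ pos (r * (suc q * 1))
      rhs = sym (ℤP.pos-* r (suc q * 1))

  unit : ℕ → ℚ
  unit g = fromℚᵘ (mkℚᵘ (pos 1) g)

  unit-pos : ∀ g → 0ℚ ℚ.< unit g
  unit-pos g = ℚP.toℚᵘ-cancel-< (ℚᵘP.<-respʳ-≃ (ℚᵘP.≃-sym (ℚP.toℚᵘ-fromℚᵘ (mkℚᵘ (pos 1) g))) (ℚᵘ.*<* (ℤ.+<+ (s≤s z≤n))))

  unit-bound : ∀ g m s → m ≤ suc g * s → unit g ℚ.* toℚ m ℚ.≤ toℚ s
  unit-bound g m s le = ℚP.toℚᵘ-cancel-≤ (ℚᵘP.≤-respʳ-≃ (ℚᵘP.≃-sym (toℚ≃ s)) (ℚᵘP.≤-respˡ-≃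
      (ℚᵘP.≃-sym (ℚᵘP.≃-trans (ℚP.toℚᵘ-homo-* (unit g) (toℚ m)) (ℚᵘP.*-cong (ℚP.toℚᵘ-fromℚᵘ (mkℚᵘ (pos 1) g)) (toℚ≃ m))))
      (*≤* (subst₂ ℤ._≤_ (sym lhs) (sym rhs) (ℤ.+≤+ le)))))
    where
    lhs : (pos 1 ℤ.* pos m) ℤ.* pos 1 ≡ pos m
    lhs = trans (ℤP.*-identityʳ _) (ℤP.*-identityˡ _)
    rhs : pos s ℤ.* pos (suc g * 1) ≡ pos (suc g * s)
    rhs = trans (sym (ℤP.pos-* s (suc g * 1))) (cong pos (trans (cong (s *_) (*-identityʳ (suc g))) (*-comm s (suc g))))

  -- l is the denominator of δ, so that 1/l ≤ δ; b is the number of exceptions among t cases.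
  δ-bound : ∀ δ → 0ℚ ℚ.< δ → ∃ λ l → (∀ t g b → t ≤ g + b → l * b ≤ t → (1ℚ ℚ.- δ) ℚ.* toℚ t ℚ.≤ toℚ g)
  δ-bound (mkℚ (ℤ.-[1+ _ ]) _ _) (ℚ.*<* ())
  δ-bound (mkℚ (pos 0) _ _) (ℚ.*<* (ℤ.+<+ ()))
  δ-bound δ@(mkℚ (pos (suc p)) q c) _ = suc q , bound
    where
    δᵘ : ℚᵘ
    δᵘ = mkℚᵘ (pos (suc p)) q
    difference : toℚᵘ (1ℚ ℚ.- δ) ℚᵘ.≃ toℚᵘ 1ℚ ℚᵘ.+ ℚᵘ.- δᵘ
    difference = ℚᵘP.≃-trans (ℚP.toℚᵘ-homo-+ 1ℚ (ℚ.- δ)) (ℚᵘP.+-congʳ (toℚᵘ 1ℚ) (ℚP.toℚᵘ-homo‿- δ))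
    bound : ∀ t g b → t ≤ g + b → suc q * b ≤ t → (1ℚ ℚ.- δ) ℚ.* toℚ t ℚ.≤ toℚ g
    bound t g b h₁ h₂ = ℚP.toℚᵘ-cancel-≤ (ℚᵘP.≤-respʳ-≃ (ℚᵘP.≃-sym (toℚ≃ g)) (ℚᵘP.≤-respˡ-≃
        (ℚᵘP.≃-sym (ℚᵘP.≃-trans (ℚP.toℚᵘ-homo-* (1ℚ ℚ.- δ) (toℚ t)) (ℚᵘP.*-cong difference (toℚ≃ t))))
        (*≤* (ℤP.≤-trans (ℤP.≤-reflexive (eq₁ (pos (suc q)) (pos (suc p)) (pos t))) (ℤP.≤-trans (ℤP.+-monoˡ-≤ (ℤ.- (pos (suc p) ℤ.* pos t)) int)
          (ℤP.≤-reflexive (trans (eq₂ (pos (suc q)) (pos (suc p)) (pos t) (pos g)) (cong (λ k → pos g ℤ.* pos k) (sym (trans (*-identityʳ (1 * suc q)) (*-identityˡ (suc q)))))))))) ))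
      where
      nat : suc q * t ≤ suc q * g + suc p * t
      nat = ≤-trans (*-monoʳ-≤ (suc q) h₁) (≤-trans (≤-reflexive (*-distribˡ-+ (suc q) g b)) (+-monoʳ-≤ (suc q * g) (≤-trans h₂ (m≤n*m t (suc p)))))
      int : pos (suc q) ℤ.* pos t ℤ.≤ pos (suc q) ℤ.* pos g ℤ.+ pos (suc p) ℤ.* pos t
      int = subst₂ ℤ._≤_ (ℤP.pos-* (suc q) t) (trans (ℤP.pos-+ (suc q * g) (suc p * t)) (cong₂ ℤ._+_ (ℤP.pos-* (suc q) g) (ℤP.pos-* (suc p) t))) (ℤ.+≤+ nat)
      eq₁ : ∀ q p t → ((pos 1 ℤ.* q) ℤ.+ (ℤ.- p) ℤ.* pos 1) ℤ.* t ℤ.* pos 1 ≡ q ℤ.* t ℤ.+ ℤ.- (p ℤ.* t)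
      eq₁ = solveℤ-∀
      eq₂ : ∀ q p t g → (q ℤ.* g ℤ.+ p ℤ.* t) ℤ.+ ℤ.- (p ℤ.* t) ≡ g ℤ.* q
      eq₂ = solveℤ-∀

  -- The value 1/(96 Q) of γ: a volume above M/(48 Q) gives at least half as many edges. The
  -- subtracted one offsets the successor in the denominator of `unit`.
  gap : ℕ → ℚ
  gap e = unit (96 * ratio e (4 * e) ∸ 1)

  gap-pos : ∀ e → 0ℚ ℚ.< gap e
  gap-pos e = unit-pos (96 * ratio e (4 * e) ∸ 1)

  gap-bound : ∀ e {q} → ratio e (4 * e) ≡ q → 1 ≤ 96 * q → ∀ m s → m ≤ 96 * q * s → gap e ℚ.* toℚ m ℚ.≤ toℚ s
  gap-bound e {q} refl 1≤96q m s le = unit-bound (96 * q ∸ 1) m s (≤-trans le (≤-reflexive (cong (_* s) (sym (m+[n∸m]≡n 1≤96q)))))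

  -- The estimate for a single degree sequence

  module Main (e dl : ℕ) (1≤e : 1 ≤ e) where

    B Q t large : ℕ
    B = 4 * e
    Q = ratio e B
    t = threshold e B dl
    -- The sum of all lower bounds that M has to meet: 2 + 4e serves `eL2`, 8t the small components,
    -- and the last two terms push the cyclic and the small case down to a fraction 1/(3 dl).
    large = 2 + (4 * e + (8 * t + (3 * dl * (1152 * 48 * (Q * Q * Q)) + 3 * dl * smallBound e B t)))

    1≤B : 1 ≤ B
    1≤B = ≤-trans 1≤e (m≤n*m e 4)

    1≤48Q : 1 ≤ 48 * Q
    1≤48Q = *-mono-≤ {1} {48} (s≤s z≤n) (*-mono-≤ {1} {16} (s≤s z≤n) (*-mono-≤ {1} 1≤e 1≤B))

    module Sequence {n : ℕ} (D : Vec ℕ n) (positive : Positive D) (M-large : large ≤ M D) (R-large : M D ≤ e * R D) where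

      open Counting D

      L : ℕ
      L = _/_ Mδ (48 * Q) {{>-nonZero 1≤48Q}}

      bounded? : ∀ A → Dec (∀ v → volume (gr A) v ≤ L)
      bounded? A = all? (λ v → volume (gr A) v ≤? L)

      private
        M≡ : M D ≡ Mδ
        M≡ = Supercritical.M≡Mδ e 0 1≤e D

        big : large ≤ Mδ
        big = subst (large ≤_) M≡ M-large

        L-small : 48 * Q * L ≤ Mδ
        L-small = ≤-trans (≤-reflexive (*-comm (48 * Q) L)) (m/n*n≤m Mδ (48 * Q) {{>-nonZero 1≤48Q}})

        -- One bounded realization bounds every degree other than 2 by L, because a vertex
        -- contributes its degree to its own component. This is the degree bound from which
        -- supercriticality is derived.
        rare-if : (∃ λ A → IsReal D A × (∀ v → volume (gr A) v ≤ L)) → dl * ∑ᴿ (λ A → 𝟙 (bounded? A)) ≤ Tot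
        rare-if (A , r , b) = Assembly.Bound.bounded-rare D e B dl Q t refl L L-small positive 1≤e 1≤B (*-mono-≤ {1} {16} (s≤s z≤n) (*-mono-≤ 1≤e 1≤B)) sup M>0
            big₁ big₂ (smallBound e B t) big₃
            (SmallComponents.mostly-small D e B t c (λ v → m⊓n≤n (d v ∸ 1) B) (λ v → m⊓n≤m (d v ∸ 1) B) sup 1≤e 1≤B big₁ M>0)
          where
          c : Fin n → ℕ
          c v = (d v ∸ 1) ⊓ B
          r₁ r₂ r₃ : ℕ
          r₁ = 8 * t
          r₂ = 3 * dl * (1152 * 48 * (Q * Q * Q))
          r₃ = 3 * dl * smallBound e B t
          big₀ : r₁ + (r₂ + r₃) ≤ Mδ
          big₀ = ≤-trans (m≤n⇒m≤o+n 2 (m≤n+m (r₁ + (r₂ + r₃)) (4 * e))) big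
          big₁ : r₁ ≤ Mδ
          big₁ = ≤-trans (m≤m+n r₁ (r₂ + r₃)) big₀
          big₂ : r₂ ≤ Mδ
          big₂ = ≤-trans (m≤n⇒m≤o+n r₁ (m≤m+n r₂ r₃)) big₀
          big₃ : r₃ ≤ Mδ
          big₃ = ≤-trans (m≤n⇒m≤o+n r₁ (m≤n+m r₃ r₂)) big₀
          M>0 : 0 < Mδ
          M>0 = ≤-trans (s≤s z≤n) big
          2eL : 2 * e * L ≤ Mδ
          2eL = ≤-trans (*-monoˡ-≤ L (≤-trans (*-mono-≤ {2} {48 * 16} (s≤s (s≤s z≤n)) (≤-trans (≤-reflexive (sym (*-identityʳ e))) (*-monoʳ-≤ e 1≤B))) (≤-reflexive (*-assoc 48 16 (e * B))))) L-small
          eL2 : e * (L + 2) < Mδ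
          eL2 = *-cancelˡ-≤ 2 (lin (+-mono-≤ 2eL big) (r₁ + (r₂ + r₃)) (eq e L (r₁ + (r₂ + r₃)) Mδ))
            where
            eq : ∀ e l r m → 2 * (1 + e * (l + 2)) + (m + m) + r ≡ 2 * m + (2 * e * l + (2 + (4 * e + r)))
            eq = solve-∀
          sup : (2 * e + 1) * Mδ ≤ 2 * e * ∑ᵛ (λ v → δ v * c v)
          sup = Supercritical.supercritical e L 1≤e D small 2eL eL2 (subst (_≤ e * R D) M≡ R-large)
            where
            small : ∀ v → d v ≢ 2 → d v ≤ L
            small v bv = ≤-trans (≤-reflexive (sym (trans (cong (_* d v) (𝟙-yes (branching? v) bv)) (*-identityˡ (d v))))) (≤-trans (δ≤vol δ (gr A) v) (b v))

      rare : dl * ∑ᴿ (λ A → 𝟙 (bounded? A)) ≤ Tot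
      rare = [ (λ none → ≤-trans (≤-reflexive (trans (cong (dl *_) none) (*-zeroʳ dl))) z≤n)
             , (λ { (A , h) → rare-if (A , 𝟙-pos (isReal? D A) (*-posˡ (𝟙 (isReal? D A)) (𝟙 (bounded? A)) h) , 𝟙-pos (bounded? A) (*-posʳ (𝟙 (isReal? D A)) (𝟙 (bounded? A)) h)) }) ]′
             (∑-none⊎some mats (λ A → 𝟙 (isReal? D A) * 𝟙 (bounded? A)))

      private
        large-component : ∀ A → IsReal D A → ¬ (∀ v → volume (gr A) v ≤ L) → T (hasComponentOfSize≥ (H D A) (gap e ℚ.* toℚ (M D)))
        large-component A r nb = [ (λ none → contradiction none nb) , witness ]′ (decide (all? (λ v → volume (gr A) v ≤? L)))
          where
          open ≤-Reasoning
          eq : ∀ s q → 2 * s * (48 * q) ≡ 96 * q * s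
          eq = solve-∀
          decide : Dec (∀ v → volume (gr A) v ≤ L) → (∀ v → volume (gr A) v ≤ L) ⊎ ∃ λ v → ¬ (volume (gr A) v ≤ L)
          decide (yes b) = inj₁ b
          decide (no _) = inj₂ (¬∀⟶∃¬ n _ (λ v → volume (gr A) v ≤? L) nb)
          -- Rounding down in L loses nothing: an integer above the floor of M/(48 Q) is above M/(48
          -- Q) itself.
          over : ∀ v → ¬ (volume (gr A) v ≤ L) → ¬ (volume (gr A) v * (48 * Q) ≤ Mδ)
          over v nv h = nv (≤-trans (≤-reflexive (sym (m*n/n≡m (volume (gr A) v) (48 * Q) {{>-nonZero 1≤48Q}}))) (/-monoˡ-≤ (48 * Q) {{>-nonZero 1≤48Q}} h))
          component : ∀ v → ¬ (volume (gr A) v ≤ L) → (∃ λ f → f ∈ H D A × volume (gr A) v ≤ 2 * componentSize (H D A) f) → T (hasComponentOfSize≥ (H D A) (gap e ℚ.* toℚ (M D)))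
          component v nv (f , f∈ , le) = ∃-any (λ f → gap e ℚ.* toℚ (M D) ℚ.≤ᵇ toℚ (componentSize (H D A) f)) f∈ (ℚP.≤⇒≤ᵇ (gap-bound e refl (≤-trans 1≤48Q (*-monoˡ-≤ Q {48} {96} (m≤m+n 48 48))) (M D) (componentSize (H D A) f) (begin
            M D ≡⟨ M≡ ⟩
            Mδ ≤⟨ <⇒≤ (≰⇒> (over v nv)) ⟩
            volume (gr A) v * (48 * Q) ≤⟨ *-monoˡ-≤ (48 * Q) le ⟩
            2 * componentSize (H D A) f * (48 * Q) ≡⟨ eq (componentSize (H D A) f) Q ⟩
            96 * Q * componentSize (H D A) f ∎)))
          witness : (∃ λ v → ¬ (volume (gr A) v ≤ L)) → T (hasComponentOfSize≥ (H D A) (gap e ℚ.* toℚ (M D)))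
          witness (v , nv) = component v nv (Multigraph.component-volume D A r v (≤-trans (s≤s z≤n) (≰⇒> nv)))

        good≡ : good D (gap e) ≡ ∑ᴿ (λ A → 𝟙 (T? (hasComponentOfSize≥ (H D A) (gap e ℚ.* toℚ (M D)))))
        good≡ = trans (length-filterᵇ D (λ A → hasComponentOfSize≥ (H D A) (gap e ℚ.* toℚ (M D))) (realizations D)) (∑-filterᵇ (isRealization D) (allMats n n) _)

      covered : total D ≤ good D (gap e) + ∑ᴿ (λ A → 𝟙 (bounded? A))
      covered = ≤-trans (≤-reflexive total≡Tot) (≤-trans (∑ᴿ-mono either) (≤-reflexive (trans (∑ᴿ-+ (λ A → 𝟙 (T? (hasComponentOfSize≥ (H D A) (gap e ℚ.* toℚ (M D))))) _) (+-subˡ (sym good≡)))))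
        where
        either : ∀ A → IsReal D A → 1 ≤ 𝟙 (T? (hasComponentOfSize≥ (H D A) (gap e ℚ.* toℚ (M D)))) + 𝟙 (bounded? A)
        either A r = go (bounded? A)
          where
          go : (b : Dec (∀ v → volume (gr A) v ≤ L)) → 1 ≤ 𝟙 (T? (hasComponentOfSize≥ (H D A) (gap e ℚ.* toℚ (M D)))) + 𝟙 b
          go (yes _) = m≤n+m 1 _
          go (no nb) = m≤n⇒m≤n+o 0 (≤-reflexive (sym (𝟙-yes (T? (hasComponentOfSize≥ (H D A) (gap e ℚ.* toℚ (M D)))) (large-component A r nb))))

      mostly-good : ∀ {δ} → (∀ t g b → t ≤ g + b → dl * b ≤ t → (1ℚ ℚ.- δ) ℚ.* toℚ t ℚ.≤ toℚ g) → (1ℚ ℚ.- δ) ℚ.* toℚ (total D) ℚ.≤ toℚ (good D (gap e))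
      mostly-good bound = bound (total D) (good D (gap e)) (∑ᴿ (λ A → 𝟙 (bounded? A))) covered (subst (dl * ∑ᴿ (λ A → 𝟙 (bounded? A)) ≤_) (sym total≡Tot) rare)

open import Defs
open import Data.Nat using (ℕ; _≤_)
open import Data.Rational using (ℚ; 0ℚ; 1ℚ; _<_; _*_; _-_)
open import Data.Nat.Properties using (≤-trans)
open import Data.Rational as ℚ using ()
open import Data.Vec using (Vec)
open import Data.Product using (Σ; _×_; _,_)

theorem9 : (λf : ℕ → ℕ)
    → ((K : ℕ) → Σ ℕ (λ N → (n : ℕ) → N ≤ n → K ≤ λf n))
    → (ε : ℚ) → 0ℚ < ε
    → Σ ℚ (λ γ → 0ℚ < γ ×
    ((δ : ℚ) → 0ℚ < δ
    → Σ ℕ (λ N → (n : ℕ) → N ≤ n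
    → (D : Vec ℕ n) → Positive D → Feasible D
    → λf n ≤ M D
    → ε * toℚ (M D) ℚ.≤ toℚ (R D)
    → (1ℚ - δ) * toℚ (total D) ℚ.≤ toℚ (good D γ))))
theorem9 λf λf→∞ ε ε>0 =
  let e , 1≤e , M≤eR = Proof.ε-bound ε ε>0
  in Proof.gap e , Proof.gap-pos e , λ δ δ>0 →
    -- Here δ enters for the first time: it fixes l and through `large` the threshold N, whereas γ
    -- was chosen from ε alone.
    let l , good-if = Proof.δ-bound δ δ>0
        N , beyond = λf→∞ (Proof.Main.large e l 1≤e)
    in N , λ n N≤n D positive _ λf≤M εM≤R →
      Proof.Main.Sequence.mostly-good e l 1≤e D positive
        (≤-trans (beyond n N≤n) λf≤M) (M≤eR (M D) (R D) εM≤R) {δ} good-if
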